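{- Fix integers $d\ge 1$ and $h$ with $d \leq h \leq 2d-2$. For $n\ge 1$ let $T_{n}$ be the set of sites in $\mathbb{Z}^d$ that topple during the stabilization of the configuration $\overline{h}+n\delta_o$. Then for any $\epsilon>0$, we have $T_{n} \subset Q_r$ for all sufficiently large $n$, where \[ r = \frac{d+\epsilon}{2d-1-h}\left(\frac{n}{\omega_d}\right)^{1/d}. \]
   Context: Abelian sandpile on $\mathbb{Z}^d$: a configuration is a function $\eta:\mathbb{Z}^d\to\mathbb{Z}$ (number of particles at each site). A site $x$ is unstable if $\eta(x)\ge 2d$; toppling $x$ sends one particle from $x$ to each of its $2d$ lattice neighbours. A configuration is stable if $\eta\le 2d-1$ everywhere. Stabilization means repeatedly toppling unstable sites until none remain (e.g. enumerate the sites of $\mathbb{Z}^d$ and at each time step topple the smallest unstable site); the set of sites that topple does not depend on the legal order chosen. $\overline{h}$ denotes the constant configuration $\sigma(x)\equiv h$, and $\delta_o$ a single particle at the origin, so $\overline{h}+n\delta_o$ has $h$ particles at every site plus $n$ extra particles at the origin. $Q_r=\{x\in\mathbb{Z}^d : \max_i |x_i|\le r\}$, and $\omega_d$ is the volume of the unit ball in $\mathbb{R}^d$. -}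

module Defs where

open import Data.Nat as ℕ using (ℕ; zero; suc)
open import Data.Integer as ℤ using (ℤ; +_)
open import Data.Rational as ℚ using (ℚ)
open import Data.Vec using (Vec; []; _∷_; replicate; zipWith; foldr)
open import Data.Vec.Properties using (≡-dec)
open import Data.List using (List; []; _∷_)
open import Data.List.Membership.Propositional using (_∈_)
open import Data.Product using (_×_; ∃-syntax)
open import Data.Unit using (⊤)
open import Relation.Nullary using (yes; no)
open import Relation.Binary.PropositionalEquality using (_≡_)

Site : ℕ → Set
Site d = Vec ℤ d

Config : ℕ → Set
Config d = Site d → ℤ

origin : (d : ℕ) → Site d
origin d = replicate d (+ 0)

dist1 : {d : ℕ} → Site d → Site d → ℕ
dist1 x y = foldr _ ℕ._+_ 0 (zipWith (λ a b → ℤ.∣ a ℤ.- b ∣) x y)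

normInf : {d : ℕ} → Site d → ℕ
normInf x = foldr _ ℕ._⊔_ 0 (Data.Vec.map ℤ.∣_∣ x)
  where import Data.Vec

topple : (d : ℕ) → Site d → Config d → Config d
topple d x η y with ≡-dec ℤ._≟_ y x
... | yes _ = η y ℤ.- (+ (2 ℕ.* d))
... | no _ with dist1 x y ℕ.≟ 1
...   | yes _ = η y ℤ.+ (+ 1)
...   | no _ = η y

Legal : (d : ℕ) → Config d → List (Site d) → Set
Legal d η [] = ⊤
Legal d η (x ∷ xs) = (+ (2 ℕ.* d) ℤ.≤ η x) × Legal d (topple d x η) xs

initial : (d h n : ℕ) → Config d
initial d h n y with ≡-dec ℤ._≟_ y (origin d)
... | yes _ = + (h ℕ.+ n)
... | no _ = + h

-- x ∈ T_n : x topples during stabilization of initial d h n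
-- (by the abelian property / least action principle, equivalently:
--  x occurs in some finite legal toppling sequence)
Topples : (d h n : ℕ) → Site d → Set
Topples d h n x = ∃[ xs ] (Legal d (initial d h n) xs × x ∈ xs)

_^ℚ_ : ℚ → ℕ → ℚ
q ^ℚ zero = ℚ.1ℚ
q ^ℚ suc k = q ℚ.* (q ^ℚ k)

-- Leibniz lower bounds for π:  L m = 4 Σ_{i≤m} (1/(4i+1) - 1/(4i+3)),
-- strictly increasing with supremum π.
piLower : ℕ → ℚ
piLower zero = (+ 4) ℚ./ 1 ℚ.* ((+ 1) ℚ./ 1 ℚ.- (+ 1) ℚ./ 3)
piLower (suc m) = piLower m ℚ.+ (+ 4) ℚ./ 1 ℚ.*
  ((+ 1) ℚ./ (4 ℕ.* suc m ℕ.+ 1) ℚ.- (+ 1) ℚ./ (4 ℕ.* suc m ℕ.+ 3))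

-- lower approximations of ω_d (volume of the unit ball of R^d), via
-- ω_0 = 1, ω_1 = 2, ω_{d+2} = 2π/(d+2) ω_d, with π replaced by piLower m.
-- For each d, omegaLower d m is nondecreasing in m with supremum ω_d.
omegaLower : ℕ → ℕ → ℚ
omegaLower zero m = ℚ.1ℚ
omegaLower (suc zero) m = (+ 2) ℚ./ 1
omegaLower (suc (suc d)) m =
  ((+ 2) ℚ./ (suc (suc d))) ℚ.* piLower m ℚ.* omegaLower d m

-- x ∈ Q_r  with  r = (d+ε)/(2d-1-h) (n/ω_d)^{1/d}.
-- Writing M = max_i |x_i| and c = 2d-1-h ≥ 1, this is equivalent to
--   (c M)^d ω_d ≤ n (d+ε)^d,
-- i.e. (since ω_d = sup_m omegaLower d m)
--   ∀ m, (c M)^d · omegaLower d m ≤ n (d+ε)^d.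
InQr : (d h n : ℕ) (ε : ℚ) → Site d → Set
InQr d h n ε x = (m : ℕ) →
  (((+ ((2 ℕ.* d ℕ.∸ 1 ℕ.∸ h) ℕ.* normInf x)) ℚ./ 1) ^ℚ d) ℚ.* omegaLower d m
    ℚ.≤ ((+ n) ℚ./ 1) ℚ.* ((((+ d) ℚ./ 1) ℚ.+ ε) ^ℚ d)

-- Let c = 2d - 1 - h and let u count the topplings. Remembering which endpoint of each edge toppled last shows that a site x
-- that has toppled satisfies η(x) ≥ d + Σ_{y ~ x} θ(x,y) with θ antisymmetric and |θ| ≤ 1/2. Hence Δu + n δ_o ≥ d - h + div θ on
-- the toppled set, and summed over a set the flow θ contributes only through its boundary edges.
-- Let r be slightly larger than the radius of the ball of volume n, w an integer function of one coordinate with Δw = d - h - 1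
-- up to distance about r and Δw = c beyond, vanishing at distance about d r / c, and f ≥ 0 a function with Δf ≤ 1 - e - n δ_o that
-- is at most 1 beyond distance about r. The divergence estimate on the sets {u - w - f > j} makes their sizes shrink
-- geometrically in j, so u ≤ w + f + O(log n). A last comparison in a slab, where no boundary edge helps, gives u ≤ w at distance
-- about r, and further out the least action principle keeps u ≤ w because adding Δw ≤ c particles to h leaves a site stable.
-- So nothing topples beyond distance about d r / c.
-- f is the potential of n δ_o after t steps of the lazy random walk, corrected by a polynomial profile whose Laplacian is
-- 1 - β (1 - |x|²/r²)₊^k up to small errors. The gradient estimate for the heat semigroup shows that after t steps a point mass and
-- the bump (1 - |x|²/r²)₊^k of the same mass are indistinguishable. The mass of the bump is bounded below through
-- ω_{d+2} = 2π/(d+2) ω_d, by counting lattice points in discs and comparing with Leibniz's series.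

module Submission where

open import Defs
open import Data.Nat as ℕ using (ℕ; zero; suc; z≤n; s≤s)
import Data.Nat.Properties as ℕₚ
import Data.Nat.Tactic.RingSolver as ℕ-Ring
open import Data.Nat.DivMod using (m/n*n≤m; m%n<n; m≡m%n+[m/n]*n)
open import Data.Integer as ℤ using (ℤ; +_; -[1+_])
import Data.Integer.Properties as ℤₚ
import Data.Rational.Unnormalised as ℚᵘ
import Data.Rational.Unnormalised.Properties as ℚᵘₚ
open import Data.Rational as ℚ using (ℚ; 0ℚ; 1ℚ; ½; _+_; _*_; _-_; -_; _≤_; _<_; _/_)
open import Data.Rational.Properties as ℚₚ using (≤-refl; ≤-trans; ≤-reflexive; <⇒≤; ≤-<-trans; <-≤-trans)
open import Data.Maybe using (Maybe; just; nothing)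
open import Data.List using (List; []; _∷_; _++_; map; cartesianProductWith)
open import Data.List.Membership.Propositional using (_∈_)
open import Data.List.Membership.Propositional.Properties using (∈-map⁺; ∈-cartesianProductWith⁺)
open import Data.List.Relation.Unary.Any using (here; there)
open import Data.Vec using (Vec; []; _∷_)
open import Data.Vec.Properties using (≡-dec; ∷-injectiveˡ; ∷-injectiveʳ)
open import Data.Product using (_×_; _,_; proj₁; proj₂; ∃-syntax)
open import Data.Sum using (_⊎_; inj₁; inj₂)
open import Data.Empty using (⊥)
open import Data.Fin using (Fin; zero; suc)
import Data.Fin.Properties
open import Relation.Nullary using (¬_; Dec; yes; no; contradiction)
open import Relation.Nullary.Decidable using (_×-dec_; toWitness)
open import Relation.Binary.PropositionalEquality using (_≡_; _≢_; refl; sym; trans; cong; cong₂; subst; subst₂)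
open import Tactic.RingSolver.Core.AlmostCommutativeRing using (AlmostCommutativeRing; fromCommutativeRing)
open import Tactic.RingSolver using (solve-∀; solve)
open import Algebra.Bundles using (AbelianGroup)
open import Algebra.Properties.Group (AbelianGroup.group ℤₚ.+-0-abelianGroup) using (∙-cancelʳ)
open import Level using (0ℓ)

-- A toppled set must carry about d particles per site; since h ≥ d, counting particles does not
-- bound it. Adding Δw = d - h - 1 lowers the background to d - 1, one below that density, so each
-- site where u exceeds w has to absorb one of the n added particles: this is why the ball of volume
-- n appears. With g = h + 1 - d, the slope of w grows by g per step up to about r and then shrinks
-- by c, so w vanishes near r + g r / c = d r / c, because c + g = d: this is the factor d of the
-- theorem. No real numbers are used. Square roots give way to a free scale l in 2 x ≤ l + x² / l,
-- exponentials to powers of rationals, π to bounds, and the radius is read off a supposed escaping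
-- site. All scales are tied to L, of order log n: the walk diffuses over about r / L while the bump
-- has width about r / L^(d + 2), so heat flow cannot tell the bump from a point mass, and the
-- exponential tail reaches only a small multiple of r beyond r.

ring : AlmostCommutativeRing 0ℓ 0ℓ
ring = fromCommutativeRing ℚₚ.+-*-commutativeRing isZero
  where
  isZero : ∀ x → Maybe (0ℚ ≡ x)
  isZero x with 0ℚ ℚₚ.≟ x
  ... | yes p = just p
  ... | no _  = nothing

infixr 5 _▹_

_▹_ : ℚ → List ℚ → List ℚ
_▹_ = _∷_

nil : List ℚ
nil = []

-- Rational inequalities proved by explicit certificates.

0≤1 : 0ℚ ≤ 1ℚ
0≤1 = ℚ.*≤* (ℤ.+≤+ z≤n)

0<1 : 0ℚ < 1ℚ
0<1 = ℚ.*<* (ℤ.+<+ (s≤s z≤n))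

0≤½ : 0ℚ ≤ ½
0≤½ = ℚ.*≤* (ℤ.+≤+ z≤n)

diff≥0 : ∀ {a b} → a ≤ b → 0ℚ ≤ b - a
diff≥0 {a} {b} h = subst (_≤ b - a) (ℚₚ.+-inverseʳ a) (ℚₚ.+-monoˡ-≤ (- a) h)

diff>0 : ∀ {a b} → a < b → 0ℚ < b - a
diff>0 {a} {b} h = subst (_< b - a) (ℚₚ.+-inverseʳ a) (ℚₚ.+-monoˡ-< (- a) h)

-- The device behind almost every inequality below: the slack `e` is assembled from nonnegative
-- pieces with `⊕` and `⊗`, and the ring solver checks b = a + e.
cert : ∀ {a b e} → 0ℚ ≤ e → b ≡ a + e → a ≤ b
cert {a} {b} {e} h eq = subst (a ≤_) (sym eq) (subst (_≤ a + e) (ℚₚ.+-identityʳ a) (ℚₚ.+-monoʳ-≤ a h))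

cert< : ∀ {a b e} → 0ℚ < e → b ≡ a + e → a < b
cert< {a} {b} {e} h eq = subst (a <_) (sym eq) (subst (_< a + e) (ℚₚ.+-identityʳ a) (ℚₚ.+-monoʳ-< a h))

infixl 6 _⊕_ _⊕<_
infixl 7 _⊗_ _⊗<_

_⊕_ : ∀ {a b} → 0ℚ ≤ a → 0ℚ ≤ b → 0ℚ ≤ a + b
_⊕_ {a} {b} p q = ≤-trans p (cert q refl)

_⊕<_ : ∀ {a b} → 0ℚ ≤ a → 0ℚ < b → 0ℚ < a + b
_⊕<_ {a} {b} p q = ≤-<-trans p (cert< q refl)

_⊗_ : ∀ {a b} → 0ℚ ≤ a → 0ℚ ≤ b → 0ℚ ≤ a * b
_⊗_ {a} {b} p q = subst (_≤ a * b) (ℚₚ.*-zeroʳ a) (ℚₚ.*-monoˡ-≤-nonNeg a {{ℚ.nonNegative p}} q)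

_⊗<_ : ∀ {a b} → 0ℚ < a → 0ℚ < b → 0ℚ < a * b
_⊗<_ {a} {b} p q = subst (_< a * b) (ℚₚ.*-zeroʳ a) (ℚₚ.*-monoʳ-<-pos a {{ℚ.positive p}} q)

sq≥0 : ∀ a → 0ℚ ≤ a * a
sq≥0 a with ℚₚ.≤-total 0ℚ a
... | inj₁ p = p ⊗ p
... | inj₂ p = subst (0ℚ ≤_) (lem a) (diff≥0 p ⊗ diff≥0 p)
  where
  lem : ∀ a → (0ℚ - a) * (0ℚ - a) ≡ a * a
  lem = solve-∀ ring

+-mono : ∀ {a b c d} → a ≤ b → c ≤ d → a + c ≤ b + d
+-mono = ℚₚ.+-mono-≤

*-mono : ∀ {a b c d} → 0ℚ ≤ a → 0ℚ ≤ c → a ≤ b → c ≤ d → a * c ≤ b * d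
*-mono {a} {b} {c} {d} pa pc h k = cert (≤-trans pa h ⊗ diff≥0 k ⊕ pc ⊗ diff≥0 h) (solve (a ▹ b ▹ c ▹ d ▹ nil) ring)

*-monoˡ : ∀ {a b} c → 0ℚ ≤ c → a ≤ b → c * a ≤ c * b
*-monoˡ {a} {b} c p h = cert (p ⊗ diff≥0 h) (solve (a ▹ b ▹ c ▹ nil) ring)

*-monoʳ : ∀ {a b} c → 0ℚ ≤ c → a ≤ b → a * c ≤ b * c
*-monoʳ {a} {b} c p h = cert (diff≥0 h ⊗ p) (solve (a ▹ b ▹ c ▹ nil) ring)

≰⇒≥ : ∀ {a b} → ¬ (a ≤ b) → b ≤ a
≰⇒≥ {a} {b} h with ℚₚ.≤-total a b
... | inj₁ p = contradiction p h
... | inj₂ p = p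

≮⇒≥ : ∀ {a b} → ¬ (a < b) → b ≤ a
≮⇒≥ = ℚₚ.≮⇒≥

*-cancel : ∀ {a b} c → 0ℚ < c → c * a ≤ c * b → a ≤ b
*-cancel c p h = ℚₚ.*-cancelˡ-≤-pos c {{ℚ.positive p}} h

sq-cancel : ∀ {a b} → 0ℚ ≤ b → a * a ≤ b * b → a ≤ b
sq-cancel {a} {b} pb h with a ℚₚ.≤? b
... | yes p = p
... | no ¬p = contradiction (<-≤-trans strict h) (ℚₚ.<-irrefl refl)
  where
  b<a = ℚₚ.≰⇒> ¬p
  strict : b * b < a * a
  strict = cert< (pb ⊗ <⇒≤ (diff>0 b<a) ⊕ pb ⊗ <⇒≤ (diff>0 b<a) ⊕< (diff>0 b<a ⊗< diff>0 b<a))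
    (solve (a ▹ b ▹ nil) ring)

-- Lets an equation enter a certificate with a multiplier of either sign; the summand it contributes
-- is 0.
≡⇒0≤ : ∀ {a b} m → a ≡ b → 0ℚ ≤ m * (a - b)
≡⇒0≤ {a} m refl = ≤-reflexive (lem a m)
  where
  lem : ∀ a m → 0ℚ ≡ m * (a - a)
  lem = solve-∀ ring

-- Expand k (x - l)² ≥ 0. With `l` a free scale this serves in place of square roots and of the
-- Cauchy-Schwarz inequality.
am-gm : ∀ x l k → l * k ≡ 1ℚ → 0ℚ ≤ k → x + x ≤ l + k * (x * x)
am-gm x l k e p = cert (p ⊗ sq≥0 (x - l) ⊕ ≡⇒0≤ (x + x - l) e) (solve (x ▹ l ▹ k ▹ nil) ring)

-- Inverses, numerals and powers.

infix 8 _⁻¹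

-- Made total by the value 0 off the positive numbers, so that terms carry no positivity proofs.
_⁻¹ : ℚ → ℚ
q ⁻¹ with 0ℚ ℚₚ.<? q
... | yes p = ℚ.1/_ q {{ℚ.>-nonZero p}}
... | no _  = 0ℚ

⁻¹-inverse : ∀ {q} → 0ℚ < q → q * q ⁻¹ ≡ 1ℚ
⁻¹-inverse {q} p with 0ℚ ℚₚ.<? q
... | yes p' = ℚₚ.*-inverseʳ q {{ℚ.>-nonZero p'}}
... | no ¬p = contradiction p ¬p

⁻¹-pos : ∀ {q} → 0ℚ < q → 0ℚ < q ⁻¹
⁻¹-pos {q} p with q ⁻¹ ℚₚ.≤? 0ℚ
... | no ¬h = ℚₚ.≰⇒> ¬h
... | yes h = contradiction (<-≤-trans 0<1 1≤0) (ℚₚ.<-irrefl refl)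
  where
  lem : ∀ q r → 0ℚ ≡ q * r + (q * (0ℚ - r))
  lem = solve-∀ ring
  1≤0 : 1ℚ ≤ 0ℚ
  1≤0 = subst (_≤ 0ℚ) (⁻¹-inverse p) (cert (<⇒≤ p ⊗ diff≥0 h) (lem q (q ⁻¹)))

-- By this recursion `⟦ suc n ⟧` unfolds to `1ℚ + ⟦ n ⟧`, so identities checked with 1 + n apply to
-- it without conversion.
⟦_⟧ : ℕ → ℚ
⟦ zero ⟧  = 0ℚ
⟦ suc n ⟧ = 1ℚ + ⟦ n ⟧

⟦⟧≥0 : ∀ n → 0ℚ ≤ ⟦ n ⟧
⟦⟧≥0 zero    = ≤-refl
⟦⟧≥0 (suc n) = 0≤1 ⊕ ⟦⟧≥0 n

⟦suc⟧>0 : ∀ n → 0ℚ < ⟦ suc n ⟧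
⟦suc⟧>0 n = subst (0ℚ <_) (ℚₚ.+-comm ⟦ n ⟧ 1ℚ) (⟦⟧≥0 n ⊕< 0<1)

⟦⟧>0 : ∀ {n} → 1 ℕ.≤ n → 0ℚ < ⟦ n ⟧
⟦⟧>0 {suc n} _ = ⟦suc⟧>0 n

⟦⟧-+ : ∀ m n → ⟦ m ℕ.+ n ⟧ ≡ ⟦ m ⟧ + ⟦ n ⟧
⟦⟧-+ zero n    = sym (ℚₚ.+-identityˡ ⟦ n ⟧)
⟦⟧-+ (suc m) n = trans (cong (λ z → 1ℚ + z) (⟦⟧-+ m n)) (sym (ℚₚ.+-assoc 1ℚ ⟦ m ⟧ ⟦ n ⟧))

⟦⟧-* : ∀ m n → ⟦ m ℕ.* n ⟧ ≡ ⟦ m ⟧ * ⟦ n ⟧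
⟦⟧-* zero n    = sym (ℚₚ.*-zeroˡ ⟦ n ⟧)
⟦⟧-* (suc m) n = trans (⟦⟧-+ n (m ℕ.* n)) (trans (cong (λ z → ⟦ n ⟧ + z) (⟦⟧-* m n)) (lem ⟦ n ⟧ ⟦ m ⟧))
  where
  lem : ∀ x y → x + y * x ≡ (1ℚ + y) * x
  lem = solve-∀ ring

⟦⟧-mono : ∀ {m n} → m ℕ.≤ n → ⟦ m ⟧ ≤ ⟦ n ⟧
⟦⟧-mono {n = n} z≤n = ⟦⟧≥0 n
⟦⟧-mono (s≤s h)     = ℚₚ.+-monoʳ-≤ 1ℚ (⟦⟧-mono h)

⟦⟧-mono< : ∀ {m n} → m ℕ.< n → ⟦ m ⟧ < ⟦ n ⟧
⟦⟧-mono< {m} h = <-≤-trans (subst (⟦ m ⟧ <_) (ℚₚ.+-comm ⟦ m ⟧ 1ℚ) (cert< 0<1 refl)) (⟦⟧-mono h)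

⟦⟧-cancel : ∀ {m n} → ⟦ m ⟧ ≤ ⟦ n ⟧ → m ℕ.≤ n
⟦⟧-cancel {m} {n} h with m ℕₚ.≤? n
... | yes p = p
... | no ¬p = contradiction (<-≤-trans (⟦⟧-mono< (ℕₚ.≰⇒> ¬p)) h) (ℚₚ.<-irrefl refl)

⟦⟧-∸ : ∀ {m n} → n ℕ.≤ m → ⟦ m ℕ.∸ n ⟧ ≡ ⟦ m ⟧ - ⟦ n ⟧
⟦⟧-∸ {m} {n} h = trans (lem ⟦ m ℕ.∸ n ⟧ ⟦ n ⟧)
  (cong (_- ⟦ n ⟧) (trans (sym (⟦⟧-+ (m ℕ.∸ n) n)) (cong ⟦_⟧ (ℕₚ.m∸n+n≡m h))))
  where
  lem : ∀ a b → a ≡ a + b - b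
  lem = solve-∀ ring

⟦⟧ᶻ : ℤ → ℚ
⟦⟧ᶻ (+ n)    = ⟦ n ⟧
⟦⟧ᶻ -[1+ n ] = - ⟦ suc n ⟧

⟦⟧ᶻ-suc : ∀ z → ⟦⟧ᶻ (ℤ.suc z) ≡ ⟦⟧ᶻ z + 1ℚ
⟦⟧ᶻ-suc (+ n) = ℚₚ.+-comm 1ℚ ⟦ n ⟧
⟦⟧ᶻ-suc -[1+ zero ] = refl
⟦⟧ᶻ-suc -[1+ suc n ] = lem ⟦ n ⟧
  where
  lem : ∀ a → - (1ℚ + a) ≡ - (1ℚ + (1ℚ + a)) + 1ℚ
  lem = solve-∀ ring

⟦⟧ᶻ-pred : ∀ z → ⟦⟧ᶻ (ℤ.pred z) ≡ ⟦⟧ᶻ z - 1ℚ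
⟦⟧ᶻ-pred (+ zero) = refl
⟦⟧ᶻ-pred (+ suc n) = lem ⟦ n ⟧
  where
  lem : ∀ a → a ≡ 1ℚ + a - 1ℚ
  lem = solve-∀ ring
⟦⟧ᶻ-pred -[1+ n ] = lem ⟦ n ⟧
  where
  lem : ∀ a → - (1ℚ + (1ℚ + a)) ≡ - (1ℚ + a) - 1ℚ
  lem = solve-∀ ring

⟦⟧ᶻ-∣∣² : ∀ z → ⟦⟧ᶻ z * ⟦⟧ᶻ z ≡ ⟦ ℤ.∣ z ∣ ⟧ * ⟦ ℤ.∣ z ∣ ⟧
⟦⟧ᶻ-∣∣² (+ n) = refl
⟦⟧ᶻ-∣∣² -[1+ n ] = lem ⟦ suc n ⟧
  where
  lem : ∀ a → - a * - a ≡ a * a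
  lem = solve-∀ ring

⟦⟧ᶻ-bounds : ∀ z → ⟦⟧ᶻ z ≤ ⟦ ℤ.∣ z ∣ ⟧ × - ⟦ ℤ.∣ z ∣ ⟧ ≤ ⟦⟧ᶻ z
⟦⟧ᶻ-bounds (+ n) = ≤-refl , cert (⟦⟧≥0 n ⊕ ⟦⟧≥0 n) (lem ⟦ n ⟧)
  where
  lem : ∀ a → a ≡ - a + (a + a)
  lem = solve-∀ ring
⟦⟧ᶻ-bounds -[1+ n ] = cert (⟦⟧≥0 (suc n) ⊕ ⟦⟧≥0 (suc n)) (lem ⟦ suc n ⟧) , ≤-refl
  where
  lem : ∀ a → a ≡ - a + (a + a)
  lem = solve-∀ ring

^-pos : ∀ {q} k → 0ℚ < q → 0ℚ < q ^ℚ k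
^-pos zero p    = 0<1
^-pos (suc k) p = p ⊗< ^-pos k p

^-nonneg : ∀ {q} k → 0ℚ ≤ q → 0ℚ ≤ q ^ℚ k
^-nonneg zero p    = 0≤1
^-nonneg (suc k) p = p ⊗ ^-nonneg k p

^-mono : ∀ {a b} k → 0ℚ ≤ a → a ≤ b → a ^ℚ k ≤ b ^ℚ k
^-mono zero p h    = ≤-refl
^-mono (suc k) p h = *-mono p (^-nonneg k p) h (^-mono k p h)

^-distrib-* : ∀ a b k → (a * b) ^ℚ k ≡ a ^ℚ k * b ^ℚ k
^-distrib-* a b zero    = refl
^-distrib-* a b (suc k) = trans (cong (a * b *_) (^-distrib-* a b k)) (lem a b (a ^ℚ k) (b ^ℚ k))
  where
  lem : ∀ a b x y → a * b * (x * y) ≡ a * x * (b * y)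
  lem = solve-∀ ring

^-+ : ∀ a j k → a ^ℚ (j ℕ.+ k) ≡ a ^ℚ j * a ^ℚ k
^-+ a zero k    = sym (ℚₚ.*-identityˡ (a ^ℚ k))
^-+ a (suc j) k = trans (cong (a *_) (^-+ a j k)) (sym (ℚₚ.*-assoc a (a ^ℚ j) (a ^ℚ k)))

^-* : ∀ a j k → a ^ℚ (j ℕ.* k) ≡ (a ^ℚ k) ^ℚ j
^-* a zero k    = refl
^-* a (suc j) k = trans (^-+ a k (j ℕ.* k)) (cong (a ^ℚ k *_) (^-* a j k))

1^ : ∀ k → 1ℚ ^ℚ k ≡ 1ℚ
1^ zero    = refl
1^ (suc k) = trans (ℚₚ.*-identityˡ (1ℚ ^ℚ k)) (1^ k)

1≤^ : ∀ {a} k → 1ℚ ≤ a → 1ℚ ≤ a ^ℚ k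
1≤^ {a} k h = subst (_≤ a ^ℚ k) (1^ k) (^-mono k 0≤1 h)

^≤1 : ∀ {a} k → 0ℚ ≤ a → a ≤ 1ℚ → a ^ℚ k ≤ 1ℚ
^≤1 {a} k p h = subst (a ^ℚ k ≤_) (1^ k) (^-mono k p h)

^-mono-exp : ∀ {a j k} → 1ℚ ≤ a → j ℕ.≤ k → a ^ℚ j ≤ a ^ℚ k
^-mono-exp {a} {j} {k} h jk = subst (a ^ℚ j ≤_) (trans (sym (^-+ a j (k ℕ.∸ j))) (cong (a ^ℚ_) (ℕₚ.m+[n∸m]≡n jk)))
  (subst (_≤ a ^ℚ j * a ^ℚ (k ℕ.∸ j)) (ℚₚ.*-identityʳ (a ^ℚ j))
    (*-monoˡ (a ^ℚ j) (^-nonneg j (≤-trans 0≤1 h)) (1≤^ (k ℕ.∸ j) h)))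

^-anti-exp : ∀ {a j k} → 0ℚ ≤ a → a ≤ 1ℚ → j ℕ.≤ k → a ^ℚ k ≤ a ^ℚ j
^-anti-exp {a} {j} {k} p h jk = subst (_≤ a ^ℚ j) (trans (sym (^-+ a j (k ℕ.∸ j))) (cong (a ^ℚ_) (ℕₚ.m+[n∸m]≡n jk)))
  (subst (a ^ℚ j * a ^ℚ (k ℕ.∸ j) ≤_) (ℚₚ.*-identityʳ (a ^ℚ j))
    (*-monoˡ (a ^ℚ j) (^-nonneg j p) (^≤1 (k ℕ.∸ j) p h)))

⟦⟧-^ : ∀ n k → ⟦ n ℕ.^ k ⟧ ≡ ⟦ n ⟧ ^ℚ k
⟦⟧-^ n zero    = refl
⟦⟧-^ n (suc k) = trans (⟦⟧-* n (n ℕ.^ k)) (cong (⟦ n ⟧ *_) (⟦⟧-^ n k))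

bernoulli : ∀ x k → 0ℚ ≤ x → 1ℚ + ⟦ k ⟧ * x ≤ (1ℚ + x) ^ℚ k
bernoulli x zero p = ≤-reflexive (lem x)
  where
  lem : ∀ x → 1ℚ + 0ℚ * x ≡ 1ℚ
  lem = solve-∀ ring
bernoulli x (suc k) p = ≤-trans
  (cert (⟦⟧≥0 k ⊗ p ⊗ p) (lem x ⟦ k ⟧))
  (*-monoˡ (1ℚ + x) (0≤1 ⊕ p) (bernoulli x k p))
  where
  lem : ∀ x k → (1ℚ + x) * (1ℚ + k * x) ≡ 1ℚ + (1ℚ + k) * x + k * x * x
  lem = solve-∀ ring

bernoulli⁻ : ∀ x k → 0ℚ ≤ x → x ≤ 1ℚ → 1ℚ - ⟦ k ⟧ * x ≤ (1ℚ - x) ^ℚ k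
bernoulli⁻ x zero p h = ≤-reflexive (lem x)
  where
  lem : ∀ x → 1ℚ - 0ℚ * x ≡ 1ℚ
  lem = solve-∀ ring
bernoulli⁻ x (suc k) p h = ≤-trans
  (cert (⟦⟧≥0 k ⊗ p ⊗ p) (lem x ⟦ k ⟧))
  (*-monoˡ (1ℚ - x) (diff≥0 h) (bernoulli⁻ x k p h))
  where
  lem : ∀ x k → (1ℚ - x) * (1ℚ - k * x) ≡ 1ℚ - (1ℚ + k) * x + k * x * x
  lem = solve-∀ ring

_⊔0 : ℚ → ℚ
x ⊔0 = 0ℚ ℚ.⊔ x

⊔0≥0 : ∀ x → 0ℚ ≤ x ⊔0
⊔0≥0 x = ℚₚ.p≤p⊔q 0ℚ x

⊔0≥ : ∀ x → x ≤ x ⊔0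
⊔0≥ x = ℚₚ.p≤q⊔p 0ℚ x

⊔0-pos : ∀ {x} → 0ℚ ≤ x → x ⊔0 ≡ x
⊔0-pos h = ℚₚ.p≤q⇒p⊔q≡q h

⊔0-neg : ∀ {x} → x ≤ 0ℚ → x ⊔0 ≡ 0ℚ
⊔0-neg h = ℚₚ.p≥q⇒p⊔q≡p h

⊔0-lub : ∀ {x y} → 0ℚ ≤ y → x ≤ y → x ⊔0 ≤ y
⊔0-lub p h = ℚₚ.⊔-lub p h

⟦⟧-toℚᵘ : ∀ n → ℚ.toℚᵘ ⟦ n ⟧ ℚᵘ.≃ ℚᵘ.mkℚᵘ (+ n) 0
⟦⟧-toℚᵘ zero    = ℚᵘ.*≡* refl
⟦⟧-toℚᵘ (suc n) = ℚᵘₚ.≃-trans (ℚₚ.toℚᵘ-homo-+ 1ℚ ⟦ n ⟧)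
  (ℚᵘₚ.≃-trans (ℚᵘₚ.+-congʳ ℚᵘ.1ℚᵘ (⟦⟧-toℚᵘ n)) (ℚᵘ.*≡* (cong (λ z → ((+ 1) ℤ.+ z) ℤ.* (+ 1)) (ℤₚ.*-identityʳ (+ n)))))

/-⟦⟧ : ∀ a b → ((+ a) / suc b) * ⟦ suc b ⟧ ≡ ⟦ a ⟧
/-⟦⟧ a b = ℚₚ.toℚᵘ-injective (ℚᵘₚ.≃-trans (ℚₚ.toℚᵘ-homo-* ((+ a) / suc b) ⟦ suc b ⟧)
  (ℚᵘₚ.≃-trans (ℚᵘₚ.*-cong (ℚₚ.toℚᵘ-fromℚᵘ (ℚᵘ.mkℚᵘ (+ a) b)) (⟦⟧-toℚᵘ (suc b)))
  (ℚᵘₚ.≃-trans (ℚᵘ.*≡* (ℤₚ.*-assoc (+ a) (+ suc b) (+ 1))) (ℚᵘₚ.≃-sym (⟦⟧-toℚᵘ a)))))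

⟦⟧-/1 : ∀ n → (+ n) / 1 ≡ ⟦ n ⟧
⟦⟧-/1 n = trans (sym (ℚₚ.*-identityʳ ((+ n) / 1))) (/-⟦⟧ n 0)

-- Finite sums.

∑ : {A : Set} → List A → (A → ℚ) → ℚ
∑ []       f = 0ℚ
∑ (x ∷ xs) f = f x + ∑ xs f

syntax ∑ xs (λ x → e) = ∑[ x ← xs ] e
infix 6.5 ∑

module _ {A : Set} where

  ∑-cong : ∀ (xs : List A) {f g} → (∀ x → f x ≡ g x) → ∑ xs f ≡ ∑ xs g
  ∑-cong [] h       = refl
  ∑-cong (x ∷ xs) h = cong₂ _+_ (h x) (∑-cong xs h)

  ∑-mono : ∀ (xs : List A) {f g} → (∀ x → f x ≤ g x) → ∑ xs f ≤ ∑ xs g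
  ∑-mono [] h       = ≤-refl
  ∑-mono (x ∷ xs) h = +-mono (h x) (∑-mono xs h)

  ∑-nonneg : ∀ (xs : List A) {f} → (∀ x → 0ℚ ≤ f x) → 0ℚ ≤ ∑ xs f
  ∑-nonneg [] h       = ≤-refl
  ∑-nonneg (x ∷ xs) h = h x ⊕ ∑-nonneg xs h

  ∑-+ : ∀ (xs : List A) f g → ∑[ x ← xs ] (f x + g x) ≡ ∑ xs f + ∑ xs g
  ∑-+ [] f g       = refl
  ∑-+ (x ∷ xs) f g = trans (cong (λ z → f x + g x + z) (∑-+ xs f g)) (lem (f x) (g x) (∑ xs f) (∑ xs g))
    where
    lem : ∀ a b c d → a + b + (c + d) ≡ a + c + (b + d)
    lem = solve-∀ ring

  ∑-* : ∀ (xs : List A) c f → ∑[ x ← xs ] (c * f x) ≡ c * ∑ xs f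
  ∑-* [] c f       = sym (ℚₚ.*-zeroʳ c)
  ∑-* (x ∷ xs) c f = trans (cong (λ z → c * f x + z) (∑-* xs c f)) (sym (ℚₚ.*-distribˡ-+ c (f x) (∑ xs f)))

  ∑-− : ∀ (xs : List A) f g → ∑[ x ← xs ] (f x - g x) ≡ ∑ xs f - ∑ xs g
  ∑-− [] f g       = refl
  ∑-− (x ∷ xs) f g = trans (cong (λ z → f x - g x + z) (∑-− xs f g)) (lem (f x) (g x) (∑ xs f) (∑ xs g))
    where
    lem : ∀ a b c d → a - b + (c - d) ≡ a + c - (b + d)
    lem = solve-∀ ring

  ∑-0 : ∀ (xs : List A) → ∑[ x ← xs ] 0ℚ ≡ 0ℚ
  ∑-0 []       = refl
  ∑-0 (x ∷ xs) = trans (ℚₚ.+-identityˡ _) (∑-0 xs)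

  ∑-term : ∀ {xs : List A} {f x} → (∀ y → 0ℚ ≤ f y) → x ∈ xs → f x ≤ ∑ xs f
  ∑-term {y ∷ xs} {f} h (here refl) = cert (∑-nonneg xs h) refl
  ∑-term {y ∷ xs} {f} h (there i)   = ≤-trans (∑-term h i) (cert (h y) (ℚₚ.+-comm (f y) (∑ xs f)))

  ∑-++ : ∀ (xs ys : List A) f → ∑ (xs ++ ys) f ≡ ∑ xs f + ∑ ys f
  ∑-++ [] ys f       = sym (ℚₚ.+-identityˡ _)
  ∑-++ (x ∷ xs) ys f = trans (cong (λ z → f x + z) (∑-++ xs ys f)) (sym (ℚₚ.+-assoc (f x) _ _))

  ∑-map : ∀ {B : Set} (h : A → B) xs f → ∑ (map h xs) f ≡ ∑ xs (λ x → f (h x))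
  ∑-map h [] f       = refl
  ∑-map h (x ∷ xs) f = cong (λ z → f (h x) + z) (∑-map h xs f)

∑-swap : ∀ {A B : Set} (xs : List A) (ys : List B) (f : A → B → ℚ) →
  ∑[ x ← xs ] ∑[ y ← ys ] f x y ≡ ∑[ y ← ys ] ∑[ x ← xs ] f x y
∑-swap [] ys f       = sym (∑-0 ys)
∑-swap (x ∷ xs) ys f = trans (cong (λ z → ∑ ys (f x) + z) (∑-swap xs ys f)) (sym (∑-+ ys (f x) _))

∑-cartesian : ∀ {A B C : Set} (h : A → B → C) xs ys f →
  ∑ (cartesianProductWith h xs ys) f ≡ ∑[ x ← xs ] ∑[ y ← ys ] f (h x y)
∑-cartesian h [] ys f       = refl
∑-cartesian h (x ∷ xs) ys f = trans (∑-++ (map (h x) ys) _ f)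
  (cong₂ _+_ (∑-map (h x) ys f) (∑-cartesian h xs ys f))

-- Lattice steps and the discrete Laplacian.

data Dir : ℕ → Set where
  fwd   : ∀ {d} → Dir (suc d)
  bwd   : ∀ {d} → Dir (suc d)
  later : ∀ {d} → Dir d → Dir (suc d)

opp : ∀ {d} → Dir d → Dir d
opp fwd       = bwd
opp bwd       = fwd
opp (later δ) = later (opp δ)

step : ∀ {d} → Dir d → Site d → Site d
step fwd (z ∷ x)       = ℤ.suc z ∷ x
step bwd (z ∷ x)       = ℤ.pred z ∷ x
step (later δ) (z ∷ x) = z ∷ step δ x

step-opp : ∀ {d} (δ : Dir d) x → step (opp δ) (step δ x) ≡ x
step-opp fwd (z ∷ x)       = cong (_∷ x) (ℤₚ.pred-suc z)
step-opp bwd (z ∷ x)       = cong (_∷ x) (ℤₚ.suc-pred z)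
step-opp (later δ) (z ∷ x) = cong (z ∷_) (step-opp δ x)

opp-involutive : ∀ {d} (δ : Dir d) → opp (opp δ) ≡ δ
opp-involutive fwd       = refl
opp-involutive bwd       = refl
opp-involutive (later δ) = cong later (opp-involutive δ)

opp-step : ∀ {d} (δ : Dir d) x → step δ (step (opp δ) x) ≡ x
opp-step δ x = subst (λ ε → step ε (step (opp δ) x) ≡ x) (opp-involutive δ) (step-opp (opp δ) x)

step-comm : ∀ {d} (δ ε : Dir d) x → step δ (step ε x) ≡ step ε (step δ x)
step-comm fwd fwd (z ∷ x)             = refl
step-comm fwd bwd (z ∷ x)             = cong (_∷ x) (trans (ℤₚ.suc-pred z) (sym (ℤₚ.pred-suc z)))
step-comm fwd (later ε) (z ∷ x)       = refl
step-comm bwd fwd (z ∷ x)             = cong (_∷ x) (trans (ℤₚ.pred-suc z) (sym (ℤₚ.suc-pred z)))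
step-comm bwd bwd (z ∷ x)             = refl
step-comm bwd (later ε) (z ∷ x)       = refl
step-comm (later δ) fwd (z ∷ x)       = refl
step-comm (later δ) bwd (z ∷ x)       = refl
step-comm (later δ) (later ε) (z ∷ x) = cong (z ∷_) (step-comm δ ε x)

dirs : ∀ d → List (Dir d)
dirs zero    = []
dirs (suc d) = fwd ∷ bwd ∷ map later (dirs d)

∑-dirs-suc : ∀ {d} (f : Dir (suc d) → ℚ) → ∑ (dirs (suc d)) f ≡ f fwd + (f bwd + ∑ (dirs d) (λ δ → f (later δ)))
∑-dirs-suc {d} f = cong (λ z → f fwd + (f bwd + z)) (∑-map later (dirs d) f)

∈-dirs : ∀ {d} (δ : Dir d) → δ ∈ dirs d
∈-dirs fwd       = here refl
∈-dirs bwd       = there (here refl)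
∈-dirs (later δ) = there (there (∈-map⁺ later (∈-dirs δ)))

∑-dirs-const : ∀ d c → ∑[ δ ← dirs d ] c ≡ (⟦ d ⟧ + ⟦ d ⟧) * c
∑-dirs-const zero c    = sym (ℚₚ.*-zeroˡ c)
∑-dirs-const (suc d) c = trans (∑-dirs-suc {d} (λ _ → c)) (trans (cong (λ z → c + (c + z)) (∑-dirs-const d c)) (lem ⟦ d ⟧ c))
  where
  lem : ∀ a c → c + (c + (a + a) * c) ≡ (1ℚ + a + (1ℚ + a)) * c
  lem = solve-∀ ring

∑-dirs-opp : ∀ d (f : Dir d → ℚ) → ∑[ δ ← dirs d ] f (opp δ) ≡ ∑ (dirs d) f
∑-dirs-opp zero f    = refl
∑-dirs-opp (suc d) f = trans (∑-dirs-suc (λ δ → f (opp δ)))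
  (trans (cong (λ z → f bwd + (f fwd + z)) (∑-dirs-opp d (λ δ → f (later δ))))
  (trans (lem (f fwd) (f bwd) _) (sym (∑-dirs-suc f))))
  where
  lem : ∀ a b c → b + (a + c) ≡ a + (b + c)
  lem = solve-∀ ring

lap : ∀ {d} → (Site d → ℚ) → Site d → ℚ
lap {d} g x = ∑[ δ ← dirs d ] (g (step δ x) - g x)

module _ {d : ℕ} where

  lap-cong : ∀ {g h : Site d → ℚ} → (∀ x → g x ≡ h x) → ∀ x → lap g x ≡ lap h x
  lap-cong e x = ∑-cong (dirs d) (λ δ → cong₂ _-_ (e (step δ x)) (e x))

  lap-+ : ∀ (g h : Site d → ℚ) x → lap (λ y → g y + h y) x ≡ lap g x + lap h x
  lap-+ g h x = trans (∑-cong (dirs d) (λ δ → lem (g (step δ x)) (h (step δ x)) (g x) (h x))) (∑-+ (dirs d) _ _)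
    where
    lem : ∀ a b c e → a + b - (c + e) ≡ a - c + (b - e)
    lem = solve-∀ ring

  lap-* : ∀ c (g : Site d → ℚ) x → lap (λ y → c * g y) x ≡ c * lap g x
  lap-* c g x = trans (∑-cong (dirs d) (λ δ → lem c (g (step δ x)) (g x))) (∑-* (dirs d) c _)
    where
    lem : ∀ c a b → c * a - c * b ≡ c * (a - b)
    lem = solve-∀ ring

  lap-− : ∀ (g h : Site d → ℚ) x → lap (λ y → g y - h y) x ≡ lap g x - lap h x
  lap-− g h x = trans (∑-cong (dirs d) (λ δ → lem (g (step δ x)) (h (step δ x)) (g x) (h x))) (∑-− (dirs d) _ _)
    where
    lem : ∀ a b c e → a - b - (c - e) ≡ a - c - (b - e)
    lem = solve-∀ ring

  lap-∑ : ∀ {A : Set} (xs : List A) (g : A → Site d → ℚ) x → lap (λ y → ∑[ a ← xs ] g a y) x ≡ ∑[ a ← xs ] lap (g a) x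
  lap-∑ [] g x       = trans (∑-cong (dirs d) (λ _ → refl)) (∑-0 (dirs d))
  lap-∑ (a ∷ xs) g x = trans (lap-+ (g a) (λ y → ∑[ b ← xs ] g b y) x) (cong (λ z → lap (g a) x + z) (lap-∑ xs g x))

  lap-step : ∀ (g : Site d → ℚ) ε x → lap (λ y → g (step ε y)) x ≡ lap g (step ε x)
  lap-step g ε x = ∑-cong (dirs d) (λ δ → cong (λ y → g y - g (step ε x)) (step-comm ε δ x))

  lap-split : ∀ (g : Site d → ℚ) x → lap g x ≡ ∑[ δ ← dirs d ] g (step δ x) - (⟦ d ⟧ + ⟦ d ⟧) * g x
  lap-split g x = trans (∑-− (dirs d) _ _) (cong (λ z → ∑[ δ ← dirs d ] g (step δ x) - z) (∑-dirs-const d (g x)))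

-- Point masses, cubes and translation of sums.

kr₁ : ℤ → ℤ → ℚ
kr₁ z w with z ℤ.≟ w
... | yes _ = 1ℚ
... | no _  = 0ℚ

kr : ∀ {d} → Site d → Site d → ℚ
kr [] []             = 1ℚ
kr (z ∷ x) (w ∷ y)   = kr₁ z w * kr x y

kr₁-refl : ∀ z → kr₁ z z ≡ 1ℚ
kr₁-refl z with z ℤ.≟ z
... | yes _ = refl
... | no ¬p = contradiction refl ¬p

kr₁-≢ : ∀ {z w} → z ≢ w → kr₁ z w ≡ 0ℚ
kr₁-≢ {z} {w} h with z ℤ.≟ w
... | yes p = contradiction p h
... | no _  = refl

kr-refl : ∀ {d} (x : Site d) → kr x x ≡ 1ℚ
kr-refl []      = refl
kr-refl (z ∷ x) = cong₂ _*_ (kr₁-refl z) (kr-refl x)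

kr-≢ : ∀ {d} {x y : Site d} → x ≢ y → kr x y ≡ 0ℚ
kr-≢ {x = []} {[]} h = contradiction refl h
kr-≢ {x = z ∷ x} {w ∷ y} h with z ℤ.≟ w
... | no _ = ℚₚ.*-zeroˡ (kr x y)
... | yes refl = trans (ℚₚ.*-identityˡ (kr x y)) (kr-≢ (λ e → h (cong (z ∷_) e)))

kr₁-bounds : ∀ z w → 0ℚ ≤ kr₁ z w × kr₁ z w ≤ 1ℚ
kr₁-bounds z w with z ℤ.≟ w
... | yes _ = 0≤1 , ≤-refl
... | no _  = ≤-refl , 0≤1

kr≥0 : ∀ {d} (x y : Site d) → 0ℚ ≤ kr x y
kr≥0 [] []           = 0≤1
kr≥0 (z ∷ x) (w ∷ y) = proj₁ (kr₁-bounds z w) ⊗ kr≥0 x y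

range : ℕ → List ℤ
range zero    = + 0 ∷ []
range (suc B) = + suc B ∷ -[1+ B ] ∷ range B

box : ∀ d → ℕ → List (Site d)
box zero B    = [] ∷ []
box (suc d) B = cartesianProductWith _∷_ (range B) (box d B)

∑-box-suc : ∀ {d} B (f : Site (suc d) → ℚ) → ∑ (box (suc d) B) f ≡ ∑[ z ← range B ] ∑[ x ← box d B ] f (z ∷ x)
∑-box-suc {d} B f = ∑-cartesian _∷_ (range B) (box d B) f

∈-range : ∀ B z → ℤ.∣ z ∣ ℕ.≤ B → z ∈ range B
∈-range zero (+ zero) h = here refl
∈-range (suc B) (+ n) h with n ℕ.≟ suc B
... | yes refl = here refl
... | no ¬p = there (there (∈-range B (+ n) (ℕₚ.≤-pred (ℕₚ.≤∧≢⇒< h ¬p))))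
∈-range (suc B) -[1+ n ] (s≤s h) with n ℕ.≟ B
... | yes refl = there (here refl)
... | no ¬p = there (there (∈-range B -[1+ n ] (ℕₚ.≤∧≢⇒< h ¬p)))

∈-box : ∀ {d} B (x : Site d) → normInf x ℕ.≤ B → x ∈ box d B
∈-box B [] h      = here refl
∈-box B (z ∷ x) h = ∈-cartesianProductWith⁺ _∷_ (∈-range B z (ℕₚ.m⊔n≤o⇒m≤o ℤ.∣ z ∣ _ h)) (∈-box B x (ℕₚ.m⊔n≤o⇒n≤o ℤ.∣ z ∣ _ h))

pred-neg : ∀ B → ℤ.suc -[1+ B ] ≡ ℤ.- (+ B)
pred-neg zero    = refl
pred-neg (suc B) = refl

-- Both sides sum `g` over the integers from -B to B + 1.
∑-range-shift : ∀ B (g : ℤ → ℚ) → ∑[ z ← range B ] g (ℤ.suc z) + g (ℤ.- (+ B)) ≡ ∑ (range B) g + g (+ suc B)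
∑-range-shift zero g = lem (g (+ 1)) (g (+ 0))
  where
  lem : ∀ a b → a + 0ℚ + b ≡ b + 0ℚ + a
  lem = solve-∀ ring
∑-range-shift (suc B) g = trans (cong (λ z → g (+ suc (suc B)) + (g z + S') + g -[1+ B ]) (pred-neg B))
  (trans (lem₁ (g (+ suc (suc B))) (g (ℤ.- (+ B))) S' (g -[1+ B ]))
  (trans (cong (λ z → g (+ suc (suc B)) + z + g -[1+ B ]) (∑-range-shift B g))
  (lem₂ (g (+ suc (suc B))) (∑ (range B) g) (g (+ suc B)) (g -[1+ B ]))))
  where
  S' = ∑[ z ← range B ] g (ℤ.suc z)
  lem₁ : ∀ a b c e → a + (b + c) + e ≡ a + (c + b) + e
  lem₁ = solve-∀ ring
  lem₂ : ∀ a b c e → a + (b + c) + e ≡ c + (e + b) + a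
  lem₂ = solve-∀ ring

-- The function must vanish already at distance `B`, since a shift trades a face at distance B for
-- one at distance B + 1.
∑-box-shift : ∀ {d} B (g : Site d → ℚ) (δ : Dir d) → (∀ x → B ℕ.≤ normInf x → g x ≡ 0ℚ) →
  ∑[ x ← box d B ] g (step δ x) ≡ ∑ (box d B) g
∑-box-shift {suc d} B g fwd h = trans (∑-box-suc B (λ x → g (step fwd x)))
  (trans (ℚ-drop (inner (ℤ.- (+ B)) (ℕₚ.≤-reflexive (sym (ℤₚ.∣-i∣≡∣i∣ (+ B))))) (inner (+ suc B) (ℕₚ.n≤1+n B)) (∑-range-shift B (λ z → ∑[ x ← box d B ] g (z ∷ x))))
    (sym (∑-box-suc B g)))
  where
  inner : ∀ z → B ℕ.≤ ℤ.∣ z ∣ → ∑[ x ← box d B ] g (z ∷ x) ≡ 0ℚ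
  inner z p = trans (∑-cong (box d B) (λ x → h (z ∷ x) (ℕₚ.≤-trans p (ℕₚ.m≤m⊔n ℤ.∣ z ∣ (normInf x))))) (∑-0 (box d B))
  ℚ-drop : ∀ {a b c e} → b ≡ 0ℚ → e ≡ 0ℚ → a + b ≡ c + e → a ≡ c
  ℚ-drop {a} {_} {c} refl refl eq = trans (sym (ℚₚ.+-identityʳ a)) (trans eq (ℚₚ.+-identityʳ c))
∑-box-shift {suc d} B g bwd h = trans (∑-box-suc B (λ x → g (step bwd x)))
  (trans (sym (ℚ-drop (inner (ℤ.pred (ℤ.- (+ B))) (far B)) (inner (ℤ.pred (+ suc B)) ℕₚ.≤-refl) shifted))
    (sym (∑-box-suc B g)))
  where
  inner : ∀ z → B ℕ.≤ ℤ.∣ z ∣ → ∑[ x ← box d B ] g (z ∷ x) ≡ 0ℚ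
  inner z p = trans (∑-cong (box d B) (λ x → h (z ∷ x) (ℕₚ.≤-trans p (ℕₚ.m≤m⊔n ℤ.∣ z ∣ (normInf x))))) (∑-0 (box d B))
  far : ∀ B → B ℕ.≤ ℤ.∣ ℤ.pred (ℤ.- (+ B)) ∣
  far zero    = z≤n
  far (suc B) = ℕₚ.n≤1+n (suc B)
  shifted : ∑[ z ← range B ] ∑[ x ← box d B ] g (z ∷ x) + ∑[ x ← box d B ] g (ℤ.pred (ℤ.- (+ B)) ∷ x)
    ≡ ∑[ z ← range B ] ∑[ x ← box d B ] g (ℤ.pred z ∷ x) + ∑[ x ← box d B ] g (ℤ.pred (+ suc B) ∷ x)
  shifted = trans
    (cong (λ t → t + ∑[ x ← box d B ] g (ℤ.pred (ℤ.- (+ B)) ∷ x))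
      (∑-cong (range B) (λ z → cong (λ w → ∑[ x ← box d B ] g (w ∷ x)) (sym (ℤₚ.pred-suc z)))))
    (∑-range-shift B (λ z → ∑[ x ← box d B ] g (ℤ.pred z ∷ x)))
  ℚ-drop : ∀ {a b c e} → b ≡ 0ℚ → e ≡ 0ℚ → a + b ≡ c + e → a ≡ c
  ℚ-drop {a} {_} {c} refl refl eq = trans (sym (ℚₚ.+-identityʳ a)) (trans eq (ℚₚ.+-identityʳ c))
∑-box-shift {suc d} B g (later δ) h = trans (∑-box-suc B (λ x → g (step (later δ) x)))
  (trans (∑-cong (range B) (λ z → ∑-box-shift B (λ x → g (z ∷ x)) δ (λ x p → h (z ∷ x) (ℕₚ.≤-trans p (ℕₚ.m≤n⊔m ℤ.∣ z ∣ (normInf x))))))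
    (sym (∑-box-suc B g)))

-- Indicators and the discrete divergence theorem.

𝟙 : ∀ {P : Set} → Dec P → ℚ
𝟙 (yes _) = 1ℚ
𝟙 (no _)  = 0ℚ

𝟙-yes : ∀ {P : Set} (p? : Dec P) → P → 𝟙 p? ≡ 1ℚ
𝟙-yes (yes _) p = refl
𝟙-yes (no ¬p) p = contradiction p ¬p

𝟙-no : ∀ {P : Set} (p? : Dec P) → ¬ P → 𝟙 p? ≡ 0ℚ
𝟙-no (yes p) ¬p = contradiction p ¬p
𝟙-no (no _) ¬p  = refl

𝟙≥0 : ∀ {P : Set} (p? : Dec P) → 0ℚ ≤ 𝟙 p?
𝟙≥0 (yes _) = 0≤1
𝟙≥0 (no _)  = ≤-refl

𝟙≤1 : ∀ {P : Set} (p? : Dec P) → 𝟙 p? ≤ 1ℚ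
𝟙≤1 (yes _) = ≤-refl
𝟙≤1 (no _)  = 0≤1

𝟙-mono : ∀ {P Q : Set} (p? : Dec P) (q? : Dec Q) → (P → Q) → 𝟙 p? ≤ 𝟙 q?
𝟙-mono (yes p) (yes _) f = ≤-refl
𝟙-mono (yes p) (no ¬q) f = contradiction (f p) ¬q
𝟙-mono (no _) q? f       = 𝟙≥0 q?

-- Discrete divergence theorem: the interior edges of A cancel by antisymmetry.
flux : ∀ {d} (A : Site d → Set) (A? : ∀ x → Dec (A x)) (K : Site d → Site d → ℚ) B →
  (∀ x y → K x y ≡ - K y x) → (∀ x → B ℕ.≤ normInf x → ¬ A x) →
  ∑[ x ← box d B ] 𝟙 (A? x) * ∑ (dirs d) (λ δ → K x (step δ x)) ≡
  ∑[ x ← box d B ] ∑[ δ ← dirs d ] 𝟙 (A? x) * (1ℚ - 𝟙 (A? (step δ x))) * K x (step δ x)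
flux {d} A A? K B anti bounded = trans (∑-cong (box d B) expand)
  (trans (∑-+ (box d B) _ _) (trans (cong (λ z → bdry + z) total≡0) (ℚₚ.+-identityʳ bdry)))
  where
  G : Dir d → Site d → ℚ
  G δ x = 𝟙 (A? x) * 𝟙 (A? (step δ x)) * K x (step δ x)
  bdry = ∑[ x ← box d B ] ∑[ δ ← dirs d ] 𝟙 (A? x) * (1ℚ - 𝟙 (A? (step δ x))) * K x (step δ x)
  expand : ∀ x → 𝟙 (A? x) * ∑ (dirs d) (λ δ → K x (step δ x)) ≡
    ∑[ δ ← dirs d ] 𝟙 (A? x) * (1ℚ - 𝟙 (A? (step δ x))) * K x (step δ x) + ∑[ δ ← dirs d ] G δ x
  expand x = trans (sym (∑-* (dirs d) (𝟙 (A? x)) _))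
    (trans (∑-cong (dirs d) (λ δ → lem (𝟙 (A? x)) (𝟙 (A? (step δ x))) (K x (step δ x)))) (∑-+ (dirs d) _ _))
    where
    lem : ∀ a b k → a * k ≡ a * (1ℚ - b) * k + a * b * k
    lem = solve-∀ ring
  S : Dir d → ℚ
  S δ = ∑ (box d B) (G δ)
  G-opp : ∀ δ x → G δ (step (opp δ) x) ≡ - G (opp δ) x
  G-opp δ x = trans (cong (λ y → 𝟙 (A? (step (opp δ) x)) * 𝟙 (A? y) * K (step (opp δ) x) y) (opp-step δ x))
    (trans (cong (λ k → 𝟙 (A? (step (opp δ) x)) * 𝟙 (A? x) * k) (anti (step (opp δ) x) x))
      (lem (𝟙 (A? (step (opp δ) x))) (𝟙 (A? x)) (K x (step (opp δ) x))))
    where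
    lem : ∀ a b k → a * b * - k ≡ - (b * a * k)
    lem = solve-∀ ring
  neg-∑ : ∀ {C : Set} (xs : List C) f → ∑[ x ← xs ] (- f x) ≡ - ∑ xs f
  neg-∑ xs f = trans (∑-cong xs (λ x → lem (f x))) (trans (∑-* xs (- 1ℚ) f) (sym (lem (∑ xs f))))
    where
    lem : ∀ a → - a ≡ - 1ℚ * a
    lem = solve-∀ ring
  S-opp : ∀ δ → S δ ≡ - S (opp δ)
  S-opp δ = trans (sym (∑-box-shift B (G δ) (opp δ) vanish))
    (trans (∑-cong (box d B) (G-opp δ)) (neg-∑ (box d B) (G (opp δ))))
    where
    vanish : ∀ x → B ℕ.≤ normInf x → G δ x ≡ 0ℚ
    vanish x p = trans (cong (λ z → z * 𝟙 (A? (step δ x)) * K x (step δ x)) (𝟙-no (A? x) (bounded x p)))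
      (lem (𝟙 (A? (step δ x))) (K x (step δ x)))
      where
      lem : ∀ b k → 0ℚ * b * k ≡ 0ℚ
      lem = solve-∀ ring
  T = ∑ (dirs d) S
  T≡-T : T ≡ - T
  T≡-T = trans (∑-cong (dirs d) S-opp) (trans (neg-∑ (dirs d) (λ δ → S (opp δ))) (cong -_ (∑-dirs-opp d S)))
  self-neg : ∀ t → t ≡ - t → t ≡ 0ℚ
  self-neg t e = trans (half t) (trans (cong (λ z → ½ * (t + z)) e) (zero' t))
    where
    half : ∀ t → t ≡ ½ * (t + t)
    half = solve-∀ ring
    zero' : ∀ t → ½ * (t + - t) ≡ 0ℚ
    zero' = solve-∀ ring
  total≡0 : ∑[ x ← box d B ] ∑[ δ ← dirs d ] G δ x ≡ 0ℚ
  total≡0 = trans (∑-swap (box d B) (dirs d) (λ x δ → G δ x)) (self-neg T T≡-T)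

∑-kr₁-out : ∀ B w (g : ℤ → ℚ) → B ℕ.< ℤ.∣ w ∣ → ∑[ z ← range B ] kr₁ w z * g z ≡ 0ℚ
∑-kr₁-out zero w g p = trans (cong (λ t → t * g (+ 0) + 0ℚ) (kr₁-≢ {w} {+ 0} λ { refl → contradiction p λ () })) (lem (g (+ 0)))
  where
  lem : ∀ a → 0ℚ * a + 0ℚ ≡ 0ℚ
  lem = solve-∀ ring
∑-kr₁-out (suc B) w g p = trans
  (cong₂ (λ s t → s * g (+ suc B) + (t * g -[1+ B ] + ∑[ z ← range B ] kr₁ w z * g z))
    (kr₁-≢ {w} {+ suc B} λ { refl → ℕₚ.<-irrefl refl p }) (kr₁-≢ {w} { -[1+ B ]} λ { refl → ℕₚ.<-irrefl refl p }))
  (trans (cong (λ t → 0ℚ * g (+ suc B) + (0ℚ * g -[1+ B ] + t)) (∑-kr₁-out B w g (ℕₚ.<-trans (ℕₚ.n<1+n B) p)))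
    (lem (g (+ suc B)) (g -[1+ B ])))
  where
  lem : ∀ a b → 0ℚ * a + (0ℚ * b + 0ℚ) ≡ 0ℚ
  lem = solve-∀ ring

∑-kr₁ : ∀ B w (g : ℤ → ℚ) → ℤ.∣ w ∣ ℕ.≤ B → ∑[ z ← range B ] kr₁ w z * g z ≡ g w
∑-kr₁ zero (+ zero) g p = lem (g (+ 0))
  where
  lem : ∀ a → 1ℚ * a + 0ℚ ≡ a
  lem = solve-∀ ring
∑-kr₁ (suc B) w g p with ℤ.∣ w ∣ ℕₚ.≤? B
... | yes q = trans
  (cong₂ (λ s t → s * g (+ suc B) + (t * g -[1+ B ] + ∑[ z ← range B ] kr₁ w z * g z))
    (kr₁-≢ {w} {+ suc B} λ { refl → ℕₚ.<-irrefl refl q }) (kr₁-≢ {w} { -[1+ B ]} λ { refl → ℕₚ.<-irrefl refl q }))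
  (trans (cong (λ t → 0ℚ * g (+ suc B) + (0ℚ * g -[1+ B ] + t)) (∑-kr₁ B w g q)) (lem (g (+ suc B)) (g -[1+ B ]) (g w)))
  where
  lem : ∀ a b c → 0ℚ * a + (0ℚ * b + c) ≡ c
  lem = solve-∀ ring
... | no ¬q = trans
  (cong (λ t → kr₁ w (+ suc B) * g (+ suc B) + (kr₁ w -[1+ B ] * g -[1+ B ] + t)) (∑-kr₁-out B w g (ℕₚ.≰⇒> ¬q)))
  (extreme w (ℕₚ.≤-antisym p (ℕₚ.≰⇒> ¬q)))
  where
  lem₁ : ∀ a b → 1ℚ * a + (0ℚ * b + 0ℚ) ≡ a
  lem₁ = solve-∀ ring
  lem₂ : ∀ a b → 0ℚ * a + (1ℚ * b + 0ℚ) ≡ b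
  lem₂ = solve-∀ ring
  extreme : ∀ w → ℤ.∣ w ∣ ≡ suc B → kr₁ w (+ suc B) * g (+ suc B) + (kr₁ w -[1+ B ] * g -[1+ B ] + 0ℚ) ≡ g w
  extreme (+ .(suc B)) refl = trans
    (cong₂ (λ s t → s * g (+ suc B) + (t * g -[1+ B ] + 0ℚ)) (kr₁-refl (+ suc B)) (kr₁-≢ {+ suc B} { -[1+ B ]} λ ()))
    (lem₁ (g (+ suc B)) (g -[1+ B ]))
  extreme -[1+ .B ] refl = trans
    (cong₂ (λ s t → s * g (+ suc B) + (t * g -[1+ B ] + 0ℚ)) (kr₁-≢ { -[1+ B ]} {+ suc B} λ ()) (kr₁-refl -[1+ B ]))
    (lem₂ (g (+ suc B)) (g -[1+ B ]))

∑-kr : ∀ {d} B (x : Site d) (g : Site d → ℚ) → normInf x ℕ.≤ B → ∑[ y ← box d B ] kr x y * g y ≡ g x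
∑-kr B [] g p = lem (g [])
  where
  lem : ∀ a → 1ℚ * a + 0ℚ ≡ a
  lem = solve-∀ ring
∑-kr {suc d} B (w ∷ x) g p = trans (∑-box-suc B (λ y → kr (w ∷ x) y * g y))
  (trans (∑-cong (range B) λ z → trans (∑-cong (box d B) λ y → ℚₚ.*-assoc (kr₁ w z) (kr x y) (g (z ∷ y)))
      (trans (∑-* (box d B) (kr₁ w z) λ y → kr x y * g (z ∷ y))
        (cong (λ t → kr₁ w z * t) (∑-kr B x (λ y → g (z ∷ y)) (ℕₚ.m⊔n≤o⇒n≤o ℤ.∣ w ∣ _ p)))))
    (∑-kr₁ B w (λ z → g (z ∷ x)) (ℕₚ.m⊔n≤o⇒m≤o ℤ.∣ w ∣ _ p)))

normInf-origin : ∀ d → normInf (origin d) ≡ 0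
normInf-origin zero    = refl
normInf-origin (suc d) = normInf-origin d

-- The dynamics in terms of the lattice Laplacian.

⟦⟧ᶻ-∸ : ∀ z m → ⟦⟧ᶻ (z ℤ.- (+ m)) ≡ ⟦⟧ᶻ z - ⟦ m ⟧
⟦⟧ᶻ-∸ z zero = trans (cong ⟦⟧ᶻ (ℤₚ.+-identityʳ z)) (lem (⟦⟧ᶻ z))
  where
  lem : ∀ a → a ≡ a - 0ℚ
  lem = solve-∀ ring
⟦⟧ᶻ-∸ z (suc m) = trans (cong ⟦⟧ᶻ (ℤₚ.minus-suc z m)) (trans (⟦⟧ᶻ-pred (z ℤ.- (+ m)))
  (trans (cong (λ t → t - 1ℚ) (⟦⟧ᶻ-∸ z m)) (lem (⟦⟧ᶻ z) ⟦ m ⟧)))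
  where
  lem : ∀ a b → a - b - 1ℚ ≡ a - (1ℚ + b)
  lem = solve-∀ ring

⟦⟧ᶻ-+1 : ∀ z → ⟦⟧ᶻ (z ℤ.+ (+ 1)) ≡ ⟦⟧ᶻ z + 1ℚ
⟦⟧ᶻ-+1 z = trans (cong ⟦⟧ᶻ (ℤₚ.+-comm z (+ 1))) (⟦⟧ᶻ-suc z)

⟦⟧ᶻ-≥ : ∀ m z → (+ m) ℤ.≤ z → ⟦ m ⟧ ≤ ⟦⟧ᶻ z
⟦⟧ᶻ-≥ m (+ k) (ℤ.+≤+ h) = ⟦⟧-mono h

kr₁-shift : ∀ b c e → kr₁ (c ℤ.+ b) (e ℤ.+ b) ≡ kr₁ c e
kr₁-shift b c e with c ℤ.≟ e
... | yes refl = kr₁-refl (c ℤ.+ b)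
... | no ¬p    = kr₁-≢ λ q → ¬p (∙-cancelʳ b c e q)

private
  unit : ∀ c → c ≢ + 0 → kr₁ c (+ 1) + kr₁ c -[1+ 0 ] ≡ 𝟙 (ℤ.∣ c ∣ ℕₚ.≟ 1)
  unit (+ zero) h         = contradiction refl h
  unit (+ suc zero) h     = refl
  unit (+ suc (suc n)) h  = refl
  unit -[1+ zero ] h      = refl
  unit -[1+ suc n ] h     = refl

neighbour₁ : ∀ a b → a ≢ b → kr₁ a (ℤ.suc b) + kr₁ a (ℤ.pred b) ≡ 𝟙 (ℤ.∣ a ℤ.- b ∣ ℕₚ.≟ 1)
neighbour₁ a b a≢b = trans
  (cong (λ t → kr₁ t (ℤ.suc b) + kr₁ t (ℤ.pred b)) (sym (recover a b)))
  (trans (cong₂ _+_ (kr₁-shift b (a ℤ.- b) (+ 1)) (kr₁-shift b (a ℤ.- b) -[1+ 0 ]))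
    (unit (a ℤ.- b) λ e → a≢b (ℤₚ.i-j≡0⇒i≡j a b e)))
  where
  recover : ∀ a b → a ℤ.- b ℤ.+ b ≡ a
  recover a b = trans (ℤₚ.+-assoc a (ℤ.- b) b) (trans (cong (λ t → a ℤ.+ t) (ℤₚ.+-inverseˡ b)) (ℤₚ.+-identityʳ a))

dist1-refl : ∀ {d} (x : Site d) → dist1 x x ≡ 0
dist1-refl []      = refl
dist1-refl (z ∷ x) = cong₂ ℕ._+_ (cong ℤ.∣_∣ (ℤₚ.+-inverseʳ z)) (dist1-refl x)

∣-∣>0 : ∀ {a b} → a ≢ b → 1 ℕ.≤ ℤ.∣ a ℤ.- b ∣
∣-∣>0 {a} {b} h with ℤ.∣ a ℤ.- b ∣ in e
... | zero  = contradiction (ℤₚ.i-j≡0⇒i≡j a b (ℤₚ.∣i∣≡0⇒i≡0 e)) h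
... | suc _ = s≤s z≤n

dist1>0 : ∀ {d} {x y : Site d} → x ≢ y → 1 ℕ.≤ dist1 x y
dist1>0 {x = []} {[]} h = contradiction refl h
dist1>0 {x = a ∷ x} {b ∷ y} h with a ℤ.≟ b
... | no p     = ℕₚ.≤-trans (∣-∣>0 p) (ℕₚ.m≤m+n _ _)
... | yes refl = ℕₚ.≤-trans (dist1>0 λ e → h (cong (a ∷_) e)) (ℕₚ.m≤n+m _ _)

-- Ties the distance test in `topple` to the list of directions: total distance 1 means distance 1
-- in a single coordinate and 0 in all others.
neighbours : ∀ {d} (z x : Site d) → ∑[ δ ← dirs d ] kr z (step δ x) ≡ 𝟙 (dist1 z x ℕₚ.≟ 1)
neighbours [] [] = refl
neighbours {suc d} (a ∷ z) (b ∷ x) = trans (∑-dirs-suc (λ δ → kr (a ∷ z) (step δ (b ∷ x))))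
  (trans (cong (λ t → kr₁ a (ℤ.suc b) * kr z x + (kr₁ a (ℤ.pred b) * kr z x + t))
    (trans (∑-* (dirs d) (kr₁ a b) _) (cong (λ t → kr₁ a b * t) (neighbours z x)))) cases)
  where
  suc≢ : ∀ a → a ≢ ℤ.suc a
  suc≢ a = ℤₚ.i≢suc[i]
  pred≢ : ∀ a → a ≢ ℤ.pred a
  pred≢ a e = ℤₚ.i≢suc[i] (sym (trans (cong ℤ.suc e) (ℤₚ.suc-pred a)))
  lem₁ : ∀ k u → 0ℚ * k + (0ℚ * k + 1ℚ * u) ≡ u
  lem₁ = solve-∀ ring
  lem₂ : ∀ p q u → p * 1ℚ + (q * 1ℚ + 0ℚ * u) ≡ p + q
  lem₂ = solve-∀ ring
  lem₃ : ∀ p q u → p * 0ℚ + (q * 0ℚ + 0ℚ * u) ≡ 0ℚ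
  lem₃ = solve-∀ ring
  u = 𝟙 (dist1 z x ℕₚ.≟ 1)
  cases : kr₁ a (ℤ.suc b) * kr z x + (kr₁ a (ℤ.pred b) * kr z x + kr₁ a b * u) ≡
    𝟙 (ℤ.∣ a ℤ.- b ∣ ℕ.+ dist1 z x ℕₚ.≟ 1)
  cases with a ℤ.≟ b
  ... | yes refl = trans
    (cong₂ (λ p q → p * kr z x + (q * kr z x + 1ℚ * u)) (kr₁-≢ (suc≢ a)) (kr₁-≢ (pred≢ a)))
    (trans (lem₁ (kr z x) u) (cong (λ t → 𝟙 (t ℕ.+ dist1 z x ℕₚ.≟ 1)) (sym (cong ℤ.∣_∣ (ℤₚ.+-inverseʳ a)))))
  ... | no a≢b with ≡-dec ℤ._≟_ z x
  ...   | yes refl = trans (cong (λ t → kr₁ a (ℤ.suc b) * t + (kr₁ a (ℤ.pred b) * t + 0ℚ * u)) (kr-refl z))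
    (trans (lem₂ (kr₁ a (ℤ.suc b)) (kr₁ a (ℤ.pred b)) u) (trans (neighbour₁ a b a≢b)
      (cong (λ t → 𝟙 (t ℕₚ.≟ 1)) (trans (sym (ℕₚ.+-identityʳ _)) (cong (ℤ.∣ a ℤ.- b ∣ ℕ.+_) (sym (dist1-refl z)))))))
  ...   | no z≢x = trans (cong (λ t → kr₁ a (ℤ.suc b) * t + (kr₁ a (ℤ.pred b) * t + 0ℚ * u)) (kr-≢ z≢x))
    (trans (lem₃ (kr₁ a (ℤ.suc b)) (kr₁ a (ℤ.pred b)) u) (sym (𝟙-no (_ ℕₚ.≟ 1) λ e →
      ℕₚ.<-irrefl (sym e) (ℕₚ.+-mono-≤ (∣-∣>0 a≢b) (dist1>0 z≢x)))))

lap-kr-self : ∀ {d} (z : Site d) → lap (kr z) z ≡ - (⟦ d ⟧ + ⟦ d ⟧)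
lap-kr-self {d} z = trans (lap-split (kr z) z) (trans (cong₂ (λ s t → s - (⟦ d ⟧ + ⟦ d ⟧) * t)
  (trans (neighbours z z) (cong (λ t → 𝟙 (t ℕₚ.≟ 1)) (dist1-refl z))) (kr-refl z)) (lem ⟦ d ⟧))
  where
  lem : ∀ a → 0ℚ - (a + a) * 1ℚ ≡ - (a + a)
  lem = solve-∀ ring

lap-kr-other : ∀ {d} (z x : Site d) → z ≢ x → lap (kr z) x ≡ ∑[ δ ← dirs d ] kr z (step δ x)
lap-kr-other {d} z x h = trans (lap-split (kr z) x) (trans (cong (λ t → s - (⟦ d ⟧ + ⟦ d ⟧) * t) (kr-≢ h)) (lem s ⟦ d ⟧))
  where
  s = ∑[ δ ← dirs d ] kr z (step δ x)
  lem : ∀ s a → s - (a + a) * 0ℚ ≡ s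
  lem = solve-∀ ring

⟦topple⟧ : ∀ {d} (z : Site d) η x → ⟦⟧ᶻ (topple d z η x) ≡ ⟦⟧ᶻ (η x) + lap (kr z) x
⟦topple⟧ {d} z η x with ≡-dec ℤ._≟_ x z
... | yes refl = trans (⟦⟧ᶻ-∸ (η z) (2 ℕ.* d)) (trans (cong (λ t → ⟦⟧ᶻ (η z) - t)
  (trans (cong ⟦_⟧ (cong (d ℕ.+_) (ℕₚ.+-identityʳ d))) (⟦⟧-+ d d))) (cong (λ t → ⟦⟧ᶻ (η z) + t) (sym (lap-kr-self z))))
... | no ¬p with dist1 z x ℕ.≟ 1
...   | yes q = trans (⟦⟧ᶻ-+1 (η x)) (cong (λ t → ⟦⟧ᶻ (η x) + t)
  (sym (trans (lap-kr-other z x (λ e → ¬p (sym e))) (trans (neighbours z x) (𝟙-yes (dist1 z x ℕₚ.≟ 1) q)))))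
...   | no ¬q = trans (sym (ℚₚ.+-identityʳ _)) (cong (λ t → ⟦⟧ᶻ (η x) + t)
  (sym (trans (lap-kr-other z x (λ e → ¬p (sym e))) (trans (neighbours z x) (𝟙-no (dist1 z x ℕₚ.≟ 1) ¬q)))))

⟦initial⟧ : ∀ d h n x → ⟦⟧ᶻ (initial d h n x) ≡ ⟦ h ⟧ + ⟦ n ⟧ * kr (origin d) x
⟦initial⟧ d h n x with ≡-dec ℤ._≟_ x (origin d)
... | yes refl = trans (⟦⟧-+ h n) (cong (λ t → ⟦ h ⟧ + t) (trans (sym (ℚₚ.*-identityʳ ⟦ n ⟧)) (cong (λ t → ⟦ n ⟧ * t) (sym (kr-refl (origin d))))))
... | no ¬p = trans (sym (ℚₚ.+-identityʳ ⟦ h ⟧)) (cong (λ t → ⟦ h ⟧ + t) (trans (sym (ℚₚ.*-zeroʳ ⟦ n ⟧))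
  (cong (λ t → ⟦ n ⟧ * t) (sym (kr-≢ λ e → ¬p (sym e))))))

-- Invariant of a legal run. θ x y is ½ if y toppled more recently than x, -½ if x did, and 0 before
-- either has. Once x has toppled, all its 2 d edges carry ±½, so d + Σ θ is exactly the number of
-- neighbours that toppled since; this is how the density d arises.
record Run {d : ℕ} (h n : ℕ) (η : Config d) : Set where
  field
    u     : Site d → ℕ
    θ     : Site d → Site d → ℚ
    eqn   : ∀ x → ⟦⟧ᶻ (η x) ≡ ⟦ h ⟧ + ⟦ n ⟧ * kr (origin d) x + lap (λ y → ⟦ u y ⟧) x
    anti  : ∀ x y → θ x y ≡ - θ y x
    θ≤½   : ∀ x y → θ x y ≤ ½
    -- The edge flow θ records which endpoint toppled last: such a neighbour has sent x a particle that x still holds.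
    flow  : ∀ x → 1 ℕ.≤ u x → ⟦ d ⟧ + ∑[ δ ← dirs d ] θ x (step δ x) ≤ ⟦⟧ᶻ (η x)
    R     : ℕ
    bound : ∀ x → R ℕ.≤ normInf x → u x ≡ 0

lap-0 : ∀ {d} (x : Site d) → lap (λ _ → 0ℚ) x ≡ 0ℚ
lap-0 {d} x = ∑-0 (dirs d)

start : ∀ d h n → Run h n (initial d h n)
start d h n = record
  { u = λ _ → 0 ; θ = λ _ _ → 0ℚ
  ; eqn = λ x → trans (⟦initial⟧ d h n x) (trans (sym (ℚₚ.+-identityʳ _)) (cong (λ t → ⟦ h ⟧ + ⟦ n ⟧ * kr (origin d) x + t) (sym (lap-0 x))))
  ; anti = λ _ _ → refl ; θ≤½ = λ _ _ → 0≤½ ; flow = λ _ () ; R = 0 ; bound = λ _ _ → refl }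

bump : ∀ {d} → Site d → (Site d → ℕ) → Site d → ℕ
bump z u x with ≡-dec ℤ._≟_ x z
... | yes _ = suc (u x)
... | no _  = u x

bump-≢ : ∀ {d} {z x : Site d} u → x ≢ z → bump z u x ≡ u x
bump-≢ {z = z} {x} u h with ≡-dec ℤ._≟_ x z
... | yes p = contradiction p h
... | no _  = refl

bump-self : ∀ {d} (z : Site d) u → bump z u z ≡ suc (u z)
bump-self z u with ≡-dec ℤ._≟_ z z
... | yes _ = refl
... | no ¬p = contradiction refl ¬p

bump-≤ : ∀ {d} (z x : Site d) u → u x ℕ.≤ bump z u x
bump-≤ z x u with ≡-dec ℤ._≟_ x z
... | yes _ = ℕₚ.n≤1+n _
... | no _  = ℕₚ.≤-refl

⟦bump⟧ : ∀ {d} (z x : Site d) u → ⟦ bump z u x ⟧ ≡ ⟦ u x ⟧ + kr z x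
⟦bump⟧ z x u with ≡-dec ℤ._≟_ x z
... | yes refl = trans (ℚₚ.+-comm 1ℚ ⟦ u z ⟧) (cong (λ t → ⟦ u z ⟧ + t) (sym (kr-refl z)))
... | no ¬p    = trans (sym (ℚₚ.+-identityʳ ⟦ u x ⟧)) (cong (λ t → ⟦ u x ⟧ + t) (sym (kr-≢ λ e → ¬p (sym e))))

step-≢ : ∀ {d} (δ : Dir d) x → step δ x ≢ x
step-≢ fwd (z ∷ x) e       = ℤₚ.i≢suc[i] (sym (∷-injectiveˡ e))
step-≢ bwd (z ∷ x) e       = ℤₚ.i≢suc[i] (sym (trans (cong ℤ.suc (sym (∷-injectiveˡ e))) (ℤₚ.suc-pred z)))
step-≢ (later δ) (z ∷ x) e = step-≢ δ x (∷-injectiveʳ e)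

reorient : ∀ {d} → Site d → (Site d → Site d → ℚ) → Site d → Site d → ℚ
reorient z θ x y with ≡-dec ℤ._≟_ x z | ≡-dec ℤ._≟_ y z
... | yes _ | yes _ = 0ℚ
... | yes _ | no _  = - ½
... | no _  | yes _ = ½
... | no _  | no _  = θ x y

toppled : ∀ {d h n} {η : Config d} (z : Site d) → (+ (2 ℕ.* d)) ℤ.≤ η z → Run h n η → Run h n (topple d z η)
toppled {d} {h} {n} {η} z legal s = record
  { u = bump z u ; θ = reorient z θ ; eqn = eqn' ; anti = anti' ; θ≤½ = θ≤½' ; flow = flow'
  ; R = R ℕ.⊔ suc (normInf z) ; bound = bound' }
  where
  open Run s
  eqn' : ∀ x → ⟦⟧ᶻ (topple d z η x) ≡ ⟦ h ⟧ + ⟦ n ⟧ * kr (origin d) x + lap (λ y → ⟦ bump z u y ⟧) x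
  eqn' x = trans (⟦topple⟧ z η x) (trans (cong (λ t → t + lap (kr z) x) (eqn x))
    (trans (ℚₚ.+-assoc (⟦ h ⟧ + ⟦ n ⟧ * kr (origin d) x) _ _) (cong (λ t → ⟦ h ⟧ + ⟦ n ⟧ * kr (origin d) x + t)
      (sym (trans (lap-cong (λ y → ⟦bump⟧ z y u) x) (lap-+ (λ y → ⟦ u y ⟧) (kr z) x))))))
  anti' : ∀ x y → reorient z θ x y ≡ - reorient z θ y x
  anti' x y with ≡-dec ℤ._≟_ x z | ≡-dec ℤ._≟_ y z
  ... | yes _ | yes _ = refl
  ... | yes _ | no _  = refl
  ... | no _  | yes _ = refl
  ... | no _  | no _  = anti x y
  θ≤½' : ∀ x y → reorient z θ x y ≤ ½
  θ≤½' x y with ≡-dec ℤ._≟_ x z | ≡-dec ℤ._≟_ y z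
  ... | yes _ | yes _ = 0≤½
  ... | yes _ | no _  = ≤-trans (ℚₚ.neg-antimono-≤ 0≤½) 0≤½
  ... | no _  | yes _ = ≤-refl
  ... | no _  | no _  = θ≤½ x y
  at-z : ∀ δ → reorient z θ z (step δ z) ≡ - ½
  at-z δ with ≡-dec ℤ._≟_ z z | ≡-dec ℤ._≟_ (step δ z) z
  ... | yes _ | yes e = contradiction e (step-≢ δ z)
  ... | yes _ | no _  = refl
  ... | no ¬p | _     = contradiction refl ¬p
  -- The edge from `x` to `z` rises from at least -½ to ½, and the increase of at most 1 is matched
  -- by the particle that `x` receives.
  off-z : ∀ x δ → x ≢ z → reorient z θ x (step δ x) ≤ θ x (step δ x) + kr z (step δ x)
  off-z x δ x≢z with ≡-dec ℤ._≟_ x z | ≡-dec ℤ._≟_ (step δ x) z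
  ... | yes e | _     = contradiction e x≢z
  ... | no _ | no _   = cert (kr≥0 z (step δ x)) refl
  ... | no _ | yes e  = cert (diff≥0 (θ≤½ (step δ x) x))
      (trans (cong₂ _+_ (anti x (step δ x)) (trans (cong (kr z) e) (kr-refl z))) (lem (θ (step δ x) x)))
    where
    lem : ∀ t → - t + 1ℚ ≡ ½ + (½ - t)
    lem = solve-∀ ring
  flow' : ∀ x → 1 ℕ.≤ bump z u x → ⟦ d ⟧ + ∑[ δ ← dirs d ] reorient z θ x (step δ x) ≤ ⟦⟧ᶻ (topple d z η x)
  flow' x p = by-cases (≡-dec ℤ._≟_ x z)
   where
   by-cases : Dec (x ≡ z) → ⟦ d ⟧ + ∑[ δ ← dirs d ] reorient z θ x (step δ x) ≤ ⟦⟧ᶻ (topple d z η x)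
   -- All edges at the toppled site now carry -½, so the required bound drops to 0, and legality
   -- leaves a nonnegative number of particles.
   by-cases (yes refl) = ≤-trans (≤-reflexive (trans (cong (λ t → ⟦ d ⟧ + t) (trans (∑-cong (dirs d) at-z) (∑-dirs-const d (- ½)))) (lem₁ ⟦ d ⟧)))
     (subst (0ℚ ≤_) (trans (cong (λ t → ⟦⟧ᶻ (η x) - t) two-d) (trans (cong (λ t → ⟦⟧ᶻ (η x) + t) (sym (lap-kr-self x))) (sym (⟦topple⟧ x η x))))
       (diff≥0 (⟦⟧ᶻ-≥ (2 ℕ.* d) (η x) legal)))
     where
     lem₁ : ∀ a → a + (a + a) * - ½ ≡ 0ℚ
     lem₁ = solve-∀ ring
     two-d : ⟦ 2 ℕ.* d ⟧ ≡ ⟦ d ⟧ + ⟦ d ⟧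
     two-d = trans (cong ⟦_⟧ (cong (d ℕ.+_) (ℕₚ.+-identityʳ d))) (⟦⟧-+ d d)
   by-cases (no x≢z) = ≤-trans (ℚₚ.+-monoʳ-≤ ⟦ d ⟧ (≤-trans (∑-mono (dirs d) (λ δ → off-z x δ x≢z)) (≤-reflexive (∑-+ (dirs d) _ _))))
     (≤-trans (≤-reflexive (sym (ℚₚ.+-assoc ⟦ d ⟧ _ _)))
       (≤-trans (ℚₚ.+-monoˡ-≤ _ (flow x (subst (1 ℕ.≤_) (bump-≢ u x≢z) p)))
         (≤-reflexive (sym (trans (⟦topple⟧ z η x) (cong (λ t → ⟦⟧ᶻ (η x) + t) (lap-kr-other z x λ e → x≢z (sym e))))))))
  bound' : ∀ x → R ℕ.⊔ suc (normInf z) ℕ.≤ normInf x → bump z u x ≡ 0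
  bound' x p with ≡-dec ℤ._≟_ x z
  ... | yes refl = contradiction (ℕₚ.m⊔n≤o⇒n≤o R _ p) (ℕₚ.<-irrefl refl)
  ... | no _     = bound x (ℕₚ.m⊔n≤o⇒m≤o R _ p)

-- A nonempty set closed under steps contains a ray in the first coordinate, so it cannot lie in the
-- bounded support of `u`.
closed-unbounded : ∀ {d} → 1 ℕ.≤ d → (P : Site d → Set) → (∀ x δ → P x → P (step δ x)) →
  ∀ R x → P x → ∃[ y ] (P y × R ℕ.≤ normInf y)
closed-unbounded {suc d} _ P closed R (z ∷ x) p = _ , climb m , ℕₚ.≤-trans (far z) (ℕₚ.m≤m⊔n _ (normInf x))
  where
  m = R ℕ.+ ℤ.∣ z ∣
  climb : ∀ m → P ((+ m) ℤ.+ z ∷ x)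
  climb zero    = subst (λ t → P (t ∷ x)) (sym (ℤₚ.+-identityˡ z)) p
  climb (suc m) = subst (λ t → P (t ∷ x)) (sym (ℤₚ.+-assoc (+ 1) (+ m) z)) (closed _ fwd (climb m))
  far : ∀ z → R ℕ.≤ ℤ.∣ (+ (R ℕ.+ ℤ.∣ z ∣)) ℤ.+ z ∣
  far (+ k)    = ℕₚ.≤-trans (ℕₚ.m≤m+n R k) (ℕₚ.m≤m+n (R ℕ.+ k) k)
  far -[1+ k ] = ℕₚ.≤-reflexive (sym (cong ℤ.∣_∣ (trans (ℤₚ.⊖-≥ (ℕₚ.m≤n+m (suc k) R)) (cong +_ (ℕₚ.m+n∸n≡m R (suc k))))))

-- `ζ` will be |x_i|. From `r'` on the potential `f` is at most 1, beyond `a` the profile `w` curves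
-- upwards, and u ≤ w is claimed from `a'` on. In between, `γ` falls from at least J + 1 to 0 with
-- Laplacian at most 1, which is all that the surplus density 1 allows.
record Barrier (d h n : ℕ) : Set where
  field
    ζ        : Site d → ℕ
    ζ-step   : ∀ δ x → ζ x ℕ.≤ suc (ζ (step δ x))
    ζ-origin : ζ (origin d) ≡ 0
    a a' r'  : ℕ
    a'≤a     : a' ℕ.≤ a
    r'<a'    : r' ℕ.< a'
    d≥1      : 1 ℕ.≤ d
    w γ      : Site d → ℕ
    w-in     : ∀ x → ζ x ℕ.≤ a → lap (λ y → ⟦ w y ⟧) x ≤ ⟦ d ⟧ - ⟦ h ⟧ - 1ℚ
    w-out    : ∀ x → a ℕ.< ζ x → lap (λ y → ⟦ w y ⟧) x ≤ ⟦ d ⟧ + ⟦ d ⟧ - 1ℚ - ⟦ h ⟧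
    f        : Site d → ℚ
    f≥0      : ∀ x → 0ℚ ≤ f x
    e        : ℚ
    e≥0      : 0ℚ ≤ e
    f-lap    : ∀ x → lap f x ≤ 1ℚ - ⟦ d ⟧ * e - ⟦ n ⟧ * kr (origin d) x
    f-far    : ∀ x → r' ℕ.≤ ζ x → f x ≤ 1ℚ
    J        : ℕ
    growth   : ⟦ n ⟧ < (1ℚ + e) ^ℚ J
    γ-lap    : ∀ x → r' ℕ.< ζ x → lap (λ y → ⟦ γ y ⟧) x ≤ 1ℚ
    γ-near   : ∀ x → ζ x ≡ r' → suc J ℕ.≤ γ x
    γ-far    : ∀ x → a' ℕ.≤ ζ x → γ x ≡ 0

-- Comparison of the odometer with a barrier.

module Argument {d h n : ℕ} (𝓑 : Barrier d h n) where
  open Barrier 𝓑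

  Below : (Site d → ℕ) → Set
  Below u = ∀ x → a' ℕ.≤ ζ x → u x ℕ.≤ w x

  module Max {η : Config d} (s : Run h n η) (out : ∀ x → a ℕ.< ζ x → Run.u s x ℕ.≤ w x) where
    open Run s

    U W : Site d → ℚ
    U x = ⟦ u x ⟧
    W x = ⟦ w x ⟧

    inside : ∀ x → w x ℕ.< u x → ζ x ℕ.≤ a
    inside x p = ℕₚ.≮⇒≥ λ q → ℕₚ.<⇒≱ p (out x q)

    -- A site with u > w has toppled and lies within `a`, so `flow`, `eqn` and `w-in` add up; the 1
    -- is the gap between the density d and the lowered background d - 1.
    excess-lap : ∀ x → w x ℕ.< u x →
      1ℚ - ⟦ n ⟧ * kr (origin d) x + ∑[ δ ← dirs d ] θ x (step δ x) ≤ lap U x - lap W x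
    excess-lap x p = cert (diff≥0 (flow x (ℕₚ.≤-trans (s≤s z≤n) p)) ⊕ diff≥0 (w-in x (inside x p)) ⊕ ≡⇒0≤ 1ℚ (sym (eqn x)))
      (lem ⟦ d ⟧ ⟦ h ⟧ (⟦ n ⟧ * kr (origin d) x) (∑[ δ ← dirs d ] θ x (step δ x)) (lap U x) (lap W x) (⟦⟧ᶻ (η x)))
      where
      lem : ∀ d h n t U W η → U - W ≡ 1ℚ - n + t + (η - (d + t) + (d - h - 1ℚ - W) + 1ℚ * (h + n + U - η))
      lem = solve-∀ ring

    -- `K` is the gradient of `v` corrected by the flow θ. Being antisymmetric, it contributes to a
    -- sum over `A` only through boundary edges, where θ costs at most ½.
    module Compare (A : Site d → Set) (A? : ∀ x → Dec (A x)) (g : Site d → ℚ) (A⇒ : ∀ x → A x → w x ℕ.< u x) where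

      v : Site d → ℚ
      v x = U x - W x - g x

      K : Site d → Site d → ℚ
      K x y = v y - v x - θ x y

      K-anti : ∀ x y → K x y ≡ - K y x
      K-anti x y = trans (cong (λ t → v y - v x - t) (anti x y)) (lem (v x) (v y) (θ y x))
        where
        lem : ∀ a b t → b - a - - t ≡ - (a - b - t)
        lem = solve-∀ ring

      K≤ : ∀ x y → K x y ≤ v y - v x + ½
      K≤ x y = cert (diff≥0 (θ≤½ y x)) (trans (lem (v y) (v x) (θ y x)) (cong (λ t → v y - v x - t + (½ - θ y x)) (sym (anti x y))))
        where
        lem : ∀ a b t → a - b + ½ ≡ a - b - - t + (½ - t)
        lem = solve-∀ ring

      A-bounded : ∀ x → R ℕ.≤ normInf x → ¬ A x
      A-bounded x p q = ℕₚ.<⇒≱ (A⇒ x q) (subst (ℕ._≤ w x) (sym (bound x p)) z≤n)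

      ∑K : ∀ x → ∑[ δ ← dirs d ] K x (step δ x) ≡ lap U x - lap W x - lap g x - ∑[ δ ← dirs d ] θ x (step δ x)
      ∑K x = trans (∑-− (dirs d) (λ δ → v (step δ x) - v x) (λ δ → θ x (step δ x)))
        (cong (λ t → t - ∑[ δ ← dirs d ] θ x (step δ x)) (trans (lap-− (λ y → U y - W y) g x) (cong (λ t → t - lap g x) (lap-− U W x))))

      boundary : ℚ
      boundary = ∑[ x ← box d R ] ∑[ δ ← dirs d ] 𝟙 (A? x) * (1ℚ - 𝟙 (A? (step δ x))) * K x (step δ x)

      compare : ∑[ x ← box d R ] 𝟙 (A? x) * (1ℚ - ⟦ n ⟧ * kr (origin d) x - lap g x) ≤ boundary
      compare = ≤-trans (∑-mono (box d R) pointwise) (≤-reflexive (flux A A? K R K-anti A-bounded))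
        where
        pointwise : ∀ x → 𝟙 (A? x) * (1ℚ - ⟦ n ⟧ * kr (origin d) x - lap g x) ≤ 𝟙 (A? x) * ∑ (dirs d) (λ δ → K x (step δ x))
        pointwise x with A? x
        ... | no _ = ≤-reflexive (trans (ℚₚ.*-zeroˡ (1ℚ - ⟦ n ⟧ * kr (origin d) x - lap g x)) (sym (ℚₚ.*-zeroˡ (∑ (dirs d) (λ δ → K x (step δ x))))))
        ... | yes p = *-monoˡ {1ℚ - ⟦ n ⟧ * kr (origin d) x - lap g x} {∑ (dirs d) (λ δ → K x (step δ x))} 1ℚ 0≤1 (≤-trans
            (cert (diff≥0 (excess-lap x (A⇒ x p))) (lem (⟦ n ⟧ * kr (origin d) x) (lap g x) (∑[ δ ← dirs d ] θ x (step δ x)) (lap U x) (lap W x)))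
            (≤-reflexive (sym (∑K x))))
          where
          lem : ∀ n g t U W → U - W - g - t ≡ 1ℚ - n - g + (U - W - (1ℚ - n + t))
          lem = solve-∀ ring

      boundary-term : ∀ {m} x δ → 0ℚ ≤ m → (A x → ¬ A (step δ x) → K x (step δ x) ≤ m) →
        𝟙 (A? x) * (1ℚ - 𝟙 (A? (step δ x))) * K x (step δ x) ≤ m
      boundary-term {m} x δ m≥0 h with A? x | A? (step δ x)
      ... | no _  | q?    = ≤-trans (≤-reflexive (lem (1ℚ - 𝟙 q?) (K x (step δ x)))) m≥0
        where
        lem : ∀ a k → 0ℚ * a * k ≡ 0ℚ
        lem = solve-∀ ring
      ... | yes _ | yes _ = ≤-trans (≤-reflexive (lem (K x (step δ x)))) m≥0
        where
        lem : ∀ k → 1ℚ * (1ℚ - 1ℚ) * k ≡ 0ℚ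
        lem = solve-∀ ring
      ... | yes p | no ¬q = ≤-trans (≤-reflexive (lem (K x (step δ x)))) (h p ¬q)
        where
        lem : ∀ k → 1ℚ * (1ℚ - 0ℚ) * k ≡ k
        lem = solve-∀ ring

    -- Integrality does the work: the excess is at least 1 at `c` and at most 0 at `b`, so the drop
    -- of at least 1 outweighs the ½ that θ may add.
    integer-gap : ∀ g g' b c → w c ℕ.+ g ℕ.< u c → u b ℕ.≤ w b ℕ.+ g' →
      (U b - W b - ⟦ g' ⟧) - (U c - W c - ⟦ g ⟧) + ½ ≤ - ½
    integer-gap g g' b c p q = cert (diff≥0 (⟦⟧-mono p) ⊕ diff≥0 (⟦⟧-mono q))
      (trans (lem (U b) (W b) ⟦ g' ⟧ (U c) (W c) ⟦ g ⟧)
        (cong₂ (λ s t → U b - W b - ⟦ g' ⟧ - (U c - W c - ⟦ g ⟧) + ½ + (U c - (1ℚ + s) + (t - U b))) (sym (⟦⟧-+ (w c) g)) (sym (⟦⟧-+ (w b) g'))))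
      where
      lem : ∀ ub wb gb uc wc gc → - ½ ≡ ub - wb - gb - (uc - wc - gc) + ½ + (uc - (1ℚ + (wc + gc)) + (wb + gb - ub))
      lem = solve-∀ ring

    -½≤0 : - ½ ≤ 0ℚ
    -½≤0 = ℚₚ.neg-antimono-≤ 0≤½

    -- With g = 0 no boundary edge contributes positively, so the set {u > w} has at most as many
    -- sites as there are added particles.
    excess-count : ∑[ x ← box d R ] 𝟙 (w x ℕₚ.<? u x) ≤ ⟦ n ⟧
    excess-count = ≤-trans (≤-trans (cert (diff≥0 lower) (lem total (⟦ n ⟧ * atOrigin))) (+-mono boundary≤0 (≤-reflexive (refl {x = ⟦ n ⟧ * atOrigin}))))
        (≤-trans (≤-reflexive (ℚₚ.+-identityˡ (⟦ n ⟧ * atOrigin))) (≤-trans (*-monoˡ ⟦ n ⟧ (⟦⟧≥0 n) atOrigin≤1) (≤-reflexive (ℚₚ.*-identityʳ ⟦ n ⟧))))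
      where
      open Compare (λ x → w x ℕ.< u x) (λ x → w x ℕₚ.<? u x) (λ _ → ⟦ 0 ⟧) (λ _ p → p)
      total = ∑[ x ← box d R ] 𝟙 (w x ℕₚ.<? u x)
      atOrigin = ∑[ x ← box d R ] 𝟙 (w x ℕₚ.<? u x) * kr (origin d) x
      lem : ∀ t o → boundary + o ≡ t + (boundary - (t - o))
      lem t o = lem' t o boundary
        where
        lem' : ∀ t o b → b + o ≡ t + (b - (t - o))
        lem' = solve-∀ ring
      lower : total - ⟦ n ⟧ * atOrigin ≤ boundary
      lower = ≤-trans (≤-reflexive (trans (cong (λ t → total - t) (sym (∑-* (box d R) ⟦ n ⟧ _)))
          (trans (sym (∑-− (box d R) _ _)) (∑-cong (box d R) λ x → trans (lem' (𝟙 (w x ℕₚ.<? u x)) ⟦ n ⟧ (kr (origin d) x))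
            (cong (λ t → 𝟙 (w x ℕₚ.<? u x) * (1ℚ - ⟦ n ⟧ * kr (origin d) x - t)) (sym (lap-0 x)))))))
        compare
        where
        lem' : ∀ a n k → a - n * (a * k) ≡ a * (1ℚ - n * k - 0ℚ)
        lem' = solve-∀ ring
      boundary≤0 : boundary ≤ 0ℚ
      boundary≤0 = ≤-trans (∑-mono (box d R) λ x → ≤-trans (∑-mono (dirs d) λ δ → boundary-term x δ ≤-refl λ p q →
          ≤-trans (K≤ x (step δ x)) (≤-trans (integer-gap 0 0 (step δ x) x
            (subst (ℕ._< u x) (sym (ℕₚ.+-identityʳ (w x))) p) (subst (u (step δ x) ℕ.≤_) (sym (ℕₚ.+-identityʳ _)) (ℕₚ.≮⇒≥ q))) -½≤0))
          (≤-reflexive (∑-0 (dirs d)))) (≤-reflexive (∑-0 (box d R)))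
      atOrigin≤1 : atOrigin ≤ 1ℚ
      atOrigin≤1 = ≤-trans (∑-mono (box d R) λ x → ≤-trans (*-monoʳ (kr (origin d) x) (kr≥0 (origin d) x) (𝟙≤1 (w x ℕₚ.<? u x)))
          (≤-reflexive (ℚₚ.*-comm 1ℚ (kr (origin d) x))))
        (≤-reflexive (∑-kr R (origin d) (λ _ → 1ℚ) (subst (ℕ._≤ R) (sym (normInf-origin d)) z≤n)))

    Level : ℕ → Site d → Set
    Level j x = W x + f x + ⟦ j ⟧ < U x

    Level? : ∀ j x → Dec (Level j x)
    Level? j x = (W x + f x + ⟦ j ⟧) ℚₚ.<? U x

    Level-excess : ∀ j x → Level j x → w x ℕ.< u x
    Level-excess j x p = ℕₚ.≰⇒> λ q → ℚₚ.<-irrefl refl (<-≤-trans p (≤-trans (⟦⟧-mono q) (cert (f≥0 x ⊕ ⟦⟧≥0 j) (ℚₚ.+-assoc (W x) (f x) ⟦ j ⟧))))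

    count : ℕ → ℚ
    count j = ∑[ x ← box d R ] 𝟙 (Level? j x)

    -- Only boundary edges of gradient below one half help; their outer ends lie in the next lower level set.
    level-growth : ∀ j → (1ℚ + e) * count (suc j) ≤ count j
    level-growth j = *-cancel ⟦ d ⟧ (⟦⟧>0 d≥1) (≤-trans
        (cert (diff≥0 lower) (lem ⟦ d ⟧ e (count (suc j)) boundary))
        (≤-trans (+-mono upper (≤-refl {⟦ d ⟧ * count (suc j)})) (≤-reflexive (lem₂ ⟦ d ⟧ (count j) (count (suc j))))))
      where
      open Compare (Level (suc j)) (Level? (suc j)) f (Level-excess (suc j))
      lem : ∀ d e c b → b + d * c ≡ d * ((1ℚ + e) * c) + (b - d * e * c)
      lem = solve-∀ ring
      lem₂ : ∀ d c c' → (d + d) * (½ * (c - c')) + d * c' ≡ d * c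
      lem₂ = solve-∀ ring
      lower : ⟦ d ⟧ * e * count (suc j) ≤ boundary
      lower = ≤-trans (≤-reflexive (sym (∑-* (box d R) (⟦ d ⟧ * e) _))) (≤-trans (∑-mono (box d R) λ x →
          ≤-trans (≤-reflexive (ℚₚ.*-comm (⟦ d ⟧ * e) (𝟙 (Level? (suc j) x))))
            (*-monoˡ (𝟙 (Level? (suc j) x)) (𝟙≥0 (Level? (suc j) x)) (cert (diff≥0 (f-lap x)) (lem' (⟦ d ⟧ * e) (⟦ n ⟧ * kr (origin d) x) (lap f x)))))
          compare)
        where
        lem' : ∀ e n f → 1ℚ - n - f ≡ e + (1ℚ - e - n - f)
        lem' = solve-∀ ring
      -- For an edge leaving level j + 1, K ≤ ½ if its outer end is in level j and K ≤ -½ otherwise;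
      -- `drop` is ½ on this layer and 0 elsewhere.
      drop : Site d → ℚ
      drop x = ½ * (𝟙 (Level? j x) - 𝟙 (Level? (suc j) x))
      nested : ∀ x → Level (suc j) x → Level j x
      nested x p = ≤-<-trans (ℚₚ.+-monoʳ-≤ (W x + f x) (⟦⟧-mono (ℕₚ.n≤1+n j))) p
      drop≥0 : ∀ x → 0ℚ ≤ drop x
      drop≥0 x = 0≤½ ⊗ diff≥0 (𝟙-mono (Level? (suc j) x) (Level? j x) (nested x))
      K≤drop : ∀ x y → Level (suc j) x → ¬ Level (suc j) y → K x y ≤ drop y
      K≤drop x y p q = ≤-trans (K≤ x y) (by-cases (Level? j y))
        where
        above : ⟦ suc j ⟧ ≤ v x
        above = cert (<⇒≤ (diff>0 p)) (lem' (U x) (W x) (f x) ⟦ suc j ⟧)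
          where
          lem' : ∀ u w f j → u - w - f ≡ j + (u - (w + f + j))
          lem' = solve-∀ ring
        below : ∀ i → ¬ Level i y → v y ≤ ⟦ i ⟧
        below i q = cert (diff≥0 (≮⇒≥ q)) (lem' (U y) (W y) (f y) ⟦ i ⟧)
          where
          lem' : ∀ u w f j → j ≡ u - w - f + (w + f + j - u)
          lem' = solve-∀ ring
        by-cases : Dec (Level j y) → v y - v x + ½ ≤ drop y
        by-cases (yes r) = ≤-trans (cert (diff≥0 above ⊕ diff≥0 (below (suc j) q)) (lem' (v x) (v y) ⟦ suc j ⟧))
          (≤-reflexive (sym (cong₂ (λ s t → ½ * (s - t)) (𝟙-yes (Level? j y) r) (𝟙-no (Level? (suc j) y) q))))
          where
          lem' : ∀ a b j → ½ * (1ℚ - 0ℚ) ≡ b - a + ½ + (a - j + (j - b))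
          lem' = solve-∀ ring
        by-cases (no r) = ≤-trans (cert (diff≥0 above ⊕ diff≥0 (below j r) ⊕ 0≤½) (lem' (v x) (v y) ⟦ j ⟧)) (drop≥0 y)
          where
          lem' : ∀ a b j → 0ℚ ≡ b - a + ½ + (a - (1ℚ + j) + (j - b) + ½)
          lem' = solve-∀ ring
      -- A site is the outer end of at most 2 d edges, each worth ½; the resulting factor d is
      -- matched by the d in the term `⟦ d ⟧ * e` of `f-lap`.
      upper : boundary ≤ (⟦ d ⟧ + ⟦ d ⟧) * (½ * (count j - count (suc j)))
      upper = ≤-trans (∑-mono (box d R) λ x → ∑-mono (dirs d) λ δ → boundary-term x δ (drop≥0 (step δ x)) (K≤drop x (step δ x)))
        (≤-reflexive (trans (∑-swap (box d R) (dirs d) (λ x δ → drop (step δ x)))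
          (trans (∑-cong (dirs d) λ δ → ∑-box-shift R drop δ vanish) (trans (∑-dirs-const d (∑ (box d R) drop))
            (cong (λ t → (⟦ d ⟧ + ⟦ d ⟧) * t) (trans (∑-* (box d R) ½ _) (cong (λ t → ½ * t) (∑-− (box d R) _ _))))))))
        where
        vanish : ∀ x → R ℕ.≤ normInf x → drop x ≡ 0ℚ
        vanish x p = cong₂ (λ s t → ½ * (s - t)) (𝟙-no (Level? j x) (λ q → empty j q)) (𝟙-no (Level? (suc j) x) (λ q → empty (suc j) q))
          where
          empty : ∀ i → ¬ Level i x
          empty i q = ℕₚ.<⇒≱ (Level-excess i x q) (subst (ℕ._≤ w x) (sym (bound x p)) z≤n)

    count≤n : ∀ j → (1ℚ + e) ^ℚ j * count j ≤ ⟦ n ⟧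
    count≤n zero = ≤-trans (≤-reflexive (ℚₚ.*-identityˡ (count 0)))
      (≤-trans (∑-mono (box d R) λ x → 𝟙-mono (Level? 0 x) (w x ℕₚ.<? u x) (Level-excess 0 x)) excess-count)
    count≤n (suc j) = ≤-trans (≤-reflexive (lem (1ℚ + e) ((1ℚ + e) ^ℚ j) (count (suc j))))
      (≤-trans (*-monoˡ ((1ℚ + e) ^ℚ j) (^-nonneg j (0≤1 ⊕ e≥0)) (level-growth j)) (count≤n j))
      where
      lem : ∀ a b c → a * b * c ≡ b * (a * c)
      lem = solve-∀ ring

    in-box : ∀ x → w x ℕ.< u x → x ∈ box d R
    in-box x p = ∈-box R x (ℕₚ.<⇒≤ (ℕₚ.≰⇒> λ q → ℕₚ.<⇒≱ p (subst (ℕ._≤ w x) (sym (bound x q)) z≤n)))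

    top-empty : ∀ x → ¬ Level J x
    top-empty x p = ℚₚ.<-irrefl refl (<-≤-trans growth (≤-trans
      (≤-trans (≤-reflexive (sym (ℚₚ.*-identityʳ ((1ℚ + e) ^ℚ J)))) (*-monoˡ ((1ℚ + e) ^ℚ J) (^-nonneg J (0≤1 ⊕ e≥0))
        (≤-trans (≤-reflexive (sym (𝟙-yes (Level? J x) p))) (∑-term (λ y → 𝟙≥0 (Level? J y)) (in-box x (Level-excess J x p))))))
      (count≤n J)))

    -- Of the J + 1 units of `γ`, J come from the empty level set and 1 covers `f`.
    near : ∀ x → ζ x ≡ r' → u x ℕ.≤ w x ℕ.+ γ x
    near x p = ⟦⟧-cancel (≤-trans (≮⇒≥ (top-empty x)) (≤-trans
      (cert (diff≥0 (f-far x (ℕₚ.≤-reflexive (sym p))) ⊕ diff≥0 (⟦⟧-mono (γ-near x p))) (lem (W x) (f x) ⟦ J ⟧ ⟦ γ x ⟧))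
      (≤-reflexive (sym (⟦⟧-+ (w x) (γ x))))))
      where
      lem : ∀ w f j g → w + g ≡ w + f + j + (1ℚ - f + (g - (1ℚ + j)))
      lem = solve-∀ ring

    Slab : Site d → Set
    Slab x = r' ℕ.< ζ x × w x ℕ.+ γ x ℕ.< u x

    Slab? : ∀ x → Dec (Slab x)
    Slab? x = (r' ℕₚ.<? ζ x) ×-dec (w x ℕ.+ γ x ℕₚ.<? u x)

    -- The slab misses the origin and Δγ ≤ 1, so the left side of `compare` is nonnegative. Each
    -- boundary edge contributes at most -½, at the inner face thanks to `near`; hence there is no
    -- boundary edge.
    slab-closed : ∀ x δ → Slab x → Slab (step δ x)
    slab-closed x₀ δ₀ p₀ with Slab? (step δ₀ x₀)
    ... | yes q = q
    ... | no ¬q = contradiction (≤-trans ½≤-boundary (≤-trans (ℚₚ.neg-antimono-≤ boundary≥0) ≤-refl)) (λ { (ℚ.*≤* (ℤ.+≤+ ())) })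
      where
      open Compare Slab Slab? (λ x → ⟦ γ x ⟧) (λ x p → ℕₚ.≤-<-trans (ℕₚ.m≤m+n (w x) (γ x)) (proj₂ p))
      boundary≥0 : 0ℚ ≤ boundary
      boundary≥0 = ≤-trans (∑-nonneg (box d R) λ x → pointwise x (Slab? x)) compare
        where
        pointwise : ∀ x (p? : Dec (Slab x)) → 0ℚ ≤ 𝟙 p? * (1ℚ - ⟦ n ⟧ * kr (origin d) x - lap (λ y → ⟦ γ y ⟧) x)
        pointwise x (no _) = ≤-reflexive (sym (ℚₚ.*-zeroˡ (1ℚ - ⟦ n ⟧ * kr (origin d) x - lap (λ y → ⟦ γ y ⟧) x)))
        pointwise x (yes p) = 0≤1 ⊗ subst (λ t → 0ℚ ≤ 1ℚ - ⟦ n ⟧ * t - lap (λ y → ⟦ γ y ⟧) x) (sym (kr-≢ not-origin))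
            (subst (0ℚ ≤_) (lem ⟦ n ⟧ (lap (λ y → ⟦ γ y ⟧) x)) (diff≥0 (γ-lap x (proj₁ p))))
          where
          lem : ∀ n g → 1ℚ - g ≡ 1ℚ - n * 0ℚ - g
          lem = solve-∀ ring
          not-origin : origin d ≢ x
          not-origin refl = contradiction (proj₁ p) (subst (λ t → ¬ (r' ℕ.< t)) (sym ζ-origin) λ ())
      edge : Site d → Dir d → ℚ
      edge x δ = - (𝟙 (Slab? x) * (1ℚ - 𝟙 (Slab? (step δ x))) * K x (step δ x))
      leaving : ∀ x δ → Slab x → ¬ Slab (step δ x) → K x (step δ x) ≤ - ½
      leaving x δ p q = ≤-trans (K≤ x (step δ x)) (integer-gap (γ x) (γ (step δ x)) (step δ x) x (proj₂ p) (outside (ζ (step δ x) ℕₚ.≟ r')))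
        where
        -- Because ζ falls by at most 1 per step, the outer end still has ζ ≥ r'; only equality
        -- needs `near`.
        outside : Dec (ζ (step δ x) ≡ r') → u (step δ x) ℕ.≤ w (step δ x) ℕ.+ γ (step δ x)
        outside (yes e) = near (step δ x) e
        outside (no ¬e) = ℕₚ.≮⇒≥ λ r → q (ℕₚ.≤∧≢⇒< (ℕₚ.≤-pred (ℕₚ.≤-trans (proj₁ p) (ζ-step δ x))) (λ e → ¬e (sym e)) , r)
      edge≥0 : ∀ x δ → 0ℚ ≤ edge x δ
      edge≥0 x δ = ℚₚ.neg-antimono-≤ (boundary-term x δ ≤-refl λ p q → ≤-trans (leaving x δ p q) -½≤0)
      neg-∑ : ∀ {C : Set} (xs : List C) (f : C → ℚ) → ∑[ x ← xs ] (- f x) ≡ - ∑ xs f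
      neg-∑ xs f = trans (∑-cong xs (λ x → lem (f x))) (trans (∑-* xs (- 1ℚ) f) (sym (lem (∑ xs f))))
        where
        lem : ∀ a → - a ≡ - 1ℚ * a
        lem = solve-∀ ring
      ½≤-boundary : ½ ≤ - boundary
      ½≤-boundary = ≤-trans (≤-trans edge₀ (∑-term (edge≥0 x₀) (∈-dirs δ₀)))
        (≤-trans (∑-term {f = λ x → ∑ (dirs d) (edge x)} (λ x → ∑-nonneg (dirs d) (edge≥0 x)) (in-box x₀ (ℕₚ.≤-<-trans (ℕₚ.m≤m+n (w x₀) (γ x₀)) (proj₂ p₀))))
          (≤-reflexive (trans (∑-cong (box d R) λ x → neg-∑ (dirs d) _) (neg-∑ (box d R) _))))
        where
        edge₀ : ½ ≤ edge x₀ δ₀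
        edge₀ = ≤-trans (ℚₚ.neg-antimono-≤ (leaving x₀ δ₀ p₀ ¬q)) (≤-reflexive (sym (trans
          (cong₂ (λ s t → - (s * (1ℚ - t) * K x₀ (step δ₀ x₀))) (𝟙-yes (Slab? x₀) p₀) (𝟙-no (Slab? (step δ₀ x₀)) ¬q)) (lem (K x₀ (step δ₀ x₀))))))
          where
          lem : ∀ k → - (1ℚ * (1ℚ - 0ℚ) * k) ≡ - k
          lem = solve-∀ ring

    slab-empty : ∀ x → ¬ Slab x
    slab-empty x p with closed-unbounded d≥1 Slab slab-closed R x p
    ... | y , (_ , q) , far = ℕₚ.<⇒≱ (ℕₚ.≤-<-trans (ℕₚ.m≤m+n (w y) (γ y)) q) (subst (ℕ._≤ w y) (sym (bound y far)) z≤n)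

    below : Below u
    below x p = ℕₚ.≮⇒≥ λ q → slab-empty x (ℕₚ.<-≤-trans r'<a' p ,
      subst (ℕ._< u x) (trans (sym (ℕₚ.+-identityʳ (w x))) (cong (w x ℕ.+_) (sym (γ-far x p)))) q)

  -- `Max` needs u ≤ w only beyond `a` and returns it from `a'` on. Beyond `a`, one more toppling
  -- cannot break the bound, by the least action principle.
  preserved : ∀ {η : Config d} z (legal : (+ (2 ℕ.* d)) ℤ.≤ η z) (s : Run h n η) → Below (Run.u s) → Below (bump z (Run.u s))
  preserved {η} z legal s b = Max.below (toppled z legal s) out
    where
    open Run s
    out : ∀ x → a ℕ.< ζ x → bump z u x ℕ.≤ w x
    out x p = by-cases (≡-dec ℤ._≟_ x z)
      where
      by-cases : Dec (x ≡ z) → bump z u x ℕ.≤ w x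
      by-cases (no x≢z) = subst (ℕ._≤ w x) (sym (bump-≢ u x≢z)) (b x (ℕₚ.≤-trans a'≤a (ℕₚ.<⇒≤ p)))
      by-cases (yes refl) = subst (ℕ._≤ w z) (sym (bump-self z u)) (ℕₚ.≤∧≢⇒< (b z (ℕₚ.≤-trans a'≤a (ℕₚ.<⇒≤ p))) unequal)
        where
        -- If u z = w z then u ≤ w nearby, so z carries at most 2 d - 1 particles.
        unequal : u z ≢ w z
        unequal eq = ℚₚ.<-irrefl refl (<-≤-trans 0<1 (cert
            (diff≥0 (⟦⟧ᶻ-≥ (2 ℕ.* d) (η z) legal) ⊕ ≡⇒0≤ 1ℚ (sym (eqn z)) ⊕ ≡⇒0≤ ⟦ n ⟧ (sym at-z) ⊕ diff≥0 lap≤ ⊕ diff≥0 (w-out z p))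
            (trans (lem ⟦ d ⟧ ⟦ h ⟧ ⟦ n ⟧ (kr (origin d) z) (⟦⟧ᶻ (η z)) (lap (λ y → ⟦ u y ⟧) z) (lap (λ y → ⟦ w y ⟧) z))
              (cong (λ t → 1ℚ + (⟦⟧ᶻ (η z) - t + 1ℚ * (⟦ h ⟧ + ⟦ n ⟧ * kr (origin d) z + lap (λ y → ⟦ u y ⟧) z - ⟦⟧ᶻ (η z))
                + ⟦ n ⟧ * (0ℚ - kr (origin d) z) + (lap (λ y → ⟦ w y ⟧) z - lap (λ y → ⟦ u y ⟧) z)
                + (⟦ d ⟧ + ⟦ d ⟧ - 1ℚ - ⟦ h ⟧ - lap (λ y → ⟦ w y ⟧) z))) (sym two-d)))))
          where
          two-d : ⟦ 2 ℕ.* d ⟧ ≡ ⟦ d ⟧ + ⟦ d ⟧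
          two-d = trans (cong ⟦_⟧ (cong (d ℕ.+_) (ℕₚ.+-identityʳ d))) (⟦⟧-+ d d)
          at-z : kr (origin d) z ≡ 0ℚ
          at-z = kr-≢ {x = origin d} {z} λ { refl → contradiction p (subst (λ t → ¬ (a ℕ.< t)) (sym ζ-origin) λ ()) }
          lap≤ : lap (λ y → ⟦ u y ⟧) z ≤ lap (λ y → ⟦ w y ⟧) z
          lap≤ = ∑-mono (dirs d) λ δ → +-mono
            (⟦⟧-mono (b (step δ z) (ℕₚ.≤-trans a'≤a (ℕₚ.≤-pred (ℕₚ.≤-trans p (ζ-step δ z))))))
            (≤-reflexive (cong (λ t → - ⟦ t ⟧) eq))
          lem : ∀ d h n k η U W → 0ℚ ≡ 1ℚ + (η - (d + d) + 1ℚ * (h + n * k + U - η) + n * (0ℚ - k) + (W - U) + (d + d - 1ℚ - h - W))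
          lem = solve-∀ ring

  run : ∀ xs {η : Config d} (s : Run h n η) → Below (Run.u s) → Legal d η xs →
    ∃[ u ] (Below u × (∀ x → x ∈ xs ⊎ 1 ℕ.≤ Run.u s x → 1 ℕ.≤ u x))
  run [] s b _ = Run.u s , b , λ { x (inj₂ p) → p }
  run (z ∷ xs) s b (legal , rest) with run xs (toppled z legal s) (preserved z legal s b) rest
  ... | u' , b' , t = u' , b' , λ
    { x (inj₁ (here refl)) → t x (inj₂ (subst (1 ℕ.≤_) (sym (bump-self z (Run.u s))) (s≤s z≤n)))
    ; x (inj₁ (there i))   → t x (inj₁ i)
    ; x (inj₂ p)           → t x (inj₂ (ℕₚ.≤-trans p (bump-≤ z x (Run.u s)))) }

  confined : ∀ x → Topples d h n x → a' ℕ.≤ ζ x → 1 ℕ.≤ w x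
  confined x (xs , legal , i) p with run xs (start d h n) (λ _ _ → z≤n) legal
  ... | u , b , t = ℕₚ.≤-trans (t x (inj₁ i)) (b x p)

-- The semigroup of the lazy random walk.

module Heat (d : ℕ) (d≥1 : 1 ℕ.≤ d) where

  -- 1/(4 d), so that the walk stays put with probability ½. Laziness gives the centre at least the
  -- weight of each neighbour, which `variance` uses.
  κ : ℚ
  κ = (⟦ d ⟧ + ⟦ d ⟧ + (⟦ d ⟧ + ⟦ d ⟧)) ⁻¹

  4d>0 : 0ℚ < ⟦ d ⟧ + ⟦ d ⟧ + (⟦ d ⟧ + ⟦ d ⟧)
  4d>0 = (⟦⟧≥0 d ⊕ ⟦⟧≥0 d) ⊕< (⟦⟧≥0 d ⊕< ⟦⟧>0 d≥1)

  κ-def : (⟦ d ⟧ + ⟦ d ⟧ + (⟦ d ⟧ + ⟦ d ⟧)) * κ ≡ 1ℚ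
  κ-def = ⁻¹-inverse 4d>0

  κ≥0 : 0ℚ ≤ κ
  κ≥0 = <⇒≤ (⁻¹-pos 4d>0)

  κ≤½ : κ ≤ ½
  κ≤½ = cert (κ≥0 ⊗ diff≥0 (⟦⟧-mono d≥1) ⊕ κ≥0 ⊗ ⟦⟧≥0 d ⊕ ≡⇒0≤ ½ (sym κ-def)) (lem ⟦ d ⟧ κ)
    where
    lem : ∀ d k → ½ ≡ k + (k * (d - 1ℚ) + k * d + ½ * (1ℚ - (d + d + (d + d)) * k))
    lem = solve-∀ ring

  Q : (Site d → ℚ) → Site d → ℚ
  Q g x = g x + κ * lap g x

  Q-average : ∀ g x → Q g x ≡ ½ * g x + κ * (∑[ δ ← dirs d ] g (step δ x))
  Q-average g x = trans (cong (λ t → g x + κ * t) (lap-split g x))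
    (trans (lem (g x) κ ⟦ d ⟧ (∑[ δ ← dirs d ] g (step δ x)))
      (trans (cong (λ t → (1ℚ - ½ * t) * g x + κ * (∑[ δ ← dirs d ] g (step δ x))) κ-def) (lem₂ (g x) (κ * (∑[ δ ← dirs d ] g (step δ x))))))
    where
    lem : ∀ g k d s → g + k * (s - (d + d) * g) ≡ (1ℚ - ½ * ((d + d + (d + d)) * k)) * g + k * s
    lem = solve-∀ ring
    lem₂ : ∀ g s → (1ℚ - ½ * 1ℚ) * g + s ≡ ½ * g + s
    lem₂ = solve-∀ ring

  Q-cong : ∀ {g h} → (∀ x → g x ≡ h x) → ∀ x → Q g x ≡ Q h x
  Q-cong e x = cong₂ (λ s t → s + κ * t) (e x) (lap-cong e x)

  Q-mono : ∀ {g h} → (∀ x → g x ≤ h x) → ∀ x → Q g x ≤ Q h x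
  Q-mono {g} {h} p x = ≤-trans (≤-reflexive (Q-average g x)) (≤-trans
    (+-mono (*-monoˡ ½ 0≤½ (p x)) (*-monoˡ κ κ≥0 (∑-mono (dirs d) (λ δ → p (step δ x))))) (≤-reflexive (sym (Q-average h x))))

  Q-+ : ∀ g h x → Q (λ y → g y + h y) x ≡ Q g x + Q h x
  Q-+ g h x = trans (cong (λ t → g x + h x + κ * t) (lap-+ g h x)) (lem (g x) (h x) κ (lap g x) (lap h x))
    where
    lem : ∀ a b k s t → a + b + k * (s + t) ≡ a + k * s + (b + k * t)
    lem = solve-∀ ring

  Q-− : ∀ g h x → Q (λ y → g y - h y) x ≡ Q g x - Q h x
  Q-− g h x = trans (cong (λ t → g x - h x + κ * t) (lap-− g h x)) (lem (g x) (h x) κ (lap g x) (lap h x))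
    where
    lem : ∀ a b k s t → a - b + k * (s - t) ≡ a + k * s - (b + k * t)
    lem = solve-∀ ring

  Q-* : ∀ c g x → Q (λ y → c * g y) x ≡ c * Q g x
  Q-* c g x = trans (cong (λ t → c * g x + κ * t) (lap-* c g x)) (lem c (g x) κ (lap g x))
    where
    lem : ∀ c a k s → c * a + k * (c * s) ≡ c * (a + k * s)
    lem = solve-∀ ring

  Q-∑ : ∀ {A : Set} (xs : List A) (g : A → Site d → ℚ) x → Q (λ y → ∑[ a ← xs ] g a y) x ≡ ∑[ a ← xs ] Q (g a) x
  Q-∑ xs g x = trans (cong (λ t → ∑[ a ← xs ] g a x + κ * t) (lap-∑ xs g x))
    (trans (cong (λ t → ∑[ a ← xs ] g a x + t) (sym (∑-* xs κ _))) (sym (∑-+ xs (λ a → g a x) (λ a → κ * lap (g a) x))))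

  Q-const : ∀ c x → Q (λ _ → c) x ≡ c
  Q-const c x = trans (cong (λ t → c + κ * t) (trans (∑-cong (dirs d) (λ _ → ℚₚ.+-inverseʳ c)) (∑-0 (dirs d)))) (lem c κ)
    where
    lem : ∀ c k → c + k * 0ℚ ≡ c
    lem = solve-∀ ring

  Qⁿ : ℕ → (Site d → ℚ) → Site d → ℚ
  Qⁿ zero g    = g
  Qⁿ (suc t) g = Q (Qⁿ t g)

  Qⁿ-cong : ∀ t {g h} → (∀ x → g x ≡ h x) → ∀ x → Qⁿ t g x ≡ Qⁿ t h x
  Qⁿ-cong zero e    = e
  Qⁿ-cong (suc t) e = Q-cong (Qⁿ-cong t e)

  Qⁿ-mono : ∀ t {g h} → (∀ x → g x ≤ h x) → ∀ x → Qⁿ t g x ≤ Qⁿ t h x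
  Qⁿ-mono zero p    = p
  Qⁿ-mono (suc t) p = Q-mono (Qⁿ-mono t p)

  Qⁿ-+ : ∀ t g h x → Qⁿ t (λ y → g y + h y) x ≡ Qⁿ t g x + Qⁿ t h x
  Qⁿ-+ zero g h x    = refl
  Qⁿ-+ (suc t) g h x = trans (Q-cong (Qⁿ-+ t g h) x) (Q-+ (Qⁿ t g) (Qⁿ t h) x)

  Qⁿ-− : ∀ t g h x → Qⁿ t (λ y → g y - h y) x ≡ Qⁿ t g x - Qⁿ t h x
  Qⁿ-− zero g h x    = refl
  Qⁿ-− (suc t) g h x = trans (Q-cong (Qⁿ-− t g h) x) (Q-− (Qⁿ t g) (Qⁿ t h) x)

  Qⁿ-* : ∀ t c g x → Qⁿ t (λ y → c * g y) x ≡ c * Qⁿ t g x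
  Qⁿ-* zero c g x    = refl
  Qⁿ-* (suc t) c g x = trans (Q-cong (Qⁿ-* t c g) x) (Q-* c (Qⁿ t g) x)

  Qⁿ-∑ : ∀ t {A : Set} (xs : List A) (g : A → Site d → ℚ) x → Qⁿ t (λ y → ∑[ a ← xs ] g a y) x ≡ ∑[ a ← xs ] Qⁿ t (g a) x
  Qⁿ-∑ zero xs g x    = refl
  Qⁿ-∑ (suc t) xs g x = trans (Q-cong (Qⁿ-∑ t xs g) x) (Q-∑ xs (λ a → Qⁿ t (g a)) x)

  Qⁿ-const : ∀ t c x → Qⁿ t (λ _ → c) x ≡ c
  Qⁿ-const zero c x    = refl
  Qⁿ-const (suc t) c x = trans (Q-cong (Qⁿ-const t c) x) (Q-const c x)

  Qⁿ-nonneg : ∀ t {g} → (∀ x → 0ℚ ≤ g x) → ∀ x → 0ℚ ≤ Qⁿ t g x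
  Qⁿ-nonneg t p x = ≤-trans (≤-reflexive (sym (Qⁿ-const t 0ℚ x))) (Qⁿ-mono t p x)

  Qⁿ-step : ∀ t ε g x → Qⁿ t (λ y → g (step ε y)) x ≡ Qⁿ t g (step ε x)
  Qⁿ-step zero ε g x    = refl
  Qⁿ-step (suc t) ε g x = trans (Q-cong (Qⁿ-step t ε g) x) (cong (λ s → Qⁿ t g (step ε x) + κ * s) (lap-step (Qⁿ t g) ε x))

  Qⁿ-lap : ∀ t g x → lap (Qⁿ t g) x ≡ Qⁿ t (lap g) x
  Qⁿ-lap zero g x    = refl
  Qⁿ-lap (suc t) g x = trans (lap-+ (Qⁿ t g) (λ y → κ * lap (Qⁿ t g) y) x)
    (trans (cong (λ s → lap (Qⁿ t g) x + s) (lap-* κ (lap (Qⁿ t g)) x)) (Q-cong (Qⁿ-lap t g) x))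

  Qⁿ-∘ : ∀ s t g x → Qⁿ (s ℕ.+ t) g x ≡ Qⁿ s (Qⁿ t g) x
  Qⁿ-∘ zero t g x    = refl
  Qⁿ-∘ (suc s) t g x = Q-cong (Qⁿ-∘ s t g) x

  Qⁿ-Q : ∀ t g x → Qⁿ t (Q g) x ≡ Qⁿ (suc t) g x
  Qⁿ-Q zero g x    = refl
  Qⁿ-Q (suc t) g x = Q-cong (Qⁿ-Q t g) x

  ∇ : Dir d → (Site d → ℚ) → Site d → ℚ
  ∇ δ g x = g x - g (step δ x)

  Qⁿ-∇ : ∀ t δ g x → Qⁿ t (∇ δ g) x ≡ ∇ δ (Qⁿ t g) x
  Qⁿ-∇ t δ g x = trans (Qⁿ-− t g (λ y → g (step δ y)) x) (cong (λ s → Qⁿ t g x - s) (Qⁿ-step t δ g x))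

  sq : (Site d → ℚ) → Site d → ℚ
  sq g x = g x * g x

  -- The difference of Q(g²) and (Q g)² is the variance of g over one step. Keep only x and
  -- `step δ x`, each of weight at least κ, and use a² + b² ≥ ½ (a - b)².
  variance : ∀ δ g x → Q g x * Q g x + ½ * κ * sq (∇ δ g) x ≤ Q (sq g) x
  variance δ g x = cert (diff≥0 spread) (trans (sym (lem m (½ * κ * sq (∇ δ g) x) (Q (sq g) x)))
      (cong (λ t → m * m + ½ * κ * sq (∇ δ g) x + (t - ½ * κ * sq (∇ δ g) x)) (sym centred)))
    where
    m = Q g x
    lem : ∀ m v q → m * m + v + (q - m * m - v) ≡ q
    lem = solve-∀ ring
    centred : Q (λ y → (g y - m) * (g y - m)) x ≡ Q (sq g) x - m * m
    centred = trans (Q-cong (λ y → lem₁ (g y) m) x)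
      (trans (Q-+ (λ y → g y * g y - (m + m) * g y) (λ _ → m * m) x)
        (trans (cong₂ _+_ (trans (Q-− (sq g) (λ y → (m + m) * g y) x) (cong (λ t → Q (sq g) x - t) (Q-* (m + m) g x))) (Q-const (m * m) x))
          (lem₂ (Q (sq g) x) m)))
      where
      lem₁ : ∀ g m → (g - m) * (g - m) ≡ g * g - (m + m) * g + m * m
      lem₁ = solve-∀ ring
      lem₂ : ∀ q m → q - (m + m) * m + m * m ≡ q - m * m
      lem₂ = solve-∀ ring
    spread : ½ * κ * sq (∇ δ g) x ≤ Q (λ y → (g y - m) * (g y - m)) x
    spread = ≤-trans (cert (diff≥0 κ≤½ ⊗ sq≥0 (g x - m) ⊕ κ≥0 ⊗ diff≥0 (∑-term {f = λ ε → (g (step ε x) - m) * (g (step ε x) - m)} (λ ε → sq≥0 (g (step ε x) - m)) (∈-dirs δ))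
        ⊕ 0≤½ ⊗ κ≥0 ⊗ sq≥0 (g x - m + (g (step δ x) - m))) (lem₃ κ (g x) (g (step δ x)) m (∑[ ε ← dirs d ] (g (step ε x) - m) * (g (step ε x) - m))))
      (≤-reflexive (sym (Q-average (λ y → (g y - m) * (g y - m)) x)))
      where
      lem₃ : ∀ k a b m s → ½ * ((a - m) * (a - m)) + k * s ≡ ½ * k * ((a - b) * (a - b)) +
        ((½ - k) * ((a - m) * (a - m)) + k * (s - (b - m) * (b - m)) + ½ * k * ((a - m + (b - m)) * (a - m + (b - m))))
      lem₃ = solve-∀ ring

  jensen : ∀ t g x → Qⁿ t g x * Qⁿ t g x ≤ Qⁿ t (sq g) x
  jensen zero g x    = ≤-refl
  jensen (suc t) g x = ≤-trans (Q-jensen (Qⁿ t g) x) (Q-mono (jensen t g) x)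
    where
    Q-jensen : ∀ h x → Q h x * Q h x ≤ Q (sq h) x
    Q-jensen h x = ≤-trans (cert (0≤½ ⊗ κ≥0 ⊗ sq≥0 (∇ δ₀ h x)) refl) (variance δ₀ h x)
      where
      δ₀ : Dir d
      δ₀ = first d≥1
        where
        first : ∀ {d} → 1 ℕ.≤ d → Dir d
        first (s≤s _) = fwd

  -- The Bakry–Émery gradient estimate: Q commutes with ∇, so every one of the s + 1 steps contributes the same variance.
  gradient : ∀ s δ g x → Qⁿ (suc s) g x * Qⁿ (suc s) g x + ⟦ suc s ⟧ * (½ * κ) * sq (∇ δ (Qⁿ s g)) x ≤ Qⁿ (suc s) (sq g) x
  gradient zero δ g x = ≤-trans (≤-reflexive (lem (Q g x * Q g x) (½ * κ) (sq (∇ δ g) x))) (variance δ g x)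
    where
    lem : ∀ a k v → a + (1ℚ + 0ℚ) * k * v ≡ a + k * v
    lem = solve-∀ ring
  gradient (suc s) δ g x = ≤-trans
      (≤-trans (cert (diff≥0 ih ⊕ 0≤½ ⊗ κ≥0 ⊗ diff≥0 (jensen (suc s) (∇ δ g) x))
        (trans (lem A D (sq (∇ δ (Qⁿ (suc s) g)) x) V (½ * κ) ⟦ s ⟧)
          (cong (λ t → Qⁿ (suc (suc s)) g x * Qⁿ (suc (suc s)) g x + ⟦ suc (suc s) ⟧ * (½ * κ) * sq (∇ δ (Qⁿ (suc s) g)) x + (D - A' + ½ * κ * (V - t)))
            (sym (cong₂ _*_ (Qⁿ-∇ (suc s) δ g x) (Qⁿ-∇ (suc s) δ g x))))))
        (≤-reflexive (sym split)))
      (≤-trans (Qⁿ-mono (suc s) (variance δ g) x) (≤-reflexive (Qⁿ-Q (suc s) (sq g) x)))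
    where
    A = Qⁿ (suc (suc s)) g x * Qⁿ (suc (suc s)) g x
    A' = A + ⟦ suc s ⟧ * (½ * κ) * sq (∇ δ (Qⁿ (suc s) g)) x
    D = Qⁿ (suc s) (sq (Q g)) x
    V = Qⁿ (suc s) (sq (∇ δ g)) x
    lem : ∀ a dd w v k s → dd + k * v ≡ a + (1ℚ + (1ℚ + s)) * k * w + (dd - (a + (1ℚ + s) * k * w) + k * (v - w))
    lem = solve-∀ ring
    ih : A' ≤ D
    ih = ≤-trans (≤-reflexive (cong₂ (λ a v → a + ⟦ suc s ⟧ * (½ * κ) * v)
        (sym (cong₂ _*_ (Qⁿ-Q (suc s) g x) (Qⁿ-Q (suc s) g x)))
        (sym (cong₂ _*_ (cong₂ _-_ (Qⁿ-Q s g x) (Qⁿ-Q s g (step δ x))) (cong₂ _-_ (Qⁿ-Q s g x) (Qⁿ-Q s g (step δ x)))))))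
      (gradient s δ (Q g) x)
    split : Qⁿ (suc s) (λ y → Q g y * Q g y + ½ * κ * sq (∇ δ g) y) x ≡ D + ½ * κ * V
    split = trans (Qⁿ-+ (suc s) (sq (Q g)) (λ y → ½ * κ * sq (∇ δ g) y) x) (cong (λ t → D + t) (Qⁿ-* (suc s) (½ * κ) (sq (∇ δ g)) x))

  -- Smoothing in sup norm: s steps make a difference of order s^(-1/2), stated with squares and
  -- with `c` of order 1/s.
  gradient-sup : ∀ s {b c} g δ → 1ℚ ≤ c * (⟦ suc s ⟧ * (½ * κ)) → 0ℚ ≤ c → (∀ x → sq g x ≤ b) →
    ∀ x → sq (∇ δ (Qⁿ s g)) x ≤ c * b
  gradient-sup s {b} {c} g δ h c≥0 p x = cert
    (c≥0 ⊗ diff≥0 (≤-trans (gradient s δ g x) (≤-trans (Qⁿ-mono (suc s) p x) (≤-reflexive (Qⁿ-const (suc s) b x))))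
      ⊕ c≥0 ⊗ sq≥0 (Qⁿ (suc s) g x) ⊕ sq≥0 (∇ δ (Qⁿ s g) x) ⊗ diff≥0 h)
    (lem c b (Qⁿ (suc s) g x * Qⁿ (suc s) g x) (sq (∇ δ (Qⁿ s g)) x) (⟦ suc s ⟧ * (½ * κ)))
    where
    lem : ∀ c b a v k → c * b ≡ v + (c * (b - (a + k * v)) + c * a + v * (c * k - 1ℚ))
    lem = solve-∀ ring

-- Functions of one coordinate.

coord : ∀ {d} → Fin d → Site d → ℤ
coord zero (z ∷ x)    = z
coord (suc i) (z ∷ x) = coord i x

∑-dirs-0 : ∀ d {f : Dir d → ℚ} → (∀ δ → f δ ≡ 0ℚ) → ∑ (dirs d) f ≡ 0ℚ
∑-dirs-0 d h = trans (∑-cong (dirs d) h) (∑-0 (dirs d))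

lap-∷ : ∀ {d} (g : Site (suc d) → ℚ) z x →
  lap g (z ∷ x) ≡ g (ℤ.suc z ∷ x) - g (z ∷ x) + (g (ℤ.pred z ∷ x) - g (z ∷ x) + lap (λ y → g (z ∷ y)) x)
lap-∷ g z x = ∑-dirs-suc (λ δ → g (step δ (z ∷ x)) - g (z ∷ x))

lap-coord : ∀ {d} (i : Fin d) (φ : ℤ → ℚ) x →
  lap (λ y → φ (coord i y)) x ≡ φ (ℤ.suc (coord i x)) - φ (coord i x) + (φ (ℤ.pred (coord i x)) - φ (coord i x))
lap-coord {suc d} zero φ (z ∷ x) = trans (lap-∷ (λ y → φ (coord zero y)) z x)
  (trans (cong (λ t → φ (ℤ.suc z) - φ z + (φ (ℤ.pred z) - φ z + t)) (∑-dirs-0 d λ _ → ℚₚ.+-inverseʳ (φ z)))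
    (lem (φ (ℤ.suc z) - φ z) (φ (ℤ.pred z) - φ z)))
  where
  lem : ∀ a b → a + (b + 0ℚ) ≡ a + b
  lem = solve-∀ ring
lap-coord {suc d} (suc i) φ (z ∷ x) = trans (lap-∷ (λ y → φ (coord (suc i) y)) z x)
  (trans (lem (φ (coord i x)) (lap (λ y → φ (coord i y)) x)) (lap-coord i φ x))
  where
  lem : ∀ a b → a - a + (a - a + b) ≡ b
  lem = solve-∀ ring

∣coord∣≤norm : ∀ {d} (i : Fin d) x → ℤ.∣ coord i x ∣ ℕ.≤ normInf x
∣coord∣≤norm zero (z ∷ x)    = ℕₚ.m≤m⊔n ℤ.∣ z ∣ (normInf x)
∣coord∣≤norm (suc i) (z ∷ x) = ℕₚ.≤-trans (∣coord∣≤norm i x) (ℕₚ.m≤n⊔m ℤ.∣ z ∣ (normInf x))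

∣coord∣-attains : ∀ {d} → 1 ℕ.≤ d → (x : Site d) → ∃[ i ] ℤ.∣ coord i x ∣ ≡ normInf x
∣coord∣-attains {suc zero} _ (z ∷ []) = zero , sym (ℕₚ.⊔-identityʳ ℤ.∣ z ∣)
∣coord∣-attains {suc (suc d)} _ (z ∷ x) with ∣coord∣-attains {suc d} (s≤s z≤n) x | ℕₚ.≤-total (normInf x) ℤ.∣ z ∣
... | i , e | inj₁ p = zero , sym (ℕₚ.m≥n⇒m⊔n≡m p)
... | i , e | inj₂ p = suc i , trans e (sym (ℕₚ.m≤n⇒m⊔n≡n p))

∣suc∣≤ : ∀ z → ℤ.∣ ℤ.suc z ∣ ℕ.≤ suc ℤ.∣ z ∣
∣suc∣≤ (+ n)        = ℕₚ.≤-refl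
∣suc∣≤ -[1+ zero ]  = z≤n
∣suc∣≤ -[1+ suc n ] = ℕₚ.≤-trans (ℕₚ.n≤1+n (suc n)) (ℕₚ.n≤1+n _)

∣pred∣≤ : ∀ z → ℤ.∣ ℤ.pred z ∣ ℕ.≤ suc ℤ.∣ z ∣
∣pred∣≤ (+ zero)  = ℕₚ.≤-refl
∣pred∣≤ (+ suc n) = ℕₚ.≤-trans (ℕₚ.n≤1+n n) (ℕₚ.n≤1+n _)
∣pred∣≤ -[1+ n ]  = ℕₚ.≤-refl

∣coord∣-step : ∀ {d} (i : Fin d) δ x → ℤ.∣ coord i x ∣ ℕ.≤ suc ℤ.∣ coord i (step δ x) ∣
∣coord∣-step i δ x = subst (λ y → ℤ.∣ coord i y ∣ ℕ.≤ suc ℤ.∣ coord i (step δ x) ∣) (step-opp δ x) (forward i (opp δ) (step δ x))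
  where
  forward : ∀ {d} (i : Fin d) δ x → ℤ.∣ coord i (step δ x) ∣ ℕ.≤ suc ℤ.∣ coord i x ∣
  forward zero fwd (z ∷ x)          = ∣suc∣≤ z
  forward zero bwd (z ∷ x)          = ∣pred∣≤ z
  forward zero (later δ) (z ∷ x)    = ℕₚ.n≤1+n _
  forward (suc i) fwd (z ∷ x)       = ℕₚ.n≤1+n _
  forward (suc i) bwd (z ∷ x)       = ℕₚ.n≤1+n _
  forward (suc i) (later δ) (z ∷ x) = forward i δ x

coord-origin : ∀ {d} (i : Fin d) → coord i (origin d) ≡ + 0
coord-origin zero    = refl
coord-origin (suc i) = coord-origin i

-- At 0 both neighbours lie at distance 1, hence the separate hypothesis on φ 1 and φ 0.
lap-radial : ∀ {d} (i : Fin d) (φ : ℕ → ℚ) (B : ℕ → ℚ) →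
  φ 1 + φ 1 - (φ 0 + φ 0) ≤ B 0 → (∀ m → φ (suc (suc m)) + φ m - (φ (suc m) + φ (suc m)) ≤ B (suc m)) →
  ∀ x → lap (λ y → φ ℤ.∣ coord i y ∣) x ≤ B ℤ.∣ coord i x ∣
lap-radial i φ B h₀ h x = ≤-trans (≤-reflexive (lap-coord i (λ z → φ ℤ.∣ z ∣) x)) (second (coord i x))
  where
  lem : ∀ a b c → a - c + (b - c) ≡ a + b - (c + c)
  lem = solve-∀ ring
  lem' : ∀ a b c → a - c + (b - c) ≡ b + a - (c + c)
  lem' = solve-∀ ring
  second : ∀ z → φ ℤ.∣ ℤ.suc z ∣ - φ ℤ.∣ z ∣ + (φ ℤ.∣ ℤ.pred z ∣ - φ ℤ.∣ z ∣) ≤ B ℤ.∣ z ∣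
  second (+ zero)     = ≤-trans (≤-reflexive (lem (φ 1) (φ 1) (φ 0))) h₀
  second (+ suc m)    = ≤-trans (≤-reflexive (lem (φ (suc (suc m))) (φ m) (φ (suc m)))) (h m)
  second -[1+ zero ]  = ≤-trans (≤-reflexive (lem' (φ 0) (φ 2) (φ 1))) (h 0)
  second -[1+ suc m ] = ≤-trans (≤-reflexive (lem' (φ (suc m)) (φ (suc (suc (suc m)))) (φ (suc (suc m))))) (h (suc m))

-- Point masses as iterated differences of orthants.

bwdAt : ∀ {d} → Fin d → Dir d
bwdAt zero    = bwd
bwdAt (suc i) = later (bwdAt i)

above₁ : ℤ → ℤ → ℚ
above₁ a z = 𝟙 (a ℤ.≤? z)

above₁-diff : ∀ a z → above₁ a z - above₁ a (ℤ.pred z) ≡ kr₁ a z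
above₁-diff a z with a ℤ.≟ z
... | yes refl = cong₂ _-_ (𝟙-yes (a ℤ.≤? a) ℤₚ.≤-refl) (𝟙-no (a ℤ.≤? ℤ.pred a) λ p → ℤₚ.<-irrefl refl (ℤₚ.≤-<-trans p (ℤₚ.i≤pred[j]⇒i<j ℤₚ.≤-refl)))
... | no ¬e with a ℤ.≤? z | a ℤ.≤? ℤ.pred z
...   | yes _ | yes _ = refl
...   | no _ | no _   = refl
...   | yes p | no ¬q = contradiction (ℤₚ.i<j⇒i≤pred[j] (ℤₚ.≤∧≢⇒< p ¬e)) ¬q
...   | no ¬p | yes q = contradiction (ℤₚ.<⇒≤ (ℤₚ.i≤pred[j]⇒i<j q)) ¬p

-- Interpolates between the orthant above y (j = 0) and the point y (j = d); one difference raises j.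
corner : ∀ {d} → ℕ → Site d → Site d → ℚ
corner j [] []                  = 1ℚ
corner zero (a ∷ y) (z ∷ x)     = above₁ a z * corner zero y x
corner (suc j) (a ∷ y) (z ∷ x)  = kr₁ a z * corner j y x

corner-diff : ∀ {d} (i : Fin d) y x → corner (Data.Fin.toℕ i) y x - corner (Data.Fin.toℕ i) y (step (bwdAt i) x) ≡ corner (suc (Data.Fin.toℕ i)) y x
corner-diff zero (a ∷ y) (z ∷ x) = trans (lem (above₁ a z) (above₁ a (ℤ.pred z)) (corner 0 y x)) (cong (λ t → t * corner 0 y x) (above₁-diff a z))
  where
  lem : ∀ a b c → a * c - b * c ≡ (a - b) * c
  lem = solve-∀ ring
corner-diff (suc i) (a ∷ y) (z ∷ x) = trans (lem (kr₁ a z) (corner (Data.Fin.toℕ i) y x) (corner (Data.Fin.toℕ i) y (step (bwdAt i) x)))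
    (cong (λ t → kr₁ a z * t) (corner-diff i y x))
  where
  lem : ∀ c a b → c * a - c * b ≡ c * (a - b)
  lem = solve-∀ ring

corner-top : ∀ {d} (y x : Site d) → corner d y x ≡ kr y x
corner-top [] []           = refl
corner-top (a ∷ y) (z ∷ x) = cong (λ t → kr₁ a z * t) (corner-top y x)

corner₀-bounds : ∀ {d} (y x : Site d) → 0ℚ ≤ corner 0 y x × corner 0 y x ≤ 1ℚ
corner₀-bounds [] []           = 0≤1 , ≤-refl
corner₀-bounds (a ∷ y) (z ∷ x) = 𝟙≥0 (a ℤ.≤? z) ⊗ proj₁ (corner₀-bounds y x) ,
  *-mono (𝟙≥0 (a ℤ.≤? z)) (proj₁ (corner₀-bounds y x)) (𝟙≤1 (a ℤ.≤? z)) (proj₂ (corner₀-bounds y x))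

kr₁-suc : ∀ a z → kr₁ (ℤ.suc a) z ≡ kr₁ a (ℤ.pred z)
kr₁-suc a z with a ℤ.≟ ℤ.pred z
... | yes refl = trans (cong (λ t → kr₁ t z) (ℤₚ.suc-pred z)) (kr₁-refl z)
... | no ¬p    = kr₁-≢ {ℤ.suc a} {z} λ e → ¬p (trans (sym (ℤₚ.pred-suc a)) (cong ℤ.pred e))

kr₁-pred : ∀ a z → kr₁ (ℤ.pred a) z ≡ kr₁ a (ℤ.suc z)
kr₁-pred a z with a ℤ.≟ ℤ.suc z
... | yes refl = trans (cong (λ t → kr₁ t z) (ℤₚ.pred-suc z)) (kr₁-refl z)
... | no ¬p    = kr₁-≢ {ℤ.pred a} {z} λ e → ¬p (trans (sym (ℤₚ.suc-pred a)) (cong ℤ.suc e))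

kr-step : ∀ {d} (δ : Dir d) y x → kr (step δ y) x ≡ kr y (step (opp δ) x)
kr-step fwd (a ∷ y) (z ∷ x)       = cong (λ t → t * kr y x) (kr₁-suc a z)
kr-step bwd (a ∷ y) (z ∷ x)       = cong (λ t → t * kr y x) (kr₁-pred a z)
kr-step (later δ) (a ∷ y) (z ∷ x) = cong (λ t → kr₁ a z * t) (kr-step δ y x)

kr₁-sym : ∀ a z → kr₁ a z ≡ kr₁ z a
kr₁-sym a z with z ℤ.≟ a
... | yes refl = kr₁-refl a
... | no ¬p    = kr₁-≢ λ e → ¬p (sym e)

kr-sym : ∀ {d} (y x : Site d) → kr y x ≡ kr x y
kr-sym [] []           = refl
kr-sym (a ∷ y) (z ∷ x) = cong₂ _*_ (kr₁-sym a z) (kr-sym y x)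

norm₁ : ∀ {d} → Site d → ℕ
norm₁ []      = 0
norm₁ (z ∷ x) = ℤ.∣ z ∣ ℕ.+ norm₁ x

lipschitz : ∀ {d} (Φ : Site d → ℚ) G → (∀ y δ → Φ y - Φ (step δ y) ≤ G) → ∀ y → Φ (origin d) - Φ y ≤ ⟦ norm₁ y ⟧ * G
lipschitz Φ G h [] = ≤-reflexive (lem (Φ []) G)
  where
  lem : ∀ a g → a - a ≡ 0ℚ * g
  lem = solve-∀ ring
lipschitz {suc d} Φ G h (z ∷ y) = ≤-trans
    (cert (diff≥0 (along z) ⊕ diff≥0 (lipschitz (λ y → Φ (z ∷ y)) G (λ y δ → h (z ∷ y) (later δ)) y))
      (trans (cong (λ t → t * G) (⟦⟧-+ ℤ.∣ z ∣ (norm₁ y))) (lem (Φ (+ 0 ∷ origin d)) (Φ (z ∷ origin d)) (Φ (z ∷ y)) ⟦ ℤ.∣ z ∣ ⟧ ⟦ norm₁ y ⟧ G)))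
    ≤-refl
  where
  lem : ∀ o m e a b g → (a + b) * g ≡ o - e + (a * g - (o - m) + (b * g - (m - e)))
  lem = solve-∀ ring
  lem₀ : ∀ a g → a - a ≡ 0ℚ * g
  lem₀ = solve-∀ ring
  lem₁ : ∀ o m e g k → (1ℚ + k) * g ≡ o - e + (k * g - (o - m) + (g - (m - e)))
  lem₁ = solve-∀ ring
  along : ∀ z → Φ (+ 0 ∷ origin d) - Φ (z ∷ origin d) ≤ ⟦ ℤ.∣ z ∣ ⟧ * G
  along (+ zero)     = ≤-reflexive (lem₀ (Φ (+ 0 ∷ origin d)) G)
  along (+ suc k)    = cert (diff≥0 (along (+ k)) ⊕ diff≥0 (h (+ k ∷ origin d) fwd))
    (lem₁ (Φ (+ 0 ∷ origin d)) (Φ (+ k ∷ origin d)) (Φ (+ suc k ∷ origin d)) G ⟦ k ⟧)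
  along -[1+ zero ]  = cert (diff≥0 (along (+ 0)) ⊕ diff≥0 (h (+ 0 ∷ origin d) bwd))
    (lem₁ (Φ (+ 0 ∷ origin d)) (Φ (+ 0 ∷ origin d)) (Φ (-[1+ 0 ] ∷ origin d)) G ⟦ 0 ⟧)
  along -[1+ suc k ] = cert (diff≥0 (along -[1+ k ]) ⊕ diff≥0 (h (-[1+ k ] ∷ origin d) bwd))
    (lem₁ (Φ (+ 0 ∷ origin d)) (Φ (-[1+ k ] ∷ origin d)) (Φ (-[1+ suc k ] ∷ origin d)) G ⟦ suc k ⟧)

-- Decay and smoothness of the heat kernel.

module Kernel (d : ℕ) (d≥1 : 1 ℕ.≤ d) (s : ℕ) (c : ℚ) (c≥0 : 0ℚ ≤ c) where
  open Heat d d≥1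

  module _ (rate : 1ℚ ≤ c * (⟦ suc s ⟧ * (½ * κ))) where

    -- Start from an orthant indicator, bounded by 1; each block of s steps pays for one difference
    -- with a factor c in the square. For j = d this is the decay s^(-d/2) of the local limit
    -- theorem, without Fourier analysis.
    corner-decay : ∀ j → j ℕ.≤ d → ∀ y x → sq (Qⁿ (j ℕ.* s) (corner j y)) x ≤ c ^ℚ j
    corner-decay zero _ y x = *-mono (proj₁ (corner₀-bounds y x)) (proj₁ (corner₀-bounds y x)) (proj₂ (corner₀-bounds y x)) (proj₂ (corner₀-bounds y x))
    corner-decay (suc j) j<d y x = ≤-trans (≤-reflexive (cong₂ _*_ rewritten rewritten))
        (gradient-sup s (Qⁿ (j ℕ.* s) (corner j y)) (bwdAt i) rate c≥0 (corner-decay j (ℕₚ.<⇒≤ j<d) y) x)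
      where
      i : Fin d
      i = Data.Fin.fromℕ< j<d
      i≡j : Data.Fin.toℕ i ≡ j
      i≡j = Data.Fin.Properties.toℕ-fromℕ< j<d
      diff : ∀ x → corner (suc j) y x ≡ ∇ (bwdAt i) (corner j y) x
      diff x = trans (cong (λ k → corner (suc k) y x) (sym i≡j)) (trans (sym (corner-diff i y x)) (cong (λ k → corner k y x - corner k y (step (bwdAt i) x)) i≡j))
      rewritten : Qⁿ (suc j ℕ.* s) (corner (suc j) y) x ≡ ∇ (bwdAt i) (Qⁿ s (Qⁿ (j ℕ.* s) (corner j y))) x
      rewritten = trans (Qⁿ-cong (suc j ℕ.* s) diff x) (trans (Qⁿ-∇ (suc j ℕ.* s) (bwdAt i) (corner j y) x)
        (cong₂ _-_ (Qⁿ-∘ s (j ℕ.* s) (corner j y) x) (Qⁿ-∘ s (j ℕ.* s) (corner j y) (step (bwdAt i) x))))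

    T : ℕ
    T = suc d ℕ.* s

    -- One more block of s steps differentiates the kernel in its source `y`, hence the exponent d +
    -- 1 and T = (d + 1) s.
    kernel-lipschitz : ∀ G → 0ℚ ≤ G → c ^ℚ suc d ≤ G * G → ∀ x y →
      Qⁿ T (kr (origin d)) x - Qⁿ T (kr y) x ≤ ⟦ norm₁ y ⟧ * G
    kernel-lipschitz G G≥0 h x = lipschitz (λ y → Qⁿ T (kr y) x) G λ y δ → sq-cancel G≥0 (≤-trans
        (≤-trans (≤-reflexive (cong₂ _*_ (rewritten y δ) (rewritten y δ)))
          (gradient-sup s (Qⁿ (d ℕ.* s) (kr y)) (opp δ) rate c≥0 (λ x → ≤-trans
            (≤-reflexive (cong₂ _*_ (Qⁿ-cong (d ℕ.* s) (λ x → sym (corner-top y x)) x) (Qⁿ-cong (d ℕ.* s) (λ x → sym (corner-top y x)) x)))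
            (corner-decay d ℕₚ.≤-refl y x)) x)) h)
      where
      rewritten : ∀ y δ → Qⁿ T (kr y) x - Qⁿ T (kr (step δ y)) x ≡ ∇ (opp δ) (Qⁿ s (Qⁿ (d ℕ.* s) (kr y))) x
      rewritten y δ = trans (cong (λ t → Qⁿ T (kr y) x - t) (trans (Qⁿ-cong T (kr-step δ y) x) (Qⁿ-step T (opp δ) (kr y) x)))
        (cong₂ _-_ (Qⁿ-∘ s (d ℕ.* s) (kr y) x) (Qⁿ-∘ s (d ℕ.* s) (kr y) (step (opp δ) x)))

-- The potential of the added particles and its tail.

module Spread (d : ℕ) (d≥1 : 1 ℕ.≤ d) (s : ℕ) (c : ℚ) (c≥0 : 0ℚ ≤ c)
  (rate : 1ℚ ≤ c * (⟦ suc s ⟧ * (½ * Heat.κ d d≥1))) where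
  open Heat d d≥1
  open Kernel d d≥1 s c c≥0

  -- κ times the expected number of visits before time t of the walk from the origin: a Green
  -- function cut off in time.
  expected : ℕ → Site d → ℚ
  expected zero x    = 0ℚ
  expected (suc t) x = expected t x + κ * Qⁿ t (kr (origin d)) x

  expected-lap : ∀ t x → lap (expected t) x ≡ Qⁿ t (kr (origin d)) x - kr (origin d) x
  expected-lap zero x    = trans (lap-0 x) (sym (ℚₚ.+-inverseʳ (kr (origin d) x)))
  expected-lap (suc t) x = trans (lap-+ (expected t) (λ y → κ * Qⁿ t (kr (origin d)) y) x)
    (trans (cong₂ _+_ (expected-lap t x) (lap-* κ (Qⁿ t (kr (origin d))) x))
      (lem (Qⁿ t (kr (origin d)) x) (kr (origin d) x) (κ * lap (Qⁿ t (kr (origin d))) x)))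
    where
    lem : ∀ a b l → a - b + l ≡ a + l - b
    lem = solve-∀ ring

  expected≥0 : ∀ t x → 0ℚ ≤ expected t x
  expected≥0 zero x    = ≤-refl
  expected≥0 (suc t) x = expected≥0 t x ⊕ κ≥0 ⊗ Qⁿ-nonneg t (kr≥0 (origin d)) x

  module Odometer (F b : Site d → ℚ) (r n : ℕ) (C c₀ e' G μ : ℚ)
    (F≥0 : ∀ x → 0ℚ ≤ F x) (b≥0 : ∀ x → 0ℚ ≤ b x) (b-supp : ∀ x → r ℕ.≤ normInf x → b x ≡ 0ℚ)
    (C≥0 : 0ℚ ≤ C) (c₀≥0 : 0ℚ ≤ c₀) (mass : c₀ * (C * ∑ (box d r) b) ≡ ⟦ n ⟧)
    (F-lap : ∀ x → lap F x ≤ 1ℚ + e' - C * b x)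
    (G≥0 : 0ℚ ≤ G) (G-bound : c ^ℚ suc d ≤ G * G)
    (mean : ∑[ y ← box d r ] b y * ⟦ norm₁ y ⟧ ≤ μ * ∑ (box d r) b) where

    Z : ℚ
    Z = ∑ (box d r) b

    -- Let the walk spread the n particles for T steps, and let the profile, smoothed by the same T
    -- steps, absorb them: Δf = n (Q^T δ - δ) + c₀ Q^T ΔF, where n Q^T δ and c₀ C Q^T b nearly
    -- cancel by `smoothed`.
    f : Site d → ℚ
    f x = ⟦ n ⟧ * expected (T rate) x + c₀ * Qⁿ (T rate) F x

    f≥0 : ∀ x → 0ℚ ≤ f x
    f≥0 x = ⟦⟧≥0 n ⊗ expected≥0 (T rate) x ⊕ c₀≥0 ⊗ Qⁿ-nonneg (T rate) F≥0 x

    b-points : ∀ x → b x ≡ ∑[ y ← box d r ] b y * kr y x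
    b-points x = trans (by-cases (r ℕₚ.≤? normInf x)) (∑-cong (box d r) λ y → sym (concentrate y))
      where
      concentrate : ∀ y → b y * kr y x ≡ kr x y * b x
      concentrate y with ≡-dec ℤ._≟_ y x
      ... | yes refl = ℚₚ.*-comm (b x) (kr x x)
      ... | no ¬p    = trans (cong (λ t → b y * t) (kr-≢ ¬p)) (trans (ℚₚ.*-zeroʳ (b y))
        (sym (trans (cong (λ t → t * b x) (kr-≢ {x = x} {y} λ e → ¬p (sym e))) (ℚₚ.*-zeroˡ (b x)))))
      by-cases : Dec (r ℕ.≤ normInf x) → b x ≡ ∑[ y ← box d r ] kr x y * b x
      by-cases (yes p) = trans (b-supp x p) (sym (trans (∑-cong (box d r) λ y → trans (cong (λ t → kr x y * t) (b-supp x p)) (ℚₚ.*-zeroʳ (kr x y))) (∑-0 (box d r))))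
      by-cases (no ¬p) = sym (∑-kr r x (λ _ → b x) (ℕₚ.<⇒≤ (ℕₚ.≰⇒> ¬p)))

    -- As a mixture of point masses, `b` differs from Z δ after smoothing by the Lipschitz constant
    -- of the kernel times the mean displacement of `b`.
    smoothed : ∀ x → Z * Qⁿ (T rate) (kr (origin d)) x - Qⁿ (T rate) b x ≤ G * (μ * Z)
    smoothed x = ≤-trans (≤-reflexive (trans (cong₂ _-_ (trans (ℚₚ.*-comm Z K₀) (sym (∑-* (box d r) K₀ b)))
        (trans (Qⁿ-cong (T rate) b-points x) (Qⁿ-∑ (T rate) (box d r) (λ y x → b y * kr y x) x)))
        (sym (∑-− (box d r) _ _))))
      (≤-trans (∑-mono (box d r) pointwise) (≤-trans (≤-reflexive (∑-* (box d r) G _)) (*-monoˡ G G≥0 mean)))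
      where
      K₀ = Qⁿ (T rate) (kr (origin d)) x
      lem : ∀ b k k' nm G → G * (b * nm) ≡ k * b - b * k' + b * (nm * G - (k - k'))
      lem = solve-∀ ring
      pointwise : ∀ y → K₀ * b y - Qⁿ (T rate) (λ x → b y * kr y x) x ≤ G * (b y * ⟦ norm₁ y ⟧)
      pointwise y = ≤-trans (≤-reflexive (cong (λ t → K₀ * b y - t) (Qⁿ-* (T rate) (b y) (kr y) x)))
        (cert (b≥0 y ⊗ diff≥0 (kernel-lipschitz rate G G≥0 G-bound x y)) (lem (b y) K₀ (Qⁿ (T rate) (kr y) x) ⟦ norm₁ y ⟧ G))

    f-lap : ∀ x → lap f x ≤ c₀ * (1ℚ + e') + ⟦ n ⟧ * (G * μ) - ⟦ n ⟧ * kr (origin d) x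
    f-lap x = ≤-trans (≤-reflexive (trans (lap-+ (λ y → ⟦ n ⟧ * expected (T rate) y) (λ y → c₀ * Qⁿ (T rate) F y) x)
        (cong₂ _+_ (trans (lap-* ⟦ n ⟧ (expected (T rate)) x) (cong (λ t → ⟦ n ⟧ * t) (expected-lap (T rate) x)))
          (trans (lap-* c₀ (Qⁿ (T rate) F) x) (cong (λ t → c₀ * t) (Qⁿ-lap (T rate) F x))))))
      (cert (c₀≥0 ⊗ diff≥0 swept ⊕ c₀≥0 ⊗ C≥0 ⊗ diff≥0 (smoothed x) ⊕ ≡⇒0≤ (K₀ - G * μ) mass)
        (lem ⟦ n ⟧ c₀ C Z K₀ (kr (origin d) x) (Qⁿ (T rate) (lap F) x) e' (Qⁿ (T rate) b x) G μ))
      where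
      K₀ = Qⁿ (T rate) (kr (origin d)) x
      swept : Qⁿ (T rate) (lap F) x ≤ 1ℚ + e' - C * Qⁿ (T rate) b x
      swept = ≤-trans (Qⁿ-mono (T rate) F-lap x) (≤-reflexive (trans (Qⁿ-− (T rate) (λ _ → 1ℚ + e') (λ y → C * b y) x)
        (cong₂ _-_ (Qⁿ-const (T rate) (1ℚ + e') x) (Qⁿ-* (T rate) C b x))))
      lem : ∀ n c₀ C Z K k L e q G μ → c₀ * (1ℚ + e) + n * (G * μ) - n * k ≡ n * (K - k) + c₀ * L +
        (c₀ * (1ℚ + e - C * q - L) + c₀ * C * (G * (μ * Z) - (Z * K - q)) + (K - G * μ) * (c₀ * (C * Z) - n))
      lem = solve-∀ ring

    -- The power ν^|x_i| plays the exponential. At distance m ≥ 1 its second difference is ν^(m-1)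
    -- (1 - ν)², at 0 it is not positive, so each step of Q enlarges ψ by at most the factor Λ.
    module Tail (i : Fin d) (ν λ' : ℚ) (ν≥0 : 0ℚ ≤ ν) (ν≤1 : ν ≤ 1ℚ) (λ≥0 : 0ℚ ≤ λ')
      (λ-bound : (1ℚ - ν) * (1ℚ - ν) ≤ λ' * ν) where

      ψ : Site d → ℚ
      ψ x = ν ^ℚ ℤ.∣ coord i x ∣

      ψ≥0 : ∀ x → 0ℚ ≤ ψ x
      ψ≥0 x = ^-nonneg ℤ.∣ coord i x ∣ ν≥0

      Λ : ℚ
      Λ = 1ℚ + κ * λ'

      1≤Λ : 1ℚ ≤ Λ
      1≤Λ = cert (κ≥0 ⊗ λ≥0) refl

      ψ-lap : ∀ x → lap ψ x ≤ λ' * ψ x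
      ψ-lap = lap-radial i (λ m → ν ^ℚ m) (λ m → λ' * ν ^ℚ m)
        (cert (diff≥0 ν≤1 ⊕ diff≥0 ν≤1 ⊕ λ≥0) (lem₀ ν λ'))
        (λ m → cert (^-nonneg m ν≥0 ⊗ diff≥0 λ-bound) (lem ν λ' (ν ^ℚ m)))
        where
        lem₀ : ∀ v l → l * 1ℚ ≡ v * 1ℚ + v * 1ℚ - (1ℚ + 1ℚ) + (1ℚ - v + (1ℚ - v) + l)
        lem₀ = solve-∀ ring
        lem : ∀ v l p → l * (v * p) ≡ v * (v * p) + p - (v * p + v * p) + p * (l * v - (1ℚ - v) * (1ℚ - v))
        lem = solve-∀ ring

      Qⁿψ : ∀ t x → Qⁿ t ψ x ≤ Λ ^ℚ t * ψ x
      Qⁿψ zero x    = ≤-reflexive (sym (ℚₚ.*-identityˡ (ψ x)))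
      Qⁿψ (suc t) x = ≤-trans (Q-mono (Qⁿψ t) x) (≤-trans (≤-reflexive (Q-* (Λ ^ℚ t) ψ x))
        (≤-trans (*-monoˡ (Λ ^ℚ t) (^-nonneg t (≤-trans 0≤1 1≤Λ)) (cert (κ≥0 ⊗ diff≥0 (ψ-lap x)) (lem κ λ' (ψ x) (lap ψ x))))
          (≤-reflexive (lem₂ (Λ ^ℚ t) Λ (ψ x)))))
        where
        lem : ∀ k l p q → (1ℚ + k * l) * p ≡ p + k * q + k * (l * p - q)
        lem = solve-∀ ring
        lem₂ : ∀ a b p → a * (b * p) ≡ b * a * p
        lem₂ = solve-∀ ring

      kr≤ψ : ∀ x → kr (origin d) x ≤ ψ x
      kr≤ψ x with ≡-dec ℤ._≟_ (origin d) x
      ... | yes refl = ≤-reflexive (trans (kr-refl (origin d)) (sym (cong (λ z → ν ^ℚ ℤ.∣ z ∣) (coord-origin i))))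
      ... | no ¬p    = ≤-trans (≤-reflexive (kr-≢ ¬p)) (ψ≥0 x)

      expected-tail : ∀ t x → expected t x ≤ ⟦ t ⟧ * Λ ^ℚ t * ψ x
      expected-tail zero x    = ≤-reflexive (lem (ψ x))
        where
        lem : ∀ p → 0ℚ ≡ 0ℚ * 1ℚ * p
        lem = solve-∀ ring
      expected-tail (suc t) x = cert
        (diff≥0 (expected-tail t x) ⊕ κ≥0 ⊗ diff≥0 (≤-trans (Qⁿ-mono t kr≤ψ x) (Qⁿψ t x)) ⊕ diff≥0 (≤-trans κ≤½ ½≤1) ⊗ (Λᵗ≥0 ⊗ ψ≥0 x)
          ⊕ diff≥0 1≤Λ ⊗ (⟦⟧≥0 (suc t) ⊗ (Λᵗ≥0 ⊗ ψ≥0 x)))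
        (lem (expected t x) κ (Qⁿ t (kr (origin d)) x) ⟦ t ⟧ Λ (Λ ^ℚ t) (ψ x))
        where
        ½≤1 : ½ ≤ 1ℚ
        ½≤1 = cert 0≤½ refl
        Λᵗ≥0 = ^-nonneg t (≤-trans 0≤1 1≤Λ)
        lem : ∀ e k q t L l p → (1ℚ + t) * (L * l) * p ≡ e + k * q +
          (t * l * p - e + k * (l * p - q) + (1ℚ - k) * (l * p) + (L - 1ℚ) * ((1ℚ + t) * (l * p)))
        lem = solve-∀ ring

      f-tail : ∀ {A} → 0ℚ ≤ A → (∀ x → F x ≤ A * ψ x) → ∀ x → f x ≤ Λ ^ℚ T rate * (⟦ n ⟧ * ⟦ T rate ⟧ + c₀ * A) * ψ x
      f-tail {A} A≥0 h x = cert (⟦⟧≥0 n ⊗ diff≥0 (expected-tail (T rate) x) ⊕ c₀≥0 ⊗ diff≥0 F-tail)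
        (lem ⟦ n ⟧ (expected (T rate) x) c₀ (Qⁿ (T rate) F x) (Λ ^ℚ T rate) ⟦ T rate ⟧ A (ψ x))
        where
        F-tail : Qⁿ (T rate) F x ≤ A * (Λ ^ℚ T rate * ψ x)
        F-tail = ≤-trans (Qⁿ-mono (T rate) h x) (≤-trans (≤-reflexive (Qⁿ-* (T rate) A ψ x)) (*-monoˡ A A≥0 (Qⁿψ (T rate) x)))
        lem : ∀ n e c q l t A p → l * (n * t + c * A) * p ≡ n * e + c * q + (n * (t * l * p - e) + c * (A * (l * p) - q))
        lem = solve-∀ ring

-- The polynomial profile and its Laplacian.

normSq : ∀ {d} → Site d → ℕ
normSq []      = 0
normSq (z ∷ x) = ℤ.∣ z ∣ ℕ.* ℤ.∣ z ∣ ℕ.+ normSq x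

normInf²≤normSq : ∀ {d} (x : Site d) → normInf x ℕ.* normInf x ℕ.≤ normSq x
normInf²≤normSq [] = z≤n
normInf²≤normSq (z ∷ x) with ℕₚ.≤-total (normInf x) ℤ.∣ z ∣
... | inj₁ p = subst (λ t → t ℕ.* t ℕ.≤ normSq (z ∷ x)) (sym (ℕₚ.m≥n⇒m⊔n≡m p)) (ℕₚ.m≤m+n _ (normSq x))
... | inj₂ p = subst (λ t → t ℕ.* t ℕ.≤ normSq (z ∷ x)) (sym (ℕₚ.m≤n⇒m⊔n≡n p))
  (ℕₚ.≤-trans (normInf²≤normSq x) (ℕₚ.m≤n+m (normSq x) (ℤ.∣ z ∣ ℕ.* ℤ.∣ z ∣)))

-- The increment of |x|² along a step.
η : ∀ {d} → Dir d → Site d → ℚ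
η fwd (z ∷ x)       = 1ℚ + (⟦⟧ᶻ z + ⟦⟧ᶻ z)
η bwd (z ∷ x)       = 1ℚ - (⟦⟧ᶻ z + ⟦⟧ᶻ z)
η (later δ) (z ∷ x) = η δ x

⟦normSq⟧ : ∀ {d} z (x : Site d) → ⟦ normSq (z ∷ x) ⟧ ≡ ⟦⟧ᶻ z * ⟦⟧ᶻ z + ⟦ normSq x ⟧
⟦normSq⟧ z x = trans (⟦⟧-+ (ℤ.∣ z ∣ ℕ.* ℤ.∣ z ∣) (normSq x)) (cong (λ t → t + ⟦ normSq x ⟧) (trans (⟦⟧-* ℤ.∣ z ∣ ℤ.∣ z ∣) (sym (⟦⟧ᶻ-∣∣² z))))

normSq-step : ∀ {d} (δ : Dir d) x → ⟦ normSq (step δ x) ⟧ ≡ ⟦ normSq x ⟧ + η δ x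
normSq-step fwd (z ∷ x) = trans (⟦normSq⟧ (ℤ.suc z) x) (trans (cong (λ t → t * t + ⟦ normSq x ⟧) (⟦⟧ᶻ-suc z))
  (trans (lem (⟦⟧ᶻ z) ⟦ normSq x ⟧) (cong (λ t → t + η fwd (z ∷ x)) (sym (⟦normSq⟧ z x)))))
  where
  lem : ∀ z n → (z + 1ℚ) * (z + 1ℚ) + n ≡ z * z + n + (1ℚ + (z + z))
  lem = solve-∀ ring
normSq-step bwd (z ∷ x) = trans (⟦normSq⟧ (ℤ.pred z) x) (trans (cong (λ t → t * t + ⟦ normSq x ⟧) (⟦⟧ᶻ-pred z))
  (trans (lem (⟦⟧ᶻ z) ⟦ normSq x ⟧) (cong (λ t → t + η bwd (z ∷ x)) (sym (⟦normSq⟧ z x)))))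
  where
  lem : ∀ z n → (z - 1ℚ) * (z - 1ℚ) + n ≡ z * z + n + (1ℚ - (z + z))
  lem = solve-∀ ring
normSq-step (later δ) (z ∷ x) = trans (⟦normSq⟧ z (step δ x)) (trans (cong (λ t → ⟦⟧ᶻ z * ⟦⟧ᶻ z + t) (normSq-step δ x))
  (trans (sym (ℚₚ.+-assoc (⟦⟧ᶻ z * ⟦⟧ᶻ z) ⟦ normSq x ⟧ (η δ x))) (cong (λ t → t + η δ x) (sym (⟦normSq⟧ z x)))))

∑-η : ∀ {d} (x : Site d) → ∑[ δ ← dirs d ] η δ x ≡ ⟦ d ⟧ + ⟦ d ⟧
∑-η [] = refl
∑-η {suc d} (z ∷ x) = trans (∑-dirs-suc (λ δ → η δ (z ∷ x))) (trans (cong (λ t → 1ℚ + (⟦⟧ᶻ z + ⟦⟧ᶻ z) + (1ℚ - (⟦⟧ᶻ z + ⟦⟧ᶻ z) + t)) (∑-η x))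
  (lem (⟦⟧ᶻ z) ⟦ d ⟧))
  where
  lem : ∀ z d → 1ℚ + (z + z) + (1ℚ - (z + z) + (d + d)) ≡ 1ℚ + d + (1ℚ + d)
  lem = solve-∀ ring

8ℚ : ℚ
8ℚ = ⟦ 8 ⟧

∑-η² : ∀ {d} (x : Site d) → ∑[ δ ← dirs d ] η δ x * η δ x ≡ ⟦ d ⟧ + ⟦ d ⟧ + 8ℚ * ⟦ normSq x ⟧
∑-η² [] = refl
∑-η² {suc d} (z ∷ x) = trans (∑-dirs-suc (λ δ → η δ (z ∷ x) * η δ (z ∷ x)))
  (trans (cong (λ t → (1ℚ + (⟦⟧ᶻ z + ⟦⟧ᶻ z)) * (1ℚ + (⟦⟧ᶻ z + ⟦⟧ᶻ z)) + ((1ℚ - (⟦⟧ᶻ z + ⟦⟧ᶻ z)) * (1ℚ - (⟦⟧ᶻ z + ⟦⟧ᶻ z)) + t)) (∑-η² x))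
  (trans (lem (⟦⟧ᶻ z) ⟦ d ⟧ ⟦ normSq x ⟧) (cong (λ t → ⟦ suc d ⟧ + ⟦ suc d ⟧ + 8ℚ * t) (sym (⟦normSq⟧ z x)))))
  where
  lem : ∀ z d n → (1ℚ + (z + z)) * (1ℚ + (z + z)) + ((1ℚ - (z + z)) * (1ℚ - (z + z)) + (d + d + 8ℚ * n)) ≡ 1ℚ + d + (1ℚ + d) + 8ℚ * (z * z + n)
  lem = solve-∀ ring

η-bounds : ∀ {d} (δ : Dir d) x → η δ x ≤ ⟦ normInf x ⟧ + ⟦ normInf x ⟧ + 1ℚ × - (⟦ normInf x ⟧ + ⟦ normInf x ⟧ + 1ℚ) ≤ η δ x
η-bounds fwd (z ∷ x) = cert (diff≥0 up ⊕ diff≥0 up) (lem (⟦⟧ᶻ z) N) , cert (diff≥0 dn ⊕ diff≥0 dn ⊕ 0≤1 ⊕ 0≤1) (lem₂ (⟦⟧ᶻ z) N)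
  where
  N = ⟦ normInf (z ∷ x) ⟧
  up = ≤-trans (proj₁ (⟦⟧ᶻ-bounds z)) (⟦⟧-mono (ℕₚ.m≤m⊔n ℤ.∣ z ∣ (normInf x)))
  dn = ≤-trans (ℚₚ.neg-antimono-≤ (⟦⟧-mono (ℕₚ.m≤m⊔n ℤ.∣ z ∣ (normInf x)))) (proj₂ (⟦⟧ᶻ-bounds z))
  lem : ∀ z n → n + n + 1ℚ ≡ 1ℚ + (z + z) + (n - z + (n - z))
  lem = solve-∀ ring
  lem₂ : ∀ z n → 1ℚ + (z + z) ≡ - (n + n + 1ℚ) + (z - - n + (z - - n) + 1ℚ + 1ℚ)
  lem₂ = solve-∀ ring
η-bounds bwd (z ∷ x) = cert (diff≥0 dn ⊕ diff≥0 dn) (lem (⟦⟧ᶻ z) N) , cert (diff≥0 up ⊕ diff≥0 up ⊕ 0≤1 ⊕ 0≤1) (lem₂ (⟦⟧ᶻ z) N)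
  where
  N = ⟦ normInf (z ∷ x) ⟧
  up = ≤-trans (proj₁ (⟦⟧ᶻ-bounds z)) (⟦⟧-mono (ℕₚ.m≤m⊔n ℤ.∣ z ∣ (normInf x)))
  dn = ≤-trans (ℚₚ.neg-antimono-≤ (⟦⟧-mono (ℕₚ.m≤m⊔n ℤ.∣ z ∣ (normInf x)))) (proj₂ (⟦⟧ᶻ-bounds z))
  lem : ∀ z n → n + n + 1ℚ ≡ 1ℚ - (z + z) + (z - - n + (z - - n))
  lem = solve-∀ ring
  lem₂ : ∀ z n → 1ℚ - (z + z) ≡ - (n + n + 1ℚ) + (n - z + (n - z) + 1ℚ + 1ℚ)
  lem₂ = solve-∀ ring
η-bounds (later δ) (z ∷ x) = ≤-trans (proj₁ (η-bounds δ x)) (+-mono (+-mono le le) ≤-refl) ,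
    ≤-trans (ℚₚ.neg-antimono-≤ (+-mono (+-mono le le) ≤-refl)) (proj₂ (η-bounds δ x))
  where
  le = ⟦⟧-mono (ℕₚ.m≤n⊔m ℤ.∣ z ∣ (normInf x))

0^suc : ∀ k → 0ℚ ^ℚ suc k ≡ 0ℚ
0^suc k = ℚₚ.*-zeroˡ (0ℚ ^ℚ k)

-- Second order Taylor bound, with M^j controlling the second derivative. It holds across the
-- truncation at 0, so sites next to the sphere need no separate treatment.
taylor : ∀ j {s ζ M} → 0ℚ ≤ s → s ≤ M → s + ζ ≤ M →
  ((s + ζ) ⊔0) ^ℚ suc (suc j) ≤ s ^ℚ suc (suc j) + ⟦ suc (suc j) ⟧ * s ^ℚ suc j * ζ + ½ * (⟦ suc (suc j) ⟧ * ⟦ suc j ⟧) * M ^ℚ j * (ζ * ζ)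
taylor j {s} {ζ} {M} s≥0 s≤M τ≤M with ℚₚ.≤-total 0ℚ (s + ζ)
... | inj₁ τ≥0 = subst (λ t → t ^ℚ suc (suc j) ≤ rhs j) (sym (⊔0-pos τ≥0)) (pos j)
  where
  M≥0 = ≤-trans s≥0 s≤M
  rhs : ℕ → ℚ
  rhs j = s ^ℚ suc (suc j) + ⟦ suc (suc j) ⟧ * s ^ℚ suc j * ζ + ½ * (⟦ suc (suc j) ⟧ * ⟦ suc j ⟧) * M ^ℚ j * (ζ * ζ)
  lem₀ : ∀ s z → (s + z) * ((s + z) * 1ℚ) ≡ s * (s * 1ℚ) + (1ℚ + (1ℚ + 0ℚ)) * (s * 1ℚ) * z + ½ * ((1ℚ + (1ℚ + 0ℚ)) * (1ℚ + 0ℚ)) * 1ℚ * (z * z)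
  lem₀ = solve-∀ ring
  lem : ∀ s z M p m j → s * (s * p) + (1ℚ + (1ℚ + (1ℚ + j))) * (s * p) * z + ½ * ((1ℚ + (1ℚ + (1ℚ + j))) * (1ℚ + (1ℚ + j))) * (M * m) * (z * z)
    ≡ (s + z) * (s * p + (1ℚ + (1ℚ + j)) * p * z + ½ * ((1ℚ + (1ℚ + j)) * (1ℚ + j)) * m * (z * z))
      + ((1ℚ + (1ℚ + j)) * (M * m - p) * (z * z) + ½ * ((1ℚ + (1ℚ + j)) * (1ℚ + j)) * (M - (s + z)) * m * (z * z))
  lem = solve-∀ ring
  pos : ∀ j → (s + ζ) ^ℚ suc (suc j) ≤ rhs j
  pos zero    = ≤-reflexive (lem₀ s ζ)
  pos (suc j) = ≤-trans (*-monoˡ (s + ζ) τ≥0 (pos j))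
    (cert (⟦⟧≥0 (suc (suc j)) ⊗ diff≥0 (^-mono (suc j) s≥0 s≤M) ⊗ sq≥0 ζ
        ⊕ 0≤½ ⊗ (⟦⟧≥0 (suc (suc j)) ⊗ ⟦⟧≥0 (suc j)) ⊗ diff≥0 τ≤M ⊗ ^-nonneg j M≥0 ⊗ sq≥0 ζ)
      (lem s ζ M (s ^ℚ suc j) (M ^ℚ j) ⟦ j ⟧))
-- The left side vanishes here, and the right side is exhibited as a sum of nonnegative terms.
... | inj₂ τ≤0 = ≤-trans (≤-reflexive (trans (cong (_^ℚ suc (suc j)) (⊔0-neg τ≤0)) (0^suc (suc j))))
  (cert (^-nonneg j s≥0 ⊗ sq≥0 (s + ζ) ⊕ ^-nonneg j s≥0 ⊗ ⟦⟧≥0 j ⊗ -ζ≥0 ⊗ diff≥0 τ≤0 ⊕ 0≤½ ⊗ (^-nonneg j s≥0 ⊗ (⟦⟧≥0 j ⊗ ⟦⟧≥0 (suc j)) ⊗ sq≥0 ζ)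
      ⊕ 0≤½ ⊗ (⟦⟧≥0 (suc (suc j)) ⊗ ⟦⟧≥0 (suc j)) ⊗ diff≥0 (^-mono j s≥0 s≤M) ⊗ sq≥0 ζ)
    (lem s ζ (s ^ℚ j) (M ^ℚ j) ⟦ j ⟧))
  where
  -ζ≥0 : 0ℚ ≤ - ζ
  -ζ≥0 = subst (0ℚ ≤_) (lem' s ζ) (diff≥0 τ≤0 ⊕ s≥0)
    where
    lem' : ∀ s z → 0ℚ - (s + z) + s ≡ - z
    lem' = solve-∀ ring
  lem : ∀ s z p m j → s * (s * p) + (1ℚ + (1ℚ + j)) * (s * p) * z + ½ * ((1ℚ + (1ℚ + j)) * (1ℚ + j)) * m * (z * z)
    ≡ 0ℚ + (p * ((s + z) * (s + z)) + p * j * - z * (0ℚ - (s + z)) + ½ * (p * (j * (1ℚ + j)) * (z * z))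
      + ½ * ((1ℚ + (1ℚ + j)) * (1ℚ + j)) * (m - p) * (z * z))
  lem = solve-∀ ring

pow-diff : ∀ j {a b} → 0ℚ ≤ b → b ≤ a → a ^ℚ suc j - b ^ℚ suc j ≤ ⟦ suc j ⟧ * (a - b) * a ^ℚ j
pow-diff zero {a} {b} p h = ≤-reflexive (lem a b)
  where
  lem : ∀ a b → a * 1ℚ - b * 1ℚ ≡ (1ℚ + 0ℚ) * (a - b) * 1ℚ
  lem = solve-∀ ring
pow-diff (suc j) {a} {b} p h = cert (≤-trans p h ⊗ diff≥0 (pow-diff j p h) ⊕ diff≥0 h ⊗ diff≥0 (^-mono (suc j) p h))
  (lem a b (a ^ℚ j) (b ^ℚ j) ⟦ j ⟧)
  where
  lem : ∀ a b p q j → (1ℚ + (1ℚ + j)) * (a - b) * (a * p) ≡ a * (a * p) - b * (b * q) + (a * ((1ℚ + j) * (a - b) * p - (a * p - b * q)) + (a - b) * (a * p - b * q))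
  lem = solve-∀ ring

pow-diff≥ : ∀ j {a b} → 0ℚ ≤ b → b ≤ a → ⟦ suc j ⟧ * (a - b) * b ^ℚ j ≤ a ^ℚ suc j - b ^ℚ suc j
pow-diff≥ zero {a} {b} p h = ≤-reflexive (lem a b)
  where
  lem : ∀ a b → (1ℚ + 0ℚ) * (a - b) * 1ℚ ≡ a * 1ℚ - b * 1ℚ
  lem = solve-∀ ring
pow-diff≥ (suc j) {a} {b} p h = cert (p ⊗ diff≥0 (pow-diff≥ j p h) ⊕ diff≥0 h ⊗ diff≥0 (^-mono (suc j) p h))
  (lem a b (a ^ℚ j) (b ^ℚ j) ⟦ j ⟧)
  where
  lem : ∀ a b p q j → a * (a * p) - b * (b * q) ≡ (1ℚ + (1ℚ + j)) * (a - b) * (b * q) + (b * (a * p - b * q - (1ℚ + j) * (a - b) * q) + (a - b) * (a * p - b * q))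
  lem = solve-∀ ring

inv : ℕ → ℚ
inv n = ⟦ suc n ⟧ ⁻¹

inv-def : ∀ n → ⟦ suc n ⟧ * inv n ≡ 1ℚ
inv-def n = ⁻¹-inverse (⟦suc⟧>0 n)

inv≥0 : ∀ n → 0ℚ ≤ inv n
inv≥0 n = <⇒≤ (⁻¹-pos (⟦suc⟧>0 n))

inv≤1 : ∀ n → inv n ≤ 1ℚ
inv≤1 n = cert (⟦⟧≥0 n ⊗ inv≥0 n ⊕ ≡⇒0≤ 1ℚ (sym (inv-def n))) (lem ⟦ n ⟧ (inv n))
  where
  lem : ∀ n i → 1ℚ ≡ i + (n * i + 1ℚ * (1ℚ - (1ℚ + n) * i))
  lem = solve-∀ ring

-- β d k = ∏_{j=1}^{k} (j + d/2)/j, the reciprocal of the mean of (1 - |x|²)^k over the unit ball of ℝᵈ.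
β : ℕ → ℕ → ℚ
β d zero    = 1ℚ
β d (suc k) = β d k * (1ℚ + ½ * (⟦ d ⟧ * inv k))

β>0 : ∀ d k → 0ℚ < β d k
β>0 d zero    = 0<1
β>0 d (suc k) = β>0 d k ⊗< subst (0ℚ <_) (ℚₚ.+-comm (½ * (⟦ d ⟧ * inv k)) 1ℚ) ((0≤½ ⊗ (⟦⟧≥0 d ⊗ inv≥0 k)) ⊕< 0<1)

β≥0 : ∀ d k → 0ℚ ≤ β d k
β≥0 d k = <⇒≤ (β>0 d k)

-- Each factor 1 + d/(2 j) is at most (1 + 1/j)^d, and the product of the latter telescopes.
β≤ : ∀ d k → β d k ≤ ⟦ suc k ⟧ ^ℚ d
β≤ d zero    = 1≤^ d (≤-reflexive refl)
β≤ d (suc k) = ≤-trans (*-mono (β≥0 d k) (0≤1 ⊕ (0≤½ ⊗ (⟦⟧≥0 d ⊗ inv≥0 k))) (β≤ d k)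
    (≤-trans (cert (0≤½ ⊗ (⟦⟧≥0 d ⊗ inv≥0 k)) (lem ⟦ d ⟧ (inv k))) (bernoulli (inv k) d (inv≥0 k))))
  (≤-reflexive (trans (sym (^-distrib-* ⟦ suc k ⟧ (1ℚ + inv k) d)) (cong (_^ℚ d) (trans (lem₂ ⟦ suc k ⟧ (inv k)) (cong (λ t → ⟦ suc k ⟧ + t) (inv-def k) ▸ ℚₚ.+-comm ⟦ suc k ⟧ 1ℚ)))))
  where
  _▸_ : ∀ {a b c : ℚ} → a ≡ b → b ≡ c → a ≡ c
  _▸_ = trans
  lem : ∀ d i → 1ℚ + d * i ≡ 1ℚ + ½ * (d * i) + ½ * (d * i)
  lem = solve-∀ ring
  lem₂ : ∀ s i → s * (1ℚ + i) ≡ s + s * i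
  lem₂ = solve-∀ ring

¼ : ℚ
¼ = ½ * ½

0≤¼ : 0ℚ ≤ ¼
0≤¼ = 0≤½ ⊗ 0≤½

2ℚ : ℚ
2ℚ = 1ℚ + 1ℚ

0≤2 : 0ℚ ≤ 2ℚ
0≤2 = 0≤1 ⊕ 0≤1

⊔0-mono : ∀ {a b} → a ≤ b → a ⊔0 ≤ b ⊔0
⊔0-mono {a} {b} h = ⊔0-lub (⊔0≥0 b) (≤-trans h (⊔0≥ b))

normInf-step : ∀ {d} (δ : Dir d) x → normInf x ℕ.≤ suc (normInf (step δ x))
normInf-step {suc d} δ x with ∣coord∣-attains (s≤s z≤n) x
... | i , e = subst (ℕ._≤ suc (normInf (step δ x))) e (ℕₚ.≤-trans (∣coord∣-step i δ x) (s≤s (∣coord∣≤norm i (step δ x))))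

module Profile (d r : ℕ) (r≥1 : 1 ℕ.≤ r) where

  ρ ρ⁻¹ : ℚ
  ρ   = ⟦ r ⟧ * ⟦ r ⟧
  ρ⁻¹ = ρ ⁻¹

  ρ>0 : 0ℚ < ρ
  ρ>0 = ⟦⟧>0 r≥1 ⊗< ⟦⟧>0 r≥1

  ρρ⁻¹ : ρ * ρ⁻¹ ≡ 1ℚ
  ρρ⁻¹ = ⁻¹-inverse ρ>0

  ρ⁻¹≥0 : 0ℚ ≤ ρ⁻¹
  ρ⁻¹≥0 = <⇒≤ (⁻¹-pos ρ>0)

  σ s : Site d → ℚ
  σ x = 1ℚ - ⟦ normSq x ⟧ * ρ⁻¹
  s x = σ x ⊔0

  s≥0 : ∀ x → 0ℚ ≤ s x
  s≥0 x = ⊔0≥0 (σ x)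

  s≤1 : ∀ x → s x ≤ 1ℚ
  s≤1 x = ⊔0-lub {σ x} 0≤1 (cert (⟦⟧≥0 (normSq x) ⊗ ρ⁻¹≥0) (lem (⟦ normSq x ⟧ * ρ⁻¹)))
    where
    lem : ∀ a → 1ℚ ≡ 1ℚ - a + a
    lem = solve-∀ ring

  s-zero : ∀ x → ρ ≤ ⟦ normSq x ⟧ → s x ≡ 0ℚ
  s-zero x h = ⊔0-neg {σ x} (cert (diff≥0 h ⊗ ρ⁻¹≥0 ⊕ ≡⇒0≤ 1ℚ ρρ⁻¹) (lem ⟦ normSq x ⟧ ρ ρ⁻¹))
    where
    lem : ∀ n r i → 0ℚ ≡ 1ℚ - n * i + ((n - r) * i + 1ℚ * (r * i - 1ℚ))
    lem = solve-∀ ring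

  s-outside : ∀ x → r ℕ.≤ normInf x → s x ≡ 0ℚ
  s-outside x h = s-zero x (≤-trans (≤-reflexive (sym (⟦⟧-* r r))) (⟦⟧-mono (ℕₚ.≤-trans (ℕₚ.*-mono-≤ h h) (normInf²≤normSq x))))

  -- `width` bounds 2 |x_i| + 1 for |x_i| ≤ r + 1, so `z₀` bounds the change of σ in one step. The
  -- d/4 in `w₀` comes from 2 d + 8 |x|² = 8 (d/4 + |x|²), the sum of the squared increments.
  width z₀ w₀ : ℚ
  width = ⟦ r ⟧ + ⟦ r ⟧ + ⟦ 3 ⟧
  z₀    = width * ρ⁻¹
  w₀    = z₀ + ¼ * ⟦ d ⟧ * ρ⁻¹

  width≥0 : 0ℚ ≤ width
  width≥0 = ⟦⟧≥0 r ⊕ ⟦⟧≥0 r ⊕ ⟦⟧≥0 3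

  z₀≥0 : 0ℚ ≤ z₀
  z₀≥0 = width≥0 ⊗ ρ⁻¹≥0

  z₀≤w₀ : z₀ ≤ w₀
  z₀≤w₀ = cert (0≤¼ ⊗ ⟦⟧≥0 d ⊗ ρ⁻¹≥0) refl

  w₀≥0 : 0ℚ ≤ w₀
  w₀≥0 = ≤-trans z₀≥0 z₀≤w₀

  term : ℕ → Site d → ℚ
  term j x = s x ^ℚ suc (suc j)

  -- Chosen to telescope. To leading order, with |x|²/r² = 1 - s, Δ s^(j+2) is 4 (j+2)(j+1) s^j (1 -
  -- s)/r² - 2 d (j+2) s^(j+1)/r². Times `coef j` this is β_j s^j - β_(j+1) s^(j+1), and the sum
  -- over j < k is 1 - β_k s^k.
  coef : ℕ → ℚ
  coef j = β d j * (ρ * ¼ * (inv (suc j) * inv j))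

  coef≥0 : ∀ j → 0ℚ ≤ coef j
  coef≥0 j = β≥0 d j ⊗ (<⇒≤ ρ>0 ⊗ 0≤¼ ⊗ (inv≥0 (suc j) ⊗ inv≥0 j))

  F : ℕ → Site d → ℚ
  F zero x    = 0ℚ
  F (suc k) x = F k x + coef k * term k x

  F≥0 : ∀ k x → 0ℚ ≤ F k x
  F≥0 zero x    = ≤-refl
  F≥0 (suc k) x = F≥0 k x ⊕ coef≥0 k ⊗ ^-nonneg (suc (suc k)) (s≥0 x)

  F-zero : ∀ k x → s x ≡ 0ℚ → F k x ≡ 0ℚ
  F-zero zero x e    = refl
  F-zero (suc k) x e = trans (cong₂ (λ a b → a + coef k * b) (F-zero k x e) (trans (cong (_^ℚ suc (suc k)) e) (0^suc (suc k)))) (lem (coef k))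
    where
    lem : ∀ c → 0ℚ + c * 0ℚ ≡ 0ℚ
    lem = solve-∀ ring

  F≤ : ∀ k K x → k ℕ.≤ K → F k x ≤ ⟦ k ⟧ * (⟦ K ⟧ ^ℚ d * ρ)
  F≤ zero K x _ = ≤-reflexive (sym (ℚₚ.*-zeroˡ (⟦ K ⟧ ^ℚ d * ρ)))
  F≤ (suc k) K x h = ≤-trans (+-mono (F≤ k K x (ℕₚ.<⇒≤ h)) last-term) (≤-reflexive (lem ⟦ k ⟧ (⟦ K ⟧ ^ℚ d * ρ)))
    where
    lem : ∀ k a → k * a + a ≡ (1ℚ + k) * a
    lem = solve-∀ ring
    ¼≤1 : ¼ ≤ 1ℚ
    ¼≤1 = ℚ.*≤* (ℤ.+≤+ (s≤s z≤n))
    last-term : coef k * term k x ≤ ⟦ K ⟧ ^ℚ d * ρ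
    last-term = ≤-trans (*-mono (coef≥0 k) (^-nonneg (suc (suc k)) (s≥0 x))
        (*-mono (β≥0 d k) (<⇒≤ ρ>0 ⊗ 0≤¼ ⊗ (inv≥0 (suc k) ⊗ inv≥0 k)) (≤-trans (β≤ d k) (^-mono d (⟦⟧≥0 (suc k)) (⟦⟧-mono h)))
          (*-mono (<⇒≤ ρ>0 ⊗ 0≤¼) (inv≥0 (suc k) ⊗ inv≥0 k) (*-monoˡ ρ (<⇒≤ ρ>0) ¼≤1)
            (*-mono (inv≥0 (suc k)) (inv≥0 k) (inv≤1 (suc k)) (inv≤1 k))))
        (^≤1 (suc (suc k)) (s≥0 x) (s≤1 x)))
      (≤-reflexive (lem' (⟦ K ⟧ ^ℚ d) ρ))
      where
      lem' : ∀ a r → a * (r * 1ℚ * (1ℚ * 1ℚ)) * 1ℚ ≡ a * r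
      lem' = solve-∀ ring

  norm≤width : ∀ (x : Site d) → normInf x ℕ.≤ suc r → ⟦ normInf x ⟧ + ⟦ normInf x ⟧ + 1ℚ ≤ width
  norm≤width x p = cert (diff≥0 (⟦⟧-mono p) ⊕ diff≥0 (⟦⟧-mono p)) (lem ⟦ normInf x ⟧ ⟦ r ⟧)
    where
    lem : ∀ n r → r + r + ⟦ 3 ⟧ ≡ n + n + 1ℚ + (1ℚ + r - n + (1ℚ + r - n))
    lem = solve-∀ ring

  ρ≤ : ∀ (x : Site d) → r ℕ.≤ normInf x → ρ ≤ ⟦ normSq x ⟧
  ρ≤ x h = ≤-trans (≤-reflexive (sym (⟦⟧-* r r))) (⟦⟧-mono (ℕₚ.≤-trans (ℕₚ.*-mono-≤ h h) (normInf²≤normSq x)))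

  module Near (x : Site d) (near₁ : normInf x ℕ.≤ suc r) (near₂ : ⟦ normSq x ⟧ ≤ ρ + width) where

    ζ : Dir d → ℚ
    ζ δ = - (η δ x * ρ⁻¹)

    σ-step : ∀ δ → σ (step δ x) ≡ σ x + ζ δ
    σ-step δ = trans (cong (λ t → 1ℚ - t * ρ⁻¹) (normSq-step δ x)) (lem ⟦ normSq x ⟧ (η δ x) ρ⁻¹)
      where
      lem : ∀ n e i → 1ℚ - (n + e) * i ≡ 1ℚ - n * i + - (e * i)
      lem = solve-∀ ring

    ζ≤z₀ : ∀ δ → ζ δ ≤ z₀
    ζ≤z₀ δ = cert (ρ⁻¹≥0 ⊗ diff≥0 (≤-trans (ℚₚ.neg-antimono-≤ (norm≤width x near₁)) (proj₂ (η-bounds δ x)))) (lem width (η δ x) ρ⁻¹)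
      where
      lem : ∀ w e i → w * i ≡ - (e * i) + i * (e - - w)
      lem = solve-∀ ring

    M : ℚ
    M = s x + z₀

    s≤M : s x ≤ M
    s≤M = cert z₀≥0 refl

    M≥0 : 0ℚ ≤ M
    M≥0 = s≥0 x ⊕ z₀≥0

    term-lap : ∀ j → lap (term j) x ≤ ⟦ suc (suc j) ⟧ * s x ^ℚ suc j * - ((⟦ d ⟧ + ⟦ d ⟧) * ρ⁻¹) +
      ½ * (⟦ suc (suc j) ⟧ * ⟦ suc j ⟧) * M ^ℚ j * ((⟦ d ⟧ + ⟦ d ⟧ + 8ℚ * ⟦ normSq x ⟧) * (ρ⁻¹ * ρ⁻¹))
    term-lap j = ≤-trans (∑-mono (dirs d) pointwise) (≤-reflexive (trans (∑-+ (dirs d) _ _) (cong₂ _+_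
        (trans (∑-* (dirs d) A ζ) (cong (λ t → A * t) (trans (∑-cong (dirs d) λ δ → lem₁ (η δ x) ρ⁻¹) (trans (∑-* (dirs d) (- ρ⁻¹) _)
          (trans (cong (λ t → - ρ⁻¹ * t) (∑-η x)) (lem₂ ρ⁻¹ (⟦ d ⟧ + ⟦ d ⟧)))))))
        (trans (∑-* (dirs d) C (λ δ → ζ δ * ζ δ)) (cong (λ t → C * t) (trans (∑-cong (dirs d) λ δ → lem₃ (η δ x) ρ⁻¹) (trans (∑-* (dirs d) (ρ⁻¹ * ρ⁻¹) _)
          (trans (cong (λ t → ρ⁻¹ * ρ⁻¹ * t) (∑-η² x)) (ℚₚ.*-comm (ρ⁻¹ * ρ⁻¹) _)))))))))
      where
      A = ⟦ suc (suc j) ⟧ * s x ^ℚ suc j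
      C = ½ * (⟦ suc (suc j) ⟧ * ⟦ suc j ⟧) * M ^ℚ j
      lem₁ : ∀ e i → - (e * i) ≡ - i * e
      lem₁ = solve-∀ ring
      lem₂ : ∀ i d → - i * d ≡ - (d * i)
      lem₂ = solve-∀ ring
      lem₃ : ∀ e i → - (e * i) * - (e * i) ≡ i * i * (e * e)
      lem₃ = solve-∀ ring
      lem₄ : ∀ p a c → p + a + c - p ≡ a + c
      lem₄ = solve-∀ ring
      pointwise : ∀ δ → term j (step δ x) - term j x ≤ A * ζ δ + C * (ζ δ * ζ δ)
      pointwise δ = ≤-trans (ℚₚ.+-monoˡ-≤ (- term j x) (≤-trans
          (^-mono (suc (suc j)) (s≥0 (step δ x)) (≤-trans (≤-reflexive (cong _⊔0 (σ-step δ))) (⊔0-mono (ℚₚ.+-monoˡ-≤ (ζ δ) (⊔0≥ (σ x))))))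
          (taylor j {ζ = ζ δ} (s≥0 x) s≤M (ℚₚ.+-monoʳ-≤ (s x) (ζ≤z₀ δ)))))
        (≤-reflexive (lem₄ (term j x) (A * ζ δ) (C * (ζ δ * ζ δ))))

    radius : (¼ * ⟦ d ⟧ + ⟦ normSq x ⟧) * ρ⁻¹ ≤ 1ℚ - s x + w₀
    radius = cert (diff≥0 (⊔0-lub {σ x} lower (cert z₀≥0 refl))) (lem ⟦ d ⟧ ⟦ normSq x ⟧ ρ⁻¹ (s x) z₀)
      where
      lower : 0ℚ ≤ σ x + z₀
      lower = cert (diff≥0 near₂ ⊗ ρ⁻¹≥0 ⊕ ≡⇒0≤ 1ℚ (sym ρρ⁻¹)) (lem₂ ⟦ normSq x ⟧ ρ width ρ⁻¹)
        where
        lem₂ : ∀ n r w i → 1ℚ - n * i + w * i ≡ 0ℚ + ((r + w - n) * i + 1ℚ * (1ℚ - r * i))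
        lem₂ = solve-∀ ring
      lem : ∀ d n i s z → 1ℚ - s + (z + ¼ * d * i) ≡ (¼ * d + n) * i + (1ℚ - n * i + z - s)
      lem = solve-∀ ring

    module _ {K : ℕ} (flat : (1ℚ + z₀) ^ℚ K ≤ 2ℚ) where

      M^≤2 : ∀ j → j ℕ.≤ K → M ^ℚ j ≤ 2ℚ
      M^≤2 j h = ≤-trans (^-mono j M≥0 (ℚₚ.+-monoˡ-≤ z₀ (s≤1 x))) (≤-trans (^-mono-exp (cert z₀≥0 refl) h) flat)

      M^-diff : ∀ j → j ℕ.≤ K → M ^ℚ j - s x ^ℚ j ≤ ⟦ j ⟧ * z₀ * 2ℚ
      M^-diff zero h    = ≤-reflexive (lem z₀)
        where
        lem : ∀ z → 1ℚ - 1ℚ ≡ 0ℚ * z * 2ℚ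
        lem = solve-∀ ring
      M^-diff (suc j) h = ≤-trans (pow-diff j (s≥0 x) s≤M) (≤-trans (≤-reflexive (cong (λ t → ⟦ suc j ⟧ * t * M ^ℚ j) (lem (s x) z₀)))
        (*-monoˡ (⟦ suc j ⟧ * z₀) (⟦⟧≥0 (suc j) ⊗ z₀≥0) (M^≤2 j (ℕₚ.<⇒≤ h))))
        where
        lem : ∀ s z → s + z - s ≡ z
        lem = solve-∀ ring

      -- The telescoping relation behind `coef`; the error comes from replacing `M` by s x and from
      -- the lattice correction in `w₀`.
      coef-lap : ∀ j → j ℕ.≤ K → coef j * lap (term j) x ≤ β d j * s x ^ℚ j - β d (suc j) * s x ^ℚ suc j + β d j * (2ℚ * ⟦ suc j ⟧ * w₀)
      coef-lap j h = ≤-trans (*-monoˡ (coef j) (coef≥0 j) (term-lap j)) (≤-trans (≤-reflexive simplify) main)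
        where
        b = β d j
        a = inv (suc j)
        a' = inv j
        J₂ = ⟦ suc (suc j) ⟧
        J₁ = ⟦ suc j ⟧
        p = s x ^ℚ j
        m = M ^ℚ j
        regroup : ∀ b r a a' J₂ J₁ s p m D n i → b * (r * ¼ * (a * a')) * (J₂ * (s * p) * - ((D + D) * i) + ½ * (J₂ * J₁) * m * ((D + D + 8ℚ * n) * (i * i)))
          ≡ b * (m * ((¼ * D + n) * i) * ((J₂ * a) * (J₁ * a') * (r * i)) - ½ * (D * a') * (s * p) * ((J₂ * a) * (r * i)))
        regroup = solve-∀ ring
        tidy : ∀ b m q e → b * (m * q * (1ℚ * 1ℚ * 1ℚ) - e * (1ℚ * 1ℚ)) ≡ b * (m * q - e)
        tidy = solve-∀ ring
        simplify : coef j * (J₂ * s x ^ℚ suc j * - ((⟦ d ⟧ + ⟦ d ⟧) * ρ⁻¹) + ½ * (J₂ * J₁) * m * ((⟦ d ⟧ + ⟦ d ⟧ + 8ℚ * ⟦ normSq x ⟧) * (ρ⁻¹ * ρ⁻¹)))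
          ≡ b * (m * ((¼ * ⟦ d ⟧ + ⟦ normSq x ⟧) * ρ⁻¹) - ½ * (⟦ d ⟧ * a') * (s x * p))
        simplify = trans (regroup b ρ a a' J₂ J₁ (s x) p m ⟦ d ⟧ ⟦ normSq x ⟧ ρ⁻¹)
          (trans (cong₂ (λ u v → b * (m * ((¼ * ⟦ d ⟧ + ⟦ normSq x ⟧) * ρ⁻¹) * (u * v * (ρ * ρ⁻¹)) - ½ * (⟦ d ⟧ * a') * (s x * p) * (u * (ρ * ρ⁻¹)))) (inv-def (suc j)) (inv-def j))
          (trans (cong (λ u → b * (m * ((¼ * ⟦ d ⟧ + ⟦ normSq x ⟧) * ρ⁻¹) * (1ℚ * 1ℚ * u) - ½ * (⟦ d ⟧ * a') * (s x * p) * (1ℚ * u))) ρρ⁻¹)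
            (tidy b m ((¼ * ⟦ d ⟧ + ⟦ normSq x ⟧) * ρ⁻¹) (½ * (⟦ d ⟧ * a') * (s x * p)))))
        main : b * (m * ((¼ * ⟦ d ⟧ + ⟦ normSq x ⟧) * ρ⁻¹) - ½ * (⟦ d ⟧ * a') * (s x * p)) ≤ b * p - b * (1ℚ + ½ * (⟦ d ⟧ * a')) * (s x * p) + b * (2ℚ * J₁ * w₀)
        main = cert (β≥0 d j ⊗ (^-nonneg j M≥0 ⊗ diff≥0 radius ⊕ diff≥0 (s≤1 x) ⊗ diff≥0 (M^-diff j h) ⊕ (diff≥0 (M^≤2 j h) ⊗ w₀≥0)
            ⊕ (⟦⟧≥0 j ⊗ z₀≥0 ⊗ 0≤2) ⊗ s≥0 x ⊕ 0≤2 ⊗ ⟦⟧≥0 j ⊗ diff≥0 z₀≤w₀))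
          (lem b m p (s x) ((¼ * ⟦ d ⟧ + ⟦ normSq x ⟧) * ρ⁻¹) (½ * (⟦ d ⟧ * a')) ⟦ j ⟧ z₀ w₀)
          where
          lem : ∀ b m p s q e j z w → b * p - b * (1ℚ + e) * (s * p) + b * (2ℚ * (1ℚ + j) * w) ≡ b * (m * q - e * (s * p)) +
            b * (m * (1ℚ - s + w - q) + (1ℚ - s) * (j * z * 2ℚ - (m - p)) + (2ℚ - m) * w + (j * z * 2ℚ) * s + 2ℚ * j * (w - z))
          lem = solve-∀ ring

      F-lap-near : ∀ k → k ℕ.≤ K → lap (F k) x ≤ 1ℚ - β d k * s x ^ℚ k + ⟦ k ⟧ * (⟦ K ⟧ ^ℚ d * (2ℚ * ⟦ K ⟧ * w₀))
      F-lap-near zero h    = ≤-reflexive (trans (lap-0 x) (lem (⟦ K ⟧ ^ℚ d * (2ℚ * ⟦ K ⟧ * w₀))))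
        where
        lem : ∀ a → 0ℚ ≡ 1ℚ - 1ℚ * 1ℚ + 0ℚ * a
        lem = solve-∀ ring
      F-lap-near (suc k) h = ≤-trans (≤-reflexive (trans (lap-+ (F k) (λ y → coef k * term k y) x) (cong (λ t → lap (F k) x + t) (lap-* (coef k) (term k) x))))
        (cert (diff≥0 (F-lap-near k (ℕₚ.<⇒≤ h)) ⊕ diff≥0 (coef-lap k (ℕₚ.<⇒≤ h)) ⊕ diff≥0 error) (lem (lap (F k) x) (coef k * lap (term k) x) (β d k * s x ^ℚ k) (β d (suc k) * s x ^ℚ suc k) ⟦ k ⟧ E (β d k * (2ℚ * ⟦ suc k ⟧ * w₀))))
        where
        E = ⟦ K ⟧ ^ℚ d * (2ℚ * ⟦ K ⟧ * w₀)
        error : β d k * (2ℚ * ⟦ suc k ⟧ * w₀) ≤ E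
        error = *-mono (β≥0 d k) (0≤2 ⊗ ⟦⟧≥0 (suc k) ⊗ w₀≥0) (≤-trans (β≤ d k) (^-mono d (⟦⟧≥0 (suc k)) (⟦⟧-mono h)))
          (*-monoʳ w₀ w₀≥0 (*-monoˡ 2ℚ 0≤2 (⟦⟧-mono h)))
        lem : ∀ L l b b' k E e → 1ℚ - b' + (1ℚ + k) * E ≡ L + l + (1ℚ - b + k * E - L + (b - b' + e - l) + (E - e))
        lem = solve-∀ ring

  far-lap : ∀ k x → ρ ≤ ⟦ normSq x ⟧ → (∀ δ → ρ ≤ ⟦ normSq (step δ x) ⟧) → lap (F k) x ≡ 0ℚ
  far-lap k x h h' = trans (∑-cong (dirs d) λ δ → cong₂ _-_ (F-zero k (step δ x) (s-zero (step δ x) (h' δ))) (F-zero k x (s-zero x h))) (∑-0 (dirs d))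

  error : ℕ → ℚ
  error k = ⟦ k ⟧ * (⟦ k ⟧ ^ℚ d * (2ℚ * ⟦ k ⟧ * w₀))

  error≥0 : ∀ k → 0ℚ ≤ error k
  error≥0 k = ⟦⟧≥0 k ⊗ (^-nonneg d (⟦⟧≥0 k) ⊗ (0≤2 ⊗ ⟦⟧≥0 k ⊗ w₀≥0))

  -- Either x is close enough to the ball for the Taylor estimate, or x and all its neighbours lie
  -- outside the ball, where F vanishes.
  F-lap : ∀ k x → (1ℚ + z₀) ^ℚ suc k ≤ 2ℚ → lap (F (suc k)) x ≤ 1ℚ + error (suc k) - β d (suc k) * s x ^ℚ suc k
  F-lap k x flat = by-cases (normInf x ℕₚ.≤? suc r) (⟦ normSq x ⟧ ℚₚ.≤? (ρ + width))
    where
    Goal = lap (F (suc k)) x ≤ 1ℚ + error (suc k) - β d (suc k) * s x ^ℚ suc k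
    outside : ρ ≤ ⟦ normSq x ⟧ → (∀ δ → ρ ≤ ⟦ normSq (step δ x) ⟧) → Goal
    outside h h' = ≤-trans (≤-reflexive (far-lap (suc k) x h h')) (≤-trans (0≤1 ⊕ error≥0 (suc k))
      (≤-reflexive (sym (trans (cong (λ t → 1ℚ + error (suc k) - β d (suc k) * t) (trans (cong (_^ℚ suc k) (s-zero x h)) (0^suc k))) (lem (1ℚ + error (suc k)) (β d (suc k)))))))
      where
      lem : ∀ a b → a - b * 0ℚ ≡ a
      lem = solve-∀ ring
    by-cases : Dec (normInf x ℕ.≤ suc r) → Dec (⟦ normSq x ⟧ ≤ ρ + width) → Goal
    by-cases (yes p) (yes q) = ≤-trans (Near.F-lap-near x p q {suc k} flat (suc k) ℕₚ.≤-refl) (≤-reflexive (lem (β d (suc k) * s x ^ℚ suc k) (error (suc k))))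
      where
      lem : ∀ b e → 1ℚ - b + e ≡ 1ℚ + e - b
      lem = solve-∀ ring
    by-cases (yes p) (no ¬q) = outside (≤-trans (cert width≥0 refl) (≰⇒≥ ¬q)) λ δ →
        ≤-trans (cert (diff≥0 (≰⇒≥ ¬q) ⊕ diff≥0 (≤-trans (ℚₚ.neg-antimono-≤ (norm≤width x p)) (proj₂ (η-bounds δ x)))) (lem ⟦ normSq x ⟧ (η δ x) ρ width))
          (≤-reflexive (sym (normSq-step δ x)))
      where
      lem : ∀ n e r w → n + e ≡ r + (n - (r + w) + (e - - w))
      lem = solve-∀ ring
    by-cases (no ¬p) _ = outside (ρ≤ x (ℕₚ.≤-trans (ℕₚ.n≤1+n r) (ℕₚ.<⇒≤ (ℕₚ.≰⇒> ¬p)))) λ δ → ρ≤ (step δ x) (ℕₚ.≤-trans (ℕₚ.n≤1+n r)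
      (ℕₚ.≤-pred (ℕₚ.≤-trans (ℕₚ.≰⇒> ¬p) (normInf-step δ x))))

-- Second moment and mean displacement of the bump.

module Moment (i : ℚ) (i≥0 : 0ℚ ≤ i) where

  trunc : ℚ → ℕ → ℚ
  trunc A n = (A - ⟦ n ⟧ * i) ⊔0

  trunc≥0 : ∀ A n → 0ℚ ≤ trunc A n
  trunc≥0 A n = ⊔0≥0 (A - ⟦ n ⟧ * i)

  trunc-+ : ∀ A m n → trunc A (m ℕ.+ n) ≡ trunc (A - ⟦ m ⟧ * i) n
  trunc-+ A m n = cong _⊔0 (trans (cong (λ t → A - t * i) (⟦⟧-+ m n)) (lem A ⟦ m ⟧ ⟦ n ⟧ i))
    where
    lem : ∀ a m n i → a - (m + n) * i ≡ a - m * i - n * i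
    lem = solve-∀ ring

  module _ (k : ℕ) where

    -- Summation by parts against the decrements of (A - z²i)^(k+2).
    moment₁ : ∀ A B → ⟦ suc (suc k) ⟧ * i * (∑[ z ← range B ] ⟦ ℤ.∣ z ∣ ℕ.* ℤ.∣ z ∣ ⟧ * trunc A (ℤ.∣ z ∣ ℕ.* ℤ.∣ z ∣) ^ℚ suc k)
      ≤ 2ℚ * (∑[ z ← range B ] trunc A (ℤ.∣ z ∣ ℕ.* ℤ.∣ z ∣) ^ℚ suc (suc k))
    moment₁ A B = cert (diff≥0 (parts B) ⊕ diff≥0 q₀≤ ⊕ 0≤2 ⊗ (⟦⟧≥0 (suc B) ⊗ q≥0 B))
        (lem (⟦ suc (suc k) ⟧ * i * (∑[ z ← range B ] ⟦ ℤ.∣ z ∣ ℕ.* ℤ.∣ z ∣ ⟧ * p ℤ.∣ z ∣)) (∑[ z ← range B ] q ℤ.∣ z ∣) (q 0) (⟦ suc B ⟧ * q B))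
      where
      a p q : ℕ → ℚ
      a n = trunc A (n ℕ.* n)
      p n = a n ^ℚ suc k
      q n = a n ^ℚ suc (suc k)
      a≥0 : ∀ n → 0ℚ ≤ a n
      a≥0 n = trunc≥0 A (n ℕ.* n)
      p≥0 : ∀ n → 0ℚ ≤ p n
      p≥0 n = ^-nonneg (suc k) (a≥0 n)
      q≥0 : ∀ n → 0ℚ ≤ q n
      q≥0 n = ^-nonneg (suc (suc k)) (a≥0 n)
      q₀≤ : q 0 ≤ ∑[ z ← range B ] q ℤ.∣ z ∣
      q₀≤ = ∑-term {f = λ z → q ℤ.∣ z ∣} (λ z → q≥0 ℤ.∣ z ∣) (∈-range B (+ 0) z≤n)
      lem : ∀ m s q₀ t → 2ℚ * s ≡ m + (q₀ + s - (m + 2ℚ * t) + (s - q₀) + 2ℚ * t)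
      lem = solve-∀ ring
      square : ∀ n → ⟦ suc n ℕ.* suc n ⟧ ≡ ⟦ n ℕ.* n ⟧ + (2ℚ * ⟦ n ⟧ + 1ℚ)
      square n = trans (⟦⟧-* (suc n) (suc n)) (trans (lem' ⟦ n ⟧) (cong (λ t → t + (2ℚ * ⟦ n ⟧ + 1ℚ)) (sym (⟦⟧-* n n))))
        where
        lem' : ∀ n → (1ℚ + n) * (1ℚ + n) ≡ n * n + (2ℚ * n + 1ℚ)
        lem' = solve-∀ ring
      a-anti : ∀ n → a (suc n) ≤ a n
      a-anti n = ⊔0-mono {A - ⟦ suc n ℕ.* suc n ⟧ * i} {A - ⟦ n ℕ.* n ⟧ * i}
        (cert ((0≤2 ⊗ ⟦⟧≥0 n ⊕ 0≤1) ⊗ i≥0) (trans (lem' A ⟦ n ℕ.* n ⟧ i (2ℚ * ⟦ n ⟧ + 1ℚ)) (cong (λ t → A - t * i + (2ℚ * ⟦ n ⟧ + 1ℚ) * i) (sym (square n)))))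
        where
        lem' : ∀ a n i w → a - n * i ≡ a - (n + w) * i + w * i
        lem' = solve-∀ ring
      decrement : ∀ n → (2ℚ * ⟦ n ⟧ + 1ℚ) * i * p (suc n) ≤ (a n - a (suc n)) * p (suc n)
      decrement n with ℚₚ.≤-total 0ℚ (A - ⟦ suc n ℕ.* suc n ⟧ * i)
      ... | inj₁ h = *-monoʳ {(2ℚ * ⟦ n ⟧ + 1ℚ) * i} {a n - a (suc n)} (p (suc n)) (p≥0 (suc n)) (cert (diff≥0 (⊔0≥ (A - ⟦ n ℕ.* n ⟧ * i)))
          (trans (cong (λ t → a n - t) (trans (⊔0-pos h) (cong (λ t → A - t * i) (square n)))) (lem' (a n) A ⟦ n ℕ.* n ⟧ i (2ℚ * ⟦ n ⟧ + 1ℚ))))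
        where
        lem' : ∀ x a n i w → x - (a - (n + w) * i) ≡ w * i + (x - (a - n * i))
        lem' = solve-∀ ring
      ... | inj₂ h = ≤-reflexive (trans (cong (λ t → (2ℚ * ⟦ n ⟧ + 1ℚ) * i * t) p≡0) (trans (lem' ((2ℚ * ⟦ n ⟧ + 1ℚ) * i) (a n - a (suc n))) (cong (λ t → (a n - a (suc n)) * t) (sym p≡0))))
        where
        p≡0 : p (suc n) ≡ 0ℚ
        p≡0 = trans (cong (_^ℚ suc k) (⊔0-neg h)) (0^suc k)
        lem' : ∀ a b → a * 0ℚ ≡ b * 0ℚ
        lem' = solve-∀ ring
      parts : ∀ B → ⟦ suc (suc k) ⟧ * i * (∑[ z ← range B ] ⟦ ℤ.∣ z ∣ ℕ.* ℤ.∣ z ∣ ⟧ * p ℤ.∣ z ∣) + 2ℚ * (⟦ suc B ⟧ * q B) ≤ q 0 + ∑[ z ← range B ] q ℤ.∣ z ∣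
      parts zero = ≤-reflexive (lem' (⟦ suc (suc k) ⟧ * i) (p 0) (q 0))
        where
        lem' : ∀ c p q → c * (0ℚ * p + 0ℚ) + 2ℚ * ((1ℚ + 0ℚ) * q) ≡ q + (q + 0ℚ)
        lem' = solve-∀ ring
      parts (suc B) = cert (diff≥0 (parts B) ⊕ 0≤2 ⊗ (⟦⟧≥0 (suc B) ⊗ (diff≥0 (pow-diff≥ (suc k) (a≥0 (suc B)) (a-anti B)) ⊕ ⟦⟧≥0 (suc (suc k)) ⊗ diff≥0 (decrement B) ⊕ ⟦⟧≥0 (suc (suc k)) ⊗ (⟦⟧≥0 B ⊗ i≥0 ⊗ p≥0 (suc B)))))
        (trans (lem' ⟦ suc (suc k) ⟧ i (∑[ z ← range B ] ⟦ ℤ.∣ z ∣ ℕ.* ℤ.∣ z ∣ ⟧ * p ℤ.∣ z ∣) (∑[ z ← range B ] q ℤ.∣ z ∣) ⟦ B ⟧ (p (suc B)) (q (suc B)) (q B) (q 0) (a B) (a (suc B)))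
          (cong (λ t → ⟦ suc (suc k) ⟧ * i * (t * p (suc B) + (t * p (suc B) + (∑[ z ← range B ] ⟦ ℤ.∣ z ∣ ℕ.* ℤ.∣ z ∣ ⟧ * p ℤ.∣ z ∣))) + 2ℚ * (⟦ suc (suc B) ⟧ * q (suc B))
              + (q 0 + ∑[ z ← range B ] q ℤ.∣ z ∣ - (⟦ suc (suc k) ⟧ * i * (∑[ z ← range B ] ⟦ ℤ.∣ z ∣ ℕ.* ℤ.∣ z ∣ ⟧ * p ℤ.∣ z ∣) + 2ℚ * (⟦ suc B ⟧ * q B))
              + 2ℚ * (⟦ suc B ⟧ * (q B - q (suc B) - ⟦ suc (suc k) ⟧ * (a B - a (suc B)) * p (suc B)
                + ⟦ suc (suc k) ⟧ * ((a B - a (suc B)) * p (suc B) - (2ℚ * ⟦ B ⟧ + 1ℚ) * i * p (suc B)) + ⟦ suc (suc k) ⟧ * (⟦ B ⟧ * i * p (suc B))))))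
            (sym (⟦⟧-* (suc B) (suc B)))))
        where
        lem' : ∀ c i S T b p q q' q₀ a a' → q₀ + (q + (q + T)) ≡ c * i * ((1ℚ + b) * (1ℚ + b) * p + ((1ℚ + b) * (1ℚ + b) * p + S)) + 2ℚ * ((1ℚ + (1ℚ + b)) * q)
          + (q₀ + T - (c * i * S + 2ℚ * ((1ℚ + b) * q')) + 2ℚ * ((1ℚ + b) * (q' - q - c * (a - a') * p + c * ((a - a') * p - (2ℚ * b + 1ℚ) * i * p) + c * (b * i * p))))
        lem' = solve-∀ ring

    -- Lattice form of integrating x · ∇ s^(k+2) by parts, one coordinate at a time and with a
    -- constant factor given away. The offset `A` absorbs the coordinates held fixed.
    moment : ∀ d A B → ⟦ suc (suc k) ⟧ * i * (∑[ x ← box d B ] ⟦ normSq x ⟧ * trunc A (normSq x) ^ℚ suc k)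
      ≤ 2ℚ * ⟦ d ⟧ * (∑[ x ← box d B ] trunc A (normSq x) ^ℚ suc (suc k))
    moment zero A B = ≤-reflexive (lem (⟦ suc (suc k) ⟧ * i) (trunc A 0 ^ℚ suc k) (trunc A 0 ^ℚ suc (suc k)))
      where
      lem : ∀ c p q → c * (0ℚ * p + 0ℚ) ≡ 2ℚ * 0ℚ * (q + 0ℚ)
      lem = solve-∀ ring
    moment (suc d) A B = ≤-trans (≤-reflexive (trans (cong (λ t → c * t) split) (ℚₚ.*-distribˡ-+ c X Y)))
        (≤-trans (+-mono first rest) (≤-reflexive (lem Q' ⟦ d ⟧)))
      where
      c = ⟦ suc (suc k) ⟧ * i
      sqz : ℤ → ℕ
      sqz z = ℤ.∣ z ∣ ℕ.* ℤ.∣ z ∣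
      w : ℤ → Site d → ℚ
      w z x = trunc A (sqz z ℕ.+ normSq x) ^ℚ suc k
      X = ∑[ x ← box d B ] ∑[ z ← range B ] ⟦ sqz z ⟧ * w z x
      Y = ∑[ z ← range B ] ∑[ x ← box d B ] ⟦ normSq x ⟧ * w z x
      Q' = ∑ (box (suc d) B) (λ x → trunc A (normSq x) ^ℚ suc (suc k))
      lem : ∀ q d → 2ℚ * q + 2ℚ * d * q ≡ 2ℚ * (1ℚ + d) * q
      lem = solve-∀ ring
      split : ∑ (box (suc d) B) (λ x → ⟦ normSq x ⟧ * trunc A (normSq x) ^ℚ suc k) ≡ X + Y
      split = trans (∑-box-suc B _) (trans (∑-cong (range B) λ z → trans (∑-cong (box d B) λ x →
            trans (cong (λ t → t * w z x) (⟦⟧-+ (sqz z) (normSq x))) (ℚₚ.*-distribʳ-+ (w z x) ⟦ sqz z ⟧ ⟦ normSq x ⟧)) (∑-+ (box d B) _ _))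
          (trans (∑-+ (range B) _ _) (cong (λ t → t + Y) (∑-swap (range B) (box d B) (λ z x → ⟦ sqz z ⟧ * w z x)))))
      first : c * X ≤ 2ℚ * Q'
      first = ≤-trans (≤-reflexive (sym (∑-* (box d B) c _))) (≤-trans (∑-mono (box d B) λ x →
          ≤-trans (≤-reflexive (cong (λ t → c * t) (∑-cong (range B) λ z → cong (λ t → ⟦ sqz z ⟧ * t ^ℚ suc k) (swap z x))))
            (≤-trans (moment₁ (A - ⟦ normSq x ⟧ * i) B) (≤-reflexive (cong (λ t → 2ℚ * t) (∑-cong (range B) λ z → cong (_^ℚ suc (suc k)) (sym (swap z x)))))))
        (≤-reflexive (trans (∑-* (box d B) 2ℚ _) (cong (λ t → 2ℚ * t) (sym (trans (∑-box-suc B (λ x → trunc A (normSq x) ^ℚ suc (suc k)))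
          (∑-swap (range B) (box d B) (λ z x → trunc A (sqz z ℕ.+ normSq x) ^ℚ suc (suc k)))))))))
        where
        swap : ∀ z x → trunc A (sqz z ℕ.+ normSq x) ≡ trunc (A - ⟦ normSq x ⟧ * i) (sqz z)
        swap z x = trans (cong (trunc A) (ℕₚ.+-comm (sqz z) (normSq x))) (trunc-+ A (normSq x) (sqz z))
      rest : c * Y ≤ 2ℚ * ⟦ d ⟧ * Q'
      rest = ≤-trans (≤-reflexive (sym (∑-* (range B) c _))) (≤-trans (∑-mono (range B) λ z →
          ≤-trans (≤-reflexive (cong (λ t → c * t) (∑-cong (box d B) λ x → cong (λ t → ⟦ normSq x ⟧ * t ^ℚ suc k) (trunc-+ A (sqz z) (normSq x)))))
            (≤-trans (moment d (A - ⟦ sqz z ⟧ * i) B) (≤-reflexive (cong (λ t → 2ℚ * ⟦ d ⟧ * t) (∑-cong (box d B) λ x → cong (_^ℚ suc (suc k)) (sym (trunc-+ A (sqz z) (normSq x))))))))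
        (≤-reflexive (trans (∑-* (range B) (2ℚ * ⟦ d ⟧) _) (cong (λ t → 2ℚ * ⟦ d ⟧ * t) (sym (∑-box-suc B (λ x → trunc A (normSq x) ^ℚ suc (suc k))))))))

norm₁≤ : ∀ {d} l l' → l * l' ≡ 1ℚ → 0ℚ ≤ l' → (y : Site d) → ⟦ norm₁ y ⟧ + ⟦ norm₁ y ⟧ ≤ ⟦ d ⟧ * l + l' * ⟦ normSq y ⟧
norm₁≤ l l' e l'≥0 [] = ≤-reflexive (lem l l')
  where
  lem : ∀ l l' → 0ℚ + 0ℚ ≡ 0ℚ * l + l' * 0ℚ
  lem = solve-∀ ring
norm₁≤ {suc d} l l' e l'≥0 (z ∷ y) = cert (diff≥0 (am-gm ⟦ ℤ.∣ z ∣ ⟧ l l' e l'≥0) ⊕ diff≥0 (norm₁≤ l l' e l'≥0 y))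
  (trans (cong (λ t → ⟦ suc d ⟧ * l + l' * t) (trans (⟦⟧-+ (ℤ.∣ z ∣ ℕ.* ℤ.∣ z ∣) (normSq y)) (cong (λ t → t + ⟦ normSq y ⟧) (⟦⟧-* ℤ.∣ z ∣ ℤ.∣ z ∣))))
    (trans (lem ⟦ d ⟧ l l' ⟦ ℤ.∣ z ∣ ⟧ ⟦ norm₁ y ⟧ ⟦ normSq y ⟧)
      (cong (λ t → t + t + (l + l' * (⟦ ℤ.∣ z ∣ ⟧ * ⟦ ℤ.∣ z ∣ ⟧) - (⟦ ℤ.∣ z ∣ ⟧ + ⟦ ℤ.∣ z ∣ ⟧) + (⟦ d ⟧ * l + l' * ⟦ normSq y ⟧ - (⟦ norm₁ y ⟧ + ⟦ norm₁ y ⟧)))) (sym (⟦⟧-+ ℤ.∣ z ∣ (norm₁ y))))))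
  where
  lem : ∀ d l l' a m n → (1ℚ + d) * l + l' * (a * a + n) ≡ (a + m) + (a + m) + (l + l' * (a * a) - (a + a) + (d * l + l' * n - (m + m)))
  lem = solve-∀ ring

module ProfileMean (d r : ℕ) (r≥1 : 1 ℕ.≤ r) (k : ℕ) where
  open Profile d r r≥1

  -- Per coordinate 2 |y_i| ≤ l + y_i²/l, and the second moment is at most 2 d r²/(k+1); the
  -- hypothesis on l' balances the two parts.
  mean-displacement : ∀ l l' → l * l' ≡ 1ℚ → 0ℚ ≤ l → 0ℚ ≤ l' → l' * ρ ≤ l * ⟦ suc k ⟧ →
    ∑[ y ← box d r ] s y ^ℚ suc k * ⟦ norm₁ y ⟧ ≤ 2ℚ * ⟦ d ⟧ * l * (∑[ y ← box d r ] s y ^ℚ suc k)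
  mean-displacement l l' e l≥0 l'≥0 h = *-cancel 2ℚ (0≤1 ⊕< 0<1) (≤-trans
      (≤-trans (≤-reflexive (sym (∑-* (box d r) 2ℚ _))) (≤-trans (∑-mono (box d r) pointwise)
        (≤-reflexive (trans (∑-+ (box d r) _ _) (cong₂ _+_ (∑-* (box d r) (⟦ d ⟧ * l) _) (∑-* (box d r) l' _))))))
      (cert (l'≥0 ⊗ diff≥0 second ⊕ (0≤2 ⊗ ⟦⟧≥0 d ⊗ Z≥0 ⊗ diff≥0 (≤-trans h' ≤-refl)) ⊕ ⟦⟧≥0 d ⊗ l≥0 ⊗ Z≥0) (lem ⟦ d ⟧ l l' Z N ρ (inv k))))
    where
    Z = ∑[ y ← box d r ] s y ^ℚ suc k
    N = ∑[ y ← box d r ] ⟦ normSq y ⟧ * s y ^ℚ suc k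
    Z≥0 : 0ℚ ≤ Z
    Z≥0 = ∑-nonneg (box d r) λ y → ^-nonneg (suc k) (s≥0 y)
    h' : l' * ρ * inv k ≤ l
    h' = cert (inv≥0 k ⊗ diff≥0 h ⊕ ≡⇒0≤ l (sym (inv-def k))) (lem' l (l' * ρ) (inv k) ⟦ suc k ⟧)
      where
      lem' : ∀ l a i k → l ≡ a * i + (i * (l * k - a) + l * (1ℚ - k * i))
      lem' = solve-∀ ring
    lem : ∀ d l l' Z N ρ i → 2ℚ * (2ℚ * d * l * Z) ≡ d * l * Z + l' * N + (l' * (2ℚ * d * ρ * i * Z - N) + 2ℚ * d * Z * (l - l' * ρ * i) + d * l * Z)
    lem = solve-∀ ring
    pointwise : ∀ y → 2ℚ * (s y ^ℚ suc k * ⟦ norm₁ y ⟧) ≤ ⟦ d ⟧ * l * s y ^ℚ suc k + l' * (⟦ normSq y ⟧ * s y ^ℚ suc k)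
    pointwise y = cert (^-nonneg (suc k) (s≥0 y) ⊗ diff≥0 (norm₁≤ l l' e l'≥0 y)) (lem' (s y ^ℚ suc k) ⟦ norm₁ y ⟧ (⟦ d ⟧ * l) l' ⟦ normSq y ⟧)
      where
      lem' : ∀ p n a l m → a * p + l * (m * p) ≡ 2ℚ * (p * n) + p * (a + l * m - (n + n))
      lem' = solve-∀ ring
    second : N ≤ 2ℚ * ⟦ d ⟧ * ρ * inv k * Z
    second = cert (<⇒≤ ρ>0 ⊗ inv≥0 k ⊗ (diff≥0 (Moment.moment ρ⁻¹ ρ⁻¹≥0 k d 1ℚ r) ⊕ 0≤2 ⊗ ⟦⟧≥0 d ⊗ diff≥0 shrink ⊕ ρ⁻¹≥0 ⊗ N≥0) ⊕ ≡⇒0≤ (N * ⟦ suc k ⟧ * inv k) ρρ⁻¹ ⊕ ≡⇒0≤ N (inv-def k))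
      (lem' N ⟦ d ⟧ ρ (inv k) Z ρ⁻¹ ⟦ suc k ⟧ (∑[ y ← box d r ] s y ^ℚ suc (suc k)))
      where
      N≥0 : 0ℚ ≤ N
      N≥0 = ∑-nonneg (box d r) λ y → ⟦⟧≥0 (normSq y) ⊗ ^-nonneg (suc k) (s≥0 y)
      shrink : ∑[ y ← box d r ] s y ^ℚ suc (suc k) ≤ Z
      shrink = ∑-mono (box d r) λ y → cert (^-nonneg (suc k) (s≥0 y) ⊗ diff≥0 (s≤1 y)) (lem'' (s y) (s y ^ℚ suc k))
        where
        lem'' : ∀ s p → p ≡ s * p + p * (1ℚ - s)
        lem'' = solve-∀ ring
      lem' : ∀ N d ρ i Z ρ' k S → 2ℚ * d * ρ * i * Z ≡ N + (ρ * i * (2ℚ * d * S - (1ℚ + k) * ρ' * N + 2ℚ * d * (Z - S) + ρ' * N) + N * k * i * (ρ * ρ' - 1ℚ) + N * (k * i - 1ℚ))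
      lem' = solve-∀ ring

-- Lattice points in discs and Leibniz's series.

below : ℕ → List ℕ
below zero    = []
below (suc n) = n ∷ below n

∑-below-front : ∀ n (f : ℕ → ℚ) → ∑ (below (suc n)) f ≡ f 0 + ∑[ j ← below n ] f (suc j)
∑-below-front zero f    = refl
∑-below-front (suc n) f = trans (cong (λ t → f (suc n) + t) (∑-below-front n f)) (lem (f (suc n)) (f 0) (∑[ j ← below n ] f (suc j)))
  where
  lem : ∀ a b c → a + (b + c) ≡ b + (a + c)
  lem = solve-∀ ring

∑-below-cong : ∀ n {f g : ℕ → ℚ} → (∀ j → j ℕ.< n → f j ≡ g j) → ∑ (below n) f ≡ ∑ (below n) g
∑-below-cong zero h    = refl
∑-below-cong (suc n) h = cong₂ _+_ (h n ℕₚ.≤-refl) (∑-below-cong n λ j p → h j (ℕₚ.m≤n⇒m≤1+n p))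

∑-below-mono : ∀ n {f g : ℕ → ℚ} → (∀ j → j ℕ.< n → f j ≤ g j) → ∑ (below n) f ≤ ∑ (below n) g
∑-below-mono zero h    = ≤-refl
∑-below-mono (suc n) h = +-mono (h n ℕₚ.≤-refl) (∑-below-mono n λ j p → h j (ℕₚ.m≤n⇒m≤1+n p))

∑-below-const : ∀ n c → ∑[ j ← below n ] c ≡ ⟦ n ⟧ * c
∑-below-const zero c    = sym (ℚₚ.*-zeroˡ c)
∑-below-const (suc n) c = trans (cong (λ t → c + t) (∑-below-const n c)) (lem c ⟦ n ⟧)
  where
  lem : ∀ c n → c + n * c ≡ (1ℚ + n) * c
  lem = solve-∀ ring

∑-below-+ : ∀ m n (f : ℕ → ℚ) → ∑ (below (m ℕ.+ n)) f ≡ ∑[ j ← below m ] f (j ℕ.+ n) + ∑ (below n) f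
∑-below-+ zero n f    = sym (ℚₚ.+-identityˡ _)
∑-below-+ (suc m) n f = trans (cong (λ t → f (m ℕ.+ n) + t) (∑-below-+ m n f)) (sym (ℚₚ.+-assoc (f (m ℕ.+ n)) _ _))

∑-below-≤ : ∀ {m n} (f : ℕ → ℚ) → (∀ j → 0ℚ ≤ f j) → m ℕ.≤ n → ∑ (below m) f ≤ ∑ (below n) f
∑-below-≤ {m} {n} f p h = subst (λ t → ∑ (below m) f ≤ ∑ (below t) f) (ℕₚ.m∸n+n≡m h)
  (≤-trans (cert (∑-nonneg (below (n ℕ.∸ m)) λ j → p (j ℕ.+ m)) (ℚₚ.+-comm _ (∑ (below m) f))) (≤-reflexive (sym (∑-below-+ (n ℕ.∸ m) m f))))

∑-below-* : ∀ G α (f : ℕ → ℚ) → ∑ (below (G ℕ.* α)) f ≡ ∑[ i ← below G ] ∑[ j ← below α ] f (j ℕ.+ i ℕ.* α)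
∑-below-* zero α f    = refl
∑-below-* (suc G) α f = trans (∑-below-+ α (G ℕ.* α) f) (cong (λ t → ∑[ j ← below α ] f (j ℕ.+ G ℕ.* α) + t) (∑-below-* G α f))

∑-below-id : ∀ n → 2ℚ * (∑[ j ← below n ] ⟦ j ⟧) ≡ ⟦ n ⟧ * ⟦ n ⟧ - ⟦ n ⟧
∑-below-id zero    = refl
∑-below-id (suc n) = trans (ℚₚ.*-distribˡ-+ 2ℚ ⟦ n ⟧ _) (trans (cong (λ t → 2ℚ * ⟦ n ⟧ + t) (∑-below-id n)) (lem ⟦ n ⟧))
  where
  lem : ∀ n → 2ℚ * n + (n * n - n) ≡ (1ℚ + n) * (1ℚ + n) - (1ℚ + n)
  lem = solve-∀ ring

∑-range-abs : ∀ B (φ : ℕ → ℚ) → ∑[ z ← range B ] φ ℤ.∣ z ∣ ≡ φ 0 + 2ℚ * (∑[ j ← below B ] φ (suc j))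
∑-range-abs zero φ    = lem (φ 0)
  where
  lem : ∀ a → a + 0ℚ ≡ a + 2ℚ * 0ℚ
  lem = solve-∀ ring
∑-range-abs (suc B) φ = trans (cong (λ t → φ (suc B) + (φ (suc B) + t)) (∑-range-abs B φ)) (lem (φ (suc B)) (φ 0) (∑[ j ← below B ] φ (suc j)))
  where
  lem : ∀ a b c → a + (a + (b + 2ℚ * c)) ≡ b + 2ℚ * (a + c)
  lem = solve-∀ ring

threshold : (P : ℕ → Set) → (∀ n → Dec (P n)) → P 0 → ∀ r → ¬ P r → ∃[ X ] (X ℕ.< r × P X × ¬ P (suc X))
threshold P P? p₀ zero ¬p = contradiction p₀ ¬p
threshold P P? p₀ (suc r) ¬p with P? r
... | yes p = r , ℕₚ.≤-refl , p , ¬p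
... | no ¬q with threshold P P? p₀ r ¬q
...   | X , X<r , p , ¬p' = X , ℕₚ.m≤n⇒m≤1+n X<r , p , ¬p'

unit-fraction : ∀ n b .{{_ : ℕ.NonZero n}} → n ≡ suc b → (+ 1) / n ≡ inv b
unit-fraction .(suc b) b refl = trans (lem ((+ 1) / suc b) ⟦ suc b ⟧ (inv b))
    (trans (cong₂ (λ u v → ((+ 1) / suc b) * (1ℚ - u) + v * inv b) (inv-def b) (/-⟦⟧ 1 b)) (lem₂ ((+ 1) / suc b) (inv b)))
  where
  lem : ∀ x s i → x ≡ x * (1ℚ - s * i) + x * s * i
  lem = solve-∀ ring
  lem₂ : ∀ x i → x * (1ℚ - 1ℚ) + 1ℚ * i ≡ i
  lem₂ = solve-∀ ring

pairs : ℕ → ℚ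
pairs zero    = inv 0 - inv 2
pairs (suc m) = pairs m + (inv (4 ℕ.* suc m) - inv (suc (suc (4 ℕ.* suc m))))

pi-pairs : ∀ m → piLower m ≡ ⟦ 4 ⟧ * pairs m
pi-pairs zero    = cong₂ (λ a b → a * b) (⟦⟧-/1 4) (cong₂ _-_ (unit-fraction 1 0 refl) (unit-fraction 3 2 refl))
pi-pairs (suc m) = trans (cong₂ _+_ (pi-pairs m) (cong₂ (λ a b → a * b) (⟦⟧-/1 4)
    (cong₂ _-_ (unit-fraction (4 ℕ.* suc m ℕ.+ 1) (4 ℕ.* suc m) (ℕₚ.+-comm (4 ℕ.* suc m) 1)) (unit-fraction (4 ℕ.* suc m ℕ.+ 3) (suc (suc (4 ℕ.* suc m))) (ℕₚ.+-comm (4 ℕ.* suc m) 3)))))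
  (sym (ℚₚ.*-distribˡ-+ ⟦ 4 ⟧ (pairs m) _))

inv-anti : ∀ {a b} → a ℕ.≤ b → inv b ≤ inv a
inv-anti {a} {b} h = cert (inv≥0 a ⊗ inv≥0 b ⊗ diff≥0 (⟦⟧-mono (s≤s h)) ⊕ ≡⇒0≤ (inv a) (sym (inv-def b)) ⊕ ≡⇒0≤ (inv b) (inv-def a))
  (lem (inv a) (inv b) ⟦ suc a ⟧ ⟦ suc b ⟧)
  where
  lem : ∀ x y a b → x ≡ y + (x * y * (b - a) + x * (1ℚ - b * y) + y * (a * x - 1ℚ))
  lem = solve-∀ ring

pairs-≤ : ∀ n M → pairs M ≤ pairs (n ℕ.+ M) × pairs (n ℕ.+ M) + inv (4 ℕ.* suc (n ℕ.+ M)) ≤ pairs M + inv (4 ℕ.* suc M)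
pairs-≤ zero M    = ≤-refl , ≤-refl
pairs-≤ (suc n) M with pairs-≤ n M
... | lo , hi = ≤-trans lo (cert (diff≥0 (inv-anti {e} (ℕₚ.≤-trans (ℕₚ.n≤1+n e) (ℕₚ.n≤1+n (suc e))))) refl) ,
    ≤-trans (cert (diff≥0 next) (lem (pairs (n ℕ.+ M)) (inv e) (inv (suc (suc e))) (inv (4 ℕ.* suc (suc (n ℕ.+ M)))))) hi
  where
  e = 4 ℕ.* suc (n ℕ.+ M)
  next : inv (4 ℕ.* suc (suc (n ℕ.+ M))) ≤ inv (suc (suc e))
  next = inv-anti (subst (suc (suc e) ℕ.≤_) (sym (ℕₚ.*-suc 4 (suc (n ℕ.+ M)))) (ℕₚ.≤-trans (ℕₚ.n≤1+n _) (ℕₚ.n≤1+n _)))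
  lem : ∀ p a c e → p + a ≡ p + (a - c) + e + (c - e)
  lem = solve-∀ ring

-- Alternating series estimate: adding the next positive term turns the increasing sums into
-- decreasing ones. This takes the place of the limit π, which is never formed.
pairs-uniform : ∀ m M → pairs m ≤ pairs M + inv (4 ℕ.* suc M)
pairs-uniform m M with ℕₚ.≤-total m M
... | inj₁ h = ≤-trans (subst (λ t → pairs m ≤ pairs t) (ℕₚ.m∸n+n≡m h) (proj₁ (pairs-≤ (M ℕ.∸ m) m))) (cert (inv≥0 (4 ℕ.* suc M)) refl)
... | inj₂ h = ≤-trans (cert (inv≥0 (4 ℕ.* suc m)) refl) (subst (λ t → pairs t + inv (4 ℕ.* suc t) ≤ pairs M + inv (4 ℕ.* suc M)) (ℕₚ.m∸n+n≡m h) (proj₂ (pairs-≤ (m ℕ.∸ M) M)))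

inside : ℕ → ℕ → ℕ → ℚ
inside t a b = 𝟙 (a ℕ.* a ℕ.+ b ℕ.* b ℕₚ.≤? t)

inside≥0 : ∀ t a b → 0ℚ ≤ inside t a b
inside≥0 t a b = 𝟙≥0 (a ℕ.* a ℕ.+ b ℕ.* b ℕₚ.≤? t)

inside-sym : ∀ t a b → inside t a b ≡ inside t b a
inside-sym t a b = cong (λ n → 𝟙 (n ℕₚ.≤? t)) (ℕₚ.+-comm (a ℕ.* a) (b ℕ.* b))

circle : ℕ → ℕ → ℚ
circle r t = ∑[ y ← range r ] ∑[ z ← range r ] inside t ℤ.∣ y ∣ ℤ.∣ z ∣

octant : ℕ → ℕ → ℚ
octant r t = ∑[ a ← below r ] ∑[ b ← below r ] 𝟙 (b ℕₚ.<? a) * inside t (suc a) (suc b)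

quadrant-drop : ∀ r (φ : ℕ → ℚ) → (∀ n → 0ℚ ≤ φ n) → 2ℚ * (∑[ j ← below r ] φ (suc j)) ≤ ∑[ z ← range r ] φ ℤ.∣ z ∣
quadrant-drop r φ p = ≤-trans (cert (p 0) (ℚₚ.+-comm (φ 0) _)) (≤-reflexive (sym (∑-range-abs r φ)))

-- Reflections give eight disjoint copies of the open octant; axes and diagonals are discarded, as
-- this is a lower bound.
octants : ∀ r t → 8ℚ * octant r t ≤ circle r t
octants r t = ≤-trans (≤-trans (≤-reflexive (lem (octant r t)))
    (*-monoˡ 2ℚ 0≤2 (*-monoˡ 2ℚ 0≤2 two)))
    (≤-trans (*-monoˡ 2ℚ 0≤2 (≤-trans (≤-reflexive (sym (∑-* (below r) 2ℚ _))) (∑-mono (below r) λ a → quadrant-drop r (inside t (suc a)) (inside≥0 t (suc a)))))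
      (quadrant-drop r (λ a → ∑[ z ← range r ] inside t a ℤ.∣ z ∣) (λ a → ∑-nonneg (range r) λ z → inside≥0 t a ℤ.∣ z ∣)))
  where
  g : ℕ → ℕ → ℚ
  g a b = inside t (suc a) (suc b)
  lem : ∀ o → 8ℚ * o ≡ 2ℚ * (2ℚ * (o + o))
  lem = solve-∀ ring
  mirror : ∑[ a ← below r ] ∑[ b ← below r ] 𝟙 (a ℕₚ.<? b) * g a b ≡ octant r t
  mirror = trans (∑-swap (below r) (below r) (λ a b → 𝟙 (a ℕₚ.<? b) * g a b))
    (∑-cong (below r) λ b → ∑-cong (below r) λ a → cong (λ s → 𝟙 (a ℕₚ.<? b) * s) (inside-sym t (suc a) (suc b)))
  one : ∀ a b → 𝟙 (b ℕₚ.<? a) * g a b + 𝟙 (a ℕₚ.<? b) * g a b ≤ g a b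
  one a b with b ℕₚ.<? a | a ℕₚ.<? b
  ... | yes p | yes q = contradiction q (ℕₚ.<-asym p)
  ... | yes _ | no _  = ≤-reflexive (lem' (g a b))
    where
    lem' : ∀ x → 1ℚ * x + 0ℚ * x ≡ x
    lem' = solve-∀ ring
  ... | no _  | yes _ = ≤-reflexive (lem' (g a b))
    where
    lem' : ∀ x → 0ℚ * x + 1ℚ * x ≡ x
    lem' = solve-∀ ring
  ... | no _  | no _  = ≤-trans (≤-reflexive (lem' (g a b))) (inside≥0 t (suc a) (suc b))
    where
    lem' : ∀ x → 0ℚ * x + 0ℚ * x ≡ 0ℚ
    lem' = solve-∀ ring
  two : octant r t + octant r t ≤ ∑[ a ← below r ] ∑[ b ← below r ] g a b
  two = ≤-trans (≤-reflexive (trans (cong (λ s → octant r t + s) (sym mirror)) (sym (trans (∑-cong (below r) λ a → ∑-+ (below r) _ _) (∑-+ (below r) _ _)))))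
    (∑-mono (below r) λ a → ∑-mono (below r) λ b → one a b)

module Circle (G : ℕ) (G≥1 : 1 ℕ.≤ G) where

  instance
    G-nonZero : ℕ.NonZero G
    G-nonZero = ℕ.>-nonZero G≥1

  -- Points of the open octant 1 ≤ b < a are grouped by the slope b/a, in G classes.
  fits : ℕ → ℕ → ℕ → Set
  fits t i A = A ℕ.* A ℕ.* (G ℕ.* G ℕ.+ suc i ℕ.* suc i) ℕ.≤ t ℕ.* (G ℕ.* G)

  fits? : ∀ t i A → Dec (fits t i A)
  fits? t i A = A ℕ.* A ℕ.* (G ℕ.* G ℕ.+ suc i ℕ.* suc i) ℕₚ.≤? t ℕ.* (G ℕ.* G)

  weight : ℕ → ℚ
  weight i = ⟦ G ⟧ * ⟦ G ⟧ * (⟦ G ⟧ * ⟦ G ⟧ + ⟦ suc i ⟧ * ⟦ suc i ⟧) ⁻¹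

  den>0 : ∀ i → 0ℚ < ⟦ G ⟧ * ⟦ G ⟧ + ⟦ suc i ⟧ * ⟦ suc i ⟧
  den>0 i = (⟦⟧≥0 G ⊗ ⟦⟧≥0 G) ⊕< (⟦suc⟧>0 i ⊗< ⟦suc⟧>0 i)

  ⟦fits⟧ : ∀ i A → ⟦ A ℕ.* A ℕ.* (G ℕ.* G ℕ.+ suc i ℕ.* suc i) ⟧ ≡ ⟦ A ⟧ * ⟦ A ⟧ * (⟦ G ⟧ * ⟦ G ⟧ + ⟦ suc i ⟧ * ⟦ suc i ⟧)
  ⟦fits⟧ i A = trans (⟦⟧-* (A ℕ.* A) _) (cong₂ _*_ (⟦⟧-* A A) (trans (⟦⟧-+ (G ℕ.* G) _) (cong₂ _+_ (⟦⟧-* G G) (⟦⟧-* (suc i) (suc i)))))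

  ⟦fits⟧ʳ : ∀ t → ⟦ t ℕ.* (G ℕ.* G) ⟧ ≡ ⟦ t ⟧ * (⟦ G ⟧ * ⟦ G ⟧)
  ⟦fits⟧ʳ t = trans (⟦⟧-* t (G ℕ.* G)) (cong (λ s → ⟦ t ⟧ * s) (⟦⟧-* G G))

  fits-anti : ∀ t i {A A'} → A' ℕ.≤ A → fits t i A → fits t i A'
  fits-anti t i h f = ℕₚ.≤-trans (ℕₚ.*-monoˡ-≤ _ (ℕₚ.*-mono-≤ h h)) f

  block : ℕ → ℕ
  block a = a ℕ./ G

  block-small : ∀ a → G ℕ.* block a ℕ.≤ a
  block-small a = subst (ℕ._≤ a) (ℕₚ.*-comm (block a) G) (m/n*n≤m a G)

  block-large : ∀ a → ⟦ a ⟧ - ⟦ G ⟧ ≤ ⟦ G ⟧ * ⟦ block a ⟧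
  block-large a = cert (diff≥0 (⟦⟧-mono (ℕₚ.<⇒≤ (m%n<n a G)))) (trans (lem ⟦ a ⟧ ⟦ G ⟧ ⟦ block a ⟧ ⟦ a ℕ.% G ⟧)
      (cong (λ t → ⟦ a ⟧ - ⟦ G ⟧ + (⟦ G ⟧ - ⟦ a ℕ.% G ⟧) + (t - ⟦ a ⟧)) (sym split) ▸ lem₂ (⟦ a ⟧ - ⟦ G ⟧) (⟦ G ⟧ - ⟦ a ℕ.% G ⟧) ⟦ a ⟧))
    where
    _▸_ : ∀ {a b c : ℚ} → a ≡ b → b ≡ c → a ≡ c
    _▸_ = trans
    split : ⟦ a ⟧ ≡ ⟦ a ℕ.% G ⟧ + ⟦ block a ⟧ * ⟦ G ⟧
    split = trans (cong ⟦_⟧ (m≡m%n+[m/n]*n a G)) (trans (⟦⟧-+ (a ℕ.% G) (block a ℕ.* G)) (cong (λ t → ⟦ a ℕ.% G ⟧ + t) (⟦⟧-* (block a) G)))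
    lem : ∀ a g b m → g * b ≡ a - g + (g - m) + (m + b * g - a)
    lem = solve-∀ ring
    lem₂ : ∀ x y a → x + y + (a - a) ≡ x + y
    lem₂ = solve-∀ ring

  -- In column a + 1 each slope class gets a block of ⌊a/G⌋ consecutive rows. Those of class i have
  -- slope at most (i + 1)/G, so all lie in the disc once `fits` holds.
  column : ∀ r t a → a ℕ.≤ r → ⟦ block a ⟧ * (∑[ i ← below G ] 𝟙 (fits? t i (suc a))) ≤ ∑[ b ← below r ] 𝟙 (b ℕₚ.<? a) * inside t (suc a) (suc b)
  column r t a h = ≤-trans (≤-reflexive (sym (trans (∑-cong (below G) λ i → ∑-below-const α (𝟙 (fits? t i (suc a)))) (∑-* (below G) ⟦ α ⟧ _))))
      (≤-trans (∑-below-mono G λ i i<G → ∑-below-mono α λ j j<α → entry i j i<G j<α)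
        (≤-trans (≤-reflexive (sym (∑-below-* G α φ))) (∑-below-≤ φ (λ b → 𝟙≥0 (b ℕₚ.<? a) ⊗ inside≥0 t (suc a) (suc b)) (ℕₚ.≤-trans (block-small a) h))))
    where
    α = block a
    φ : ℕ → ℚ
    φ b = 𝟙 (b ℕₚ.<? a) * inside t (suc a) (suc b)
    entry : ∀ i j → i ℕ.< G → j ℕ.< α → 𝟙 (fits? t i (suc a)) ≤ φ (j ℕ.+ i ℕ.* α)
    entry i j i<G j<α with fits? t i (suc a)
    ... | no _  = 𝟙≥0 (j ℕ.+ i ℕ.* α ℕₚ.<? a) ⊗ inside≥0 t (suc a) (suc (j ℕ.+ i ℕ.* α))
    ... | yes f = ≤-reflexive (sym (cong₂ _*_ (𝟙-yes (b ℕₚ.<? a) b<a) (𝟙-yes (suc a ℕ.* suc a ℕ.+ suc b ℕ.* suc b ℕₚ.≤? t) in-circle)))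
      where
      b = j ℕ.+ i ℕ.* α
      b≤ : suc b ℕ.≤ suc i ℕ.* α
      b≤ = ℕₚ.+-monoˡ-≤ (i ℕ.* α) j<α
      b<a : b ℕ.< a
      b<a = ℕₚ.≤-trans b≤ (ℕₚ.≤-trans (ℕₚ.*-monoˡ-≤ α i<G) (block-small a))
      Gb≤ : suc b ℕ.* G ℕ.≤ suc i ℕ.* suc a
      Gb≤ = ℕₚ.≤-trans (ℕₚ.*-monoˡ-≤ G b≤) (ℕₚ.≤-trans (ℕₚ.≤-reflexive (trans (ℕₚ.*-assoc (suc i) α G) (cong (suc i ℕ.*_) (ℕₚ.*-comm α G))))
        (ℕₚ.*-monoʳ-≤ (suc i) (ℕₚ.≤-trans (block-small a) (ℕₚ.n≤1+n a))))
      in-circle : suc a ℕ.* suc a ℕ.+ suc b ℕ.* suc b ℕ.≤ t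
      in-circle = ⟦⟧-cancel (*-cancel (⟦ G ⟧ * ⟦ G ⟧) (⟦⟧>0 G≥1 ⊗< ⟦⟧>0 G≥1) (≤-trans
          (cert (diff≥0 (*-mono (⟦⟧≥0 (suc b ℕ.* G)) (⟦⟧≥0 (suc b ℕ.* G)) (⟦⟧-mono Gb≤) (⟦⟧-mono Gb≤)) ⊕ diff≥0 (⟦⟧-mono f))
            (trans (lem ⟦ suc a ⟧ ⟦ suc b ⟧ ⟦ suc i ⟧ ⟦ G ⟧ ⟦ t ⟧)
              (trans (cong (λ s → ⟦ G ⟧ * ⟦ G ⟧ * s + (⟦ suc i ⟧ * ⟦ suc a ⟧ * (⟦ suc i ⟧ * ⟦ suc a ⟧) - ⟦ suc b ⟧ * ⟦ G ⟧ * (⟦ suc b ⟧ * ⟦ G ⟧) + (⟦ t ⟧ * (⟦ G ⟧ * ⟦ G ⟧) - ⟦ suc a ⟧ * ⟦ suc a ⟧ * (⟦ G ⟧ * ⟦ G ⟧ + ⟦ suc i ⟧ * ⟦ suc i ⟧))))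
                  (sym (trans (⟦⟧-+ (suc a ℕ.* suc a) (suc b ℕ.* suc b)) (cong₂ _+_ (⟦⟧-* (suc a) (suc a)) (⟦⟧-* (suc b) (suc b))))))
                (cong₂ (λ s u → ⟦ G ⟧ * ⟦ G ⟧ * ⟦ suc a ℕ.* suc a ℕ.+ suc b ℕ.* suc b ⟧ + (s + u))
                  (sym (cong₂ _-_ (cong₂ _*_ (⟦⟧-* (suc i) (suc a)) (⟦⟧-* (suc i) (suc a))) (cong₂ _*_ (⟦⟧-* (suc b) G) (⟦⟧-* (suc b) G))))
                  (sym (cong₂ _-_ (⟦fits⟧ʳ t) (⟦fits⟧ i (suc a))))))))
          ≤-refl))
        where
        lem : ∀ a b i g t → g * g * t ≡ g * g * (a * a + b * b) + (i * a * (i * a) - b * g * (b * g) + (t * (g * g) - a * a * (g * g + i * i)))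
        lem = solve-∀ ring

  -- Σ_{a<X} ⌊a/G⌋ against X²/2G, where X is the length of the ray of slope class i in the disc.
  ray : ∀ r t i l l' → t ℕ.< r ℕ.* r → l * l' ≡ 1ℚ → 0ℚ ≤ l' →
    ½ * (⟦ t ⟧ * weight i) - (⟦ G ⟧ + 2ℚ) * (½ * (l + l' * ⟦ t ⟧) + 1ℚ) ≤ ⟦ G ⟧ * (∑[ a ← below r ] ⟦ block a ⟧ * 𝟙 (fits? t i (suc a)))
  ray r t i l l' t<r² e l'≥0 with threshold (fits t i) (fits? t i) z≤n r too-big
    where
    too-big : ¬ fits t i r
    too-big f = ℕₚ.<⇒≱ t<r² (ℕₚ.*-cancelʳ-≤ (r ℕ.* r) t (G ℕ.* G) {{ℕₚ.m*n≢0 G G}} (ℕₚ.≤-trans (ℕₚ.*-monoʳ-≤ (r ℕ.* r) (ℕₚ.m≤m+n (G ℕ.* G) _)) f))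
  ... | X , X<r , fit , ¬fit = ≤-trans (≤-trans
      (cert (0≤½ ⊗ diff≥0 long ⊕ (⟦⟧≥0 G ⊕ 0≤2) ⊗ diff≥0 X≤ ⊕ (0≤½ ⊗ ⟦⟧≥0 X ⊕ ⟦⟧≥0 G ⊕ 0≤1 ⊕ 0≤½)) (lem ⟦ t ⟧ (weight i) ⟦ G ⟧ ⟦ X ⟧ l l'))
      (≤-reflexive sum))
    (≤-trans (∑-below-mono X {λ a → ⟦ a ⟧ - ⟦ G ⟧} {λ a → ⟦ G ⟧ * (⟦ block a ⟧ * 𝟙 (fits? t i (suc a)))} λ a a<X → ≤-trans (block-large a)
        (≤-reflexive (cong (λ s → ⟦ G ⟧ * s) (sym (trans (cong (λ s → ⟦ block a ⟧ * s) (𝟙-yes (fits? t i (suc a)) (fits-anti t i a<X fit))) (ℚₚ.*-identityʳ ⟦ block a ⟧))))))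
      (≤-trans (≤-reflexive (∑-* (below X) ⟦ G ⟧ _))
        (*-monoˡ ⟦ G ⟧ (⟦⟧≥0 G) (∑-below-≤ (λ a → ⟦ block a ⟧ * 𝟙 (fits? t i (suc a))) (λ a → ⟦⟧≥0 (block a) ⊗ 𝟙≥0 (fits? t i (suc a))) (ℕₚ.<⇒≤ X<r)))))
    where
    D = ⟦ G ⟧ * ⟦ G ⟧ + ⟦ suc i ⟧ * ⟦ suc i ⟧
    long : ⟦ t ⟧ * weight i ≤ (1ℚ + ⟦ X ⟧) * (1ℚ + ⟦ X ⟧)
    long = cert (diff≥0 beyond ⊗ <⇒≤ (⁻¹-pos (den>0 i)) ⊕ ≡⇒0≤ ((1ℚ + ⟦ X ⟧) * (1ℚ + ⟦ X ⟧)) (sym (⁻¹-inverse (den>0 i))))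
      (lem' ⟦ t ⟧ (⟦ G ⟧ * ⟦ G ⟧) D (D ⁻¹) ((1ℚ + ⟦ X ⟧) * (1ℚ + ⟦ X ⟧)))
      where
      beyond : ⟦ t ⟧ * (⟦ G ⟧ * ⟦ G ⟧) ≤ ⟦ suc X ⟧ * ⟦ suc X ⟧ * D
      beyond = subst₂ _≤_ (⟦fits⟧ʳ t) (⟦fits⟧ i (suc X)) (⟦⟧-mono (ℕₚ.<⇒≤ (ℕₚ.≰⇒> ¬fit)))
      lem' : ∀ t g d d' x → x ≡ t * (g * d') + ((x * d - t * g) * d' + x * (1ℚ - d * d'))
      lem' = solve-∀ ring
    X²≤t : ⟦ X ⟧ * ⟦ X ⟧ ≤ ⟦ t ⟧
    X²≤t = ≤-trans (≤-reflexive (sym (⟦⟧-* X X))) (⟦⟧-mono (ℕₚ.*-cancelʳ-≤ (X ℕ.* X) t (G ℕ.* G) {{ℕₚ.m*n≢0 G G}}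
      (ℕₚ.≤-trans (ℕₚ.*-monoʳ-≤ (X ℕ.* X) (ℕₚ.m≤m+n (G ℕ.* G) _)) fit)))
    X≤ : ⟦ X ⟧ ≤ ½ * (l + l' * ⟦ t ⟧)
    X≤ = cert (0≤½ ⊗ (diff≥0 (am-gm ⟦ X ⟧ l l' e l'≥0) ⊕ l'≥0 ⊗ diff≥0 X²≤t)) (lem' ⟦ X ⟧ l l' ⟦ t ⟧)
      where
      lem' : ∀ x l l' t → ½ * (l + l' * t) ≡ x + ½ * (l + l' * (x * x) - (x + x) + l' * (t - x * x))
      lem' = solve-∀ ring
    lem : ∀ t w g x l l' → ½ * (x * x - x) - g * x ≡ ½ * (t * w) - (g + 2ℚ) * (½ * (l + l' * t) + 1ℚ)
      + (½ * ((1ℚ + x) * (1ℚ + x) - t * w) + (g + 2ℚ) * (½ * (l + l' * t) - x) + (½ * x + g + 1ℚ + ½))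
    lem = solve-∀ ring
    sum : ½ * (⟦ X ⟧ * ⟦ X ⟧ - ⟦ X ⟧) - ⟦ G ⟧ * ⟦ X ⟧ ≡ ∑[ a ← below X ] (⟦ a ⟧ - ⟦ G ⟧)
    sum = trans (cong₂ (λ s u → ½ * s - u) (sym (∑-below-id X)) (trans (ℚₚ.*-comm ⟦ G ⟧ ⟦ X ⟧) (sym (∑-below-const X ⟦ G ⟧))))
      (trans (cong (λ s → s - ∑[ a ← below X ] ⟦ G ⟧) (lem' (∑[ a ← below X ] ⟦ a ⟧))) (sym (∑-− (below X) ⟦_⟧ (λ _ → ⟦ G ⟧))))
      where
      lem' : ∀ s → ½ * (2ℚ * s) ≡ s
      lem' = solve-∀ ring

  -- A Riemann sum of 1/(1 + x²) over [0, 1] at the right end points of G cells, hence close to π/4.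
  grid : ℚ
  grid = ⟦ G ⟧ ⁻¹ * ∑ (below G) weight

  G⁻¹≥0 : 0ℚ ≤ ⟦ G ⟧ ⁻¹
  G⁻¹≥0 = <⇒≤ (⁻¹-pos (⟦⟧>0 G≥1))

  G⁻¹ : ⟦ G ⟧ * ⟦ G ⟧ ⁻¹ ≡ 1ℚ
  G⁻¹ = ⁻¹-inverse (⟦⟧>0 G≥1)

  octant-bound : ∀ r t l l' → t ℕ.< r ℕ.* r → l * l' ≡ 1ℚ → 0ℚ ≤ l' →
    ½ * (⟦ t ⟧ * grid) - (⟦ G ⟧ + 2ℚ) * (½ * (l + l' * ⟦ t ⟧) + 1ℚ) ≤ octant r t
  octant-bound r t l l' h e l'≥0 = *-cancel ⟦ G ⟧ (⟦⟧>0 G≥1) (≤-trans (≤-reflexive expand)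
      (≤-trans (∑-mono (below G) λ i → ray r t i l l' h e l'≥0)
        (≤-trans (≤-reflexive (trans (∑-* (below G) ⟦ G ⟧ _) (cong (λ s → ⟦ G ⟧ * s) (trans (∑-swap (below G) (below r) _) (∑-cong (below r) λ a → ∑-* (below G) ⟦ block a ⟧ _)))))
          (*-monoˡ ⟦ G ⟧ (⟦⟧≥0 G) (∑-below-mono r λ a a<r → column r t a (ℕₚ.<⇒≤ a<r))))))
    where
    K = (⟦ G ⟧ + 2ℚ) * (½ * (l + l' * ⟦ t ⟧) + 1ℚ)
    lem : ∀ g g' t W k → g * (½ * (t * (g' * W)) - k) ≡ ½ * t * W * (g * g') - g * k
    lem = solve-∀ ring
    lem₂ : ∀ t W k → ½ * t * W * 1ℚ - k ≡ ½ * t * W - k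
    lem₂ = solve-∀ ring
    expand : ⟦ G ⟧ * (½ * (⟦ t ⟧ * grid) - K) ≡ ∑[ i ← below G ] (½ * (⟦ t ⟧ * weight i) - K)
    expand = trans (lem ⟦ G ⟧ (⟦ G ⟧ ⁻¹) ⟦ t ⟧ (∑ (below G) weight) K) (trans (cong (λ s → ½ * ⟦ t ⟧ * ∑ (below G) weight * s - ⟦ G ⟧ * K) G⁻¹)
      (trans (lem₂ ⟦ t ⟧ (∑ (below G) weight) (⟦ G ⟧ * K))
        (sym (trans (∑-− (below G) _ _) (cong₂ _-_ (trans (∑-cong (below G) λ i → sym (ℚₚ.*-assoc ½ ⟦ t ⟧ (weight i))) (∑-* (below G) (½ * ⟦ t ⟧) weight)) (∑-below-const G K))))))

  circle-bound : ∀ r t l l' → t ℕ.< r ℕ.* r → l * l' ≡ 1ℚ → 0ℚ ≤ l' →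
    (⟦ 4 ⟧ * grid - ⟦ 4 ⟧ * (⟦ G ⟧ + 2ℚ) * l') * ⟦ t ⟧ ≤ circle r t + 8ℚ * (⟦ G ⟧ + 2ℚ) * (½ * l + 1ℚ)
  circle-bound r t l l' h e l'≥0 = cert (⟦⟧≥0 8 ⊗ diff≥0 (octant-bound r t l l' h e l'≥0) ⊕ diff≥0 (octants r t))
    (lem grid (⟦ G ⟧ + 2ℚ) l l' ⟦ t ⟧ (circle r t) (octant r t))
    where
    lem : ∀ g G l l' t c o → c + 8ℚ * G * (½ * l + 1ℚ) ≡ (⟦ 4 ⟧ * g - ⟦ 4 ⟧ * G * l') * t + (8ℚ * (o - (½ * (t * g) - G * (½ * (l + l' * t) + 1ℚ))) + (c - 8ℚ * o))
    lem = solve-∀ ring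

  node : ℕ → ℚ
  node i = ⟦ suc i ⟧ * ⟦ G ⟧ ⁻¹

  node≥0 : ∀ i → 0ℚ ≤ node i
  node≥0 i = ⟦⟧≥0 (suc i) ⊗ G⁻¹≥0

  -- Leibniz's alternating sum Σ_{j≤2m+1} (-1)^j t^{2j}, grouped in pairs.
  leibniz : ℕ → ℚ → ℚ
  leibniz zero t    = 1ℚ - t * t
  leibniz (suc m) t = leibniz m t + (t ^ℚ (4 ℕ.* suc m) - t ^ℚ suc (suc (4 ℕ.* suc m)))

  leibniz-sum : ∀ m t → (1ℚ + t * t) * leibniz m t ≡ 1ℚ - t ^ℚ (4 ℕ.* suc m)
  leibniz-sum zero t    = lem t
    where
    lem : ∀ t → (1ℚ + t * t) * (1ℚ - t * t) ≡ 1ℚ - t * (t * (t * (t * 1ℚ)))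
    lem = solve-∀ ring
  leibniz-sum (suc m) t = trans (ℚₚ.*-distribˡ-+ (1ℚ + t * t) (leibniz m t) _) (trans (cong (λ s → s + (1ℚ + t * t) * (p - t * (t * p))) (leibniz-sum m t))
      (trans (lem t p) (cong (λ e → 1ℚ - t ^ℚ e) (sym (ℕₚ.*-suc 4 (suc m))))))
    where
    p = t ^ℚ (4 ℕ.* suc m)
    lem : ∀ t p → 1ℚ - p + (1ℚ + t * t) * (p - t * (t * p)) ≡ 1ℚ - t * (t * (t * (t * p)))
    lem = solve-∀ ring

  weight-node : ∀ i → (1ℚ + node i * node i) * weight i ≡ 1ℚ
  weight-node i = trans (lem ⟦ suc i ⟧ (⟦ G ⟧ ⁻¹) ⟦ G ⟧ (D ⁻¹)) (trans (cong (λ u → (⟦ G ⟧ * ⟦ G ⟧ + ⟦ suc i ⟧ * ⟦ suc i ⟧ * (u * u)) * D ⁻¹) G⁻¹)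
      (trans (lem₂ ⟦ G ⟧ ⟦ suc i ⟧ (D ⁻¹)) (⁻¹-inverse (den>0 i))))
    where
    D = ⟦ G ⟧ * ⟦ G ⟧ + ⟦ suc i ⟧ * ⟦ suc i ⟧
    lem : ∀ s g' g d' → (1ℚ + s * g' * (s * g')) * (g * g * d') ≡ (g * g + s * s * ((g * g') * (g * g'))) * d'
    lem = solve-∀ ring
    lem₂ : ∀ g s d' → (g * g + s * s * (1ℚ * 1ℚ)) * d' ≡ (g * g + s * s) * d'
    lem₂ = solve-∀ ring

  leibniz≤weight : ∀ m i → leibniz m (node i) ≤ weight i
  leibniz≤weight m i = *-cancel (1ℚ + node i * node i) (subst (0ℚ <_) (ℚₚ.+-comm (node i * node i) 1ℚ) (sq≥0 (node i) ⊕< 0<1))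
    (≤-trans (≤-reflexive (leibniz-sum m (node i))) (≤-trans (cert (^-nonneg (4 ℕ.* suc m) (node≥0 i)) (lem (node i ^ℚ (4 ℕ.* suc m)))) (≤-reflexive (sym (weight-node i)))))
    where
    lem : ∀ p → 1ℚ ≡ 1ℚ - p + p
    lem = solve-∀ ring

  power-sum : ℕ → ℚ
  power-sum e = ⟦ G ⟧ ⁻¹ * (∑[ i ← below G ] node i ^ℚ e)

  g : ℚ
  g = ⟦ G ⟧ ⁻¹

  -- Riemann sum of t^e against its integral 1/(e + 1): telescope (n/G)^(e+1) and bound each
  -- increment by the derivative at the right end. The upper bound uses left ends and loses one
  -- cell.
  power-sum-lower : ∀ e → inv e ≤ power-sum e
  power-sum-lower e = *-cancel ⟦ suc e ⟧ (⟦suc⟧>0 e) (≤-trans (≤-reflexive (trans (inv-def e) (sym (trans (cong (_^ℚ suc e) G⁻¹) (1^ (suc e))))))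
      (≤-trans (partial G) (≤-reflexive (lem ⟦ suc e ⟧ g (∑[ i ← below G ] node i ^ℚ e)))))
    where
    lem : ∀ s g x → s * g * x ≡ s * (g * x)
    lem = solve-∀ ring
    partial : ∀ n → (⟦ n ⟧ * g) ^ℚ suc e ≤ ⟦ suc e ⟧ * g * (∑[ i ← below n ] node i ^ℚ e)
    partial zero = ≤-reflexive (trans (cong (_^ℚ suc e) (ℚₚ.*-zeroˡ g)) (trans (0^suc e) (sym (ℚₚ.*-zeroʳ (⟦ suc e ⟧ * g)))))
    partial (suc n) = cert (diff≥0 (partial n) ⊕ diff≥0 (pow-diff e (⟦⟧≥0 n ⊗ G⁻¹≥0) (*-monoʳ g G⁻¹≥0 (⟦⟧-mono (ℕₚ.n≤1+n n)))))
      (lem' ⟦ suc e ⟧ g (node n ^ℚ e) (∑[ i ← below n ] node i ^ℚ e) ⟦ n ⟧ ((⟦ n ⟧ * g) ^ℚ e))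
      where
      lem' : ∀ s g p x n q → s * g * (p + x) ≡ (1ℚ + n) * g * p + (s * g * x - n * g * q + (s * ((1ℚ + n) * g - n * g) * p - ((1ℚ + n) * g * p - n * g * q)))
      lem' = solve-∀ ring

  power-sum-upper : ∀ e → power-sum e ≤ inv e + g
  power-sum-upper e = *-cancel ⟦ suc e ⟧ (⟦suc⟧>0 e) (≤-trans (≤-reflexive (sym (lem ⟦ suc e ⟧ g (∑[ i ← below G ] node i ^ℚ e))))
      (≤-trans (partial G) (≤-reflexive (trans (cong (λ u → u ^ℚ suc e + ⟦ suc e ⟧ * g * (u ^ℚ e)) G⁻¹)
        (trans (cong₂ (λ u v → u + ⟦ suc e ⟧ * g * v) (1^ (suc e)) (1^ e)) (trans (cong (λ u → u + ⟦ suc e ⟧ * g * 1ℚ) (sym (inv-def e))) (lem₂ ⟦ suc e ⟧ (inv e) g)))))))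
    where
    lem : ∀ s g x → s * g * x ≡ s * (g * x)
    lem = solve-∀ ring
    lem₂ : ∀ s i g → s * i + s * g * 1ℚ ≡ s * (i + g)
    lem₂ = solve-∀ ring
    partial : ∀ n → ⟦ suc e ⟧ * g * (∑[ i ← below n ] node i ^ℚ e) ≤ (⟦ n ⟧ * g) ^ℚ suc e + ⟦ suc e ⟧ * g * (⟦ n ⟧ * g) ^ℚ e
    partial zero = ≤-trans (≤-reflexive (ℚₚ.*-zeroʳ (⟦ suc e ⟧ * g))) (^-nonneg (suc e) (⟦⟧≥0 0 ⊗ G⁻¹≥0) ⊕ ⟦⟧≥0 (suc e) ⊗ G⁻¹≥0 ⊗ ^-nonneg e (⟦⟧≥0 0 ⊗ G⁻¹≥0))
    partial (suc n) = cert (diff≥0 (partial n) ⊕ diff≥0 (pow-diff≥ e (⟦⟧≥0 n ⊗ G⁻¹≥0) (*-monoʳ g G⁻¹≥0 (⟦⟧-mono (ℕₚ.n≤1+n n)))))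
      (lem' ⟦ suc e ⟧ g (node n ^ℚ e) (∑[ i ← below n ] node i ^ℚ e) ⟦ n ⟧ ((⟦ n ⟧ * g) ^ℚ e))
      where
      lem' : ∀ s g p x n q → (1ℚ + n) * g * p + s * g * p ≡ s * g * (p + x) + (n * g * q + s * g * q - s * g * x + ((1ℚ + n) * g * p - n * g * q - s * ((1ℚ + n) * g - n * g) * q))
      lem' = solve-∀ ring

  -- Termwise integration of the Leibniz sum, which lies below 1/(1 + x²); each of the m + 1 pairs
  -- costs at most one cell.
  leibniz-grid : ∀ m → pairs m ≤ grid + ⟦ suc m ⟧ * g
  leibniz-grid m = ≤-trans (pairs≤ m) (ℚₚ.+-monoˡ-≤ (⟦ suc m ⟧ * g) (*-monoˡ g G⁻¹≥0 (∑-mono (below G) (leibniz≤weight m))))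
    where
    pair : ∀ e → inv e - inv (suc (suc e)) - g ≤ g * (∑[ i ← below G ] (node i ^ℚ e - node i ^ℚ suc (suc e)))
    pair e = ≤-trans (cert (diff≥0 (power-sum-lower e) ⊕ diff≥0 (power-sum-upper (suc (suc e)))) (lem (inv e) (inv (suc (suc e))) g (power-sum e) (power-sum (suc (suc e)))))
        (≤-reflexive (trans (lem₂ g _ _) (cong (λ u → g * u) (sym (∑-− (below G) _ _)))))
      where
      lem : ∀ a b g p q → p - q ≡ a - b - g + (p - a + (b + g - q))
      lem = solve-∀ ring
      lem₂ : ∀ g x y → g * x - g * y ≡ g * (x - y)
      lem₂ = solve-∀ ring
    pairs≤ : ∀ m → pairs m ≤ g * (∑[ i ← below G ] leibniz m (node i)) + ⟦ suc m ⟧ * g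
    pairs≤ zero    = ≤-trans (cert (diff≥0 (pair 0)) (lem (inv 0 - inv 2) g (g * (∑[ i ← below G ] (node i ^ℚ 0 - node i ^ℚ 2)))))
        (≤-reflexive (cong (λ u → g * u + ⟦ 1 ⟧ * g) (∑-cong (below G) λ i → cong (λ u → 1ℚ - node i * u) (ℚₚ.*-identityʳ (node i)))))
      where
      lem : ∀ a g x → x + (1ℚ + 0ℚ) * g ≡ a + (x - (a - g))
      lem = solve-∀ ring
    pairs≤ (suc m) = ≤-trans (cert (diff≥0 (pairs≤ m) ⊕ diff≥0 (pair (4 ℕ.* suc m)))
          (lem (pairs m) (inv (4 ℕ.* suc m) - inv (suc (suc (4 ℕ.* suc m)))) g (∑[ i ← below G ] leibniz m (node i)) (∑[ i ← below G ] (node i ^ℚ (4 ℕ.* suc m) - node i ^ℚ suc (suc (4 ℕ.* suc m)))) ⟦ suc m ⟧))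
        (≤-reflexive (cong (λ u → g * u + ⟦ suc (suc m) ⟧ * g) (sym (∑-+ (below G) _ _))))
      where
      lem : ∀ p a g x y m → g * (x + y) + (1ℚ + m) * g ≡ p + a + (g * x + m * g - p + (g * y - (a - g)))
      lem = solve-∀ ring

-- A lower bound p for the lattice points per unit area of a disc that is also, up to 12/(E+1), an upper bound for Leibniz's π.
pi-circle : ∀ E → ∃[ p ] ∃[ C ] (0ℚ ≤ C × (∀ r t → t ℕ.< r ℕ.* r → p * ⟦ t ⟧ ≤ circle r t + C) × (∀ m → piLower m ≤ p + ⟦ 12 ⟧ * inv E))
pi-circle E = p , 8ℚ * (⟦ G ⟧ + 2ℚ) * (½ * l + 1ℚ) , ⟦⟧≥0 8 ⊗ <⇒≤ G+2>0 ⊗ (0≤½ ⊗ (⟦⟧≥0 (suc E) ⊗ <⇒≤ G+2>0) ⊕ 0≤1) ,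
    (λ r t h → circle-bound r t l l' h l-inv (inv≥0 E ⊗ <⇒≤ (⁻¹-pos G+2>0))) , upper
  where
  -- With the square, E + 1 pairs at one cell 1/G each cost 1/(E + 1). The 12 is 4 times three
  -- errors of at most this size: the cells, the tail of the series and the scale `l'`.
  G = suc E ℕ.* suc E
  open Circle G (s≤s z≤n)
  G+2>0 : 0ℚ < ⟦ G ⟧ + 2ℚ
  G+2>0 = ⟦⟧≥0 G ⊕< (0≤1 ⊕< 0<1)
  G+2 = ⟦ G ⟧ + 2ℚ
  l = ⟦ suc E ⟧ * G+2
  l' = inv E * G+2 ⁻¹
  p = ⟦ 4 ⟧ * grid - ⟦ 4 ⟧ * G+2 * l'
  l-inv : l * l' ≡ 1ℚ
  l-inv = trans (lem ⟦ suc E ⟧ G+2 (inv E) (G+2 ⁻¹)) (cong₂ _*_ (inv-def E) (⁻¹-inverse G+2>0))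
    where
    lem : ∀ e g i j → e * g * (i * j) ≡ e * i * (g * j)
    lem = solve-∀ ring
  cell : ⟦ suc E ⟧ * g ≡ inv E
  cell = trans (lem ⟦ suc E ⟧ g (inv E)) (trans (cong₂ (λ u v → ⟦ suc E ⟧ * g * (1ℚ - u) + v * inv E) (inv-def E) (trans (cong (λ u → u * g) (sym (⟦⟧-* (suc E) (suc E)))) G⁻¹)) (lem₂ (⟦ suc E ⟧ * g) (inv E)))
    where
    lem : ∀ e g i → e * g ≡ e * g * (1ℚ - e * i) + e * e * g * i
    lem = solve-∀ ring
    lem₂ : ∀ x i → x * (1ℚ - 1ℚ) + 1ℚ * i ≡ i
    lem₂ = solve-∀ ring
  upper : ∀ m → piLower m ≤ p + ⟦ 12 ⟧ * inv E
  upper m = ≤-trans (≤-reflexive (pi-pairs m)) (cert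
      (⟦⟧≥0 4 ⊗ (diff≥0 (pairs-uniform m E) ⊕ diff≥0 (leibniz-grid E) ⊕ ≡⇒0≤ 1ℚ (sym cell) ⊕ diff≥0 (inv-anti {E} {4 ℕ.* suc E} (ℕₚ.≤-trans (ℕₚ.n≤1+n E) (ℕₚ.m≤m+n (suc E) _)))) ⊕ ≡⇒0≤ (⟦ 4 ⟧ * inv E) (sym (⁻¹-inverse G+2>0)))
    (lem (pairs m) (pairs E) (inv (4 ℕ.* suc E)) grid (⟦ suc E ⟧ * g) (inv E) G+2 (G+2 ⁻¹)))
    where
    lem : ∀ a b c g e i G j → ⟦ 4 ⟧ * g - ⟦ 4 ⟧ * G * (i * j) + ⟦ 12 ⟧ * i ≡ ⟦ 4 ⟧ * a + (⟦ 4 ⟧ * (b + c - a + (g + e - b) + 1ℚ * (i - e) + (i - c)) + ⟦ 4 ⟧ * i * (1ℚ - G * j))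
    lem = solve-∀ ring

-- The mass of the bump and the recursion for the volume of the ball.

module Volume (r : ℕ) (r≥1 : 1 ℕ.≤ r) where

  open Profile 0 r r≥1 using (ρ; ρ⁻¹; ρ>0; ρρ⁻¹; ρ⁻¹≥0)
  open Moment ρ⁻¹ ρ⁻¹≥0

  r⁻¹ : ℚ
  r⁻¹ = ⟦ r ⟧ ⁻¹

  r⁻¹≥0 : 0ℚ ≤ r⁻¹
  r⁻¹≥0 = <⇒≤ (⁻¹-pos (⟦⟧>0 r≥1))

  rr⁻¹ : ⟦ r ⟧ * r⁻¹ ≡ 1ℚ
  rr⁻¹ = ⁻¹-inverse (⟦⟧>0 r≥1)

  -- `β` cancels the mean of the bump over the ball, so `V d k` approximates ω_d r^d whatever k is.
  S V : ℕ → ℕ → ℚ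
  S d k = ∑[ x ← box d r ] trunc 1ℚ (normSq x) ^ℚ k
  V d k = β d k * S d k

  trunc-∸ : ∀ m → trunc 1ℚ m ≡ ⟦ r ℕ.* r ℕ.∸ m ⟧ * ρ⁻¹
  trunc-∸ m with ℕₚ.≤-total m (r ℕ.* r)
  ... | inj₁ h = trans (⊔0-pos (subst (0ℚ ≤_) value (⟦⟧≥0 (r ℕ.* r ℕ.∸ m) ⊗ ρ⁻¹≥0))) (sym value)
    where
    lem : ∀ a m i → (a - m) * i ≡ a * i - m * i
    lem = solve-∀ ring
    value : ⟦ r ℕ.* r ℕ.∸ m ⟧ * ρ⁻¹ ≡ 1ℚ - ⟦ m ⟧ * ρ⁻¹
    value = trans (cong (λ t → t * ρ⁻¹) (⟦⟧-∸ h)) (trans (lem ⟦ r ℕ.* r ⟧ ⟦ m ⟧ ρ⁻¹) (cong (λ t → t - ⟦ m ⟧ * ρ⁻¹) (trans (cong (λ t → t * ρ⁻¹) (⟦⟧-* r r)) ρρ⁻¹)))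
  ... | inj₂ h = trans (⊔0-neg {1ℚ - ⟦ m ⟧ * ρ⁻¹} (cert (diff≥0 (≤-trans (≤-reflexive (sym (⟦⟧-* r r))) (⟦⟧-mono h)) ⊗ ρ⁻¹≥0 ⊕ ≡⇒0≤ 1ℚ ρρ⁻¹) (lem ⟦ m ⟧ ρ ρ⁻¹)))
      (sym (trans (cong (λ t → ⟦ t ⟧ * ρ⁻¹) (ℕₚ.m≤n⇒m∸n≡0 h)) (ℚₚ.*-zeroˡ ρ⁻¹)))
    where
    lem : ∀ n r i → 0ℚ ≡ 1ℚ - n * i + ((n - r) * i + 1ℚ * (r * i - 1ℚ))
    lem = solve-∀ ring

  ∑-range-1 : ∀ B → ∑[ z ← range B ] 1ℚ ≡ 1ℚ + 2ℚ * ⟦ B ⟧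
  ∑-range-1 B = trans (∑-range-abs B (λ _ → 1ℚ)) (cong (λ t → 1ℚ + 2ℚ * t) (trans (∑-below-const B 1ℚ) (ℚₚ.*-identityʳ ⟦ B ⟧)))

  S≤ : ∀ d k → S d k ≤ ⟦ 3 ⟧ ^ℚ d * ⟦ r ⟧ ^ℚ d
  S≤ d k = ≤-trans (∑-mono (box d r) λ x → ^≤1 k (trunc≥0 1ℚ (normSq x)) (Profile.s≤1 d r r≥1 x)) (≤-trans (count d) (≤-reflexive (^-distrib-* ⟦ 3 ⟧ ⟦ r ⟧ d)))
    where
    lem : ∀ r → ⟦ 3 ⟧ * r ≡ 1ℚ + 2ℚ * r + (r - 1ℚ)
    lem = solve-∀ ring
    count : ∀ d → ∑[ x ← box d r ] 1ℚ ≤ (⟦ 3 ⟧ * ⟦ r ⟧) ^ℚ d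
    count zero    = ≤-refl
    count (suc d) = ≤-trans (≤-reflexive (trans (∑-box-suc r (λ _ → 1ℚ)) (trans (∑-cong (range r) λ _ → sym (ℚₚ.*-identityʳ (∑[ x ← box d r ] 1ℚ))) (∑-* (range r) (∑[ x ← box d r ] 1ℚ) (λ _ → 1ℚ)))))
      (≤-trans (*-mono (∑-nonneg (box d r) λ _ → 0≤1) (∑-nonneg (range r) λ _ → 0≤1) (count d) (≤-trans (≤-reflexive (∑-range-1 r)) (cert (diff≥0 (⟦⟧-mono r≥1)) (lem ⟦ r ⟧))))
        (≤-reflexive (ℚₚ.*-comm ((⟦ 3 ⟧ * ⟦ r ⟧) ^ℚ d) (⟦ 3 ⟧ * ⟦ r ⟧))))

  module Layers (p C : ℚ) (p≥0 : 0ℚ ≤ p) (C≥0 : 0ℚ ≤ C) (disc : ∀ t → t ℕ.< r ℕ.* r → p * ⟦ t ⟧ ≤ circle r t + C) where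

    module _ (k : ℕ) where

      h : ℕ → ℚ
      h n = ⟦ n ⟧ ^ℚ suc k

      h-mono : ∀ {m n} → m ℕ.≤ n → h m ≤ h n
      h-mono {m} m≤n = ^-mono (suc k) (⟦⟧≥0 m) (⟦⟧-mono m≤n)

      Δ : ℕ → ℕ → ℚ
      Δ τ j = h (τ ℕ.∸ j) - h (τ ℕ.∸ suc j)

      -- The increments at levels j ≥ q telescope. Taking for q the squared norm of a plane vector
      -- turns radial sums over the plane into sums of `circle`.
      layer-cake : ∀ τ q → ∑[ j ← below τ ] Δ τ j * 𝟙 (q ℕₚ.≤? j) ≡ h (τ ℕ.∸ q)
      layer-cake zero q    = sym (trans (cong h (ℕₚ.0∸n≡0 q)) (0^suc k))
      layer-cake (suc τ) zero = trans (∑-below-front τ (λ j → Δ (suc τ) j * 𝟙 (0 ℕₚ.≤? j))) (trans (cong (λ t → (h (suc τ) - h τ) * 1ℚ + t) (layer-cake τ zero)) (lem (h (suc τ)) (h τ)))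
        where
        lem : ∀ a b → (a - b) * 1ℚ + b ≡ a
        lem = solve-∀ ring
      layer-cake (suc τ) (suc q) = trans (∑-below-front τ (λ j → Δ (suc τ) j * 𝟙 (suc q ℕₚ.≤? j)))
          (trans (cong (λ t → (h (suc τ) - h τ) * 0ℚ + t) (trans (∑-cong (below τ) λ j → cong (λ t → Δ τ j * t) (shift j)) (layer-cake τ q))) (lem (h (suc τ)) (h τ) (h (τ ℕ.∸ q))))
        where
        lem : ∀ a b c → (a - b) * 0ℚ + c ≡ c
        lem = solve-∀ ring
        shift : ∀ j → 𝟙 (suc q ℕₚ.≤? suc j) ≡ 𝟙 (q ℕₚ.≤? j)
        shift j with q ℕₚ.≤? j
        ... | yes p = 𝟙-yes (suc q ℕₚ.≤? suc j) (s≤s p)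
        ... | no ¬p = 𝟙-no (suc q ℕₚ.≤? suc j) λ { (s≤s p) → ¬p p }

      -- By parts, the bracket is the sum of t^(k+1) over t ≤ τ, an upper Riemann sum for
      -- τ^(k+2)/(k+2).
      weighted : ∀ τ → ⟦ τ ⟧ ^ℚ suc (suc k) ≤ ⟦ suc (suc k) ⟧ * (∑[ j ← below τ ] Δ τ j * ⟦ j ⟧ + h τ)
      weighted zero    = ≤-trans (≤-reflexive (0^suc (suc k))) (⟦⟧≥0 (suc (suc k)) ⊗ (≤-refl {0ℚ} ⊕ ^-nonneg (suc k) (⟦⟧≥0 0)))
      weighted (suc τ) = ≤-trans (cert (diff≥0 (weighted τ) ⊕ diff≥0 (pow-diff (suc k) (⟦⟧≥0 τ) (⟦⟧-mono (ℕₚ.n≤1+n τ)))) (lem (⟦ suc τ ⟧ ^ℚ suc (suc k)) (⟦ τ ⟧ ^ℚ suc (suc k)) ⟦ suc (suc k) ⟧ E (h τ) (h (suc τ)) ⟦ τ ⟧))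
          (≤-reflexive (cong (λ t → ⟦ suc (suc k) ⟧ * (t + h (suc τ))) (sym peel)))
        where
        E = ∑[ j ← below τ ] Δ τ j * ⟦ j ⟧
        lem : ∀ A B c E a b t → c * (E + a + b) ≡ A + (c * (E + a) - B + (c * (1ℚ + t - t) * b - (A - B)))
        lem = solve-∀ ring
        lem₂ : ∀ a b → a * (1ℚ + b) ≡ a * b + a * 1ℚ
        lem₂ = solve-∀ ring
        lem₃ : ∀ a c → a * 0ℚ + c ≡ c
        lem₃ = solve-∀ ring
        peel : ∑[ j ← below (suc τ) ] Δ (suc τ) j * ⟦ j ⟧ ≡ E + h τ
        peel = trans (∑-below-front τ (λ j → Δ (suc τ) j * ⟦ j ⟧)) (trans (lem₃ (Δ (suc τ) 0) _)
          (trans (∑-cong (below τ) λ j → lem₂ (Δ τ j) ⟦ j ⟧) (trans (∑-+ (below τ) _ _) (cong (λ t → E + t) (layer-cake τ 0)))))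

      disc-sum : ∀ τ → τ ℕ.≤ r ℕ.* r → p * ⟦ τ ⟧ ^ℚ suc (suc k) ≤
        ⟦ suc (suc k) ⟧ * (∑[ y ← range r ] ∑[ z ← range r ] h (τ ℕ.∸ (ℤ.∣ y ∣ ℕ.* ℤ.∣ y ∣ ℕ.+ ℤ.∣ z ∣ ℕ.* ℤ.∣ z ∣)) + (C + p) * h τ)
      disc-sum τ τ≤ = cert (p≥0 ⊗ diff≥0 (weighted τ) ⊕ ⟦⟧≥0 (suc (suc k)) ⊗ diff≥0 slices) (lem p (⟦ τ ⟧ ^ℚ suc (suc k)) ⟦ suc (suc k) ⟧ (∑[ j ← below τ ] Δ τ j * ⟦ j ⟧) (h τ) D C)
        where
        D = ∑[ y ← range r ] ∑[ z ← range r ] h (τ ℕ.∸ (ℤ.∣ y ∣ ℕ.* ℤ.∣ y ∣ ℕ.+ ℤ.∣ z ∣ ℕ.* ℤ.∣ z ∣))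
        lem : ∀ p t c E h D C → c * (D + (C + p) * h) ≡ p * t + (p * (c * (E + h) - t) + c * (D - (p * E - C * h)))
        lem = solve-∀ ring
        slices : p * (∑[ j ← below τ ] Δ τ j * ⟦ j ⟧) - C * h τ ≤ D
        slices = ≤-trans (≤-reflexive (trans (cong₂ _-_ (sym (∑-* (below τ) p _)) (trans (cong (λ t → C * t) (sym (layer-cake τ 0))) (sym (∑-* (below τ) C _)))) (sym (∑-− (below τ) _ _))))
          (≤-trans (∑-below-mono τ {λ j → p * (Δ τ j * ⟦ j ⟧) - C * (Δ τ j * 𝟙 (0 ℕₚ.≤? j))} {λ j → Δ τ j * circle r j} slice) (≤-reflexive swap))
          where
          slice : ∀ j → j ℕ.< τ → p * (Δ τ j * ⟦ j ⟧) - C * (Δ τ j * 𝟙 (0 ℕₚ.≤? j)) ≤ Δ τ j * circle r j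
          slice j j<τ = cert (diff≥0 (h-mono (ℕₚ.∸-monoʳ-≤ τ (ℕₚ.n≤1+n j))) ⊗ diff≥0 (disc j (ℕₚ.≤-trans j<τ τ≤))) (lem' p (Δ τ j) ⟦ j ⟧ C (circle r j))
            where
            lem' : ∀ p d j C c → d * c ≡ p * (d * j) - C * (d * 1ℚ) + d * (c + C - p * j)
            lem' = solve-∀ ring
          swap : ∑[ j ← below τ ] Δ τ j * circle r j ≡ D
          swap = trans (∑-cong (below τ) λ j → trans (sym (∑-* (range r) (Δ τ j) _)) (∑-cong (range r) λ y → sym (∑-* (range r) (Δ τ j) _)))
            (trans (∑-swap (below τ) (range r) _) (∑-cong (range r) λ y → trans (∑-swap (below τ) (range r) _)
              (∑-cong (range r) λ z → layer-cake τ (ℤ.∣ y ∣ ℕ.* ℤ.∣ y ∣ ℕ.+ ℤ.∣ z ∣ ℕ.* ℤ.∣ z ∣))))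

      -- Integrates out two coordinates: in the continuum, (s - |y|²/ρ)^(k+1) over the disc |y|² ≤ s
      -- ρ has integral π ρ s^(k+2)/(k+2).
      fibre : ∀ n → p * ρ * trunc 1ℚ n ^ℚ suc (suc k) ≤
        ⟦ suc (suc k) ⟧ * (∑[ y ← range r ] ∑[ z ← range r ] trunc 1ℚ (ℤ.∣ y ∣ ℕ.* ℤ.∣ y ∣ ℕ.+ (ℤ.∣ z ∣ ℕ.* ℤ.∣ z ∣ ℕ.+ n)) ^ℚ suc k + (C + p) * trunc 1ℚ n ^ℚ suc k)
      fibre n = ≤-trans (≤-reflexive left) (≤-trans (*-monoʳ (ρ⁻¹ ^ℚ suc k) (^-nonneg (suc k) ρ⁻¹≥0) (disc-sum τ (ℕₚ.m∸n≤m (r ℕ.* r) n)))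
          (≤-reflexive (trans (lem ⟦ suc (suc k) ⟧ D (C + p) (h τ) (ρ⁻¹ ^ℚ suc k)) (cong₂ (λ s t → ⟦ suc (suc k) ⟧ * (s + (C + p) * t)) right (sym (power n))))))
        where
        τ = r ℕ.* r ℕ.∸ n
        D = ∑[ y ← range r ] ∑[ z ← range r ] h (τ ℕ.∸ (ℤ.∣ y ∣ ℕ.* ℤ.∣ y ∣ ℕ.+ ℤ.∣ z ∣ ℕ.* ℤ.∣ z ∣))
        lem : ∀ c D q h i → c * (D + q * h) * i ≡ c * (i * D + q * (h * i))
        lem = solve-∀ ring
        power : ∀ n → trunc 1ℚ n ^ℚ suc k ≡ h (r ℕ.* r ℕ.∸ n) * ρ⁻¹ ^ℚ suc k
        power n = trans (cong (_^ℚ suc k) (trunc-∸ n)) (^-distrib-* ⟦ r ℕ.* r ℕ.∸ n ⟧ ρ⁻¹ (suc k))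
        left : p * ρ * trunc 1ℚ n ^ℚ suc (suc k) ≡ p * ⟦ τ ⟧ ^ℚ suc (suc k) * ρ⁻¹ ^ℚ suc k
        left = trans (cong₂ (λ s t → p * ρ * (s * t)) (trunc-∸ n) (power n)) (trans (lem' p ρ ⟦ τ ⟧ ρ⁻¹ (h τ) (ρ⁻¹ ^ℚ suc k))
            (trans (cong (λ u → p * (⟦ τ ⟧ * h τ) * ρ⁻¹ ^ℚ suc k * u) ρρ⁻¹) (ℚₚ.*-identityʳ _)))
          where
          lem' : ∀ p r t i h j → p * r * (t * i * (h * j)) ≡ p * (t * h) * j * (r * i)
          lem' = solve-∀ ring
        right : ρ⁻¹ ^ℚ suc k * D ≡ ∑[ y ← range r ] ∑[ z ← range r ] trunc 1ℚ (ℤ.∣ y ∣ ℕ.* ℤ.∣ y ∣ ℕ.+ (ℤ.∣ z ∣ ℕ.* ℤ.∣ z ∣ ℕ.+ n)) ^ℚ suc k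
        right = trans (sym (∑-* (range r) (ρ⁻¹ ^ℚ suc k) _)) (∑-cong (range r) λ y → trans (sym (∑-* (range r) (ρ⁻¹ ^ℚ suc k) _)) (∑-cong (range r) λ z → point (ℤ.∣ y ∣ ℕ.* ℤ.∣ y ∣) (ℤ.∣ z ∣ ℕ.* ℤ.∣ z ∣)))
          where
          point : ∀ a b → ρ⁻¹ ^ℚ suc k * h (τ ℕ.∸ (a ℕ.+ b)) ≡ trunc 1ℚ (a ℕ.+ (b ℕ.+ n)) ^ℚ suc k
          point a b = trans (ℚₚ.*-comm (ρ⁻¹ ^ℚ suc k) _) (trans (cong (λ t → h t * ρ⁻¹ ^ℚ suc k)
            (trans (ℕₚ.∸-+-assoc (r ℕ.* r) n (a ℕ.+ b)) (cong (r ℕ.* r ℕ.∸_) (trans (ℕₚ.+-comm n (a ℕ.+ b)) (ℕₚ.+-assoc a b n))))) (sym (power (a ℕ.+ (b ℕ.+ n)))))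

      fibres : ∀ d → p * ρ * S d (suc (suc k)) ≤ ⟦ suc (suc k) ⟧ * (S (suc (suc d)) (suc k) + (C + p) * S d (suc k))
      fibres d = ≤-trans (≤-reflexive (sym (∑-* (box d r) (p * ρ) _))) (≤-trans (∑-mono (box d r) λ x → fibre (normSq x))
        (≤-reflexive (trans (∑-* (box d r) ⟦ suc (suc k) ⟧ _) (cong (λ t → ⟦ suc (suc k) ⟧ * t) (trans (∑-+ (box d r) _ _) (cong₂ _+_ plane (∑-* (box d r) (C + p) _)))))))
        where
        plane : ∑[ x ← box d r ] ∑[ y ← range r ] ∑[ z ← range r ] trunc 1ℚ (ℤ.∣ y ∣ ℕ.* ℤ.∣ y ∣ ℕ.+ (ℤ.∣ z ∣ ℕ.* ℤ.∣ z ∣ ℕ.+ normSq x)) ^ℚ suc k ≡ S (suc (suc d)) (suc k)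
        plane = trans (∑-swap (box d r) (range r) _) (sym (trans (∑-box-suc r (λ x → trunc 1ℚ (normSq x) ^ℚ suc k))
          (∑-cong (range r) λ y → trans (∑-box-suc r (λ x → trunc 1ℚ (normSq (y ∷ x)) ^ℚ suc k)) (∑-swap (range r) (box d r) _))))

-- Two more dimensions are worth one power of the bump, up to the factor 1 + d/2 that produces 2/(d
-- + 2) in the recursion.
β-shift : ∀ d k → β (suc (suc d)) k * (1ℚ + ½ * ⟦ d ⟧) ≡ ⟦ suc k ⟧ * β d (suc k)
β-shift d zero    = lem ⟦ d ⟧ (inv 0)
  where
  lem : ∀ d i → 1ℚ * (1ℚ + ½ * d) ≡ (1ℚ + 0ℚ) * (1ℚ * (1ℚ + ½ * (d * 1ℚ)))
  lem = solve-∀ ring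
β-shift d (suc k) = trans (lem (β (suc (suc d)) k) (inv k) ⟦ d ⟧) (trans (cong (λ t → t * (1ℚ + ½ * ((1ℚ + (1ℚ + ⟦ d ⟧)) * inv k))) (β-shift d k))
    (trans (lem₂ ⟦ suc k ⟧ (β d (suc k)) ⟦ d ⟧ (inv k)) (trans (cong (λ u → β d (suc k) * (⟦ suc k ⟧ + ½ * ((1ℚ + (1ℚ + ⟦ d ⟧)) * u))) (inv-def k))
      (trans (lem₃ ⟦ k ⟧ (β d (suc k)) ⟦ d ⟧) (trans (cong (λ u → β d (suc k) * (⟦ suc (suc k) ⟧ + ½ * (⟦ d ⟧ * u))) (sym (inv-def (suc k)))) (lem₄ ⟦ suc (suc k) ⟧ (β d (suc k)) ⟦ d ⟧ (inv (suc k))))))))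
  where
  lem : ∀ b i d → b * (1ℚ + ½ * ((1ℚ + (1ℚ + d)) * i)) * (1ℚ + ½ * d) ≡ b * (1ℚ + ½ * d) * (1ℚ + ½ * ((1ℚ + (1ℚ + d)) * i))
  lem = solve-∀ ring
  lem₂ : ∀ k b d i → k * b * (1ℚ + ½ * ((1ℚ + (1ℚ + d)) * i)) ≡ b * (k + ½ * ((1ℚ + (1ℚ + d)) * (k * i)))
  lem₂ = solve-∀ ring
  lem₃ : ∀ k b d → b * (1ℚ + k + ½ * ((1ℚ + (1ℚ + d)) * 1ℚ)) ≡ b * (1ℚ + (1ℚ + k) + ½ * (d * 1ℚ))
  lem₃ = solve-∀ ring
  lem₄ : ∀ k b d i → b * (k + ½ * (d * (k * i))) ≡ k * (b * (1ℚ + ½ * (d * i)))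
  lem₄ = solve-∀ ring

-- The volume of the unit ball with π replaced by p.
Ω : ℚ → ℕ → ℚ
Ω p zero          = 1ℚ
Ω p (suc zero)    = ⟦ 2 ⟧
Ω p (suc (suc d)) = ⟦ 2 ⟧ * inv (suc d) * p * Ω p d

Ω≥0 : ∀ {p} → 0ℚ ≤ p → ∀ d → 0ℚ ≤ Ω p d
Ω≥0 h zero          = 0≤1
Ω≥0 h (suc zero)    = ⟦⟧≥0 2
Ω≥0 h (suc (suc d)) = ⟦⟧≥0 2 ⊗ inv≥0 (suc d) ⊗ h ⊗ Ω≥0 h d

module VolumeStep (r : ℕ) (r≥1 : 1 ℕ.≤ r) (p C : ℚ) (p≥0 : 0ℚ ≤ p) (C≥0 : 0ℚ ≤ C)
  (disc : ∀ t → t ℕ.< r ℕ.* r → p * ⟦ t ⟧ ≤ circle r t + C) where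
  open Volume r r≥1
  open Layers p C p≥0 C≥0 disc
  open Profile 0 r r≥1 using (ρ; ρ>0)

  volume-step : ∀ d k → ⟦ 2 ⟧ * inv (suc d) * p * ρ * V d (suc (suc k)) ≤
    V (suc (suc d)) (suc k) + β (suc (suc d)) (suc k) * (C + p) * (⟦ 3 ⟧ ^ℚ d * ⟦ r ⟧ ^ℚ d)
  volume-step d k = *-cancel ⟦ suc (suc k) ⟧ (⟦suc⟧>0 (suc k)) (≤-trans (≤-reflexive shift)
      (cert (β≥0 (suc (suc d)) (suc k) ⊗ (diff≥0 (fibres k d) ⊕ ⟦⟧≥0 (suc (suc k)) ⊗ (C≥0 ⊕ p≥0) ⊗ diff≥0 (S≤ d (suc k))))
        (lem (β (suc (suc d)) (suc k)) p ρ (S d (suc (suc k))) ⟦ suc (suc k) ⟧ (S (suc (suc d)) (suc k)) (C + p) (S d (suc k)) (⟦ 3 ⟧ ^ℚ d * ⟦ r ⟧ ^ℚ d))))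
    where
    lem : ∀ b p ρ s c S q s' m → c * (b * S + b * q * m) ≡ b * (p * ρ * s) + b * (c * (S + q * s') - p * ρ * s + c * q * (m - s'))
    lem = solve-∀ ring
    half : ⟦ 2 ⟧ * inv (suc d) * (1ℚ + ½ * ⟦ d ⟧) ≡ 1ℚ
    half = trans (lem' (inv (suc d)) ⟦ d ⟧) (inv-def (suc d))
      where
      lem' : ∀ i d → ⟦ 2 ⟧ * i * (1ℚ + ½ * d) ≡ (1ℚ + (1ℚ + d)) * i
      lem' = solve-∀ ring
    shift : ⟦ suc (suc k) ⟧ * (⟦ 2 ⟧ * inv (suc d) * p * ρ * (β d (suc (suc k)) * S d (suc (suc k)))) ≡ β (suc (suc d)) (suc k) * (p * ρ * S d (suc (suc k)))
    shift = trans (lem₁ ⟦ suc (suc k) ⟧ (inv (suc d)) p ρ (β d (suc (suc k))) (S d (suc (suc k)))) (trans (cong (λ t → ⟦ 2 ⟧ * inv (suc d) * t * (p * ρ * S d (suc (suc k)))) (sym (β-shift d (suc k))))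
        (trans (lem₂ (inv (suc d)) (β (suc (suc d)) (suc k)) (½ * ⟦ d ⟧) (p * ρ * S d (suc (suc k)))) (trans (cong (λ u → u * (β (suc (suc d)) (suc k) * (p * ρ * S d (suc (suc k))))) half) (ℚₚ.*-identityˡ _))))
      where
      lem₁ : ∀ c i p r b s → c * (⟦ 2 ⟧ * i * p * r * (b * s)) ≡ ⟦ 2 ⟧ * i * (c * b) * (p * r * s)
      lem₁ = solve-∀ ring
      lem₂ : ∀ i b h x → ⟦ 2 ⟧ * i * (b * (1ℚ + h)) * x ≡ ⟦ 2 ⟧ * i * (1ℚ + h) * (b * x)
      lem₂ = solve-∀ ring

module Line (r : ℕ) (r≥1 : 1 ℕ.≤ r) where
  open Volume r r≥1
  open Profile 0 r r≥1 using (ρ; ρ⁻¹; ρ>0; ρρ⁻¹; ρ⁻¹≥0)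
  open Moment ρ⁻¹ ρ⁻¹≥0

  x : ℕ → ℚ
  x n = 1ℚ - ⟦ n ⟧ * ⟦ n ⟧ * ρ⁻¹

  x≥0 : ∀ n → n ℕ.≤ r → 0ℚ ≤ x n
  x≥0 n h = cert (diff≥0 (*-mono (⟦⟧≥0 n) (⟦⟧≥0 n) (⟦⟧-mono h) (⟦⟧-mono h)) ⊗ ρ⁻¹≥0 ⊕ ≡⇒0≤ 1ℚ (sym ρρ⁻¹)) (lem (⟦ n ⟧ * ⟦ n ⟧) ρ ρ⁻¹)
    where
    lem : ∀ n r i → 1ℚ - n * i ≡ 0ℚ + ((r - n) * i + 1ℚ * (1ℚ - r * i))
    lem = solve-∀ ring

  x-anti : ∀ n → x (suc n) ≤ x n
  x-anti n = cert ((⟦⟧≥0 n ⊕ ⟦⟧≥0 n ⊕ 0≤1) ⊗ ρ⁻¹≥0) (lem ⟦ n ⟧ ρ⁻¹)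
    where
    lem : ∀ n i → 1ℚ - n * n * i ≡ 1ℚ - (1ℚ + n) * (1ℚ + n) * i + (n + n + 1ℚ) * i
    lem = solve-∀ ring

  H : ℕ → ℚ
  H k = ∑[ n ← below r ] x n ^ℚ k

  parts : ∀ k B → B ℕ.≤ r → ⟦ suc k ⟧ * (∑[ n ← below (suc B) ] (2ℚ * (1ℚ - x n) - ⟦ n ⟧ * ρ⁻¹) * x n ^ℚ k) + ⟦ B ⟧ * x B ^ℚ suc k ≤ ∑[ n ← below B ] x n ^ℚ suc k
  parts k zero _    = ≤-reflexive (lem ⟦ suc k ⟧ ρ⁻¹ (x 0 ^ℚ k) (x 0 ^ℚ suc k))
    where
    lem : ∀ c i p q → c * ((2ℚ * (1ℚ - (1ℚ - 0ℚ * 0ℚ * i)) - 0ℚ * i) * p + 0ℚ) + 0ℚ * q ≡ 0ℚ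
    lem = solve-∀ ring
  parts k (suc B) h = cert (diff≥0 (parts k B (ℕₚ.<⇒≤ h)) ⊕ ⟦⟧≥0 (suc B) ⊗ diff≥0 (pow-diff≥ k (x≥0 (suc B) h) (x-anti B)))
      (lem ⟦ suc k ⟧ (∑[ n ← below (suc B) ] (2ℚ * (1ℚ - x n) - ⟦ n ⟧ * ρ⁻¹) * x n ^ℚ k) ⟦ B ⟧ ρ⁻¹ (x (suc B) ^ℚ k) (x B ^ℚ suc k) (x (suc B) ^ℚ suc k) (∑[ n ← below B ] x n ^ℚ suc k))
    where
    lem : ∀ c S b i p q q' T → q + T ≡ c * ((2ℚ * (1ℚ - (1ℚ - (1ℚ + b) * (1ℚ + b) * i)) - (1ℚ + b) * i) * p + S) + (1ℚ + b) * q'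
      + (T - (c * S + b * q) + (1ℚ + b) * (q - q' - c * (1ℚ - b * b * i - (1ℚ - (1ℚ + b) * (1ℚ + b) * i)) * p))
    lem = solve-∀ ring

  -- Summation by parts gives Wallis's relation between the integrals of (1 - x²)^k and (1 -
  -- x²)^(k+1), ratio (2 k + 2)/(2 k + 3), with a loss of order 1/r.
  H-step : ∀ k → ⟦ suc k ⟧ * ((2ℚ - r⁻¹) * H k) ≤ (2ℚ * ⟦ suc k ⟧ + 1ℚ) * H (suc k)
  H-step k = go r r≥1 refl
    where
    go : ∀ n → 1 ℕ.≤ n → n ≡ r → ⟦ suc k ⟧ * ((2ℚ - r⁻¹) * H k) ≤ (2ℚ * ⟦ suc k ⟧ + 1ℚ) * H (suc k)
    go (suc B) _ refl = cert (diff≥0 (parts k B (ℕₚ.n≤1+n B)) ⊕ ⟦⟧≥0 B ⊗ ^-nonneg (suc k) (x≥0 B (ℕₚ.n≤1+n B)) ⊕ ^-nonneg (suc k) (x≥0 B (ℕₚ.n≤1+n B)) ⊕ ⟦⟧≥0 (suc k) ⊗ diff≥0 termwise)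
        (lem ⟦ suc k ⟧ r⁻¹ (H k) (∑[ n ← below B ] x n ^ℚ suc k) (x B ^ℚ suc k) ⟦ B ⟧ (∑[ n ← below (suc B) ] (2ℚ * (1ℚ - x n) - ⟦ n ⟧ * ρ⁻¹) * x n ^ℚ k))
      where
      lem : ∀ c i h T q b S → (2ℚ * c + 1ℚ) * (q + T) ≡ c * ((2ℚ - i) * h) + (T - (c * S + b * q) + b * q + q + c * (S - ((2ℚ - i) * h - 2ℚ * (q + T))))
      lem = solve-∀ ring
      termwise : (2ℚ - r⁻¹) * H k - 2ℚ * H (suc k) ≤ ∑[ n ← below (suc B) ] (2ℚ * (1ℚ - x n) - ⟦ n ⟧ * ρ⁻¹) * x n ^ℚ k
      termwise = ≤-trans (≤-reflexive (trans (cong₂ _-_ (sym (∑-* (below (suc B)) (2ℚ - r⁻¹) (λ n → x n ^ℚ k))) (sym (∑-* (below (suc B)) 2ℚ (λ n → x n ^ℚ suc k)))) (sym (∑-− (below (suc B)) (λ n → (2ℚ - r⁻¹) * x n ^ℚ k) (λ n → 2ℚ * x n ^ℚ suc k)))))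
        (∑-below-mono (suc B) {λ n → (2ℚ - r⁻¹) * x n ^ℚ k - 2ℚ * x n ^ℚ suc k} {λ n → (2ℚ * (1ℚ - x n) - ⟦ n ⟧ * ρ⁻¹) * x n ^ℚ k} λ n n<r → cert (^-nonneg k (x≥0 n (ℕₚ.<⇒≤ n<r)) ⊗ diff≥0 (small n (ℕₚ.<⇒≤ n<r))) (lem' (x n) (x n ^ℚ k) r⁻¹ (⟦ n ⟧ * ρ⁻¹)))
        where
        lem' : ∀ x p i m → (2ℚ * (1ℚ - x) - m) * p ≡ (2ℚ - i) * p - 2ℚ * (x * p) + p * (i - m)
        lem' = solve-∀ ring
        small : ∀ n → n ℕ.≤ suc B → ⟦ n ⟧ * ρ⁻¹ ≤ r⁻¹
        small n n≤r = *-cancel (⟦ suc B ⟧ * ⟦ suc B ⟧) ρ>0 (≤-trans (≤-reflexive (trans (lem₁ ⟦ n ⟧ ρ⁻¹ ρ) (trans (cong (λ u → ⟦ n ⟧ * u) ρρ⁻¹) (ℚₚ.*-identityʳ ⟦ n ⟧))))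
          (≤-trans (⟦⟧-mono n≤r) (≤-reflexive (sym (trans (lem₂ ⟦ suc B ⟧ r⁻¹) (trans (cong (λ u → ⟦ suc B ⟧ * u) rr⁻¹) (ℚₚ.*-identityʳ ⟦ suc B ⟧)))))))
          where
          lem₁ : ∀ n i r → r * (n * i) ≡ n * (r * i)
          lem₁ = solve-∀ ring
          lem₂ : ∀ b i → b * b * i ≡ b * (b * i)
          lem₂ = solve-∀ ring

  ½r⁻¹≥0 : 0ℚ ≤ ½ * r⁻¹
  ½r⁻¹≥0 = 0≤½ ⊗ r⁻¹≥0

  r⁻¹≤1 : r⁻¹ ≤ 1ℚ
  r⁻¹≤1 = cert (r⁻¹≥0 ⊗ diff≥0 (⟦⟧-mono r≥1) ⊕ ≡⇒0≤ 1ℚ (sym rr⁻¹)) (lem ⟦ r ⟧ r⁻¹)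
    where
    lem : ∀ r i → 1ℚ ≡ i + (i * (r - 1ℚ) + 1ℚ * (1ℚ - r * i))
    lem = solve-∀ ring

  ½r⁻¹≤1 : ½ * r⁻¹ ≤ 1ℚ
  ½r⁻¹≤1 = ≤-trans (*-monoˡ ½ 0≤½ r⁻¹≤1) (cert 0≤½ refl)

  βH : ∀ k → (1ℚ - ½ * r⁻¹) ^ℚ k * ⟦ r ⟧ ≤ β 1 k * H k
  βH zero    = ≤-reflexive (trans (ℚₚ.*-comm 1ℚ ⟦ r ⟧) (trans (sym (∑-below-const r 1ℚ)) (sym (ℚₚ.*-identityˡ _))))
  βH (suc k) = ≤-trans (≤-reflexive (ℚₚ.*-assoc (1ℚ - ½ * r⁻¹) ((1ℚ - ½ * r⁻¹) ^ℚ k) ⟦ r ⟧)) (≤-trans (*-monoˡ (1ℚ - ½ * r⁻¹) (diff≥0 ½r⁻¹≤1) (βH k))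
    (cert (0≤½ ⊗ inv≥0 k ⊗ β≥0 1 k ⊗ diff≥0 (H-step k) ⊕ ≡⇒0≤ (β 1 k * (1ℚ - ½ * r⁻¹) * H k - β 1 k * H (suc k)) (inv-def k))
      (lem (β 1 k) (inv k) ⟦ suc k ⟧ r⁻¹ (H k) (H (suc k)))))
    where
    lem : ∀ b i c j h h' → b * (1ℚ + ½ * ((1ℚ + 0ℚ) * i)) * h' ≡ (1ℚ - ½ * j) * (b * h) + (½ * i * b * ((2ℚ * c + 1ℚ) * h' - c * ((2ℚ - j) * h)) + (b * (1ℚ - ½ * j) * h - b * h') * (c * i - 1ℚ))
    lem = solve-∀ ring

  x≡trunc : ∀ n → n ℕ.≤ r → x n ≡ trunc 1ℚ (n ℕ.* n)
  x≡trunc n h = sym (trans (cong (λ t → (1ℚ - t * ρ⁻¹) ⊔0) (⟦⟧-* n n)) (⊔0-pos (x≥0 n h)))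

  line : ∀ k → ⟦ 2 ⟧ * (⟦ r ⟧ * 1ℚ) ≤ V 1 (suc k) + ⟦ 3 ⟧ * (⟦ suc k ⟧ * 1ℚ)
  line k = cert (0≤2 ⊗ (diff≥0 (βH (suc k)) ⊕ ⟦⟧≥0 r ⊗ diff≥0 (bernoulli⁻ (½ * r⁻¹) (suc k) ½r⁻¹≥0 ½r⁻¹≤1)) ⊕ β≥0 1 (suc k) ⊗ diff≥0 S-lower ⊕ diff≥0 (β≤ 1 (suc k)) ⊕ ⟦⟧≥0 k ⊕ ≡⇒0≤ ⟦ suc k ⟧ (sym rr⁻¹))
      (lem ⟦ r ⟧ r⁻¹ ⟦ k ⟧ (β 1 (suc k)) (H (suc k)) (S 1 (suc k)) ((1ℚ - ½ * r⁻¹) ^ℚ suc k))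
    where
    φ : ℕ → ℚ
    φ n = trunc 1ℚ (n ℕ.* n) ^ℚ suc k
    lem : ∀ r i k b h s q → b * s + ⟦ 3 ⟧ * ((1ℚ + k) * 1ℚ) ≡ ⟦ 2 ⟧ * (r * 1ℚ) + (2ℚ * (b * h - q * r + r * (q - (1ℚ - (1ℚ + k) * (½ * i)))) + b * (s - (2ℚ * h - 1ℚ))
      + ((1ℚ + (1ℚ + k)) * 1ℚ - b) + k + (1ℚ + k) * (1ℚ - r * i))
    lem = solve-∀ ring
    S-lower : 2ℚ * H (suc k) - 1ℚ ≤ S 1 (suc k)
    S-lower = ≤-trans (cert (φ≥0 r ⊕ φ≥0 r ⊕ diff≥0 φ₀≤1) (lem' (H (suc k)) (φ r) (φ 0))) (≤-reflexive (sym S≡))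
      where
      φ≥0 : ∀ n → 0ℚ ≤ φ n
      φ≥0 n = ^-nonneg (suc k) (trunc≥0 1ℚ (n ℕ.* n))
      φ₀≤1 : φ 0 ≤ 1ℚ
      φ₀≤1 = ≤-trans (≤-reflexive (cong (_^ℚ suc k) (sym (x≡trunc 0 z≤n)))) (^≤1 (suc k) (x≥0 0 z≤n) (≤-reflexive (lem₀ ρ⁻¹)))
        where
        lem₀ : ∀ i → 1ℚ - 0ℚ * 0ℚ * i ≡ 1ℚ
        lem₀ = solve-∀ ring
      lem' : ∀ h a b → b + 2ℚ * (a + h - b) ≡ 2ℚ * h - 1ℚ + (a + a + (1ℚ - b))
      lem' = solve-∀ ring
      lem'' : ∀ a b s → a + b ≡ s → b ≡ s - a
      lem'' a b .(a + b) refl = lem₁ a b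
        where
        lem₁ : ∀ a b → b ≡ a + b - a
        lem₁ = solve-∀ ring
      S≡ : S 1 (suc k) ≡ φ 0 + 2ℚ * (φ r + H (suc k) - φ 0)
      S≡ = trans (∑-box-suc r (λ y → trunc 1ℚ (normSq y) ^ℚ suc k))
        (trans (∑-cong (range r) λ z → trans (ℚₚ.+-identityʳ (trunc 1ℚ (normSq (z ∷ [])) ^ℚ suc k)) (cong (λ t → trunc 1ℚ t ^ℚ suc k) (ℕₚ.+-identityʳ (ℤ.∣ z ∣ ℕ.* ℤ.∣ z ∣))))
          (trans (∑-range-abs r φ) (cong (λ t → φ 0 + 2ℚ * t) (lem'' (φ 0) _ _ (trans (sym (∑-below-front r φ))
            (cong (λ t → φ r + t) (∑-below-cong r λ n n<r → cong (_^ℚ suc k) (sym (x≡trunc n (ℕₚ.<⇒≤ n<r))))))))))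

-- The exponent k will grow like a power of log n, so the error must show its polynomial dependence
-- on k.
VolumeBound : ℚ → ℕ → Set
VolumeBound p d = ∃[ K ] ∃[ e ] (0ℚ ≤ K × (∀ r (r≥1 : 1 ℕ.≤ r) k →
  Ω p d * ⟦ r ⟧ ^ℚ d ≤ Volume.V r r≥1 d (suc k) + K * ⟦ suc k ⟧ ^ℚ e * (⟦ r ⟧ ^ℚ d * ⟦ r ⟧ ⁻¹)))

volume-bound : ∀ p C → 0ℚ ≤ p → 0ℚ ≤ C → (∀ r t → t ℕ.< r ℕ.* r → p * ⟦ t ⟧ ≤ circle r t + C) → ∀ d → VolumeBound p d
volume-bound p C p≥0 C≥0 disc zero = 0ℚ , 0 , ≤-refl , λ r r≥1 k → ≤-reflexive (sym (trans (cong₂ (λ u v → u * (v ^ℚ suc k + 0ℚ) + 0ℚ * 1ℚ * (1ℚ * ⟦ r ⟧ ⁻¹)) (β₀ (suc k)) (one (Profile.ρ⁻¹ 0 r r≥1)))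
    (trans (cong (λ u → 1ℚ * (u + 0ℚ) + 0ℚ * 1ℚ * (1ℚ * ⟦ r ⟧ ⁻¹)) (1^ (suc k))) (lem (⟦ r ⟧ ⁻¹)))))
  where
  one : ∀ i → (1ℚ - 0ℚ * i) ⊔0 ≡ 1ℚ
  one i = trans (cong _⊔0 (lem' i)) (⊔0-pos 0≤1)
    where
    lem' : ∀ i → 1ℚ - 0ℚ * i ≡ 1ℚ
    lem' = solve-∀ ring
  β₀ : ∀ k → β 0 k ≡ 1ℚ
  β₀ zero    = refl
  β₀ (suc k) = trans (cong (λ t → t * (1ℚ + ½ * (0ℚ * inv k))) (β₀ k)) (lem' (inv k))
    where
    lem' : ∀ i → 1ℚ * (1ℚ + ½ * (0ℚ * i)) ≡ 1ℚ
    lem' = solve-∀ ring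
  lem : ∀ i → 1ℚ * (1ℚ + 0ℚ) + 0ℚ * 1ℚ * (1ℚ * i) ≡ 1ℚ * 1ℚ
  lem = solve-∀ ring
volume-bound p C p≥0 C≥0 disc (suc zero) = ⟦ 3 ⟧ , 1 , ⟦⟧≥0 3 , λ r r≥1 k → ≤-trans (Line.line r r≥1 k) (ℚₚ.+-monoʳ-≤ (Volume.V r r≥1 1 (suc k))
    (≤-reflexive (trans (lem ⟦ suc k ⟧) (cong (λ u → ⟦ 3 ⟧ * (⟦ suc k ⟧ * 1ℚ) * u) (sym (trans (lem₂ ⟦ r ⟧ (⟦ r ⟧ ⁻¹)) (⁻¹-inverse (⟦⟧>0 r≥1))))))))
  where
  lem : ∀ k → ⟦ 3 ⟧ * (k * 1ℚ) ≡ ⟦ 3 ⟧ * (k * 1ℚ) * 1ℚ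
  lem = solve-∀ ring
  lem₂ : ∀ r i → r * 1ℚ * i ≡ r * i
  lem₂ = solve-∀ ring
volume-bound p C p≥0 C≥0 disc (suc (suc d)) with volume-bound p C p≥0 C≥0 disc d
... | K , e , K≥0 , bound = K₁ + K₂ , e ℕ.+ suc (suc d) , (K₁≥0 ⊕ K₂≥0) , step'
  where
  D = suc (suc d)
  K₁ = ⟦ 2 ⟧ ^ℚ D * (C + p) * ⟦ 3 ⟧ ^ℚ d
  K₂ = ⟦ 2 ⟧ * p * K * ⟦ 2 ⟧ ^ℚ e
  K₁≥0 : 0ℚ ≤ K₁
  K₁≥0 = ^-nonneg D (⟦⟧≥0 2) ⊗ (C≥0 ⊕ p≥0) ⊗ ^-nonneg d (⟦⟧≥0 3)
  K₂≥0 : 0ℚ ≤ K₂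
  K₂≥0 = ⟦⟧≥0 2 ⊗ p≥0 ⊗ K≥0 ⊗ ^-nonneg e (⟦⟧≥0 2)
  step' : ∀ r (r≥1 : 1 ℕ.≤ r) k → Ω p D * ⟦ r ⟧ ^ℚ D ≤ Volume.V r r≥1 D (suc k) + (K₁ + K₂) * ⟦ suc k ⟧ ^ℚ (e ℕ.+ D) * (⟦ r ⟧ ^ℚ D * ⟦ r ⟧ ⁻¹)
  step' r r≥1 k = cert (⟦⟧≥0 2 ⊗ inv≥0 (suc d) ⊗ p≥0 ⊗ <⇒≤ ρ>0 ⊗ diff≥0 (bound r r≥1 (suc k)) ⊕ diff≥0 (VolumeStep.volume-step r r≥1 p C p≥0 C≥0 (disc r) d k) ⊕ diff≥0 err₁ ⊕ diff≥0 err₂)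
      (lem (inv (suc d)) p (Ω p d) R ⟦ r ⟧ (Volume.V r r≥1 d (suc (suc k))) E (Volume.V r r≥1 D (suc k)) B K₁ K₂ T X)
    where
    open Profile 0 r r≥1 using (ρ; ρ>0)
    R = ⟦ r ⟧ ^ℚ d
    T = ⟦ suc k ⟧ ^ℚ (e ℕ.+ D)
    X = ⟦ r ⟧ ^ℚ D * ⟦ r ⟧ ⁻¹
    E = K * ⟦ suc (suc k) ⟧ ^ℚ e * (R * ⟦ r ⟧ ⁻¹)
    B = β D (suc k) * (C + p) * (⟦ 3 ⟧ ^ℚ d * R)
    R≥0 : 0ℚ ≤ R
    R≥0 = ^-nonneg d (⟦⟧≥0 r)
    r⁻¹≥0 : 0ℚ ≤ ⟦ r ⟧ ⁻¹
    r⁻¹≥0 = <⇒≤ (⁻¹-pos (⟦⟧>0 r≥1))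
    1≤k : 1ℚ ≤ ⟦ suc k ⟧
    1≤k = cert (⟦⟧≥0 k) refl
    -- The induction hypothesis is used at k + 1, because the step lowers the exponent of the bump
    -- by one; passing from k + 2 to k + 1 costs 2^j.
    double : ∀ j → j ℕ.≤ e ℕ.+ D → ⟦ suc (suc k) ⟧ ^ℚ j ≤ ⟦ 2 ⟧ ^ℚ j * T
    double j h = ≤-trans (^-mono j (⟦⟧≥0 (suc (suc k))) (cert (⟦⟧≥0 k) (lem' ⟦ k ⟧))) (≤-trans (≤-reflexive (^-distrib-* ⟦ 2 ⟧ ⟦ suc k ⟧ j))
        (*-monoˡ (⟦ 2 ⟧ ^ℚ j) (^-nonneg j (⟦⟧≥0 2)) (^-mono-exp 1≤k h)))
      where
      lem' : ∀ k → ⟦ 2 ⟧ * (1ℚ + k) ≡ 1ℚ + (1ℚ + k) + k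
      lem' = solve-∀ ring
    R≤X : R ≤ X
    R≤X = cert (R≥0 ⊗ diff≥0 (⟦⟧-mono r≥1) ⊕ ≡⇒0≤ (⟦ r ⟧ * R) (⁻¹-inverse (⟦⟧>0 r≥1))) (lem' ⟦ r ⟧ (⟦ r ⟧ ⁻¹) R)
      where
      lem' : ∀ r i R → r * (r * R) * i ≡ R + (R * (r - 1ℚ) + r * R * (r * i - 1ℚ))
      lem' = solve-∀ ring
    err₁ : B ≤ K₁ * T * X
    err₁ = ≤-trans (*-mono (β≥0 D (suc k) ⊗ (C≥0 ⊕ p≥0)) (^-nonneg d (⟦⟧≥0 3) ⊗ R≥0)
        (*-monoʳ (C + p) (C≥0 ⊕ p≥0) (≤-trans (β≤ D (suc k)) (double D (ℕₚ.m≤n+m D e)))) (*-monoˡ (⟦ 3 ⟧ ^ℚ d) (^-nonneg d (⟦⟧≥0 3)) R≤X))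
      (≤-reflexive (lem' (⟦ 2 ⟧ ^ℚ D) T (C + p) (⟦ 3 ⟧ ^ℚ d) X))
      where
      lem' : ∀ a t c b x → a * t * c * (b * x) ≡ a * c * b * t * x
      lem' = solve-∀ ring
    err₂ : ⟦ 2 ⟧ * inv (suc d) * p * ρ * E ≤ K₂ * T * X
    err₂ = cert (Y≥0 ⊗ (diff≥0 (double e (ℕₚ.m≤m+n e D)) ⊕ diff≥0 (inv≤1 (suc d)) ⊗ ^-nonneg e (⟦⟧≥0 (suc (suc k))))) (lem' (inv (suc d)) p ⟦ r ⟧ K (⟦ suc (suc k) ⟧ ^ℚ e) R (⟦ r ⟧ ⁻¹) (⟦ 2 ⟧ ^ℚ e) T)
      where
      Y = ⟦ 2 ⟧ * p * ρ * K * R * ⟦ r ⟧ ⁻¹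
      Y≥0 : 0ℚ ≤ Y
      Y≥0 = ⟦⟧≥0 2 ⊗ p≥0 ⊗ <⇒≤ ρ>0 ⊗ K≥0 ⊗ R≥0 ⊗ r⁻¹≥0
      lem' : ∀ v p r K q R i a t → ⟦ 2 ⟧ * p * K * a * t * (r * (r * R) * i) ≡ ⟦ 2 ⟧ * v * p * (r * r) * (K * q * (R * i)) + ⟦ 2 ⟧ * p * (r * r) * K * R * i * (a * t - q + (1ℚ - v) * q)
      lem' = solve-∀ ring
    lem : ∀ v p w R r V E V' B K₁ K₂ T X → V' + (K₁ + K₂) * T * X ≡ ⟦ 2 ⟧ * v * p * w * (r * (r * R)) +
      (⟦ 2 ⟧ * v * p * (r * r) * (V + E - w * R) + (V' + B - ⟦ 2 ⟧ * v * p * (r * r) * V) + (K₁ * T * X - B) + (K₂ * T * X - ⟦ 2 ⟧ * v * p * (r * r) * E))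
    lem = solve-∀ ring

-- The integer profiles `w` and `γ`.

tri : ℕ → ℕ
tri zero    = 0
tri (suc m) = suc m ℕ.+ tri m

m≤tri : ∀ m → m ℕ.≤ tri m
m≤tri zero    = z≤n
m≤tri (suc m) = ℕₚ.m≤m+n (suc m) (tri m)

-- The integer profile w falls off with slope growing by g up to a, then decreasing by c until it vanishes.
module Shape (c g a : ℕ) (c≥1 : 1 ℕ.≤ c) where

  instance
    c-nonZero : ℕ.NonZero c
    c-nonZero = ℕ.>-nonZero c≥1

  -- The drop of `w` from z to z + 1. Truncated subtraction stops it at 0, so `w` ends flat instead
  -- of turning upwards.
  slope : ℕ → ℕ
  slope z = g ℕ.* suc (z ℕ.⊓ a) ℕ.∸ c ℕ.* (z ℕ.∸ a)

  R : ℕ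
  R = a ℕ.+ suc (g ℕ.* suc a ℕ./ c)

  -- The slope g (a + 1) reached at `a` is used up after about g (a + 1)/c further steps. With c + g
  -- = d the right side is d (a + 1).
  cR≤ : c ℕ.* R ℕ.≤ (c ℕ.+ g) ℕ.* suc a
  cR≤ = subst₂ ℕ._≤_ (sym (trans (ℕₚ.*-distribˡ-+ c a (suc m)) (cong (c ℕ.* a ℕ.+_) (ℕₚ.*-suc c m)))) regroup
      (ℕₚ.+-monoʳ-≤ (c ℕ.* a) (ℕₚ.+-monoʳ-≤ c (subst (ℕ._≤ g ℕ.* suc a) (ℕₚ.*-comm m c) (m/n*n≤m (g ℕ.* suc a) c))))
    where
    m = g ℕ.* suc a ℕ./ c
    regroup : c ℕ.* a ℕ.+ (c ℕ.+ g ℕ.* suc a) ≡ (c ℕ.+ g) ℕ.* suc a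
    regroup = trans (sym (ℕₚ.+-assoc (c ℕ.* a) c (g ℕ.* suc a))) (trans (cong (ℕ._+ g ℕ.* suc a) (trans (ℕₚ.+-comm (c ℕ.* a) c) (sym (ℕₚ.*-suc c a)))) (sym (ℕₚ.*-distribʳ-+ (suc a) c g)))

  slope-zero : ∀ z → R ℕ.≤ z → slope z ≡ 0
  slope-zero z h = ℕₚ.m≤n⇒m∸n≡0 (ℕₚ.≤-trans (ℕₚ.*-monoʳ-≤ g (s≤s (ℕₚ.m⊓n≤n z a))) (ℕₚ.≤-trans large (ℕₚ.*-monoʳ-≤ c (subst (ℕ._≤ z ℕ.∸ a) (ℕₚ.m+n∸m≡n a (suc m)) (ℕₚ.∸-monoˡ-≤ a h)))))
    where
    m = g ℕ.* suc a ℕ./ c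
    large : g ℕ.* suc a ℕ.≤ c ℕ.* suc m
    large = subst₂ ℕ._≤_ (sym (m≡m%n+[m/n]*n (g ℕ.* suc a) c)) (trans (cong (c ℕ.+_) (ℕₚ.*-comm m c)) (sym (ℕₚ.*-suc c m)))
      (ℕₚ.+-monoˡ-≤ (m ℕ.* c) (ℕₚ.<⇒≤ (m%n<n (g ℕ.* suc a) c)))

  tail-sum : ℕ → ℕ → ℕ
  tail-sum zero z    = 0
  tail-sum (suc m) z = slope z ℕ.+ tail-sum m (suc z)

  w : ℕ → ℕ
  w z = tail-sum (R ℕ.∸ z) z

  w-far : ∀ z → R ℕ.≤ z → w z ≡ 0
  w-far z h = cong (λ m → tail-sum m z) (ℕₚ.m≤n⇒m∸n≡0 h)

  w-step : ∀ z → w z ≡ slope z ℕ.+ w (suc z)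
  w-step z with ℕₚ.≤-total R z
  ... | inj₁ h = trans (w-far z h) (sym (cong₂ ℕ._+_ (slope-zero z h) (w-far (suc z) (ℕₚ.m≤n⇒m≤1+n h))))
  ... | inj₂ h with ℕₚ.m≤n⇒m<n∨m≡n h
  ...   | inj₁ z<R = cong (λ m → tail-sum m z) (ℕₚ.+-∸-assoc 1 z<R)
  ...   | inj₂ refl = trans (w-far R ℕₚ.≤-refl) (sym (cong₂ ℕ._+_ (slope-zero R ℕₚ.≤-refl) (w-far (suc R) (ℕₚ.n≤1+n R))))

  ⟦w⟧ : ∀ z → ⟦ w z ⟧ ≡ ⟦ slope z ⟧ + ⟦ w (suc z) ⟧
  ⟦w⟧ z = trans (cong ⟦_⟧ (w-step z)) (⟦⟧-+ (slope z) (w (suc z)))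

  curvature : ∀ z {B} → ⟦ slope z ⟧ ≤ ⟦ slope (suc z) ⟧ + B → ⟦ w (suc (suc z)) ⟧ + ⟦ w z ⟧ - (⟦ w (suc z) ⟧ + ⟦ w (suc z) ⟧) ≤ B
  curvature z {B} h = cert (diff≥0 h ⊕ ≡⇒0≤ 1ℚ (sym (⟦w⟧ z)) ⊕ ≡⇒0≤ 1ℚ (⟦w⟧ (suc z))) (lem ⟦ w (suc (suc z)) ⟧ ⟦ w (suc z) ⟧ ⟦ w z ⟧ ⟦ slope z ⟧ ⟦ slope (suc z) ⟧ B)
    where
    lem : ∀ w₂ w₁ w₀ s s' B → B ≡ w₂ + w₀ - (w₁ + w₁) + (s' + B - s + 1ℚ * (s + w₁ - w₀) + 1ℚ * (w₁ - (s' + w₂)))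
    lem = solve-∀ ring

  slope-in : ∀ z → z ℕ.≤ a → slope z ≡ g ℕ.* suc z
  slope-in z h = trans (cong₂ (λ m n → g ℕ.* suc m ℕ.∸ c ℕ.* n) (ℕₚ.m≤n⇒m⊓n≡m h) (ℕₚ.m≤n⇒m∸n≡0 h)) (cong (g ℕ.* suc z ℕ.∸_) (ℕₚ.*-zeroʳ c))

  bound : ℕ → ℚ
  bound z with z ℕₚ.≤? a
  ... | yes _ = - ⟦ g ⟧
  ... | no _  = ⟦ c ⟧

  bound-in : ∀ z → z ℕ.≤ a → bound z ≡ - ⟦ g ⟧
  bound-in z h with z ℕₚ.≤? a
  ... | yes _ = refl
  ... | no ¬p = contradiction h ¬p

  bound-out : ∀ z → a ℕ.< z → bound z ≡ ⟦ c ⟧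
  bound-out z h with z ℕₚ.≤? a
  ... | yes p = contradiction p (ℕₚ.<⇒≱ h)
  ... | no _  = refl

  w-lap : ∀ {d} (i : Fin d) x → lap (λ y → ⟦ w ℤ.∣ coord i y ∣ ⟧) x ≤ bound ℤ.∣ coord i x ∣
  w-lap i = lap-radial i (λ z → ⟦ w z ⟧) bound at-0 at-suc
    where
    at-0 : ⟦ w 1 ⟧ + ⟦ w 1 ⟧ - (⟦ w 0 ⟧ + ⟦ w 0 ⟧) ≤ bound 0
    at-0 = subst (⟦ w 1 ⟧ + ⟦ w 1 ⟧ - (⟦ w 0 ⟧ + ⟦ w 0 ⟧) ≤_) (sym (bound-in 0 z≤n))
      (cert (⟦⟧≥0 g ⊕ ≡⇒0≤ 2ℚ (⟦w⟧ 0) ⊕ ≡⇒0≤ 2ℚ (trans (cong ⟦_⟧ (slope-in 0 z≤n)) (cong ⟦_⟧ (ℕₚ.*-identityʳ g)))) (lem ⟦ w 1 ⟧ ⟦ w 0 ⟧ ⟦ g ⟧ ⟦ slope 0 ⟧))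
      where
      lem : ∀ w₁ w₀ g s → - g ≡ w₁ + w₁ - (w₀ + w₀) + (g + 2ℚ * (w₀ - (s + w₁)) + 2ℚ * (s - g))
      lem = solve-∀ ring
    at-suc : ∀ z → ⟦ w (suc (suc z)) ⟧ + ⟦ w z ⟧ - (⟦ w (suc z) ⟧ + ⟦ w (suc z) ⟧) ≤ bound (suc z)
    at-suc z = by-cases (suc z ℕₚ.≤? a)
      where
      by-cases : Dec (suc z ℕ.≤ a) → ⟦ w (suc (suc z)) ⟧ + ⟦ w z ⟧ - (⟦ w (suc z) ⟧ + ⟦ w (suc z) ⟧) ≤ bound (suc z)
      by-cases (yes h) = subst (⟦ w (suc (suc z)) ⟧ + ⟦ w z ⟧ - (⟦ w (suc z) ⟧ + ⟦ w (suc z) ⟧) ≤_) (sym (bound-in (suc z) h))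
          (curvature z (≤-reflexive (trans (cong ⟦_⟧ (slope-in z (ℕₚ.<⇒≤ h))) (trans (⟦⟧-* g (suc z)) (trans (lem ⟦ g ⟧ ⟦ z ⟧)
            (cong (λ t → t + - ⟦ g ⟧) (sym (trans (cong ⟦_⟧ (slope-in (suc z) h)) (⟦⟧-* g (suc (suc z)))))))))))
        where
        lem : ∀ g z → g * (1ℚ + z) ≡ g * (1ℚ + (1ℚ + z)) + - g
        lem = solve-∀ ring
      by-cases (no ¬h) = subst (⟦ w (suc (suc z)) ⟧ + ⟦ w z ⟧ - (⟦ w (suc z) ⟧ + ⟦ w (suc z) ⟧) ≤_) (sym (bound-out (suc z) (ℕₚ.≰⇒> ¬h)))
          (curvature z (≤-trans (⟦⟧-mono drop) (≤-reflexive (⟦⟧-+ (slope (suc z)) c))))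
        where
        a≤z = ℕₚ.≤-pred (ℕₚ.≰⇒> ¬h)
        X = g ℕ.* suc a
        m = c ℕ.* (z ℕ.∸ a)
        slope≡ : slope z ≡ X ℕ.∸ m
        slope≡ = cong (λ t → g ℕ.* suc t ℕ.∸ m) (ℕₚ.m≥n⇒m⊓n≡n a≤z)
        slope'≡ : slope (suc z) ≡ X ℕ.∸ (c ℕ.+ m)
        slope'≡ = cong₂ (λ s t → g ℕ.* suc s ℕ.∸ t) (ℕₚ.m≥n⇒m⊓n≡n (ℕₚ.m≤n⇒m≤1+n a≤z)) (trans (cong (c ℕ.*_) (ℕₚ.+-∸-assoc 1 a≤z)) (ℕₚ.*-suc c (z ℕ.∸ a)))
        drop : slope z ℕ.≤ slope (suc z) ℕ.+ c
        drop = subst₂ (λ s t → s ℕ.≤ t ℕ.+ c) (sym slope≡) (sym (trans slope'≡ (trans (cong (X ℕ.∸_) (ℕₚ.+-comm c m)) (sym (ℕₚ.∸-+-assoc X m c)))))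
          (subst (X ℕ.∸ m ℕ.≤_) (ℕₚ.+-comm c _) (ℕₚ.m≤n+m∸n (X ℕ.∸ m) c))

γ-lap : ∀ {d} a (i : Fin d) x → lap (λ y → ⟦ tri (a ℕ.∸ ℤ.∣ coord i y ∣) ⟧) x ≤ 1ℚ
γ-lap a i = lap-radial i (λ z → ⟦ tri (a ℕ.∸ z) ⟧) (λ _ → 1ℚ) (≤-trans (cert (diff≥0 decreasing ⊕ diff≥0 decreasing) (lem₀ ⟦ tri (a ℕ.∸ 1) ⟧ ⟦ tri a ⟧)) 0≤1) (at-suc a)
  where
  lem₀ : ∀ s t → 0ℚ ≡ s + s - (t + t) + (t - s + (t - s))
  lem₀ = solve-∀ ring
  decreasing : ⟦ tri (a ℕ.∸ 1) ⟧ ≤ ⟦ tri a ⟧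
  decreasing = ⟦⟧-mono (lower a)
    where
    lower : ∀ a → tri (a ℕ.∸ 1) ℕ.≤ tri a
    lower zero    = z≤n
    lower (suc a) = ℕₚ.m≤n+m (tri a) (suc a)
  at-suc : ∀ a z → ⟦ tri (a ℕ.∸ suc (suc z)) ⟧ + ⟦ tri (a ℕ.∸ z) ⟧ - (⟦ tri (a ℕ.∸ suc z) ⟧ + ⟦ tri (a ℕ.∸ suc z) ⟧) ≤ 1ℚ
  at-suc zero z                = subst (λ t → ⟦ 0 ⟧ + ⟦ tri t ⟧ - (⟦ 0 ⟧ + ⟦ 0 ⟧) ≤ 1ℚ) (sym (ℕₚ.0∸n≡0 z)) 0≤1
  at-suc (suc zero) zero       = ≤-refl
  at-suc (suc (suc m)) zero    = ≤-reflexive (trans (cong₂ (λ s t → ⟦ tri m ⟧ + s - (t + t)) (trans (⟦⟧-+ (suc (suc m)) (suc m ℕ.+ tri m)) (cong (λ t → ⟦ suc (suc m) ⟧ + t) (⟦⟧-+ (suc m) (tri m)))) (⟦⟧-+ (suc m) (tri m)))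
      (lem ⟦ m ⟧ ⟦ tri m ⟧))
    where
    lem : ∀ m t → t + (1ℚ + (1ℚ + m) + (1ℚ + m + t)) - (1ℚ + m + t + (1ℚ + m + t)) ≡ 1ℚ
    lem = solve-∀ ring
  at-suc (suc a) (suc z)       = at-suc a z

-- Bernoulli gives (1 - z)^k ≥ ½, and (1 - z)(1 + z) ≤ 1.
pow≤2 : ∀ k z → 0ℚ ≤ z → ⟦ k ⟧ * z ≤ ½ → (1ℚ + z) ^ℚ k ≤ 2ℚ
pow≤2 zero z z≥0 h    = ℚ.*≤* (ℤ.+≤+ (s≤s z≤n))
pow≤2 (suc k) z z≥0 h = *-cancel ½ 0<½ (≤-trans (*-monoʳ ((1ℚ + z) ^ℚ suc k) (^-nonneg (suc k) (0≤1 ⊕ z≥0)) ½≤)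
    (≤-trans (≤-reflexive (sym (^-distrib-* (1ℚ - z) (1ℚ + z) (suc k)))) (^≤1 (suc k) (diff≥0 z≤1 ⊗ (0≤1 ⊕ z≥0)) (cert (sq≥0 z) (lem z)))))
  where
  0<½ : 0ℚ < ½
  0<½ = ℚ.*<* (ℤ.+<+ (s≤s z≤n))
  lem : ∀ z → 1ℚ ≡ (1ℚ - z) * (1ℚ + z) + z * z
  lem = solve-∀ ring
  lem₁ : ∀ k z → ½ ≡ z + (½ - (1ℚ + k) * z + k * z)
  lem₁ = solve-∀ ring
  lem₂ : ∀ k z → 1ℚ - k * z ≡ ½ + (½ - k * z)
  lem₂ = solve-∀ ring
  z≤1 : z ≤ 1ℚ
  z≤1 = ≤-trans (cert (diff≥0 h ⊕ ⟦⟧≥0 k ⊗ z≥0) (lem₁ ⟦ k ⟧ z)) (cert 0≤½ refl)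
  ½≤ : ½ ≤ (1ℚ - z) ^ℚ suc k
  ½≤ = ≤-trans (cert (diff≥0 h) (lem₂ ⟦ suc k ⟧ z)) (bernoulli⁻ z (suc k) z≥0 z≤1)

-- Choice of scales and assembly of the barrier.

module Outer (d h n c g : ℕ) (d≥1 : 1 ℕ.≤ d) (c≥1 : 1 ℕ.≤ c) (c+h : c ℕ.+ suc h ≡ d ℕ.+ d) (c+g : c ℕ.+ g ≡ d)
  (E L q : ℕ) (L≥1 : 1 ℕ.≤ L) (q≥1 : 1 ℕ.≤ q) where

  τ r disp k s p J r' a : ℕ
  -- `q` is the diffusion length and r = q τ the radius, so τ is their ratio, of order `L`. The
  -- factor 2 (d + 1)(E + 1) makes the margin L p equal to r/(E + 1).
  τ    = 2 ℕ.* suc d ℕ.* suc E ℕ.* L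
  r    = q ℕ.* τ
  -- The smearing error is n q^(-d-1) 2 d r/disp = 2 d n/(r^d τ), small by the spare factor τ; k =
  -- disp² gives the bump width r/disp.
  disp = τ ℕ.^ suc (suc d)
  k    = disp ℕ.* disp
  -- 8 d q² is what `rate` needs with c = 1/q² and κ = 1/(4 d).
  s    = 8 ℕ.* d ℕ.* q ℕ.* q
  -- Decay length of ψ: T = (d + 1) s steps enlarge ψ by at most 2, since T κ/p² = 1/(2 (d + 1)) ≤
  -- ½.
  p    = 2 ℕ.* suc d ℕ.* q
  -- With e = 1/(d (E + 1)), d (E + 1) levels double (1 + e)^j, so J levels reach 2^L > n.
  J    = L ℕ.* (d ℕ.* suc E)
  r'   = r ℕ.+ L ℕ.* p
  a    = r' ℕ.+ suc J

  δ : ℚ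
  δ = inv E

  δ≥0 : 0ℚ ≤ δ
  δ≥0 = inv≥0 E

  τ≥1 : 1 ℕ.≤ τ
  τ≥1 = ℕₚ.*-mono-≤ {1} {2 ℕ.* suc d ℕ.* suc E} {1} {L} (s≤s z≤n) L≥1

  r≥1 : 1 ℕ.≤ r
  r≥1 = ℕₚ.*-mono-≤ q≥1 τ≥1

  p≥1 : 1 ℕ.≤ p
  p≥1 = ℕₚ.*-mono-≤ {1} {2 ℕ.* suc d} {1} {q} (s≤s z≤n) q≥1

  disp≥1 : 1 ℕ.≤ disp
  disp≥1 = subst (ℕ._≤ disp) (ℕₚ.^-zeroˡ (suc (suc d))) (ℕₚ.^-monoˡ-≤ (suc (suc d)) τ≥1)

  open Heat d d≥1 using (κ; κ≥0; κ-def)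
  module Pr = Profile d r r≥1
  open Pr using (ρ; ρ⁻¹; ρ>0; ρρ⁻¹; ρ⁻¹≥0; z₀; w₀)

  q⁻¹ : ℚ
  q⁻¹ = ⟦ q ⟧ ⁻¹

  q⁻¹≥0 : 0ℚ ≤ q⁻¹
  q⁻¹≥0 = <⇒≤ (⁻¹-pos (⟦⟧>0 q≥1))

  qq⁻¹ : ⟦ q ⟧ * q⁻¹ ≡ 1ℚ
  qq⁻¹ = ⁻¹-inverse (⟦⟧>0 q≥1)

  ⟦s⟧ : ⟦ s ⟧ ≡ ⟦ 8 ⟧ * ⟦ d ⟧ * ⟦ q ⟧ * ⟦ q ⟧
  ⟦s⟧ = trans (⟦⟧-* (8 ℕ.* d ℕ.* q) q) (cong (λ t → t * ⟦ q ⟧) (trans (⟦⟧-* (8 ℕ.* d) q) (cong (λ t → t * ⟦ q ⟧) (⟦⟧-* 8 d))))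

  rate : 1ℚ ≤ q⁻¹ * q⁻¹ * (⟦ suc s ⟧ * (½ * κ))
  rate = cert (q⁻¹≥0 ⊗ q⁻¹≥0 ⊗ (0≤½ ⊗ κ≥0) ⊕ ≡⇒0≤ (⟦ q ⟧ * q⁻¹ + 1ℚ) qq⁻¹ ⊕ ≡⇒0≤ (q⁻¹ * q⁻¹ * (⟦ q ⟧ * ⟦ q ⟧)) κ-def ⊕ ≡⇒0≤ (q⁻¹ * q⁻¹ * (½ * κ)) ⟦s⟧)
    (lem q⁻¹ ⟦ q ⟧ ⟦ s ⟧ κ ⟦ d ⟧)
    where
    lem : ∀ i q s κ d → i * i * ((1ℚ + s) * (½ * κ)) ≡ 1ℚ + (i * i * (½ * κ) + (q * i + 1ℚ) * (q * i - 1ℚ)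
      + i * i * (q * q) * ((d + d + (d + d)) * κ - 1ℚ) + i * i * (½ * κ) * (s - ⟦ 8 ⟧ * d * q * q))
    lem = solve-∀ ring

  module Sp = Spread d d≥1 s (q⁻¹ * q⁻¹) (q⁻¹≥0 ⊗ q⁻¹≥0) rate

  T : ℕ
  T = suc d ℕ.* s

  ⟦T⟧ : ⟦ T ⟧ ≡ ⟦ suc d ⟧ * (⟦ 8 ⟧ * ⟦ d ⟧ * ⟦ q ⟧ * ⟦ q ⟧)
  ⟦T⟧ = trans (⟦⟧-* (suc d) s) (cong (λ t → ⟦ suc d ⟧ * t) ⟦s⟧)

  ⟦p⟧ : ⟦ p ⟧ ≡ ⟦ 2 ⟧ * ⟦ suc d ⟧ * ⟦ q ⟧
  ⟦p⟧ = trans (⟦⟧-* (2 ℕ.* suc d) q) (cong (λ t → t * ⟦ q ⟧) (⟦⟧-* 2 (suc d)))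

  ν λ' μ : ℚ
  ν  = ⟦ p ⟧ * inv p
  λ' = (⟦ p ⟧ * ⟦ p ⟧) ⁻¹
  μ  = ⟦ suc p ⟧ * ⟦ p ⟧ ⁻¹

  p>0 : 0ℚ < ⟦ p ⟧
  p>0 = ⟦⟧>0 p≥1

  ν≥0 : 0ℚ ≤ ν
  ν≥0 = ⟦⟧≥0 p ⊗ inv≥0 p

  1-ν : 1ℚ - ν ≡ inv p
  1-ν = trans (cong (λ t → t - ν) (sym (inv-def p))) (lem ⟦ p ⟧ (inv p))
    where
    lem : ∀ p i → (1ℚ + p) * i - p * i ≡ i
    lem = solve-∀ ring

  ν≤1 : ν ≤ 1ℚ
  ν≤1 = cert (inv≥0 p) (trans (lem ν) (cong (λ t → ν + t) 1-ν))
    where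
    lem : ∀ v → 1ℚ ≡ v + (1ℚ - v)
    lem = solve-∀ ring

  νμ : ν * μ ≡ 1ℚ
  νμ = trans (lem ⟦ p ⟧ (inv p) ⟦ suc p ⟧ (⟦ p ⟧ ⁻¹)) (cong₂ _*_ (⁻¹-inverse p>0) (inv-def p))
    where
    lem : ∀ p i s j → p * i * (s * j) ≡ p * j * (s * i)
    lem = solve-∀ ring

  μ≥0 : 0ℚ ≤ μ
  μ≥0 = ⟦⟧≥0 (suc p) ⊗ <⇒≤ (⁻¹-pos p>0)

  λ'≥0 : 0ℚ ≤ λ'
  λ'≥0 = <⇒≤ (⁻¹-pos (p>0 ⊗< p>0))

  λ-bound : (1ℚ - ν) * (1ℚ - ν) ≤ λ' * ν
  λ-bound = ≤-trans (≤-reflexive (cong₂ _*_ 1-ν 1-ν)) (≤-trans (*-monoʳ (inv p) (inv≥0 p) small) (≤-reflexive (lem λ' ⟦ p ⟧ (inv p))))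
    where
    lem : ∀ l p i → l * p * i ≡ l * (p * i)
    lem = solve-∀ ring
    small : inv p ≤ λ' * ⟦ p ⟧
    small = *-cancel ⟦ p ⟧ p>0 (≤-trans ν≤1 (≤-reflexive (sym (trans (lem' ⟦ p ⟧ λ') (⁻¹-inverse (p>0 ⊗< p>0))))))
      where
      lem' : ∀ p l → p * (l * p) ≡ p * p * l
      lem' = solve-∀ ring

  Λ-flat : (1ℚ + κ * λ') ^ℚ T ≤ 2ℚ
  Λ-flat = pow≤2 T (κ * λ') (κ≥0 ⊗ λ'≥0) (cert
      (⟦⟧≥0 2 ⊗ ⟦⟧≥0 (suc d) ⊗ ⟦⟧≥0 d ⊗ ⟦⟧≥0 q ⊗ ⟦⟧≥0 q ⊗ λ'≥0
        ⊕ ≡⇒0≤ (κ * λ') (sym ⟦T⟧) ⊕ ≡⇒0≤ (⟦ 2 ⟧ * ⟦ suc d ⟧ * ⟦ q ⟧ * ⟦ q ⟧ * λ') (sym κ-def)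
        ⊕ ≡⇒0≤ ½ (sym (⁻¹-inverse (p>0 ⊗< p>0))) ⊕ ≡⇒0≤ (½ * λ' * (⟦ p ⟧ + ⟦ 2 ⟧ * ⟦ suc d ⟧ * ⟦ q ⟧)) ⟦p⟧)
      (lem ⟦ T ⟧ κ λ' ⟦ d ⟧ ⟦ q ⟧ ⟦ p ⟧))
    where
    lem : ∀ T κ l d q p → ½ ≡ T * (κ * l) + (⟦ 2 ⟧ * (1ℚ + d) * d * q * q * l + κ * l * ((1ℚ + d) * (⟦ 8 ⟧ * d * q * q) - T)
      + ⟦ 2 ⟧ * (1ℚ + d) * q * q * l * (1ℚ - (d + d + (d + d)) * κ) + ½ * (1ℚ - p * p * l) + ½ * l * (p + ⟦ 2 ⟧ * (1ℚ + d) * q) * (p - ⟦ 2 ⟧ * (1ℚ + d) * q))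
    lem = solve-∀ ring

  half-power : ν ^ℚ p ≤ ½
  half-power = *-cancel 2ℚ (0≤1 ⊕< 0<1) (≤-trans (*-monoʳ (ν ^ℚ p) (^-nonneg p ν≥0) two) (≤-reflexive (trans (sym (^-distrib-* μ ν p)) (trans (cong (_^ℚ p) (trans (ℚₚ.*-comm μ ν) νμ)) (1^ p)))))
    where
    two : 2ℚ ≤ μ ^ℚ p
    two = ≤-trans (≤-reflexive (cong (λ t → 1ℚ + t) (sym (⁻¹-inverse p>0)))) (≤-trans (bernoulli (⟦ p ⟧ ⁻¹) p (<⇒≤ (⁻¹-pos p>0)))
      (≤-reflexive (cong (_^ℚ p) (trans (cong (λ t → t + ⟦ p ⟧ ⁻¹) (sym (⁻¹-inverse p>0))) (lem ⟦ p ⟧ (⟦ p ⟧ ⁻¹))))))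
      where
      lem : ∀ p i → p * i + i ≡ (1ℚ + p) * i
      lem = solve-∀ ring

  Z V Fmax : ℚ
  Z    = ∑[ y ← box d r ] Pr.s y ^ℚ suc k
  V    = β d (suc k) * Z
  Fmax = ⟦ suc k ⟧ * (⟦ suc k ⟧ ^ℚ d * ρ)

  Z>0 : 0ℚ < Z
  Z>0 = <-≤-trans 0<1 (≤-trans (≤-reflexive (sym at-origin)) (∑-term {f = λ y → Pr.s y ^ℚ suc k} (λ y → ^-nonneg (suc k) (Pr.s≥0 y))
      (∈-box r (origin d) (subst (ℕ._≤ r) (sym (normInf-origin d)) z≤n))))
    where
    normSq-origin : ∀ d → normSq (origin d) ≡ 0
    normSq-origin zero    = refl
    normSq-origin (suc d) = normSq-origin d
    lem : ∀ i → 1ℚ - 0ℚ * i ≡ 1ℚ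
    lem = solve-∀ ring
    at-origin : Pr.s (origin d) ^ℚ suc k ≡ 1ℚ
    at-origin = trans (cong (_^ℚ suc k) (trans (cong _⊔0 (trans (cong (λ m → 1ℚ - ⟦ m ⟧ * ρ⁻¹) (normSq-origin d)) (lem ρ⁻¹))) (⊔0-pos 0≤1))) (1^ (suc k))

  V>0 : 0ℚ < V
  V>0 = β>0 d (suc k) ⊗< Z>0

  -- `flat` and `precise` bound the discretisation error of the profile, `filling` keeps n below the
  -- mass of the bump, `crude` bounds the cost of a point mass in its place, `negligible` the
  -- exponential tail, `few` the number of levels and `thin` the slab.
  record Conditions : Set where
    field
      flat      : ⟦ 10 ⟧ * ⟦ suc k ⟧ ≤ ⟦ r ⟧
      precise   : ⟦ 2 ⟧ * (⟦ 5 ⟧ + ⟦ d ⟧) * ⟦ suc E ⟧ * ⟦ suc k ⟧ ^ℚ suc (suc d) ≤ ⟦ r ⟧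
      filling   : ⟦ n ⟧ ≤ (1ℚ - ⟦ 5 ⟧ * δ) * V
      crude     : ⟦ n ⟧ * (⟦ 2 ⟧ * ⟦ d ⟧ * ⟦ suc E ⟧) ≤ ⟦ r ⟧ ^ℚ d * ⟦ τ ⟧
      negligible : 2ℚ * (⟦ n ⟧ * ⟦ T ⟧ + Fmax) ≤ 2ℚ ^ℚ L
      few       : ⟦ n ⟧ < 2ℚ ^ℚ L
      thin      : ⟦ suc E ⟧ * ⟦ suc (suc J) ⟧ ≤ ⟦ r ⟧

  module _ (cond : Conditions) where
    open Conditions cond

    z₀-flat : (1ℚ + z₀) ^ℚ suc k ≤ 2ℚ
    z₀-flat = pow≤2 (suc k) z₀ Pr.z₀≥0 (cert (0≤½ ⊗ ρ⁻¹≥0 ⊗ (⟦⟧≥0 r ⊗ diff≥0 flat ⊕ ⟦⟧≥0 6 ⊗ ⟦⟧≥0 (suc k) ⊗ diff≥0 (⟦⟧-mono r≥1)) ⊕ ≡⇒0≤ ½ (sym ρρ⁻¹))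
        (lem ⟦ suc k ⟧ ⟦ r ⟧ ρ⁻¹))
      where
      lem : ∀ k r i → ½ ≡ k * ((r + r + ⟦ 3 ⟧) * i) + (½ * i * (r * (r - ⟦ 10 ⟧ * k) + ⟦ 6 ⟧ * k * (r - 1ℚ)) + ½ * (1ℚ - r * r * i))
      lem = solve-∀ ring

    error≤δ : Pr.error (suc k) ≤ δ
    error≤δ = ≤-trans (cert (⟦⟧≥0 2 ⊗ Y≥0 ⊗ ρ⁻¹≥0 ⊗ (⟦⟧≥0 3 ⊗ diff≥0 (⟦⟧-mono r≥1) ⊕ ⟦⟧≥0 d ⊗ diff≥0 (⟦⟧-mono r≥1) ⊕ ¾≥0 ⊗ ⟦⟧≥0 d)) (lem ⟦ suc k ⟧ (⟦ suc k ⟧ ^ℚ d) ⟦ r ⟧ ρ⁻¹ ⟦ d ⟧))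
        (cert (δ≥0 ⊗ ρ⁻¹≥0 ⊗ ⟦⟧≥0 r ⊗ diff≥0 precise ⊕ ≡⇒0≤ (⟦ 2 ⟧ * Y * (⟦ 5 ⟧ + ⟦ d ⟧) * ⟦ r ⟧ * ρ⁻¹) (inv-def E) ⊕ ≡⇒0≤ δ (sym ρρ⁻¹))
          (lem₂ Y ⟦ r ⟧ ρ⁻¹ (⟦ 5 ⟧ + ⟦ d ⟧) ⟦ suc E ⟧ δ))
      where
      Y = ⟦ suc k ⟧ ^ℚ suc (suc d)
      Y≥0 : 0ℚ ≤ Y
      Y≥0 = ^-nonneg (suc (suc d)) (⟦⟧≥0 (suc k))
      ¾≥0 : 0ℚ ≤ 1ℚ - ¼
      ¾≥0 = ℚ.*≤* (ℤ.+≤+ z≤n)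
      lem : ∀ k y r i d → ⟦ 2 ⟧ * (k * (k * y)) * (⟦ 5 ⟧ + d) * r * i ≡ k * (y * (2ℚ * k * ((r + r + ⟦ 3 ⟧) * i + ¼ * d * i)))
        + ⟦ 2 ⟧ * (k * (k * y)) * i * (⟦ 3 ⟧ * (r - 1ℚ) + d * (r - 1ℚ) + (1ℚ - ¼) * d)
      lem = solve-∀ ring
      lem₂ : ∀ y r i a e δ → δ ≡ ⟦ 2 ⟧ * y * a * r * i + (δ * i * r * (r - ⟦ 2 ⟧ * a * e * y) + ⟦ 2 ⟧ * y * a * r * i * (e * δ - 1ℚ) + δ * (1ℚ - r * r * i))
      lem₂ = solve-∀ ring

    c₀ : ℚ
    c₀ = ⟦ n ⟧ * V ⁻¹

    V⁻¹≥0 : 0ℚ ≤ V ⁻¹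
    V⁻¹≥0 = <⇒≤ (⁻¹-pos V>0)

    c₀≥0 : 0ℚ ≤ c₀
    c₀≥0 = ⟦⟧≥0 n ⊗ V⁻¹≥0

    c₀≤ : c₀ ≤ 1ℚ - ⟦ 5 ⟧ * δ
    c₀≤ = cert (V⁻¹≥0 ⊗ diff≥0 filling ⊕ ≡⇒0≤ (1ℚ - ⟦ 5 ⟧ * δ) (sym (⁻¹-inverse V>0))) (lem ⟦ n ⟧ (V ⁻¹) V (1ℚ - ⟦ 5 ⟧ * δ))
      where
      lem : ∀ n i v a → a ≡ n * i + (i * (a * v - n) + a * (1ℚ - v * i))
      lem = solve-∀ ring

    c₀≤1 : c₀ ≤ 1ℚ
    c₀≤1 = ≤-trans c₀≤ (cert (⟦⟧≥0 5 ⊗ δ≥0) (lem (⟦ 5 ⟧ * δ)))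
      where
      lem : ∀ a → 1ℚ ≡ 1ℚ - a + a
      lem = solve-∀ ring

    mass : c₀ * V ≡ ⟦ n ⟧
    mass = trans (lem ⟦ n ⟧ (V ⁻¹) V) (trans (cong (λ t → ⟦ n ⟧ * t) (⁻¹-inverse V>0)) (ℚₚ.*-identityʳ ⟦ n ⟧))
      where
      lem : ∀ n i v → n * i * v ≡ n * (v * i)
      lem = solve-∀ ring

    disp>0 : 0ℚ < ⟦ disp ⟧
    disp>0 = ⟦⟧>0 disp≥1

    l l' G : ℚ
    l  = ⟦ r ⟧ * ⟦ disp ⟧ ⁻¹
    l' = ⟦ disp ⟧ * ⟦ r ⟧ ⁻¹
    G  = q⁻¹ ^ℚ suc d

    l≥0 : 0ℚ ≤ l
    l≥0 = ⟦⟧≥0 r ⊗ <⇒≤ (⁻¹-pos disp>0)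

    mean : ∑[ y ← box d r ] Pr.s y ^ℚ suc k * ⟦ norm₁ y ⟧ ≤ 2ℚ * ⟦ d ⟧ * l * Z
    mean = ProfileMean.mean-displacement d r r≥1 k l l'
        (trans (lem ⟦ r ⟧ (⟦ disp ⟧ ⁻¹) ⟦ disp ⟧ (⟦ r ⟧ ⁻¹)) (cong₂ _*_ (⁻¹-inverse (⟦⟧>0 r≥1)) (⁻¹-inverse disp>0)))
        l≥0 (⟦⟧≥0 disp ⊗ <⇒≤ (⁻¹-pos (⟦⟧>0 r≥1)))
        (cert (l≥0 ⊕ ≡⇒0≤ (⟦ r ⟧ * ⟦ disp ⟧) (sym (⁻¹-inverse (⟦⟧>0 r≥1))) ⊕ ≡⇒0≤ (⟦ r ⟧ * ⟦ disp ⟧) (⁻¹-inverse disp>0) ⊕ ≡⇒0≤ l (⟦⟧-* disp disp))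
          (lem₂ ⟦ r ⟧ (⟦ r ⟧ ⁻¹) ⟦ disp ⟧ (⟦ disp ⟧ ⁻¹) ⟦ k ⟧))
      where
      lem : ∀ r i d j → r * i * (d * j) ≡ r * j * (d * i)
      lem = solve-∀ ring
      lem₂ : ∀ r i d j k → r * j * (1ℚ + k) ≡ d * i * (r * r) + (r * j + r * d * (1ℚ - r * i) + r * d * (d * j - 1ℚ) + r * j * (k - d * d))
      lem₂ = solve-∀ ring

    open Sp.Odometer (Pr.F (suc k)) (λ y → Pr.s y ^ℚ suc k) r n (β d (suc k)) c₀ (Pr.error (suc k)) G (2ℚ * ⟦ d ⟧ * l)
      (Pr.F≥0 (suc k)) (λ y → ^-nonneg (suc k) (Pr.s≥0 y)) (λ y h → trans (cong (_^ℚ suc k) (Pr.s-outside y h)) (0^suc k))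
      (β≥0 d (suc k)) c₀≥0 mass (λ y → Pr.F-lap k y z₀-flat) (^-nonneg (suc d) q⁻¹≥0) (≤-reflexive (^-distrib-* q⁻¹ q⁻¹ (suc d))) mean using (f; f≥0; f-lap; module Tail)

    spread≤δ : ⟦ n ⟧ * (G * (2ℚ * ⟦ d ⟧ * l)) ≤ δ
    spread≤δ = cert (δ≥0 ⊗ X≥0 ⊗ diff≥0 crude ⊕ ≡⇒0≤ (⟦ n ⟧ * ⟦ 2 ⟧ * ⟦ d ⟧ * X) (inv-def E) ⊕ ≡⇒0≤ δ (sym one)) (lem ⟦ n ⟧ G ⟦ d ⟧ ⟦ r ⟧ (⟦ disp ⟧ ⁻¹) ⟦ suc E ⟧ δ (⟦ r ⟧ ^ℚ d) ⟦ τ ⟧)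
      where
      X = G * ⟦ r ⟧ * ⟦ disp ⟧ ⁻¹
      X≥0 : 0ℚ ≤ X
      X≥0 = ^-nonneg (suc d) q⁻¹≥0 ⊗ ⟦⟧≥0 r ⊗ <⇒≤ (⁻¹-pos disp>0)
      lem : ∀ n G d r i e δ R t → δ ≡ n * (G * (2ℚ * d * (r * i))) + (δ * (G * r * i) * (R * t - n * (⟦ 2 ⟧ * d * e)) + n * ⟦ 2 ⟧ * d * (G * r * i) * (e * δ - 1ℚ) + δ * (1ℚ - G * (r * R) * t * i))
      lem = solve-∀ ring
      scaled : G * ⟦ r ⟧ ^ℚ suc d ≡ ⟦ τ ⟧ ^ℚ suc d
      scaled = trans (sym (^-distrib-* q⁻¹ ⟦ r ⟧ (suc d))) (cong (_^ℚ suc d) (trans (cong (λ t → q⁻¹ * t) (⟦⟧-* q τ)) (trans (lem' q⁻¹ ⟦ q ⟧ ⟦ τ ⟧) (trans (cong (λ t → t * ⟦ τ ⟧) qq⁻¹) (ℚₚ.*-identityˡ ⟦ τ ⟧)))))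
        where
        lem' : ∀ i q t → i * (q * t) ≡ q * i * t
        lem' = solve-∀ ring
      one : G * ⟦ r ⟧ ^ℚ suc d * ⟦ τ ⟧ * ⟦ disp ⟧ ⁻¹ ≡ 1ℚ
      one = trans (cong (λ t → t * ⟦ disp ⟧ ⁻¹) (trans (cong (λ t → t * ⟦ τ ⟧) scaled) (trans (ℚₚ.*-comm _ ⟦ τ ⟧) (sym (⟦⟧-^ τ (suc (suc d))))))) (⁻¹-inverse disp>0)

    e : ℚ
    e = δ * ⟦ d ⟧ ⁻¹

    d⁻¹≥0 : 0ℚ ≤ ⟦ d ⟧ ⁻¹
    d⁻¹≥0 = <⇒≤ (⁻¹-pos (⟦⟧>0 d≥1))

    e≥0 : 0ℚ ≤ e
    e≥0 = δ≥0 ⊗ d⁻¹≥0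

    d-e : ⟦ d ⟧ * e ≡ δ
    d-e = trans (lem ⟦ d ⟧ δ (⟦ d ⟧ ⁻¹)) (trans (cong (λ t → δ * t) (⁻¹-inverse (⟦⟧>0 d≥1))) (ℚₚ.*-identityʳ δ))
      where
      lem : ∀ d δ i → d * (δ * i) ≡ δ * (d * i)
      lem = solve-∀ ring

    f-lap' : ∀ x → lap f x ≤ 1ℚ - ⟦ d ⟧ * e - ⟦ n ⟧ * kr (origin d) x
    -- The 5 δ of `c₀≤` pays for the profile error δ, the smearing error δ and d e = δ.
    f-lap' x = ≤-trans (f-lap x) (cert (c₀≥0 ⊗ diff≥0 error≤δ ⊕ diff≥0 c₀≤ ⊗ (0≤1 ⊕ δ≥0) ⊕ ⟦⟧≥0 5 ⊗ (δ≥0 ⊗ δ≥0) ⊕ ⟦⟧≥0 2 ⊗ δ≥0 ⊕ diff≥0 spread≤δ ⊕ ≡⇒0≤ 1ℚ (sym d-e))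
        (lem c₀ (Pr.error (suc k)) δ (⟦ n ⟧ * (G * (2ℚ * ⟦ d ⟧ * l))) (⟦ d ⟧ * e) (⟦ n ⟧ * kr (origin d) x)))
      where
      lem : ∀ c e δ s D k → 1ℚ - D - k ≡ c * (1ℚ + e) + s - k + (c * (δ - e) + (1ℚ - ⟦ 5 ⟧ * δ - c) * (1ℚ + δ) + ⟦ 5 ⟧ * (δ * δ) + ⟦ 2 ⟧ * δ + (δ - s) + 1ℚ * (δ - D))
      lem = solve-∀ ring

    doubling : 2ℚ ≤ (1ℚ + e) ^ℚ (d ℕ.* suc E)
    doubling = ≤-trans (≤-reflexive (cong (λ t → 1ℚ + t) (sym (trans (cong (λ t → t * e) (⟦⟧-* d (suc E))) (trans (lem ⟦ d ⟧ ⟦ suc E ⟧ e) (trans (cong (λ t → ⟦ suc E ⟧ * t) d-e) (inv-def E)))))))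
        (bernoulli e (d ℕ.* suc E) e≥0)
      where
      lem : ∀ d E e → d * E * e ≡ E * (d * e)
      lem = solve-∀ ring

    growth : ⟦ n ⟧ < (1ℚ + e) ^ℚ J
    growth = <-≤-trans few (≤-trans (^-mono L 0≤2 doubling) (≤-reflexive (sym (^-* (1ℚ + e) L (d ℕ.* suc E)))))

    module _ (i : Fin d) where
      open Tail i ν λ' ν≥0 ν≤1 λ'≥0 λ-bound

      -- F is at most `Fmax` and vanishes once |x_i| ≥ r, so the factor μ^r makes up for the decay
      -- of ψ as far as it matters.
      A : ℚ
      A = Fmax * μ ^ℚ r

      Fmax≥0 : 0ℚ ≤ Fmax
      Fmax≥0 = ⟦⟧≥0 (suc k) ⊗ (^-nonneg d (⟦⟧≥0 (suc k)) ⊗ <⇒≤ ρ>0)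

      ν-cancel : ∀ m → μ ^ℚ m * ν ^ℚ m ≡ 1ℚ
      ν-cancel m = trans (sym (^-distrib-* μ ν m)) (trans (cong (_^ℚ m) (trans (ℚₚ.*-comm μ ν) νμ)) (1^ m))

      A≥0 : 0ℚ ≤ A
      A≥0 = Fmax≥0 ⊗ ^-nonneg r μ≥0

      F≤Aψ : ∀ x → Pr.F (suc k) x ≤ A * ψ x
      F≤Aψ x with ℕₚ.≤-total r ℤ.∣ coord i x ∣
      ... | inj₁ h = ≤-trans (≤-reflexive (Pr.F-zero (suc k) x (Pr.s-outside x (ℕₚ.≤-trans h (∣coord∣≤norm i x))))) (A≥0 ⊗ ψ≥0 x)
      ... | inj₂ h = ≤-trans (Pr.F≤ (suc k) (suc k) x ℕₚ.≤-refl) (≤-trans (≤-reflexive (sym (trans (ℚₚ.*-assoc Fmax (μ ^ℚ r) (ν ^ℚ r)) (trans (cong (λ t → Fmax * t) (ν-cancel r)) (ℚₚ.*-identityʳ Fmax)))))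
        (*-monoˡ A A≥0 (^-anti-exp ν≥0 ν≤1 h)))

      f-far : ∀ x → r' ℕ.≤ ℤ.∣ coord i x ∣ → f x ≤ 1ℚ
      f-far x far = ≤-trans (f-tail A≥0 F≤Aψ x) (≤-trans (*-mono (Λ≥0 ⊗ S≥0) (ψ≥0 x) (*-monoʳ S S≥0 Λ-flat) (^-anti-exp ν≥0 ν≤1 far))
          (≤-trans (≤-reflexive split) (≤-trans (*-mono (0≤2 ⊗ S'≥0) (^-nonneg L (^-nonneg p ν≥0)) (*-monoˡ 2ℚ 0≤2 S'≤) (^-mono L (^-nonneg p ν≥0) half-power))
            (≤-trans (*-monoʳ (½ ^ℚ L) (^-nonneg L 0≤½) negligible) (≤-reflexive (trans (sym (^-distrib-* 2ℚ ½ L)) (1^ L)))))))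
        where
        S = ⟦ n ⟧ * ⟦ T ⟧ + c₀ * A
        S' = ⟦ n ⟧ * ⟦ T ⟧ * ν ^ℚ r + c₀ * Fmax
        S≥0 : 0ℚ ≤ S
        S≥0 = ⟦⟧≥0 n ⊗ ⟦⟧≥0 T ⊕ c₀≥0 ⊗ A≥0
        S'≥0 : 0ℚ ≤ S'
        S'≥0 = ⟦⟧≥0 n ⊗ ⟦⟧≥0 T ⊗ ^-nonneg r ν≥0 ⊕ c₀≥0 ⊗ Fmax≥0
        Λ≥0 : 0ℚ ≤ (1ℚ + κ * λ') ^ℚ T
        Λ≥0 = ^-nonneg T (0≤1 ⊕ κ≥0 ⊗ λ'≥0)
        S'≤ : S' ≤ ⟦ n ⟧ * ⟦ T ⟧ + Fmax
        S'≤ = cert (⟦⟧≥0 n ⊗ ⟦⟧≥0 T ⊗ diff≥0 (^≤1 r ν≥0 ν≤1) ⊕ diff≥0 c₀≤1 ⊗ Fmax≥0) (lem (⟦ n ⟧ * ⟦ T ⟧) (ν ^ℚ r) c₀ Fmax)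
          where
          lem : ∀ a v c F → a + F ≡ a * v + c * F + (a * (1ℚ - v) + (1ℚ - c) * F)
          lem = solve-∀ ring
        split : 2ℚ * S * ν ^ℚ r' ≡ 2ℚ * S' * (ν ^ℚ p) ^ℚ L
        split = trans (cong (λ t → 2ℚ * S * t) (trans (^-+ ν r (L ℕ.* p)) (cong (λ t → ν ^ℚ r * t) (^-* ν L p)))) (trans (lem (⟦ n ⟧ * ⟦ T ⟧) c₀ Fmax (μ ^ℚ r) (ν ^ℚ r) ((ν ^ℚ p) ^ℚ L))
            (cong (λ t → 2ℚ * (⟦ n ⟧ * ⟦ T ⟧ * ν ^ℚ r + c₀ * Fmax * t) * (ν ^ℚ p) ^ℚ L) (ν-cancel r) ▸ cong (λ t → 2ℚ * (⟦ n ⟧ * ⟦ T ⟧ * ν ^ℚ r + t) * (ν ^ℚ p) ^ℚ L) (ℚₚ.*-identityʳ (c₀ * Fmax))))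
          where
          _▸_ : ∀ {a b c : ℚ} → a ≡ b → b ≡ c → a ≡ c
          _▸_ = trans
          lem : ∀ a c F m v w → 2ℚ * (a + c * (F * m)) * (v * w) ≡ 2ℚ * (a * v + c * F * (m * v)) * w
          lem = solve-∀ ring

      open Shape c g a c≥1

      barrier : Barrier d h n
      barrier = record
        { ζ = λ x → ℤ.∣ coord i x ∣ ; ζ-step = ∣coord∣-step i ; ζ-origin = cong ℤ.∣_∣ (coord-origin i)
        ; a = a ; a' = a ; r' = r' ; a'≤a = ℕₚ.≤-refl ; r'<a' = ℕₚ.m<m+n r' (s≤s z≤n) ; d≥1 = d≥1
        ; w = λ x → w ℤ.∣ coord i x ∣ ; γ = λ x → tri (a ℕ.∸ ℤ.∣ coord i x ∣)
        ; w-in = λ x p → ≤-trans (w-lap i x) (≤-reflexive (trans (bound-in _ p) inner))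
        ; w-out = λ x p → ≤-trans (w-lap i x) (≤-reflexive (trans (bound-out _ p) outer))
        ; f = f ; f≥0 = f≥0 ; e = e ; e≥0 = e≥0 ; f-lap = f-lap' ; f-far = f-far ; J = J ; growth = growth
        ; γ-lap = λ x _ → γ-lap a i x
        ; γ-near = λ x p → subst (λ z → suc J ℕ.≤ tri (a ℕ.∸ z)) (sym p) (subst (λ m → suc J ℕ.≤ tri m) (sym (ℕₚ.m+n∸m≡n r' (suc J))) (m≤tri (suc J)))
        ; γ-far = λ x p → cong tri (ℕₚ.m≤n⇒m∸n≡0 p) }
        where
        outer : ⟦ c ⟧ ≡ ⟦ d ⟧ + ⟦ d ⟧ - 1ℚ - ⟦ h ⟧
        outer = trans (lem ⟦ c ⟧ ⟦ h ⟧) (cong (λ t → t - 1ℚ - ⟦ h ⟧) (trans (sym (⟦⟧-+ c (suc h))) (trans (cong ⟦_⟧ c+h) (⟦⟧-+ d d))))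
          where
          lem : ∀ c h → c ≡ c + (1ℚ + h) - 1ℚ - h
          lem = solve-∀ ring
        inner : - ⟦ g ⟧ ≡ ⟦ d ⟧ - ⟦ h ⟧ - 1ℚ
        inner = trans (lem ⟦ c ⟧ ⟦ g ⟧) (trans (cong₂ (λ s t → s - t) outer (trans (sym (⟦⟧-+ c g)) (cong ⟦_⟧ c+g))) (lem₂ ⟦ d ⟧ ⟦ h ⟧))
          where
          lem : ∀ c g → - g ≡ c - (c + g)
          lem = solve-∀ ring
          lem₂ : ∀ d h → d + d - 1ℚ - h - d ≡ d - h - 1ℚ
          lem₂ = solve-∀ ring

      coordinate-bound : ∀ x → Topples d h n x → c ℕ.* ℤ.∣ coord i x ∣ ℕ.≤ d ℕ.* suc a
      coordinate-bound x t with ℕₚ.≤-total a ℤ.∣ coord i x ∣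
      ... | inj₂ p = ℕₚ.*-mono-≤ (subst (c ℕ.≤_) c+g (ℕₚ.m≤m+n c g)) (ℕₚ.m≤n⇒m≤1+n p)
      ... | inj₁ p = ℕₚ.≤-trans (ℕₚ.*-monoʳ-≤ c (ℕₚ.<⇒≤ (ℕₚ.≰⇒> λ far → ℕₚ.<⇒≱ (Argument.confined barrier x t p) (ℕₚ.≤-reflexive (w-far _ far)))))
        (subst (λ m → c ℕ.* R ℕ.≤ m ℕ.* suc a) c+g cR≤)

    -- Here a + 1 = r + L p + (J + 2): the margin L p is exactly δ r, and `thin` bounds J + 2 by δ
    -- r.
    norm-bound : ∀ x → Topples d h n x → ⟦ c ℕ.* normInf x ⟧ ≤ ⟦ d ⟧ * ((1ℚ + δ + δ) * ⟦ r ⟧)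
    norm-bound x t with ∣coord∣-attains d≥1 x
    ... | i , eq = ≤-trans (⟦⟧-mono (subst (λ m → c ℕ.* m ℕ.≤ d ℕ.* suc a) eq (coordinate-bound i x t))) (≤-trans (≤-reflexive (⟦⟧-* d (suc a))) (*-monoˡ ⟦ d ⟧ (⟦⟧≥0 d) suc-a))
      where
      margin : ⟦ L ℕ.* p ⟧ ≡ δ * ⟦ r ⟧
      margin = trans (trans (⟦⟧-* L p) (cong (λ t → ⟦ L ⟧ * t) ⟦p⟧)) (sym (trans (cong (λ t → δ * t) (trans (⟦⟧-* q τ) (cong (λ t → ⟦ q ⟧ * t)
          (trans (⟦⟧-* (2 ℕ.* suc d ℕ.* suc E) L) (cong (λ t → t * ⟦ L ⟧) (trans (⟦⟧-* (2 ℕ.* suc d) (suc E)) (cong (λ t → t * ⟦ suc E ⟧) (⟦⟧-* 2 (suc d)))))))))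
          (trans (lem δ ⟦ q ⟧ ⟦ suc d ⟧ ⟦ suc E ⟧ ⟦ L ⟧) (trans (cong (λ t → t * (⟦ L ⟧ * (⟦ 2 ⟧ * ⟦ suc d ⟧ * ⟦ q ⟧))) (inv-def E)) (ℚₚ.*-identityˡ _)))))
        where
        lem : ∀ δ q d E L → δ * (q * (⟦ 2 ⟧ * d * E * L)) ≡ E * δ * (L * (⟦ 2 ⟧ * d * q))
        lem = solve-∀ ring
      suc-a : ⟦ suc a ⟧ ≤ (1ℚ + δ + δ) * ⟦ r ⟧
      suc-a = ≤-trans (≤-reflexive (cong (λ t → 1ℚ + t) (trans (⟦⟧-+ r' (suc J)) (cong (λ t → t + ⟦ suc J ⟧) (trans (⟦⟧-+ r (L ℕ.* p)) (cong (λ t → ⟦ r ⟧ + t) margin))))))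
        (cert (δ≥0 ⊗ diff≥0 thin ⊕ ≡⇒0≤ ⟦ suc (suc J) ⟧ (inv-def E)) (lem δ ⟦ r ⟧ ⟦ J ⟧ ⟦ suc E ⟧))
        where
        lem : ∀ δ r J E → (1ℚ + δ + δ) * r ≡ 1ℚ + (r + δ * r + (1ℚ + J)) + (δ * (r - E * (1ℚ + (1ℚ + J))) + (1ℚ + (1ℚ + J)) * (E * δ - 1ℚ))
        lem = solve-∀ ring

-- Reduction of the conditions to a few size inequalities.

∃-⟦⟧≥ : ∀ x → ∃[ N ] x ≤ ⟦ N ⟧
∃-⟦⟧≥ x@(ℚ.mkℚ (+ a) b _) = a , ≤-trans (cert (ℚₚ.nonNegative⁻¹ x ⊗ ⟦⟧≥0 b) (lem x ⟦ b ⟧))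
    (≤-reflexive (trans (cong (λ t → t * ⟦ suc b ⟧) (sym (ℚₚ.↥p/↧p≡p x))) (/-⟦⟧ a b)))
  where
  lem : ∀ x b → x * (1ℚ + b) ≡ x + x * b
  lem = solve-∀ ring
∃-⟦⟧≥ x@(ℚ.mkℚ -[1+ _ ] _ _) = 0 , <⇒≤ (ℚₚ.negative⁻¹ x)

summandˡ : ∀ {x y a} → 0ℚ ≤ y → x + y ≤ a → x ≤ a
summandˡ h = ≤-trans (cert h refl)

summandʳ : ∀ {x y a} → 0ℚ ≤ x → x + y ≤ a → y ≤ a
summandʳ {x} {y} h = ≤-trans (cert h (ℚₚ.+-comm x y))

-- Dominates every coefficient by which a power of suc k is multiplied in Conditions.
constants : (d E : ℕ) (K W : ℚ) → ℚ
constants d E K W = ⟦ 10 ⟧ + ⟦ 2 ⟧ * (⟦ 5 ⟧ + ⟦ d ⟧) * ⟦ suc E ⟧ + K * ⟦ suc E ⟧ * W ⁻¹ + ⟦ suc E ⟧ * (⟦ 2 ⟧ + ⟦ d ⟧ * ⟦ suc E ⟧) + ⟦ suc d ⟧ * (⟦ 8 ⟧ * ⟦ d ⟧) + W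

module Parameters (d h n c g : ℕ) (d≥1 : 1 ℕ.≤ d) (c≥1 : 1 ℕ.≤ c) (c+h : c ℕ.+ suc h ≡ d ℕ.+ d) (c+g : c ℕ.+ g ≡ d)
  (E L q : ℕ) (L≥1 : 1 ℕ.≤ L) (q≥1 : 1 ℕ.≤ q) where

  open Outer d h n c g d≥1 c≥1 c+h c+g E L q L≥1 q≥1

  L≤k : L ℕ.≤ suc k
  L≤k = ℕₚ.≤-trans (L≤ (2 ℕ.* suc d ℕ.* suc E) (s≤s z≤n)) (ℕₚ.≤-trans τ≤disp (ℕₚ.m≤n⇒m≤1+n (L≤ disp disp≥1)))
    where
    L≤ : ∀ {L} m → 1 ℕ.≤ m → L ℕ.≤ m ℕ.* L
    L≤ {L} m h = ℕₚ.≤-trans (ℕₚ.≤-reflexive (sym (ℕₚ.*-identityˡ L))) (ℕₚ.*-monoˡ-≤ L h)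
    τ≤disp : τ ℕ.≤ disp
    τ≤disp = ℕₚ.≤-trans (ℕₚ.≤-reflexive (sym (ℕₚ.*-identityʳ τ))) (ℕₚ.*-monoʳ-≤ τ (subst (ℕ._≤ τ ℕ.^ suc d) (ℕₚ.^-zeroˡ (suc d)) (ℕₚ.^-monoˡ-≤ (suc d) τ≥1)))

  module _ (A e : ℕ) (K W : ℚ) (K≥0 : 0ℚ ≤ K) (W>0 : 0ℚ < W)
    (E≥ : 4 ℕ.≤ E) (n≥1 : 1 ℕ.≤ n)
    (volume : W * ⟦ r ⟧ ^ℚ d ≤ V + K * ⟦ suc k ⟧ ^ℚ e * (⟦ r ⟧ ^ℚ d * ⟦ r ⟧ ⁻¹))
    (A≥ : constants d E K W ≤ ⟦ A ⟧)
    (A≤L : A ℕ.≤ L) (k-small : A ℕ.* suc k ℕ.^ (e ℕ.+ suc (suc d)) ℕ.≤ r) (power : r ℕ.^ (5 ℕ.+ d) ℕ.≤ 2 ℕ.^ L)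
    (filled : ⟦ n ⟧ ≤ (1ℚ - ⟦ 6 ⟧ * δ) * (W * ⟦ r ⟧ ^ℚ d)) where

    private
      R : ℚ
      R = ⟦ r ⟧ ^ℚ d

      R≥0 : 0ℚ ≤ R
      R≥0 = ^-nonneg d (⟦⟧≥0 r)

      r⁻¹≥0 : 0ℚ ≤ ⟦ r ⟧ ⁻¹
      r⁻¹≥0 = <⇒≤ (⁻¹-pos (⟦⟧>0 r≥1))

      W⁻¹≥0 : 0ℚ ≤ W ⁻¹
      W⁻¹≥0 = <⇒≤ (⁻¹-pos W>0)

      x₁ x₂ x₃ x₄ x₅ : ℚ
      x₁ = ⟦ 10 ⟧
      x₂ = ⟦ 2 ⟧ * (⟦ 5 ⟧ + ⟦ d ⟧) * ⟦ suc E ⟧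
      x₃ = K * ⟦ suc E ⟧ * W ⁻¹
      x₄ = ⟦ suc E ⟧ * (⟦ 2 ⟧ + ⟦ d ⟧ * ⟦ suc E ⟧)
      x₅ = ⟦ suc d ⟧ * (⟦ 8 ⟧ * ⟦ d ⟧)

      x₁≥0 : 0ℚ ≤ x₁
      x₁≥0 = ⟦⟧≥0 10

      x₂≥0 : 0ℚ ≤ x₂
      x₂≥0 = ⟦⟧≥0 2 ⊗ (⟦⟧≥0 5 ⊕ ⟦⟧≥0 d) ⊗ ⟦⟧≥0 (suc E)

      x₃≥0 : 0ℚ ≤ x₃
      x₃≥0 = K≥0 ⊗ ⟦⟧≥0 (suc E) ⊗ W⁻¹≥0

      x₄≥0 : 0ℚ ≤ x₄
      x₄≥0 = ⟦⟧≥0 (suc E) ⊗ (⟦⟧≥0 2 ⊕ ⟦⟧≥0 d ⊗ ⟦⟧≥0 (suc E))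

      x₅≥0 : 0ℚ ≤ x₅
      x₅≥0 = ⟦⟧≥0 (suc d) ⊗ (⟦⟧≥0 8 ⊗ ⟦⟧≥0 d)

      1≤k : 1ℚ ≤ ⟦ suc k ⟧
      1≤k = cert (⟦⟧≥0 k) refl

      k-power : ∀ {x} j → j ℕ.≤ e ℕ.+ suc (suc d) → 0ℚ ≤ x → x ≤ ⟦ A ⟧ → x * ⟦ suc k ⟧ ^ℚ j ≤ ⟦ r ⟧
      k-power j j≤ x≥0 x≤A = ≤-trans (*-mono x≥0 (^-nonneg j (⟦⟧≥0 (suc k))) x≤A (^-mono-exp 1≤k j≤))
        (≤-trans (≤-reflexive (sym (trans (⟦⟧-* A (suc k ℕ.^ (e ℕ.+ suc (suc d)))) (cong (λ t → ⟦ A ⟧ * t) (⟦⟧-^ (suc k) (e ℕ.+ suc (suc d))))))) (⟦⟧-mono k-small))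

      A≤r : ⟦ A ⟧ ≤ ⟦ r ⟧
      A≤r = ≤-trans (≤-reflexive (sym (ℚₚ.*-identityʳ ⟦ A ⟧))) (k-power 0 z≤n (⟦⟧≥0 A) ≤-refl)

      1≤r : 1ℚ ≤ ⟦ r ⟧
      1≤r = ⟦⟧-mono r≥1

      ⟦n⟧≤ : ⟦ n ⟧ ≤ W * R
      ⟦n⟧≤ = ≤-trans filled (cert (⟦⟧≥0 6 ⊗ δ≥0 ⊗ (<⇒≤ W>0 ⊗ R≥0)) (lem (⟦ 6 ⟧ * δ) (W * R)))
        where
        lem : ∀ a x → x ≡ (1ℚ - a) * x + a * x
        lem = solve-∀ ring

      s₆ = summandʳ {x₁ + x₂ + x₃ + x₄ + x₅} {W} (x₁≥0 ⊕ x₂≥0 ⊕ x₃≥0 ⊕ x₄≥0 ⊕ x₅≥0) A≥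
      t₅ = summandˡ {x₁ + x₂ + x₃ + x₄ + x₅} {W} (<⇒≤ W>0) A≥
      s₅ = summandʳ {x₁ + x₂ + x₃ + x₄} {x₅} (x₁≥0 ⊕ x₂≥0 ⊕ x₃≥0 ⊕ x₄≥0) t₅
      t₄ = summandˡ {x₁ + x₂ + x₃ + x₄} {x₅} x₅≥0 t₅
      s₄ = summandʳ {x₁ + x₂ + x₃} {x₄} (x₁≥0 ⊕ x₂≥0 ⊕ x₃≥0) t₄
      t₃ = summandˡ {x₁ + x₂ + x₃} {x₄} x₄≥0 t₄
      s₃ = summandʳ {x₁ + x₂} {x₃} (x₁≥0 ⊕ x₂≥0) t₃
      t₂ = summandˡ {x₁ + x₂} {x₃} x₃≥0 t₃
      s₂ = summandʳ {x₁} {x₂} x₁≥0 t₂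
      s₁ = summandˡ {x₁} {x₂} x₂≥0 t₂

      flat-enough : ⟦ 10 ⟧ * ⟦ suc k ⟧ ≤ ⟦ r ⟧
      flat-enough = ≤-trans (≤-reflexive (cong (λ t → ⟦ 10 ⟧ * t) (sym (ℚₚ.*-identityʳ ⟦ suc k ⟧)))) (k-power 1 (ℕₚ.≤-trans (s≤s z≤n) (ℕₚ.m≤n+m (suc (suc d)) e)) x₁≥0 s₁)

      k≤r : ⟦ suc k ⟧ ≤ ⟦ r ⟧
      k≤r = ≤-trans (cert (⟦⟧≥0 9 ⊗ ⟦⟧≥0 (suc k)) (lem ⟦ suc k ⟧)) flat-enough
        where
        lem : ∀ x → ⟦ 10 ⟧ * x ≡ x + ⟦ 9 ⟧ * x
        lem = solve-∀ ring

      4≤r : ⟦ 4 ⟧ ≤ ⟦ r ⟧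
      4≤r = ≤-trans (⟦⟧-mono {4} {10} (s≤s (s≤s (s≤s (s≤s z≤n))))) (≤-trans s₁ A≤r)

      -- The error in the volume is at most δ W r^d, and 1 - 6 δ ≤ (1 - 5 δ)(1 - δ).
      filling-enough : ⟦ n ⟧ ≤ (1ℚ - ⟦ 5 ⟧ * δ) * V
      filling-enough = cert (5δ≤1 ⊗ (diff≥0 volume ⊕ (δ≥0 ⊗ <⇒≤ W>0 ⊗ R≥0 ⊗ r⁻¹≥0 ⊗ diff≥0 (k-power e (ℕₚ.m≤m+n e _) x₃≥0 s₃) ⊕ ≡⇒0≤ (δ * W * R) (sym (⁻¹-inverse (⟦⟧>0 r≥1)))
            ⊕ ≡⇒0≤ (X * (W * W ⁻¹)) (inv-def E) ⊕ ≡⇒0≤ X (⁻¹-inverse W>0)))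
          ⊕ diff≥0 filled ⊕ ⟦⟧≥0 5 ⊗ (δ≥0 ⊗ δ≥0) ⊗ (<⇒≤ W>0 ⊗ R≥0))
          (lem ⟦ n ⟧ δ V W R K (⟦ suc k ⟧ ^ℚ e) ⟦ r ⟧ (⟦ r ⟧ ⁻¹) ⟦ suc E ⟧ (W ⁻¹))
        where
        X = K * ⟦ suc k ⟧ ^ℚ e * (R * ⟦ r ⟧ ⁻¹)
        5δ≤1 : 0ℚ ≤ 1ℚ - ⟦ 5 ⟧ * δ
        5δ≤1 = subst (0ℚ ≤_) (trans (lem' ⟦ suc E ⟧ δ) (cong (λ t → t - ⟦ 5 ⟧ * δ) (inv-def E))) (diff≥0 (⟦⟧-mono {5} (s≤s E≥)) ⊗ δ≥0)
          where
          lem' : ∀ e d → (e - ⟦ 5 ⟧) * d ≡ e * d - ⟦ 5 ⟧ * d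
          lem' = solve-∀ ring
        lem : ∀ n δ V W R K Y r i e w → (1ℚ - ⟦ 5 ⟧ * δ) * V ≡ n + ((1ℚ - ⟦ 5 ⟧ * δ) * (V + K * Y * (R * i) - W * R + (δ * W * R * i * (r - K * e * w * Y) + δ * W * R * (1ℚ - r * i)
          + K * Y * (R * i) * (W * w) * (e * δ - 1ℚ) + K * Y * (R * i) * (W * w - 1ℚ))) + ((1ℚ - ⟦ 6 ⟧ * δ) * (W * R) - n) + ⟦ 5 ⟧ * (δ * δ) * (W * R))
        lem = solve-∀ ring

      ⟦τ⟧ : ⟦ τ ⟧ ≡ ⟦ 2 ⟧ * ⟦ suc d ⟧ * ⟦ suc E ⟧ * ⟦ L ⟧
      ⟦τ⟧ = trans (⟦⟧-* (2 ℕ.* suc d ℕ.* suc E) L) (cong (λ t → t * ⟦ L ⟧) (trans (⟦⟧-* (2 ℕ.* suc d) (suc E)) (cong (λ t → t * ⟦ suc E ⟧) (⟦⟧-* 2 (suc d)))))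

      crude-enough : ⟦ n ⟧ * (⟦ 2 ⟧ * ⟦ d ⟧ * ⟦ suc E ⟧) ≤ R * ⟦ τ ⟧
      crude-enough = cert (⟦⟧≥0 2 ⊗ ⟦⟧≥0 d ⊗ ⟦⟧≥0 (suc E) ⊗ (diff≥0 ⟦n⟧≤ ⊕ R≥0 ⊗ diff≥0 (≤-trans s₆ (⟦⟧-mono A≤L))) ⊕ ⟦⟧≥0 2 ⊗ ⟦⟧≥0 (suc E) ⊗ ⟦⟧≥0 L ⊗ R≥0 ⊕ ≡⇒0≤ R ⟦τ⟧)
          (lem ⟦ n ⟧ ⟦ d ⟧ ⟦ suc E ⟧ R W ⟦ L ⟧ ⟦ τ ⟧)
        where
        lem : ∀ n d e R W L t → R * t ≡ n * (⟦ 2 ⟧ * d * e) + (⟦ 2 ⟧ * d * e * (W * R - n + R * (L - W)) + ⟦ 2 ⟧ * e * L * R + R * (t - ⟦ 2 ⟧ * (1ℚ + d) * e * L))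
        lem = solve-∀ ring

      thin-enough : ⟦ suc E ⟧ * ⟦ suc (suc J) ⟧ ≤ ⟦ r ⟧
      thin-enough = ≤-trans (≤-reflexive (cong (λ t → ⟦ suc E ⟧ * (1ℚ + (1ℚ + t))) (trans (⟦⟧-* L (d ℕ.* suc E)) (cong (λ t → ⟦ L ⟧ * t) (⟦⟧-* d (suc E))))))
        (≤-trans (cert (⟦⟧≥0 (suc E) ⊗ (⟦⟧≥0 2 ⊗ ⟦⟧≥0 k ⊕ ⟦⟧≥0 d ⊗ ⟦⟧≥0 (suc E) ⊗ diff≥0 (⟦⟧-mono L≤k))) (lem ⟦ suc E ⟧ ⟦ L ⟧ ⟦ d ⟧ ⟦ k ⟧))
          (k-power 1 (ℕₚ.≤-trans (s≤s z≤n) (ℕₚ.m≤n+m (suc (suc d)) e)) x₄≥0 s₄))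
        where
        lem : ∀ e L d k → e * (⟦ 2 ⟧ + d * e) * ((1ℚ + k) * 1ℚ) ≡ e * (1ℚ + (1ℚ + L * (d * e))) + e * (⟦ 2 ⟧ * k + d * e * (1ℚ + k - L))
        lem = solve-∀ ring

      ⟦q⟧≤r : ⟦ q ⟧ ≤ ⟦ r ⟧
      ⟦q⟧≤r = ⟦⟧-mono (ℕₚ.≤-trans (ℕₚ.≤-reflexive (sym (ℕₚ.*-identityʳ q))) (ℕₚ.*-monoʳ-≤ q τ≥1))

      -- Origin of the exponent 5 + d: n ≤ r^(d+1), T ≤ r³ and Fmax ≤ r^(d+3), and one more factor r
      -- ≥ 4 absorbs the constants.
      negligible-enough : 2ℚ * (⟦ n ⟧ * ⟦ T ⟧ + Fmax) ≤ 2ℚ ^ℚ L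
      negligible-enough = ≤-trans (cert (0≤2 ⊗ (diff≥0 nT≤ ⊕ diff≥0 F≤) ⊕ Y≥0 ⊗ (diff≥0 4≤r ⊗ ⟦⟧≥0 r ⊕ 0≤2 ⊗ diff≥0 1≤r)) (lem (⟦ n ⟧ * ⟦ T ⟧) Fmax ⟦ r ⟧ R))
          (≤-trans (≤-reflexive (sym (⟦⟧-^ r (5 ℕ.+ d)))) (≤-trans (⟦⟧-mono power) (≤-reflexive (⟦⟧-^ 2 L))))
        where
        Y = ⟦ r ⟧ * ⟦ r ⟧ * ⟦ r ⟧ * R
        Y≥0 : 0ℚ ≤ Y
        Y≥0 = ⟦⟧≥0 r ⊗ ⟦⟧≥0 r ⊗ ⟦⟧≥0 r ⊗ R≥0
        lem : ∀ a f r R → r * (r * (r * (r * (r * R)))) ≡ 2ℚ * (a + f) + (2ℚ * (r * R * (r * (r * r)) - a + (r * (R * (r * r)) - f)) + r * r * r * R * ((r - ⟦ 4 ⟧) * r + 2ℚ * (r - 1ℚ)))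
        lem = solve-∀ ring
        nT≤ : ⟦ n ⟧ * ⟦ T ⟧ ≤ ⟦ r ⟧ * R * (⟦ r ⟧ * (⟦ r ⟧ * ⟦ r ⟧))
        nT≤ = *-mono (⟦⟧≥0 n) (⟦⟧≥0 T) (≤-trans ⟦n⟧≤ (*-monoʳ R R≥0 (≤-trans s₆ A≤r)))
          (≤-trans (≤-reflexive (trans ⟦T⟧ (lem' ⟦ suc d ⟧ ⟦ d ⟧ ⟦ q ⟧))) (*-mono x₅≥0 (⟦⟧≥0 q ⊗ ⟦⟧≥0 q) (≤-trans s₅ A≤r) (*-mono (⟦⟧≥0 q) (⟦⟧≥0 q) ⟦q⟧≤r ⟦q⟧≤r)))
          where
          lem' : ∀ s d q → s * (⟦ 8 ⟧ * d * q * q) ≡ s * (⟦ 8 ⟧ * d) * (q * q)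
          lem' = solve-∀ ring
        F≤ : Fmax ≤ ⟦ r ⟧ * (R * (⟦ r ⟧ * ⟦ r ⟧))
        F≤ = *-mono (⟦⟧≥0 (suc k)) (^-nonneg d (⟦⟧≥0 (suc k)) ⊗ <⇒≤ Pr.ρ>0) k≤r (*-monoʳ Pr.ρ (<⇒≤ Pr.ρ>0) (^-mono d (⟦⟧≥0 (suc k)) k≤r))

      few-enough : ⟦ n ⟧ < 2ℚ ^ℚ L
      few-enough = <-≤-trans (cert< (0≤2 ⊗ ⟦⟧≥0 n ⊗ diff≥0 (⟦⟧-mono T≥1) ⊕ 0≤2 ⊗ size-F≥0 ⊕< ⟦⟧>0 n≥1) (lem ⟦ n ⟧ ⟦ T ⟧ Fmax)) negligible-enough
        where
        T≥1 : 1 ℕ.≤ T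
        T≥1 = ℕₚ.*-mono-≤ {1} {suc d} (s≤s z≤n) (ℕₚ.*-mono-≤ (ℕₚ.*-mono-≤ (ℕₚ.*-mono-≤ {1} {8} (s≤s z≤n) d≥1) q≥1) q≥1)
        size-F≥0 : 0ℚ ≤ Fmax
        size-F≥0 = ⟦⟧≥0 (suc k) ⊗ (^-nonneg d (⟦⟧≥0 (suc k)) ⊗ <⇒≤ Pr.ρ>0)
        lem : ∀ n t f → 2ℚ * (n * t + f) ≡ n + (2ℚ * n * (t - 1ℚ) + 2ℚ * f + n)
        lem = solve-∀ ring

    conditions : Conditions
    conditions = record
      { flat = flat-enough ; precise = k-power (suc (suc d)) (ℕₚ.m≤n+m (suc (suc d)) e) x₂≥0 s₂ ; filling = filling-enough
      ; crude = crude-enough ; negligible = negligible-enough ; few = few-enough ; thin = thin-enough }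


-- Sizes with `L` logarithmic in the target.

halve : ∀ t → ∃[ s ] (s ℕ.+ s ℕ.≤ t × t ℕ.≤ suc (s ℕ.+ s))
halve zero = 0 , z≤n , z≤n
halve (suc zero) = 0 , z≤n , s≤s z≤n
halve (suc (suc t)) with halve t
... | s , p , q = suc s , subst (ℕ._≤ suc (suc t)) (cong suc (sym (ℕₚ.+-suc s s))) (s≤s (s≤s p)) ,
    subst (λ z → suc (suc t) ℕ.≤ suc (suc z)) (sym (ℕₚ.+-suc s s)) (s≤s (s≤s q))

n<2^n : ∀ n → n ℕ.< 2 ℕ.^ n
n<2^n zero    = s≤s z≤n
n<2^n (suc n) = ℕₚ.≤-trans (ℕₚ.+-mono-≤ (ℕₚ.≤-trans (s≤s z≤n) (n<2^n n)) (n<2^n n)) (ℕₚ.≤-reflexive (cong (2 ℕ.^ n ℕ.+_) (sym (ℕₚ.+-identityʳ (2 ℕ.^ n)))))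

^-distribʳ-* : ∀ k m n → (m ℕ.* n) ℕ.^ k ≡ m ℕ.^ k ℕ.* n ℕ.^ k
^-distribʳ-* zero m n    = refl
^-distribʳ-* (suc k) m n = trans (cong (m ℕ.* n ℕ.*_) (^-distribʳ-* k m n)) (lem m n (m ℕ.^ k) (n ℕ.^ k))
  where
  lem : ∀ m n x y → m ℕ.* n ℕ.* (x ℕ.* y) ≡ m ℕ.* x ℕ.* (n ℕ.* y)
  lem = ℕ-Ring.solve-∀

-- Induction on the degree by halving: with s = ⌊t/2⌋ one factor 2^s pays for the lower power by
-- hypothesis, the other for the remaining s, and t ≤ 3 s supplies the constant.
polynomial≤exponential : ∀ B A → ∃[ t₀ ] (∀ t → t₀ ℕ.≤ t → A ℕ.* t ℕ.^ B ℕ.≤ 2 ℕ.^ t)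
polynomial≤exponential zero A = A , λ t h → ℕₚ.≤-trans (ℕₚ.≤-reflexive (ℕₚ.*-identityʳ A)) (ℕₚ.≤-trans h (ℕₚ.<⇒≤ (n<2^n t)))
polynomial≤exponential (suc B) A with polynomial≤exponential B (A ℕ.* 3 ℕ.^ suc B)
... | s₀ , bound = suc (suc (s₀ ℕ.+ s₀)) , λ t h → go t h (halve t)
  where
  go : ∀ t → suc (suc (s₀ ℕ.+ s₀)) ℕ.≤ t → ∃[ s ] (s ℕ.+ s ℕ.≤ t × t ℕ.≤ suc (s ℕ.+ s)) → A ℕ.* t ℕ.^ suc B ℕ.≤ 2 ℕ.^ t
  go t h (s , lo , hi) = begin
      A ℕ.* t ℕ.^ suc B                 ≤⟨ ℕₚ.*-monoʳ-≤ A (ℕₚ.^-monoˡ-≤ (suc B) t≤3s) ⟩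
      A ℕ.* (3 ℕ.* s) ℕ.^ suc B           ≡⟨ cong (A ℕ.*_) (^-distribʳ-* (suc B) 3 s) ⟩
      A ℕ.* (3 ℕ.^ suc B ℕ.* (s ℕ.* s ℕ.^ B)) ≡⟨ lem A (3 ℕ.^ suc B) s (s ℕ.^ B) ⟩
      A ℕ.* 3 ℕ.^ suc B ℕ.* s ℕ.^ B ℕ.* s     ≤⟨ ℕₚ.*-mono-≤ (bound s s₀≤s) (ℕₚ.<⇒≤ (n<2^n s)) ⟩
      2 ℕ.^ s ℕ.* 2 ℕ.^ s                 ≡⟨ sym (ℕₚ.^-distribˡ-+-* 2 s s) ⟩
      2 ℕ.^ (s ℕ.+ s)                   ≤⟨ ℕₚ.^-monoʳ-≤ 2 lo ⟩
      2 ℕ.^ t                         ∎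
    where
    open ℕₚ.≤-Reasoning
    lem : ∀ A c s x → A ℕ.* (c ℕ.* (s ℕ.* x)) ≡ A ℕ.* c ℕ.* x ℕ.* s
    lem = ℕ-Ring.solve-∀
    s₀<s : suc s₀ ℕ.≤ s
    s₀<s = ℕₚ.≮⇒≥ λ s<s₀ → ℕₚ.<⇒≱ (ℕₚ.≤-trans h hi) (s≤s (ℕₚ.+-mono-≤ (ℕₚ.≤-pred s<s₀) (ℕₚ.≤-pred s<s₀)))
    s₀≤s : s₀ ℕ.≤ s
    s₀≤s = ℕₚ.<⇒≤ s₀<s
    t≤3s : t ℕ.≤ 3 ℕ.* s
    t≤3s = ℕₚ.≤-trans hi (ℕₚ.≤-trans (ℕₚ.+-monoˡ-≤ (s ℕ.+ s) (ℕₚ.≤-trans (s≤s z≤n) s₀<s)) (ℕₚ.≤-reflexive (cong (λ z → s ℕ.+ (s ℕ.+ z)) (sym (ℕₚ.+-identityʳ s)))))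

dyadic : ∀ X → 1 ℕ.≤ X → ∃[ u ] (X ℕ.< 2 ℕ.^ u × 2 ℕ.^ u ℕ.≤ 2 ℕ.* X)
dyadic (suc zero) _ = 1 , s≤s (s≤s z≤n) , s≤s (s≤s z≤n)
dyadic (suc (suc X)) _ with dyadic (suc X) (s≤s z≤n)
... | u , lt , le with suc (suc X) ℕₚ.<? 2 ℕ.^ u
... | yes p = u , p , ℕₚ.≤-trans le (ℕₚ.*-monoʳ-≤ 2 (ℕₚ.n≤1+n (suc X)))
... | no ¬p = suc u , ℕₚ.≤-trans (s≤s lt) (ℕₚ.≤-trans (ℕₚ.+-monoˡ-≤ (2 ℕ.^ u) (ℕₚ.≤-trans (s≤s z≤n) lt)) (ℕₚ.≤-reflexive (cong (2 ℕ.^ u ℕ.+_) (sym (ℕₚ.+-identityʳ (2 ℕ.^ u)))))) ,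
    ℕₚ.*-monoʳ-≤ 2 (ℕₚ.≮⇒≥ ¬p)

-- `t * L` will be τ, `q * (t * L)` the radius r and (t L)^(2 m) the exponent k. The two bounds on X
-- say that q is the largest number with b r < X.
Sizes : (t D m E A e b X : ℕ) → Set
Sizes t D m E A e b X = ∃[ L ] ∃[ q ]
  (1 ℕ.≤ L × A ℕ.≤ L × suc E ℕ.≤ q × b ℕ.* (q ℕ.* (t ℕ.* L)) ℕ.< X × X ℕ.≤ b ℕ.* (suc q ℕ.* (t ℕ.* L)) ×
    A ℕ.* suc ((t ℕ.* L) ℕ.^ m ℕ.* (t ℕ.* L) ℕ.^ m) ℕ.^ e ℕ.≤ q ℕ.* (t ℕ.* L) × X ℕ.^ D ℕ.≤ 2 ℕ.^ L)

-- L is of order log X, so that every power of L is small against X.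
sizes : ∀ t D m E A e b → 1 ℕ.≤ t → 1 ℕ.≤ D → 1 ℕ.≤ b → ∃[ X₀ ] (∀ X → X₀ ℕ.≤ X → Sizes t D m E A e b X)
sizes t D m E A e b t≥1 D≥1 b≥1 = 2 ℕ.^ u₀ , λ X X₀≤X → go X X₀≤X (dyadic X (ℕₚ.≤-trans (ℕₚ.m^n>0 2 u₀) X₀≤X))
  where
  -- In terms of u with 2^u about X one has τ = a u and k + 1 ≤ G u^(2 m); B₁ then serves `k-small`
  -- and B₂ serves `suc E ≤ q`.
  a  = t ℕ.* D
  G  = 2 ℕ.* (a ℕ.^ m ℕ.* a ℕ.^ m)
  B  = (m ℕ.+ m) ℕ.* e
  B₁ = 4 ℕ.* b ℕ.* A ℕ.* G ℕ.^ e
  B₂ = 2 ℕ.* suc (suc E ℕ.* b ℕ.* a)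
  T  = polynomial≤exponential (suc B) (B₁ ℕ.+ B₂)
  u₀ = suc A ℕ.+ proj₁ T
  go : ∀ X → 2 ℕ.^ u₀ ℕ.≤ X → ∃[ u ] (X ℕ.< 2 ℕ.^ u × 2 ℕ.^ u ℕ.≤ 2 ℕ.* X) → Sizes t D m E A e b X
  go X X₀≤X (u , X<2^u , 2^u≤2X) = L , q , L≥1 , A≤L , E<q , b*r<X , X≤ , k-small , power
    where
    open ℕₚ.≤-Reasoning
    u₀≤u : u₀ ℕ.≤ u
    u₀≤u = ℕₚ.≮⇒≥ λ u<u₀ → ℕₚ.<⇒≱ X<2^u (ℕₚ.≤-trans (ℕₚ.^-monoʳ-≤ 2 (ℕₚ.<⇒≤ u<u₀)) X₀≤X)
    A<u : A ℕ.< u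
    A<u = ℕₚ.≤-trans (ℕₚ.m≤m+n (suc A) (proj₁ T)) u₀≤u
    u≥1 : 1 ℕ.≤ u
    u≥1 = ℕₚ.≤-trans (s≤s z≤n) A<u
    -- Since X < 2^u, this choice makes X^D ≤ 2^L immediate.
    L = D ℕ.* u
    L≥u : u ℕ.≤ L
    L≥u = ℕₚ.≤-trans (ℕₚ.≤-reflexive (sym (ℕₚ.*-identityˡ u))) (ℕₚ.*-monoˡ-≤ u D≥1)
    L≥1 : 1 ℕ.≤ L
    L≥1 = ℕₚ.≤-trans u≥1 L≥u
    A≤L : A ℕ.≤ L
    A≤L = ℕₚ.≤-trans (ℕₚ.<⇒≤ A<u) L≥u
    τ = t ℕ.* L
    k = τ ℕ.^ m ℕ.* τ ℕ.^ m
    τ≡ : τ ≡ a ℕ.* u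
    τ≡ = sym (ℕₚ.*-assoc t D u)
    bound : (B₁ ℕ.+ B₂) ℕ.* u ℕ.^ suc B ℕ.≤ 2 ℕ.* X
    bound = ℕₚ.≤-trans (proj₂ T u (ℕₚ.≤-trans (ℕₚ.m≤n+m (proj₁ T) (suc A)) u₀≤u)) 2^u≤2X
    u^B≤ : u ℕ.^ B ℕ.≤ u ℕ.^ suc B
    u^B≤ = ℕₚ.≤-trans (ℕₚ.≤-reflexive (sym (ℕₚ.*-identityˡ (u ℕ.^ B)))) (ℕₚ.*-monoˡ-≤ (u ℕ.^ B) u≥1)
    u≤ : u ℕ.≤ u ℕ.^ suc B
    u≤ = ℕₚ.≤-trans (ℕₚ.≤-reflexive (sym (ℕₚ.*-identityʳ u))) (ℕₚ.*-monoʳ-≤ u (subst (ℕ._≤ u ℕ.^ B) (ℕₚ.^-zeroˡ B) (ℕₚ.^-monoˡ-≤ B u≥1)))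
    room : suc (suc E ℕ.* b ℕ.* a) ℕ.* u ℕ.≤ X
    room = ℕₚ.*-cancelˡ-≤ 2 (ℕₚ.≤-trans (ℕₚ.≤-reflexive (sym (ℕₚ.*-assoc 2 (suc (suc E ℕ.* b ℕ.* a)) u))) (ℕₚ.≤-trans (ℕₚ.*-mono-≤ (ℕₚ.m≤n+m B₂ B₁) u≤) bound))
    Ebτ<X : suc E ℕ.* (b ℕ.* τ) ℕ.< X
    Ebτ<X = ℕₚ.≤-trans (subst (λ t → suc (suc E ℕ.* (b ℕ.* t)) ℕ.≤ suc (suc E ℕ.* b ℕ.* a) ℕ.* u) (sym τ≡) (ℕₚ.≤-trans (ℕₚ.+-monoˡ-≤ (suc E ℕ.* (b ℕ.* (a ℕ.* u))) u≥1) (ℕₚ.≤-reflexive (lem (suc E) b a u)))) room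
      where
      lem : ∀ E b a u → u ℕ.+ E ℕ.* (b ℕ.* (a ℕ.* u)) ≡ (1 ℕ.+ E ℕ.* b ℕ.* a) ℕ.* u
      lem = ℕ-Ring.solve-∀
    τ≥1 : 1 ℕ.≤ τ
    τ≥1 = ℕₚ.*-mono-≤ t≥1 L≥1
    bτ≥1 : 1 ℕ.≤ b ℕ.* τ
    bτ≥1 = ℕₚ.*-mono-≤ b≥1 τ≥1
    instance
      nz : ℕ.NonZero (b ℕ.* τ)
      nz = ℕ.>-nonZero bτ≥1
    X≥1 : 1 ℕ.≤ X
    X≥1 = ℕₚ.≤-trans (s≤s z≤n) Ebτ<X
    X≡ : X ≡ suc (X ℕ.∸ 1)
    X≡ = sym (ℕₚ.m+[n∸m]≡n X≥1)
    -- Dividing X - 1 rather than X makes b r < X strict.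
    q = (X ℕ.∸ 1) ℕ./ (b ℕ.* τ)
    b*r<X : b ℕ.* (q ℕ.* τ) ℕ.< X
    b*r<X = subst (b ℕ.* (q ℕ.* τ) ℕ.<_) (sym X≡) (s≤s (ℕₚ.≤-trans (ℕₚ.≤-reflexive (lem b q τ)) (m/n*n≤m (X ℕ.∸ 1) (b ℕ.* τ))))
      where
      lem : ∀ b q t → b ℕ.* (q ℕ.* t) ≡ q ℕ.* (b ℕ.* t)
      lem = ℕ-Ring.solve-∀
    X≤ : X ℕ.≤ b ℕ.* (suc q ℕ.* τ)
    X≤ = ℕₚ.≤-trans (ℕₚ.≤-reflexive (trans X≡ (cong suc (m≡m%n+[m/n]*n (X ℕ.∸ 1) (b ℕ.* τ))))) (ℕₚ.≤-trans (ℕₚ.+-monoˡ-≤ (q ℕ.* (b ℕ.* τ)) (m%n<n (X ℕ.∸ 1) (b ℕ.* τ))) (ℕₚ.≤-reflexive (lem b q τ)))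
      where
      lem : ∀ b q t → b ℕ.* t ℕ.+ q ℕ.* (b ℕ.* t) ≡ b ℕ.* ((1 ℕ.+ q) ℕ.* t)
      lem = ℕ-Ring.solve-∀
    E<q : suc E ℕ.≤ q
    E<q = ℕₚ.≮⇒≥ λ h → ℕₚ.<⇒≱ Ebτ<X (ℕₚ.≤-trans X≤ (ℕₚ.≤-trans (ℕₚ.*-monoʳ-≤ b (ℕₚ.*-monoˡ-≤ τ h)) (ℕₚ.≤-reflexive (lem b (suc E) τ))))
      where
      lem : ∀ b q t → b ℕ.* (q ℕ.* t) ≡ q ℕ.* (b ℕ.* t)
      lem = ℕ-Ring.solve-∀
    k≤ : suc k ℕ.≤ G ℕ.* u ℕ.^ (m ℕ.+ m)
    k≤ = begin
      suc k                   ≤⟨ ℕₚ.+-monoˡ-≤ k (ℕₚ.*-mono-≤ τ^≥1 τ^≥1) ⟩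
      k ℕ.+ k                   ≡⟨ cong (k ℕ.+_) (sym (ℕₚ.+-identityʳ k)) ⟩
      2 ℕ.* k                   ≡⟨ cong (λ t → 2 ℕ.* (t ℕ.* t)) (trans (cong (ℕ._^ m) τ≡) (^-distribʳ-* m a u)) ⟩
      2 ℕ.* (a ℕ.^ m ℕ.* u ℕ.^ m ℕ.* (a ℕ.^ m ℕ.* u ℕ.^ m)) ≡⟨ lem (a ℕ.^ m) (u ℕ.^ m) ⟩
      G ℕ.* (u ℕ.^ m ℕ.* u ℕ.^ m)     ≡⟨ cong (G ℕ.*_) (sym (ℕₚ.^-distribˡ-+-* u m m)) ⟩
      G ℕ.* u ℕ.^ (m ℕ.+ m)         ∎
      where
      τ^≥1 : 1 ℕ.≤ τ ℕ.^ m
      τ^≥1 = subst (ℕ._≤ τ ℕ.^ m) (ℕₚ.^-zeroˡ m) (ℕₚ.^-monoˡ-≤ m τ≥1)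
      lem : ∀ x y → 2 ℕ.* (x ℕ.* y ℕ.* (x ℕ.* y)) ≡ 2 ℕ.* (x ℕ.* x) ℕ.* (y ℕ.* y)
      lem = ℕ-Ring.solve-∀
    k-small : A ℕ.* suc k ℕ.^ e ℕ.≤ q ℕ.* τ
    k-small = ℕₚ.*-cancelˡ-≤ (4 ℕ.* b) {{ℕ.>-nonZero (ℕₚ.*-mono-≤ {1} {4} (s≤s z≤n) b≥1)}} (begin
      4 ℕ.* b ℕ.* (A ℕ.* suc k ℕ.^ e)             ≤⟨ ℕₚ.*-monoʳ-≤ (4 ℕ.* b) (ℕₚ.*-monoʳ-≤ A (ℕₚ.^-monoˡ-≤ e k≤)) ⟩
      4 ℕ.* b ℕ.* (A ℕ.* (G ℕ.* u ℕ.^ (m ℕ.+ m)) ℕ.^ e) ≡⟨ cong (λ t → 4 ℕ.* b ℕ.* (A ℕ.* t)) (trans (^-distribʳ-* e G (u ℕ.^ (m ℕ.+ m))) (cong (G ℕ.^ e ℕ.*_) (ℕₚ.^-*-assoc u (m ℕ.+ m) e))) ⟩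
      4 ℕ.* b ℕ.* (A ℕ.* (G ℕ.^ e ℕ.* u ℕ.^ B))       ≡⟨ lem (4 ℕ.* b) A (G ℕ.^ e) (u ℕ.^ B) ⟩
      B₁ ℕ.* u ℕ.^ B                          ≤⟨ ℕₚ.*-mono-≤ (ℕₚ.m≤m+n B₁ B₂) u^B≤ ⟩
      (B₁ ℕ.+ B₂) ℕ.* u ℕ.^ suc B               ≤⟨ bound ⟩
      2 ℕ.* X                               ≤⟨ ℕₚ.*-monoʳ-≤ 2 X≤ ⟩
      2 ℕ.* (b ℕ.* (suc q ℕ.* τ))               ≤⟨ ℕₚ.*-monoʳ-≤ 2 (ℕₚ.*-monoʳ-≤ b (ℕₚ.*-monoˡ-≤ τ (ℕₚ.+-monoˡ-≤ q q≥1))) ⟩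
      2 ℕ.* (b ℕ.* ((q ℕ.+ q) ℕ.* τ))             ≡⟨ lem₂ b q τ ⟩
      4 ℕ.* b ℕ.* (q ℕ.* τ)                     ∎)
      where
      q≥1 : 1 ℕ.≤ q
      q≥1 = ℕₚ.≤-trans (s≤s z≤n) E<q
      lem : ∀ b A g v → b ℕ.* (A ℕ.* (g ℕ.* v)) ≡ b ℕ.* A ℕ.* g ℕ.* v
      lem = ℕ-Ring.solve-∀
      lem₂ : ∀ b q t → 2 ℕ.* (b ℕ.* ((q ℕ.+ q) ℕ.* t)) ≡ 4 ℕ.* b ℕ.* (q ℕ.* t)
      lem₂ = ℕ-Ring.solve-∀
    power : X ℕ.^ D ℕ.≤ 2 ℕ.^ L
    power = ℕₚ.≤-trans (ℕₚ.^-monoˡ-≤ D (ℕₚ.<⇒≤ X<2^u)) (ℕₚ.≤-reflexive (trans (ℕₚ.^-*-assoc 2 u D) (cong (2 ℕ.^_) (ℕₚ.*-comm u D))))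

-- Comparison of `Ω` with `omegaLower`.

2≤piLower : ∀ m → ⟦ 2 ⟧ ≤ piLower m
2≤piLower m = ≤-trans (toWitness {a? = ⟦ 2 ⟧ ℚₚ.≤? piLower 0} _) (≤-trans (≤-reflexive (pi-pairs 0))
  (≤-trans (*-monoˡ ⟦ 4 ⟧ (⟦⟧≥0 4) (subst (λ j → pairs 0 ≤ pairs j) (ℕₚ.+-identityʳ m) (proj₁ (pairs-≤ m 0)))) (≤-reflexive (sym (pi-pairs m)))))

Ω>0 : ∀ {p} → 0ℚ < p → ∀ d → 0ℚ < Ω p d
Ω>0 h zero          = 0<1
Ω>0 h (suc zero)    = ⟦⟧>0 {2} (s≤s z≤n)
Ω>0 h (suc (suc d)) = ⟦⟧>0 {2} (s≤s z≤n) ⊗< ⁻¹-pos (⟦suc⟧>0 (suc d)) ⊗< h ⊗< Ω>0 h d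

-- π enters once per two dimensions, so a relative error η in it costs at most (1 + η)^d.
omegaLower-≤Ω : ∀ {p η} → 0ℚ ≤ p → 0ℚ ≤ η → ∀ m → piLower m ≤ (1ℚ + η) * p → ∀ d → 0ℚ ≤ omegaLower d m × omegaLower d m ≤ (1ℚ + η) ^ℚ d * Ω p d
omegaLower-≤Ω p≥0 η≥0 m h zero = 0≤1 , ≤-refl
omegaLower-≤Ω {p} {η} p≥0 η≥0 m h (suc zero) = ≤-trans (⟦⟧≥0 2) (≤-reflexive (sym (⟦⟧-/1 2))) ,
    ≤-trans (≤-reflexive (⟦⟧-/1 2)) (cert (⟦⟧≥0 2 ⊗ η≥0) (lem η))
  where
  lem : ∀ η → (1ℚ + η) * 1ℚ * ⟦ 2 ⟧ ≡ ⟦ 2 ⟧ + ⟦ 2 ⟧ * η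
  lem = solve-∀ ring
omegaLower-≤Ω {p} {η} p≥0 η≥0 m h (suc (suc d)) with omegaLower-≤Ω p≥0 η≥0 m h d
... | lo , hi = ≤-trans (a≥0 ⊗ π≥0 ⊗ lo) (≤-reflexive (sym value)) , ≤-trans (≤-reflexive value)
    (≤-trans (*-mono (a≥0 ⊗ π≥0) lo (*-monoˡ a a≥0 h) hi)
      (cert (η≥0 ⊗ (a≥0 ⊗ ((0≤1 ⊕ η≥0) ⊗ p≥0) ⊗ (^-nonneg d (0≤1 ⊕ η≥0) ⊗ Ω≥0 p≥0 d))) (lem a η p ((1ℚ + η) ^ℚ d) (Ω p d))))
  where
  a : ℚ
  a = ⟦ 2 ⟧ * inv (suc d)
  a≥0 : 0ℚ ≤ a
  a≥0 = ⟦⟧≥0 2 ⊗ inv≥0 (suc d)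
  π≥0 : 0ℚ ≤ piLower m
  π≥0 = ≤-trans (⟦⟧≥0 2) (2≤piLower m)
  a≡ : (+ 2) / suc (suc d) ≡ a
  a≡ = trans (sym (ℚₚ.*-identityʳ _)) (trans (cong (λ t → ((+ 2) / suc (suc d)) * t) (sym (inv-def (suc d))))
    (trans (sym (ℚₚ.*-assoc ((+ 2) / suc (suc d)) ⟦ suc (suc d) ⟧ (inv (suc d)))) (cong (λ t → t * inv (suc d)) (/-⟦⟧ 2 (suc d)))))
  value : omegaLower (suc (suc d)) m ≡ a * piLower m * omegaLower d m
  value = cong (λ t → t * piLower m * omegaLower d m) a≡
  lem : ∀ a η p y w → (1ℚ + η) * ((1ℚ + η) * y) * (a * p * w) ≡ a * ((1ℚ + η) * p) * (y * w) + η * (a * ((1ℚ + η) * p) * (y * w))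
  lem = solve-∀ ring

-- Refuting an escaping site.

suc-∸-2 : ∀ {n} → 2 ℕ.≤ n → suc (n ℕ.∸ 2) ≡ n ℕ.∸ 1
suc-∸-2 (s≤s (s≤s _)) = refl

-- To avoid a d-th root of n, the radius is read off the escaping site: r is the largest multiple of
-- τ with d (1 + 2 δ) r < c |x|. That n is small against |x|^d makes the conditions hold at this r,
-- and `norm-bound` contradicts its choice.
module Escape (d h n c g : ℕ) (d≥1 : 1 ℕ.≤ d) (c≥1 : 1 ℕ.≤ c) (c+h : c ℕ.+ suc h ≡ d ℕ.+ d) (c+g : c ℕ.+ g ≡ d) (n≥1 : 1 ℕ.≤ n)
  (E : ℕ) (E≥11 : 11 ℕ.≤ E) (ε : ℚ) (δ≤ε : ⟦ 155 ⟧ * ⟦ d ⟧ * inv E ≤ ε)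
  (K W : ℚ) (e A : ℕ) (K≥0 : 0ℚ ≤ K) (W>0 : 0ℚ < W)
  (A≥ : constants d E K W ≤ ⟦ A ⟧)
  (volume : ∀ r (r≥1 : 1 ℕ.≤ r) k → W * ⟦ r ⟧ ^ℚ d ≤ Volume.V r r≥1 d (suc k) + K * ⟦ suc k ⟧ ^ℚ e * (⟦ r ⟧ ^ℚ d * ⟦ r ⟧ ⁻¹))
  (x : Site d) (t : Topples d h n x) where

  b X : ℕ
  -- b/(E + 1) = d (1 + 2 δ) is the factor in `norm-bound`.
  b = d ℕ.* suc (suc (suc E))
  X = c ℕ.* normInf x ℕ.* suc E

  δ M : ℚ
  δ = inv E
  M = ⟦ c ℕ.* normInf x ⟧

  M≥0 : 0ℚ ≤ M
  M≥0 = ⟦⟧≥0 (c ℕ.* normInf x)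

  ⟦X⟧ : ⟦ X ⟧ ≡ M * ⟦ suc E ⟧
  ⟦X⟧ = ⟦⟧-* (c ℕ.* normInf x) (suc E)

  δ≥0 : 0ℚ ≤ δ
  δ≥0 = inv≥0 E

  δ≤1 : δ ≤ 1ℚ
  δ≤1 = inv≤1 E

  12δ≤1 : ⟦ 12 ⟧ * δ ≤ 1ℚ
  12δ≤1 = ≤-trans (*-monoʳ δ δ≥0 (⟦⟧-mono {12} (s≤s E≥11))) (≤-reflexive (inv-def E))

  module _ (escape : ⟦ n ⟧ * (⟦ d ⟧ + ε) ^ℚ d < M ^ℚ d * ((1ℚ + δ) ^ℚ d * W))
    (L q : ℕ) (L≥1 : 1 ℕ.≤ L) (A≤L : A ℕ.≤ L) (E<q : suc E ℕ.≤ q) (br<X : b ℕ.* (q ℕ.* (2 ℕ.* suc d ℕ.* suc E ℕ.* L)) ℕ.< X)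
    (X≤ : X ℕ.≤ b ℕ.* (suc q ℕ.* (2 ℕ.* suc d ℕ.* suc E ℕ.* L)))
    (k-small : A ℕ.* suc ((2 ℕ.* suc d ℕ.* suc E ℕ.* L) ℕ.^ suc (suc d) ℕ.* (2 ℕ.* suc d ℕ.* suc E ℕ.* L) ℕ.^ suc (suc d)) ℕ.^ (e ℕ.+ suc (suc d)) ℕ.≤ q ℕ.* (2 ℕ.* suc d ℕ.* suc E ℕ.* L))
    (power : X ℕ.^ (5 ℕ.+ d) ℕ.≤ 2 ℕ.^ L) where

    q≥1 : 1 ℕ.≤ q
    q≥1 = ℕₚ.≤-trans (s≤s z≤n) E<q

    open Outer d h n c g d≥1 c≥1 c+h c+g E L q L≥1 q≥1 using (r; r≥1; k; τ; norm-bound)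

    R Γ y : ℚ
    R = ⟦ r ⟧ ^ℚ d
    -- 1 + 2 δ comes from `norm-bound`; one factor 1 + δ pays for replacing q + 1 by q ≥ E + 1, the
    -- other for the error in π. The factor y is kept in reserve for `filled`.
    Γ = (1ℚ + δ + δ) * ((1ℚ + δ) * (1ℚ + δ))
    y = 1ℚ + ⟦ 12 ⟧ * δ

    Γ>0 : 0ℚ < Γ
    Γ>0 = <-≤-trans 0<1 (cert (⟦⟧≥0 4 ⊗ δ≥0 ⊕ ⟦⟧≥0 5 ⊗ (δ≥0 ⊗ δ≥0) ⊕ ⟦⟧≥0 2 ⊗ (δ≥0 ⊗ δ≥0 ⊗ δ≥0)) (lem δ))
      where
      lem : ∀ δ → (1ℚ + δ + δ) * ((1ℚ + δ) * (1ℚ + δ)) ≡ 1ℚ + (⟦ 4 ⟧ * δ + ⟦ 5 ⟧ * (δ * δ) + ⟦ 2 ⟧ * (δ * δ * δ))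
      lem = solve-∀ ring

    ⟦b⟧ : ⟦ b ⟧ ≡ ⟦ d ⟧ * (⟦ 2 ⟧ + ⟦ suc E ⟧)
    ⟦b⟧ = trans (⟦⟧-* d (suc (suc (suc E)))) (cong (λ t → ⟦ d ⟧ * t) (⟦⟧-+ 2 (suc E)))

    M≤ : M * (1ℚ + δ) ≤ ⟦ d ⟧ * Γ * ⟦ r ⟧
    M≤ = cert ((0≤1 ⊕ δ≥0) ⊗ (δ≥0 ⊗ diff≥0 X≤ℚ ⊕ ≡⇒0≤ (M - ⟦ d ⟧ * (⟦ suc q ⟧ * ⟦ τ ⟧)) (inv-def E) ⊕ ⟦⟧≥0 d ⊗ (0≤1 ⊕ δ≥0 ⊕ δ≥0) ⊗ ⟦⟧≥0 τ ⊗ (δ≥0 ⊗ diff≥0 (⟦⟧-mono E<q) ⊕ ≡⇒0≤ 1ℚ (inv-def E)))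
        ⊕ ≡⇒0≤ (⟦ d ⟧ * Γ) (⟦⟧-* q τ)) (lem M δ ⟦ suc E ⟧ ⟦ d ⟧ ⟦ q ⟧ ⟦ τ ⟧ ⟦ r ⟧)
      where
      X≤ℚ : M * ⟦ suc E ⟧ ≤ ⟦ d ⟧ * (⟦ 2 ⟧ + ⟦ suc E ⟧) * (⟦ suc q ⟧ * ⟦ τ ⟧)
      X≤ℚ = ≤-trans (≤-reflexive (sym ⟦X⟧)) (≤-trans (⟦⟧-mono X≤) (≤-reflexive (trans (⟦⟧-* b (suc q ℕ.* τ)) (cong₂ _*_ ⟦b⟧ (⟦⟧-* (suc q) τ)))))
      lem : ∀ M δ s d q t r → d * ((1ℚ + δ + δ) * ((1ℚ + δ) * (1ℚ + δ))) * r ≡ M * (1ℚ + δ)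
        + ((1ℚ + δ) * (δ * (d * (⟦ 2 ⟧ + s) * ((1ℚ + q) * t) - M * s) + (M - d * ((1ℚ + q) * t)) * (s * δ - 1ℚ) + d * (1ℚ + δ + δ) * t * (δ * (q - s) + 1ℚ * (s * δ - 1ℚ)))
          + d * ((1ℚ + δ + δ) * ((1ℚ + δ) * (1ℚ + δ))) * (r - q * t))
      lem = solve-∀ ring

    -- Γ y = (1+2δ)(1+δ)²(1+12δ) ≤ 1 + 155δ since δ ≤ 1.
    inflate : ⟦ d ⟧ * Γ * y ≤ ⟦ d ⟧ + ε
    inflate = cert (diff≥0 δ≤ε ⊕ ⟦⟧≥0 d ⊗ δ≥0 ⊗ diff≥0 δ≤1 ⊗ (⟦⟧≥0 53 ⊕ ⟦⟧≥0 62 ⊗ (0≤1 ⊕ δ≥0) ⊕ ⟦⟧≥0 24 ⊗ (0≤1 ⊕ δ≥0 ⊕ δ≥0 ⊗ δ≥0))) (lem ⟦ d ⟧ δ ε)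
      where
      lem : ∀ d δ ε → d + ε ≡ d * ((1ℚ + δ + δ) * ((1ℚ + δ) * (1ℚ + δ))) * (1ℚ + ⟦ 12 ⟧ * δ)
        + (ε - ⟦ 155 ⟧ * d * δ + d * δ * (1ℚ - δ) * (⟦ 53 ⟧ + ⟦ 62 ⟧ * (1ℚ + δ) + ⟦ 24 ⟧ * (1ℚ + δ + δ * δ)))
      lem = solve-∀ ring

    1≤y : 1ℚ ≤ y
    1≤y = cert (⟦⟧≥0 12 ⊗ δ≥0) refl

    y≥0 : 0ℚ ≤ y
    y≥0 = ≤-trans 0≤1 1≤y

    dΓ>0 : 0ℚ < ⟦ d ⟧ * Γ
    dΓ>0 = ⟦⟧>0 d≥1 ⊗< Γ>0

    ny≤ : ⟦ n ⟧ * y ^ℚ d ≤ W * R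
    ny≤ = *-cancel ((⟦ d ⟧ * Γ) ^ℚ d) (^-pos d dΓ>0) (≤-trans (≤-reflexive (trans (lem ((⟦ d ⟧ * Γ) ^ℚ d) ⟦ n ⟧ (y ^ℚ d)) (cong (λ t → ⟦ n ⟧ * t) (sym (^-distrib-* (⟦ d ⟧ * Γ) y d)))))
      (≤-trans (*-monoˡ ⟦ n ⟧ (⟦⟧≥0 n) (^-mono d (<⇒≤ dΓ>0 ⊗ y≥0) inflate)) (≤-trans (<⇒≤ escape)
        (≤-trans (≤-reflexive (trans (sym (ℚₚ.*-assoc (M ^ℚ d) ((1ℚ + δ) ^ℚ d) W)) (cong (λ t → t * W) (sym (^-distrib-* M (1ℚ + δ) d)))))
          (≤-trans (*-monoʳ W (<⇒≤ W>0) (^-mono d (M≥0 ⊗ (0≤1 ⊕ δ≥0)) M≤)) (≤-reflexive (trans (cong (λ t → t * W) (^-distrib-* (⟦ d ⟧ * Γ) ⟦ r ⟧ d)) (lem₂ ((⟦ d ⟧ * Γ) ^ℚ d) R W))))))))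
      where
      lem : ∀ a n y → a * (n * y) ≡ n * (a * y)
      lem = solve-∀ ring
      lem₂ : ∀ a r w → a * r * w ≡ a * (w * r)
      lem₂ = solve-∀ ring

    -- (1 - 6 δ)(1 + 12 δ) ≥ 1 as soon as 12 δ ≤ 1, whence the requirement E ≥ 11.
    filled : ⟦ n ⟧ ≤ (1ℚ - ⟦ 6 ⟧ * δ) * (W * R)
    filled = cert (1-6δ≥0 ⊗ (diff≥0 ny≤ ⊕ ⟦⟧≥0 n ⊗ diff≥0 y≤y^d) ⊕ ⟦⟧≥0 n ⊗ (⟦⟧≥0 6 ⊗ δ≥0) ⊗ diff≥0 12δ≤1) (lem ⟦ n ⟧ δ (y ^ℚ d) (W * R))
      where
      y≤y^d : y ≤ y ^ℚ d
      y≤y^d = ≤-trans (≤-reflexive (sym (ℚₚ.*-identityʳ y))) (^-mono-exp {j = 1} 1≤y d≥1)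
      1-6δ≥0 : 0ℚ ≤ 1ℚ - ⟦ 6 ⟧ * δ
      1-6δ≥0 = ≤-trans (diff≥0 12δ≤1 ⊕ ⟦⟧≥0 6 ⊗ δ≥0) (≤-reflexive (lem' δ))
        where
        lem' : ∀ δ → 1ℚ - ⟦ 12 ⟧ * δ + ⟦ 6 ⟧ * δ ≡ 1ℚ - ⟦ 6 ⟧ * δ
        lem' = solve-∀ ring
      lem : ∀ n δ Y w → (1ℚ - ⟦ 6 ⟧ * δ) * w ≡ n + ((1ℚ - ⟦ 6 ⟧ * δ) * (w - n * Y + n * (Y - (1ℚ + ⟦ 12 ⟧ * δ))) + n * (⟦ 6 ⟧ * δ) * (1ℚ - ⟦ 12 ⟧ * δ))
      lem = solve-∀ ring

    r≤X : r ℕ.≤ X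
    r≤X = ℕₚ.≤-trans (ℕₚ.≤-trans (ℕₚ.≤-reflexive (sym (ℕₚ.*-identityˡ r))) (ℕₚ.*-monoˡ-≤ r (ℕₚ.*-mono-≤ {1} {d} {1} {suc (suc (suc E))} d≥1 (s≤s z≤n)))) (ℕₚ.<⇒≤ br<X)

    contradictory : ⊥
    contradictory = ℕₚ.<⇒≱ br<X (⟦⟧-cancel (≤-trans (≤-reflexive ⟦X⟧) (≤-trans (*-monoʳ ⟦ suc E ⟧ (⟦⟧≥0 (suc E)) confined)
        (≤-reflexive (trans (lem ⟦ d ⟧ δ ⟦ r ⟧ ⟦ suc E ⟧) (trans (cong (λ t → ⟦ d ⟧ * (t + t + ⟦ suc E ⟧) * ⟦ r ⟧) (inv-def E)) (trans (cong (λ t → t * ⟦ r ⟧) (sym ⟦b⟧)) (sym (⟦⟧-* b r)))))))))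
      where
      lem : ∀ d δ r s → d * ((1ℚ + δ + δ) * r) * s ≡ d * (s * δ + s * δ + s) * r
      lem = solve-∀ ring
      confined : M ≤ ⟦ d ⟧ * ((1ℚ + δ + δ) * ⟦ r ⟧)
      confined = norm-bound (Parameters.conditions d h n c g d≥1 c≥1 c+h c+g E L q L≥1 q≥1 A e K W K≥0 W>0 (ℕₚ.≤-trans (s≤s (s≤s (s≤s (s≤s z≤n)))) E≥11) n≥1
        (volume r r≥1 k) A≥ A≤L k-small (ℕₚ.≤-trans (ℕₚ.^-monoˡ-≤ (5 ℕ.+ d) r≤X) power) filled) x t


module Slopes (d h : ℕ) (d≥1 : 1 ℕ.≤ d) (d≤h : d ℕ.≤ h) (h≤ : h ℕ.≤ 2 ℕ.* d ℕ.∸ 2) where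

  c g : ℕ
  c = 2 ℕ.* d ℕ.∸ 1 ℕ.∸ h
  g = d ℕ.∸ c

  h< : suc h ℕ.≤ 2 ℕ.* d ℕ.∸ 1
  h< = subst (suc h ℕ.≤_) (suc-∸-2 (ℕₚ.*-monoʳ-≤ 2 d≥1)) (s≤s h≤)

  c≥1 : 1 ℕ.≤ c
  c≥1 = ℕₚ.m<n⇒0<n∸m h<

  c+h : c ℕ.+ suc h ≡ d ℕ.+ d
  c+h = trans (ℕₚ.+-suc c h) (trans (cong suc (ℕₚ.m∸n+n≡m (ℕₚ.<⇒≤ h<))) (trans (ℕₚ.m+[n∸m]≡n (ℕₚ.*-mono-≤ {1} {2} (s≤s z≤n) d≥1)) (cong (d ℕ.+_) (ℕₚ.+-identityʳ d))))

  c+g : c ℕ.+ g ≡ d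
  c+g = ℕₚ.m+[n∸m]≡n (ℕₚ.+-cancelʳ-≤ d c d (ℕₚ.≤-trans (ℕₚ.+-monoʳ-≤ c (ℕₚ.m≤n⇒m≤1+n d≤h)) (ℕₚ.≤-reflexive c+h)))

precision : ∀ d ε → 0ℚ < ε → ∃[ E ] (11 ℕ.≤ E × ⟦ 155 ⟧ * ⟦ d ⟧ * inv E ≤ ε)
precision d ε ε>0 with ∃-⟦⟧≥ (⟦ 155 ⟧ * ⟦ d ⟧ * ε ⁻¹)
... | E₁ , E₁≥ = E , ℕₚ.m≤n+m 11 E₁ ,
    cert (δ≥0 ⊗ <⇒≤ ε>0 ⊗ (diff≥0 E₁≥ ⊕ diff≥0 (⟦⟧-mono {E₁} {suc E} (ℕₚ.m≤n⇒m≤1+n (ℕₚ.m≤m+n E₁ 11)))) ⊕ ≡⇒0≤ ε (sym (inv-def E)) ⊕ ≡⇒0≤ (⟦ 155 ⟧ * ⟦ d ⟧ * inv E) (⁻¹-inverse ε>0))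
      (lem (⟦ 155 ⟧ * ⟦ d ⟧) (inv E) ε (ε ⁻¹) ⟦ E₁ ⟧ ⟦ suc E ⟧)
  where
  E = E₁ ℕ.+ 11
  δ≥0 = inv≥0 E
  lem : ∀ b δ ε i f e → ε ≡ b * δ + (δ * ε * (f - b * i + (e - f)) + ε * (1ℚ - e * δ) + b * δ * (ε * i - 1ℚ))
  lem = solve-∀ ring


twelfth : ∀ E → ⟦ 12 ⟧ * inv (11 ℕ.+ 12 ℕ.* E) ≡ inv E
twelfth E = trans (lem (inv E) i ⟦ suc E ⟧) (trans (cong₂ (λ u v → inv E + (⟦ 12 ⟧ * i * (1ℚ - u) + inv E * (v - 1ℚ))) (inv-def E)
    (trans (cong (λ t → t * i) (trans (sym (⟦⟧-* 12 (suc E))) (cong ⟦_⟧ (ℕₚ.*-suc 12 E)))) (inv-def (11 ℕ.+ 12 ℕ.* E)))) (lem₂ (inv E) (⟦ 12 ⟧ * i)))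
  where
  i = inv (11 ℕ.+ 12 ℕ.* E)
  lem : ∀ δ i s → ⟦ 12 ⟧ * i ≡ δ + (⟦ 12 ⟧ * i * (1ℚ - s * δ) + δ * (⟦ 12 ⟧ * s * i - 1ℚ))
  lem = solve-∀ ring
  lem₂ : ∀ δ x → δ + (x * (1ℚ - 1ℚ) + δ * (1ℚ - 1ℚ)) ≡ δ
  lem₂ = solve-∀ ring


module Confinement (d h : ℕ) (d≥1 : 1 ℕ.≤ d) (d≤h : d ℕ.≤ h) (h≤ : h ℕ.≤ 2 ℕ.* d ℕ.∸ 2) (ε : ℚ) (ε>0 : 0ℚ < ε)
  (E : ℕ) (E≥11 : 11 ℕ.≤ E) (δ≤ε : ⟦ 155 ⟧ * ⟦ d ⟧ * inv E ≤ ε)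
  (p : ℚ) (p-upper : ∀ m → piLower m ≤ p + inv E) where

  open Slopes d h d≥1 d≤h h≤

  δ : ℚ
  δ = inv E

  δ≥0 : 0ℚ ≤ δ
  δ≥0 = inv≥0 E

  δ≤1 : δ ≤ 1ℚ
  δ≤1 = inv≤1 E

  1≤p : 1ℚ ≤ p
  1≤p = cert (diff≥0 (≤-trans (2≤piLower 0) (p-upper 0)) ⊕ diff≥0 δ≤1) (lem p δ)
    where
    lem : ∀ p δ → p ≡ 1ℚ + (p + δ - ⟦ 2 ⟧ + (1ℚ - δ))
    lem = solve-∀ ring

  p>0 : 0ℚ < p
  p>0 = <-≤-trans 0<1 1≤p

  p-relative : ∀ m → piLower m ≤ (1ℚ + δ) * p
  p-relative m = ≤-trans (p-upper m) (cert (δ≥0 ⊗ diff≥0 1≤p) (lem p δ))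
    where
    lem : ∀ p δ → (1ℚ + δ) * p ≡ p + δ + δ * (p - 1ℚ)
    lem = solve-∀ ring

  W : ℚ
  W = Ω p d

  W>0 : 0ℚ < W
  W>0 = Ω>0 p>0 d

  b : ℕ
  b = d ℕ.* suc (suc (suc E))

  module _ (K : ℚ) (e : ℕ) (K≥0 : 0ℚ ≤ K)
    (volume : ∀ r (r≥1 : 1 ℕ.≤ r) k → W * ⟦ r ⟧ ^ℚ d ≤ Volume.V r r≥1 d (suc k) + K * ⟦ suc k ⟧ ^ℚ e * (⟦ r ⟧ ^ℚ d * ⟦ r ⟧ ⁻¹))
    (A : ℕ) (A≥ : constants d E K W ≤ ⟦ A ⟧)
    (X₀ : ℕ) (choice : ∀ X → X₀ ℕ.≤ X → Sizes (2 ℕ.* suc d ℕ.* suc E) (5 ℕ.+ d) (suc (suc d)) E A (e ℕ.+ suc (suc d)) b X)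
    (N : ℕ) (N≥ : ⟦ X₀ ⟧ ^ℚ d * (2ℚ ^ℚ d * W) ≤ ⟦ N ⟧) where

    module _ (n : ℕ) (N≤n : N ℕ.≤ n) (n≥1 : 1 ℕ.≤ n) (x : Site d) (t : Topples d h n x) where

      M : ℚ
      M = ⟦ c ℕ.* normInf x ⟧

      M≥0 : 0ℚ ≤ M
      M≥0 = ⟦⟧≥0 (c ℕ.* normInf x)

      X : ℕ
      X = c ℕ.* normInf x ℕ.* suc E

      module _ (escape : ⟦ n ⟧ * (⟦ d ⟧ + ε) ^ℚ d < M ^ℚ d * ((1ℚ + δ) ^ℚ d * W)) where

        n≤escape : ⟦ n ⟧ < M ^ℚ d * ((1ℚ + δ) ^ℚ d * W)
        n≤escape = ≤-<-trans (≤-trans (≤-reflexive (sym (ℚₚ.*-identityʳ ⟦ n ⟧))) (*-monoˡ ⟦ n ⟧ (⟦⟧≥0 n) (1≤^ d (≤-trans (⟦⟧-mono d≥1) (cert (<⇒≤ ε>0) refl))))) escape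

        -- Otherwise c |x| ≤ X₀, and the escape inequality with d + ε ≥ 1 gives n < X₀^d 2^d W ≤ N.
        X-large : X₀ ℕ.≤ X
        X-large = ℕₚ.≮⇒≥ λ X<X₀ → ℚₚ.<-irrefl refl (<-≤-trans n≤escape (≤-trans
          (*-mono (^-nonneg d M≥0) (^-nonneg d (0≤1 ⊕ δ≥0) ⊗ <⇒≤ W>0) (^-mono d M≥0 (⟦⟧-mono (ℕₚ.≤-trans (ℕₚ.≤-trans (ℕₚ.≤-reflexive (sym (ℕₚ.*-identityʳ (c ℕ.* normInf x)))) (ℕₚ.*-monoʳ-≤ (c ℕ.* normInf x) (s≤s z≤n))) (ℕₚ.<⇒≤ X<X₀))))
            (*-monoʳ W (<⇒≤ W>0) (^-mono d (0≤1 ⊕ δ≥0) (ℚₚ.+-monoʳ-≤ 1ℚ δ≤1))))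
          (≤-trans (N≥) (⟦⟧-mono N≤n))))

        impossible : ⊥
        impossible = refute (choice X X-large)
          where
          refute : Sizes (2 ℕ.* suc d ℕ.* suc E) (5 ℕ.+ d) (suc (suc d)) E A (e ℕ.+ suc (suc d)) b X → ⊥
          refute (L , q , L≥1 , A≤L , E<q , br<X , X≤ , k-small , power) =
            Escape.contradictory d h n c g d≥1 c≥1 c+h c+g n≥1 E E≥11 ε δ≤ε K W e A K≥0 W>0 A≥ volume x t escape L q L≥1 A≤L E<q br<X X≤ k-small power

      -- One `W` serves every m, because each `omegaLower d m` is at most (1 + δ)^d W; this is why
      -- `N` does not depend on m.
      in-Qr : InQr d h n ε x
      in-Qr m = subst₂ (λ u v → u ^ℚ d * omegaLower d m ≤ v * (((+ d) / 1) + ε) ^ℚ d) (sym (⟦⟧-/1 (c ℕ.* normInf x))) (sym (⟦⟧-/1 n))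
        (subst (λ u → M ^ℚ d * omegaLower d m ≤ ⟦ n ⟧ * (u + ε) ^ℚ d) (sym (⟦⟧-/1 d))
          (≤-trans (*-monoˡ (M ^ℚ d) (^-nonneg d M≥0) (proj₂ (omegaLower-≤Ω (<⇒≤ p>0) δ≥0 m (p-relative m) d))) (≮⇒≥ impossible)))


theorem1p1 : (d h : ℕ) → 1 ℕ.≤ d → d ℕ.≤ h → h ℕ.≤ 2 ℕ.* d ℕ.∸ 2 →
  (ε : ℚ) → 0ℚ < ε →
  ∃[ N ] ((n : ℕ) → N ℕ.≤ n → 1 ℕ.≤ n →
    (x : Site d) → Topples d h n x → InQr d h n ε x)
theorem1p1 d h d≥1 d≤h h≤ ε ε>0 = at-precision (precision d ε ε>0)
  where
  Goal : Set
  Goal = ∃[ N ] ((n : ℕ) → N ℕ.≤ n → 1 ℕ.≤ n → (x : Site d) → Topples d h n x → InQr d h n ε x)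

  module _ (E : ℕ) (E≥11 : 11 ℕ.≤ E) (δ≤ε : ⟦ 155 ⟧ * ⟦ d ⟧ * inv E ≤ ε) (p : ℚ) (p-upper : ∀ m → piLower m ≤ p + inv E) where
    open Confinement d h d≥1 d≤h h≤ ε ε>0 E E≥11 δ≤ε p p-upper

    at-scale : VolumeBound p d → Goal
    at-scale (K , e , K≥0 , volume) = with-A (∃-⟦⟧≥ _)
      where
      with-A : ∃[ A ] (constants d E K W ≤ ⟦ A ⟧) → Goal
      with-A (A , A≥) = with-X₀ (sizes (2 ℕ.* suc d ℕ.* suc E) (5 ℕ.+ d) (suc (suc d)) E A (e ℕ.+ suc (suc d)) b (s≤s z≤n) (s≤s z≤n) (ℕₚ.*-mono-≤ {1} {d} {1} {suc (suc (suc E))} d≥1 (s≤s z≤n)))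
        where
        with-X₀ : ∃[ X₀ ] (∀ X → X₀ ℕ.≤ X → Sizes (2 ℕ.* suc d ℕ.* suc E) (5 ℕ.+ d) (suc (suc d)) E A (e ℕ.+ suc (suc d)) b X) → Goal
        with-X₀ (X₀ , choice) = with-N (∃-⟦⟧≥ _)
          where
          with-N : ∃[ N ] (⟦ X₀ ⟧ ^ℚ d * (2ℚ ^ℚ d * W) ≤ ⟦ N ⟧) → Goal
          with-N (N , N≥) = N , in-Qr K e K≥0 volume A A≥ X₀ choice N N≥

    p≥0 : 0ℚ ≤ p
    p≥0 = <⇒≤ p>0

  at-precision : ∃[ E ] (11 ℕ.≤ E × ⟦ 155 ⟧ * ⟦ d ⟧ * inv E ≤ ε) → Goal
  -- The index is chosen so that its successor is 12 (E + 1), which turns the error 12/(index + 1)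
  -- into δ.
  at-precision (E , E≥11 , δ≤ε) = at-disc (pi-circle (11 ℕ.+ 12 ℕ.* E))
    where
    at-disc : ∃[ p ] ∃[ C ] (0ℚ ≤ C × (∀ r t → t ℕ.< r ℕ.* r → p * ⟦ t ⟧ ≤ circle r t + C) × (∀ m → piLower m ≤ p + ⟦ 12 ⟧ * inv (11 ℕ.+ 12 ℕ.* E))) → Goal
    at-disc (p , C , C≥0 , disc , upper) = at-scale E E≥11 δ≤ε p p-upper (volume-bound p C (p≥0 E E≥11 δ≤ε p p-upper) C≥0 disc d)
      where
      p-upper : ∀ m → piLower m ≤ p + inv E
      p-upper m = subst (λ t → piLower m ≤ p + t) (twelfth E) (upper m)
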